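{- For $j\geq 0$ let $t_j=(4^j-1)/3$ (so that for $j\ge1$ the binary representation of $t_j$ is $(10)^{j-1}1$, i.e. the block $10$ repeated $j-1$ times followed by $1$). Then, as $j\to\infty$, \[ c_{t_j}=\frac 12+\frac{\sqrt{3}}{4\sqrt{2\pi j} }+O\bigl(j^{ -3/2}\bigr). \] Moreover, $c_{t_j} > \frac 12$ holds for all $j\ge 1$.
   Context: For a nonnegative integer $n$, $s(n)$ denotes the binary sum of digits of $n$. For an integer $t\ge 0$, $c_t$ is the asymptotic density of the set $\{n\ge 0: s(n+t)\ge s(n)\}$ (this density exists). -}

module Defs where

open import Data.Bool.Base as 𝔹 using (Bool; true; false; if_then_else_)
open import Data.Nat.Coprimality using (Coprime)
open import Data.Digit using (Expansion; fromDigits; toDigits)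
open import Data.Empty using (⊥-elim)
open import Data.Fin.Base as Fin using (Fin)
open import Data.Integer.Base as ℤ using (+_; -[1+_])
import Data.Integer.Properties as ℤP
open import Data.List.Base using (List; []; _∷_; _++_; length; filter; upTo; map)
import Data.List.Properties as ListP
open import Data.Nat.Base as ℕ using (ℕ; zero; suc; NonZero; _⊔_)
open import Data.Nat.ListAction using (sum)
import Data.Nat.DivMod as ℕD
open import Data.Nat.Induction using (<-rec)
import Data.Nat.Properties as ℕP
import Data.Nat.Tactic.RingSolver as ℕR
open import Data.Product.Base using (∃-syntax; _×_; _,_; proj₁; proj₂)
open import Data.Rational.Base as ℚ using (ℚ; mkℚ; 0ℚ; 1ℚ; ½)
import Data.Rational.Properties as ℚP
open import Data.Rational.Solver using (module +-*-Solver)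
import Data.Rational.Unnormalised.Base as ℚᵘ
import Data.Rational.Unnormalised.Properties as ℚᵘP
open import Data.Sum.Base using (inj₁; inj₂)
open import Function.Base using (_∘_)
open import Relation.Binary.PropositionalEquality
open import Relation.Nullary using (¬_; yes; no; does)
open import Relation.Unary using (Pred; Decidable)

infix  4 _≤_ _<_
infixl 6 _+_ _-_
infixl 7 _*_ _/_
infixr 8 _^_
infix  9 √_

ι : ℕ → ℚ
ι n = + n ℚ./ 1

u : ℕ → ℚ
u n = + 1 ℚ./ suc n

toℚᵘ-/ : ∀ p n → ℚ.toℚᵘ (p ℚ./ suc n) ℚᵘ.≃ ℚᵘ.mkℚᵘ p n
toℚᵘ-/ p n = ℚP.toℚᵘ-fromℚᵘ (ℚᵘ.mkℚᵘ p n)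

/-≡ι*u : ∀ p n → + p ℚ./ suc n ≡ ι p ℚ.* u n
/-≡ι*u p n = ℚP.toℚᵘ-injective (begin
  ℚ.toℚᵘ (+ p ℚ./ suc n)                ≈⟨ toℚᵘ-/ (+ p) n ⟩
  ℚᵘ.mkℚᵘ (+ p) n                       ≈⟨ ℚᵘ.*≡* (cong₂ ℤ._*_ (sym (ℤP.*-identityʳ (+ p))) (cong +_ (ℕP.+-identityʳ (suc n)))) ⟩
  ℚᵘ.mkℚᵘ (+ p) 0 ℚᵘ.* ℚᵘ.mkℚᵘ (+ 1) n  ≈⟨ ℚᵘP.*-cong (toℚᵘ-/ (+ p) 0) (toℚᵘ-/ (+ 1) n) ⟨
  ℚ.toℚᵘ (ι p) ℚᵘ.* ℚ.toℚᵘ (u n)        ≈⟨ ℚP.toℚᵘ-homo-* (ι p) (u n) ⟨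
  ℚ.toℚᵘ (ι p ℚ.* u n)                  ∎)
  where open ℚᵘP.≃-Reasoning

ι-+ : ∀ m n → ι (m ℕ.+ n) ≡ ι m ℚ.+ ι n
ι-+ m n = ℚP.toℚᵘ-injective (begin
  ℚ.toℚᵘ (ι (m ℕ.+ n))                  ≈⟨ toℚᵘ-/ (+ (m ℕ.+ n)) 0 ⟩
  ℚᵘ.mkℚᵘ (+ (m ℕ.+ n)) 0               ≈⟨ ℚᵘ.*≡* (cong (ℤ._* + 1) (cong₂ ℤ._+_ (sym (ℤP.*-identityʳ (+ m))) (sym (ℤP.*-identityʳ (+ n))))) ⟩
  ℚᵘ.mkℚᵘ (+ m) 0 ℚᵘ.+ ℚᵘ.mkℚᵘ (+ n) 0  ≈⟨ ℚᵘP.+-cong (toℚᵘ-/ (+ m) 0) (toℚᵘ-/ (+ n) 0) ⟨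
  ℚ.toℚᵘ (ι m) ℚᵘ.+ ℚ.toℚᵘ (ι n)        ≈⟨ ℚP.toℚᵘ-homo-+ (ι m) (ι n) ⟨
  ℚ.toℚᵘ (ι m ℚ.+ ι n)                  ∎)
  where open ℚᵘP.≃-Reasoning

ι-* : ∀ m n → ι (m ℕ.* n) ≡ ι m ℚ.* ι n
ι-* m n = ℚP.toℚᵘ-injective (begin
  ℚ.toℚᵘ (ι (m ℕ.* n))                  ≈⟨ toℚᵘ-/ (+ (m ℕ.* n)) 0 ⟩
  ℚᵘ.mkℚᵘ (+ (m ℕ.* n)) 0               ≈⟨ ℚᵘ.*≡* (cong (ℤ._* + 1) (ℤP.pos-* m n)) ⟩
  ℚᵘ.mkℚᵘ (+ m) 0 ℚᵘ.* ℚᵘ.mkℚᵘ (+ n) 0  ≈⟨ ℚᵘP.*-cong (toℚᵘ-/ (+ m) 0) (toℚᵘ-/ (+ n) 0) ⟨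
  ℚ.toℚᵘ (ι m) ℚᵘ.* ℚ.toℚᵘ (ι n)        ≈⟨ ℚP.toℚᵘ-homo-* (ι m) (ι n) ⟨
  ℚ.toℚᵘ (ι m ℚ.* ι n)                  ∎)
  where open ℚᵘP.≃-Reasoning

ι*u≡1 : ∀ n → ι (suc n) ℚ.* u n ≡ 1ℚ
ι*u≡1 n = ℚP.toℚᵘ-injective (begin
  ℚ.toℚᵘ (ι (suc n) ℚ.* u n)                  ≈⟨ ℚP.toℚᵘ-homo-* (ι (suc n)) (u n) ⟩
  ℚ.toℚᵘ (ι (suc n)) ℚᵘ.* ℚ.toℚᵘ (u n)        ≈⟨ ℚᵘP.*-cong (toℚᵘ-/ (+ suc n) 0) (toℚᵘ-/ (+ 1) n) ⟩
  ℚᵘ.mkℚᵘ (+ suc n) 0 ℚᵘ.* ℚᵘ.mkℚᵘ (+ 1) n    ≈⟨ ℚᵘ.*≡* (trans (ℤP.*-identityʳ _) (trans (ℤP.*-identityʳ _) (cong +_ (sym (trans (ℕP.+-identityʳ _) (ℕP.+-identityʳ _)))))) ⟩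
  ℚᵘ.mkℚᵘ (+ 1) 0                             ∎)
  where open ℚᵘP.≃-Reasoning

ι-mono : ∀ {m n} → m ℕ.≤ n → ι m ℚ.≤ ι n
ι-mono {m} {n} m≤n = ℚP.toℚᵘ-cancel-≤ (begin
  ℚ.toℚᵘ (ι m)     ≃⟨ toℚᵘ-/ (+ m) 0 ⟩
  ℚᵘ.mkℚᵘ (+ m) 0  ≤⟨ ℚᵘ.*≤* (ℤP.*-monoʳ-≤-nonNeg (+ 1) (ℤ.+≤+ m≤n)) ⟩
  ℚᵘ.mkℚᵘ (+ n) 0  ≃⟨ toℚᵘ-/ (+ n) 0 ⟨
  ℚ.toℚᵘ (ι n)     ∎)
  where open ℚᵘP.≤-Reasoning

u-anti : ∀ {m n} → m ℕ.≤ n → u n ℚ.≤ u m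
u-anti {m} {n} m≤n = ℚP.toℚᵘ-cancel-≤ (begin
  ℚ.toℚᵘ (u n)     ≃⟨ toℚᵘ-/ (+ 1) n ⟩
  ℚᵘ.mkℚᵘ (+ 1) n  ≤⟨ ℚᵘ.*≤* (ℤP.*-monoˡ-≤-nonNeg (+ 1) (ℤ.+≤+ (ℕ.s≤s m≤n))) ⟩
  ℚᵘ.mkℚᵘ (+ 1) m  ≃⟨ toℚᵘ-/ (+ 1) m ⟨
  ℚ.toℚᵘ (u m)     ∎)
  where open ℚᵘP.≤-Reasoning

0≤ι : ∀ n → 0ℚ ℚ.≤ ι n
0≤ι n = ι-mono {0} {n} ℕ.z≤n

0<u : ∀ n → 0ℚ ℚ.< u n
0<u n = ℚP.positive⁻¹ (u n) {{ℚP.normalize-pos 1 (suc n)}}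

archimedean : ∀ ε → 0ℚ ℚ.< ε → ∃[ N ] ∀ n → N ℕ.≤ n → u n ℚ.≤ ε
archimedean ε@(mkℚ (+ suc a) d _) 0<ε = d , λ n d≤n → ℚP.≤-trans (u-anti d≤n) (ℚP.toℚᵘ-cancel-≤ (begin
  ℚ.toℚᵘ (u d)         ≃⟨ toℚᵘ-/ (+ 1) d ⟩
  ℚᵘ.mkℚᵘ (+ 1) d      ≤⟨ ℚᵘ.*≤* (ℤP.*-monoʳ-≤-nonNeg (+ suc d) (ℤ.+≤+ (ℕ.s≤s (ℕ.z≤n {a})))) ⟩
  ℚᵘ.mkℚᵘ (+ suc a) d  ∎))
  where open ℚᵘP.≤-Reasoning
archimedean (mkℚ (+ 0) d _) (ℚ.*<* (ℤ.+<+ ()))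
archimedean (mkℚ -[1+ a ] d _) (ℚ.*<* ())

mkℚ≡ι*u : ∀ p d .{c : Coprime p (suc d)} → mkℚ (+ p) d c ≡ ι p ℚ.* u d
mkℚ≡ι*u p d {c} = trans (ℚP.toℚᵘ-injective {mkℚ (+ p) d c} {+ p ℚ./ suc d} (ℚᵘP.≃-sym (toℚᵘ-/ (+ p) d))) (/-≡ι*u p d)

*-mono-≤ : ∀ {a b c d} → 0ℚ ℚ.≤ a → a ℚ.≤ b → 0ℚ ℚ.≤ c → c ℚ.≤ d → a ℚ.* c ℚ.≤ b ℚ.* d
*-mono-≤ {a} {b} {c} {d} 0≤a a≤b 0≤c c≤d = ℚP.≤-trans
  (ℚP.*-monoʳ-≤-nonNeg c {{ℚ.nonNegative 0≤c}} a≤b)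
  (ℚP.*-monoˡ-≤-nonNeg b {{ℚ.nonNegative (ℚP.≤-trans 0≤a a≤b)}} c≤d)

0≤* : ∀ {a b} → 0ℚ ℚ.≤ a → 0ℚ ℚ.≤ b → 0ℚ ℚ.≤ a ℚ.* b
0≤* {a} {b} p q = ℚP.nonNegative⁻¹ _ {{ℚP.nonNeg*nonNeg⇒nonNeg a {{ℚ.nonNegative p}} b {{ℚ.nonNegative q}}}}

0<* : ∀ {a b} → 0ℚ ℚ.< a → 0ℚ ℚ.< b → 0ℚ ℚ.< a ℚ.* b
0<* {a} {b} p q = ℚP.positive⁻¹ _ {{ℚP.pos*pos⇒pos a {{ℚ.positive p}} b {{ℚ.positive q}}}}

0≤+ : ∀ {a b} → 0ℚ ℚ.≤ a → 0ℚ ℚ.≤ b → 0ℚ ℚ.≤ a ℚ.+ b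
0≤+ = ℚP.+-mono-≤

≤-by : ∀ {x y} z → 0ℚ ℚ.≤ z → x ℚ.+ z ≡ y → x ℚ.≤ y
≤-by {x} z 0≤z refl = subst (ℚ._≤ x ℚ.+ z) (ℚP.+-identityʳ x) (ℚP.+-monoʳ-≤ x 0≤z)

0≤- : ∀ {x y} → x ℚ.≤ y → 0ℚ ℚ.≤ y ℚ.- x
0≤- {x} {y} p = subst (ℚ._≤ y ℚ.- x) (ℚP.+-inverseʳ x) (ℚP.+-monoˡ-≤ (ℚ.- x) p)

½-pos : ∀ {ε} → 0ℚ ℚ.< ε → 0ℚ ℚ.< ½ ℚ.* ε
½-pos {ε} p = 0<* {½} {ε} (ℚP.positive⁻¹ ½) p

½+½ : ∀ ε → ½ ℚ.* ε ℚ.+ ½ ℚ.* ε ≡ ε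
½+½ = solve 1 (λ e → con ½ :* e :+ con ½ :* e := e) refl
  where open +-*-Solver

p≤∣p∣ : ∀ p → p ℚ.≤ ℚ.∣ p ∣
p≤∣p∣ p with ℚP.≤-total 0ℚ p
... | inj₁ 0≤p = ℚP.≤-reflexive (sym (ℚP.0≤p⇒∣p∣≡p 0≤p))
... | inj₂ p≤0 = ℚP.≤-trans p≤0 (ℚP.0≤∣p∣ p)

∣∣-≤ : ∀ {p e} → p ℚ.≤ e → ℚ.- p ℚ.≤ e → ℚ.∣ p ∣ ℚ.≤ e
∣∣-≤ {p} {e} a b with ℚP.∣p∣≡p∨∣p∣≡-p p
... | inj₁ eq = subst (ℚ._≤ e) (sym eq) a
... | inj₂ eq = subst (ℚ._≤ e) (sym eq) b

∣-∣-comm : ∀ p q → ℚ.∣ p ℚ.- q ∣ ≡ ℚ.∣ q ℚ.- p ∣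
∣-∣-comm p q = trans (sym (ℚP.∣-p∣≡∣p∣ (p ℚ.- q)))
  (cong ℚ.∣_∣ (solve 2 (λ a b → :- (a :- b) := b :- a) refl p q))
  where open +-*-Solver

triangle : ∀ p q r → ℚ.∣ p ℚ.- r ∣ ℚ.≤ ℚ.∣ p ℚ.- q ∣ ℚ.+ ℚ.∣ q ℚ.- r ∣
triangle p q r = subst (λ z → ℚ.∣ z ∣ ℚ.≤ ℚ.∣ p ℚ.- q ∣ ℚ.+ ℚ.∣ q ℚ.- r ∣)
  (solve 3 (λ a b c → (a :- b) :+ (b :- c) := a :- c) refl p q r)
  (ℚP.∣p+q∣≤∣p∣+∣q∣ (p ℚ.- q) (q ℚ.- r))
  where open +-*-Solver

-≤⇒≤+ : ∀ {p q e} → ℚ.∣ p ℚ.- q ∣ ℚ.≤ e → p ℚ.≤ q ℚ.+ e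
-≤⇒≤+ {p} {q} {e} h = ≤-by _ (0≤- (ℚP.≤-trans (p≤∣p∣ (p ℚ.- q)) h))
  (solve 3 (λ a b c → a :+ (c :- (a :- b)) := b :+ c) refl p q e)
  where open +-*-Solver

∣-∣-intro : ∀ {p q e} → p ℚ.≤ q ℚ.+ e → q ℚ.≤ p ℚ.+ e → ℚ.∣ p ℚ.- q ∣ ℚ.≤ e
∣-∣-intro {p} {q} {e} h k = ∣∣-≤
  (≤-by _ (0≤- h) (solve 3 (λ a b c → (a :- b) :+ ((b :+ c) :- a) := c) refl p q e))
  (≤-by _ (0≤- k) (solve 3 (λ a b c → (:- (a :- b)) :+ ((a :+ c) :- b) := c) refl p q e))
  where open +-*-Solver

-- The reciprocal made total by 0⁻¹ = 0.
inv : ℚ → ℚ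
inv q with q ℚP.≟ 0ℚ
... | yes _  = 0ℚ
... | no q≢0 = (ℚ.1/ q) {{ℚ.≢-nonZero q≢0}}

inv-* : ∀ {q} → 0ℚ ℚ.< q → inv q ℚ.* q ≡ 1ℚ
inv-* {q} 0<q with q ℚP.≟ 0ℚ
... | yes refl = ⊥-elim (ℚP.<-irrefl refl 0<q)
... | no q≢0   = ℚP.*-inverseˡ q {{ℚ.≢-nonZero q≢0}}

inv-pos : ∀ {q} → 0ℚ ℚ.< q → 0ℚ ℚ.< inv q
inv-pos {q} 0<q with q ℚP.≟ 0ℚ
... | yes refl = ⊥-elim (ℚP.<-irrefl refl 0<q)
... | no q≢0   = ℚP.positive⁻¹ _ {{ℚP.1/pos⇒pos q {{ℚ.positive 0<q}}}}

inv-anti : ∀ {p q} → 0ℚ ℚ.< p → p ℚ.≤ q → inv q ℚ.≤ inv p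
inv-anti {p} {q} 0<p p≤q = begin
  inv q                      ≡⟨ ℚP.*-identityʳ (inv q) ⟨
  inv q ℚ.* 1ℚ               ≡⟨ cong (inv q ℚ.*_) (inv-* 0<p) ⟨
  inv q ℚ.* (inv p ℚ.* p)    ≤⟨ ℚP.*-monoˡ-≤-nonNeg (inv q) {{ℚ.nonNegative 0≤iq}}
                                 (ℚP.*-monoˡ-≤-nonNeg (inv p) {{ℚ.nonNegative (ℚP.<⇒≤ (inv-pos 0<p))}} p≤q) ⟩
  inv q ℚ.* (inv p ℚ.* q)    ≡⟨ solve 3 (λ a b c → a :* (b :* c) := (a :* c) :* b) refl (inv q) (inv p) q ⟩
  (inv q ℚ.* q) ℚ.* inv p    ≡⟨ cong (ℚ._* inv p) (inv-* 0<q) ⟩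
  1ℚ ℚ.* inv p               ≡⟨ ℚP.*-identityˡ (inv p) ⟩
  inv p                      ∎
  where
  open ℚP.≤-Reasoning
  open +-*-Solver
  0<q = ℚP.<-≤-trans 0<p p≤q
  0≤iq = ℚP.<⇒≤ (inv-pos 0<q)

-- Real numbers are Cauchy sequences of rationals; since no quotient is taken,
-- x and y are equal as reals when x ≤ y and y ≤ x.

Cauchy : (ℕ → ℚ) → Set
Cauchy a = ∀ ε → 0ℚ ℚ.< ε → ∃[ N ] ∀ m n → N ℕ.≤ m → N ℕ.≤ n → ℚ.∣ a m ℚ.- a n ∣ ℚ.≤ ε

-- Without eta, and with the operations defined by copatterns, terms such as
-- x * y are normal forms, which lets instance search find Positive (x * y).
record ℝ : Set where
  no-eta-equality
  field
    seq    : ℕ → ℚ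
    cauchy : Cauchy seq

open ℝ public

_≤_ : ℝ → ℝ → Set
x ≤ y = ∀ ε → 0ℚ ℚ.< ε → ∃[ N ] ∀ n → N ℕ.≤ n → seq x n ℚ.≤ seq y n ℚ.+ ε

_<_ : ℝ → ℝ → Set
x < y = ∃[ ε ] 0ℚ ℚ.< ε × ∃[ N ] ∀ n → N ℕ.≤ n → seq x n ℚ.+ ε ℚ.≤ seq y n

fromℚ : ℚ → ℝ
fromℚ q .seq _ = q
fromℚ q .cauchy ε 0<ε = 0 , λ _ _ _ _ →
  subst (λ z → ℚ.∣ z ∣ ℚ.≤ ε) (sym (ℚP.+-inverseʳ q)) (ℚP.<⇒≤ 0<ε)

fromℕ : ℕ → ℝ
fromℕ n .seq    = fromℚ (+ n ℚ./ 1) .seq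
fromℕ n .cauchy = fromℚ (+ n ℚ./ 1) .cauchy

_+_ : ℝ → ℝ → ℝ
(x + y) .seq n = seq x n ℚ.+ seq y n
(x + y) .cauchy ε 0<ε with cauchy x _ (½-pos 0<ε) | cauchy y _ (½-pos 0<ε)
... | M , hM | N , hN = M ⊔ N , λ m n p q → begin
    ℚ.∣ (seq x m ℚ.+ seq y m) ℚ.- (seq x n ℚ.+ seq y n) ∣
      ≡⟨ cong ℚ.∣_∣ (solve 4 (λ a b c d → (a :+ b) :- (c :+ d) := (a :- c) :+ (b :- d)) refl
           (seq x m) (seq y m) (seq x n) (seq y n)) ⟩
    ℚ.∣ (seq x m ℚ.- seq x n) ℚ.+ (seq y m ℚ.- seq y n) ∣
      ≤⟨ ℚP.∣p+q∣≤∣p∣+∣q∣ (seq x m ℚ.- seq x n) (seq y m ℚ.- seq y n) ⟩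
    ℚ.∣ seq x m ℚ.- seq x n ∣ ℚ.+ ℚ.∣ seq y m ℚ.- seq y n ∣
      ≤⟨ ℚP.+-mono-≤ (hM m n (ℕP.m⊔n≤o⇒m≤o M N p) (ℕP.m⊔n≤o⇒m≤o M N q))
                     (hN m n (ℕP.m⊔n≤o⇒n≤o M N p) (ℕP.m⊔n≤o⇒n≤o M N q)) ⟩
    ½ ℚ.* ε ℚ.+ ½ ℚ.* ε
      ≡⟨ ½+½ ε ⟩
    ε ∎
  where
  open ℚP.≤-Reasoning
  open +-*-Solver

-_ : ℝ → ℝ
(- x) .seq n = ℚ.- seq x n
(- x) .cauchy ε 0<ε with cauchy x ε 0<ε
... | N , h = N , λ m n p q → subst (ℚ._≤ ε)
    (trans (∣-∣-comm (seq x m) (seq x n))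
      (cong ℚ.∣_∣ (solve 2 (λ a b → b :- a := (:- a) :- (:- b)) refl (seq x m) (seq x n))))
    (h m n p q)
  where open +-*-Solver

_-_ : ℝ → ℝ → ℝ
x - y = x + (- y)

∣_∣ : ℝ → ℝ
∣ x ∣ .seq n = ℚ.∣ seq x n ∣
∣ x ∣ .cauchy ε 0<ε with cauchy x ε 0<ε
... | N , h = N , λ m n p q → ∣-∣-intro (lem m n (h m n p q)) (lem n m (h n m q p))
  where
  open +-*-Solver
  lem : ∀ m n → ℚ.∣ seq x m ℚ.- seq x n ∣ ℚ.≤ ε → ℚ.∣ seq x m ∣ ℚ.≤ ℚ.∣ seq x n ∣ ℚ.+ ε
  lem m n k = begin
    ℚ.∣ seq x m ∣
      ≡⟨ cong ℚ.∣_∣ (solve 2 (λ a b → a := b :+ (a :- b)) refl (seq x m) (seq x n)) ⟩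
    ℚ.∣ seq x n ℚ.+ (seq x m ℚ.- seq x n) ∣
      ≤⟨ ℚP.∣p+q∣≤∣p∣+∣q∣ (seq x n) (seq x m ℚ.- seq x n) ⟩
    ℚ.∣ seq x n ∣ ℚ.+ ℚ.∣ seq x m ℚ.- seq x n ∣
      ≤⟨ ℚP.+-monoʳ-≤ ℚ.∣ seq x n ∣ k ⟩
    ℚ.∣ seq x n ∣ ℚ.+ ε ∎
    where open ℚP.≤-Reasoning

bounded : ∀ x → ∃[ B ] 0ℚ ℚ.< B × ∃[ N ] ∀ n → N ℕ.≤ n → ℚ.∣ seq x n ∣ ℚ.≤ B
bounded x = from (cauchy ∣ x ∣ 1ℚ (ℚP.positive⁻¹ 1ℚ))
  where
  from : (∃[ N ] ∀ m n → N ℕ.≤ m → N ℕ.≤ n → ℚ.∣ ℚ.∣ seq x m ∣ ℚ.- ℚ.∣ seq x n ∣ ∣ ℚ.≤ 1ℚ) →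
         ∃[ B ] 0ℚ ℚ.< B × ∃[ N ] ∀ n → N ℕ.≤ n → ℚ.∣ seq x n ∣ ℚ.≤ B
  from (N , h) = ℚ.∣ seq x N ∣ ℚ.+ 1ℚ
               , ℚP.+-mono-≤-< {0ℚ} {ℚ.∣ seq x N ∣} {0ℚ} {1ℚ} (ℚP.0≤∣p∣ (seq x N)) (ℚP.positive⁻¹ 1ℚ)
               , N , λ n p → -≤⇒≤+ {ℚ.∣ seq x n ∣} {ℚ.∣ seq x N ∣} {1ℚ} (h n N p ℕP.≤-refl)

inv-cancel : ∀ {C} e → 0ℚ ℚ.< C → C ℚ.* (inv C ℚ.* e) ≡ e
inv-cancel {C} e 0<C = begin
  C ℚ.* (inv C ℚ.* e)  ≡⟨ solve 3 (λ a b c → a :* (b :* c) := (b :* a) :* c) refl C (inv C) e ⟩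
  (inv C ℚ.* C) ℚ.* e  ≡⟨ cong (ℚ._* e) (inv-* 0<C) ⟩
  1ℚ ℚ.* e             ≡⟨ ℚP.*-identityˡ e ⟩
  e                    ∎
  where
  open ≡-Reasoning
  open +-*-Solver

*-close : ∀ {a b c d A B e f} → ℚ.∣ a ∣ ℚ.≤ A → ℚ.∣ d ∣ ℚ.≤ B →
  ℚ.∣ a ℚ.- c ∣ ℚ.≤ e → ℚ.∣ b ℚ.- d ∣ ℚ.≤ f →
  ℚ.∣ a ℚ.* b ℚ.- c ℚ.* d ∣ ℚ.≤ A ℚ.* f ℚ.+ B ℚ.* e
*-close {a} {b} {c} {d} {A} {B} {e} {f} a≤ d≤ a-c≤ b-d≤ = begin
  ℚ.∣ a ℚ.* b ℚ.- c ℚ.* d ∣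
    ≡⟨ cong ℚ.∣_∣ (solve 4 (λ a b c d → a :* b :- c :* d := a :* (b :- d) :+ d :* (a :- c)) refl a b c d) ⟩
  ℚ.∣ a ℚ.* (b ℚ.- d) ℚ.+ d ℚ.* (a ℚ.- c) ∣
    ≤⟨ ℚP.∣p+q∣≤∣p∣+∣q∣ (a ℚ.* (b ℚ.- d)) (d ℚ.* (a ℚ.- c)) ⟩
  ℚ.∣ a ℚ.* (b ℚ.- d) ∣ ℚ.+ ℚ.∣ d ℚ.* (a ℚ.- c) ∣
    ≡⟨ cong₂ ℚ._+_ (ℚP.∣p*q∣≡∣p∣*∣q∣ a (b ℚ.- d)) (ℚP.∣p*q∣≡∣p∣*∣q∣ d (a ℚ.- c)) ⟩
  ℚ.∣ a ∣ ℚ.* ℚ.∣ b ℚ.- d ∣ ℚ.+ ℚ.∣ d ∣ ℚ.* ℚ.∣ a ℚ.- c ∣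
    ≤⟨ ℚP.+-mono-≤
         (*-mono-≤ {ℚ.∣ a ∣} {A} {ℚ.∣ b ℚ.- d ∣} {f} (ℚP.0≤∣p∣ a) a≤ (ℚP.0≤∣p∣ (b ℚ.- d)) b-d≤)
         (*-mono-≤ {ℚ.∣ d ∣} {B} {ℚ.∣ a ℚ.- c ∣} {e} (ℚP.0≤∣p∣ d) d≤ (ℚP.0≤∣p∣ (a ℚ.- c)) a-c≤) ⟩
  A ℚ.* f ℚ.+ B ℚ.* e ∎
  where
  open ℚP.≤-Reasoning
  open +-*-Solver

*-cauchy : ∀ {a b} → Cauchy a → Cauchy b →
  (∃[ A ] 0ℚ ℚ.< A × ∃[ N ] ∀ n → N ℕ.≤ n → ℚ.∣ a n ∣ ℚ.≤ A) →
  (∃[ B ] 0ℚ ℚ.< B × ∃[ N ] ∀ n → N ℕ.≤ n → ℚ.∣ b n ∣ ℚ.≤ B) →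
  Cauchy (λ n → a n ℚ.* b n)
*-cauchy {a} {b} ca cb (A , 0<A , K , hA) (B , 0<B , L , hB) ε 0<ε =
  from (ca e (0<* (inv-pos 0<B) (½-pos 0<ε))) (cb f (0<* (inv-pos 0<A) (½-pos 0<ε)))
  where
  e = inv B ℚ.* (½ ℚ.* ε)
  f = inv A ℚ.* (½ ℚ.* ε)
  total : A ℚ.* f ℚ.+ B ℚ.* e ≡ ε
  total = trans (cong₂ ℚ._+_ (inv-cancel (½ ℚ.* ε) 0<A) (inv-cancel (½ ℚ.* ε) 0<B)) (½+½ ε)
  from : (∃[ N ] ∀ m n → N ℕ.≤ m → N ℕ.≤ n → ℚ.∣ a m ℚ.- a n ∣ ℚ.≤ e) →
         (∃[ N ] ∀ m n → N ℕ.≤ m → N ℕ.≤ n → ℚ.∣ b m ℚ.- b n ∣ ℚ.≤ f) →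
         ∃[ N ] ∀ m n → N ℕ.≤ m → N ℕ.≤ n → ℚ.∣ a m ℚ.* b m ℚ.- a n ℚ.* b n ∣ ℚ.≤ ε
  from (M , hM) (N , hN) = (K ⊔ L) ⊔ (M ⊔ N) , λ m n p q →
    let pKL = ℕP.m⊔n≤o⇒m≤o (K ⊔ L) (M ⊔ N) p ; pMN = ℕP.m⊔n≤o⇒n≤o (K ⊔ L) (M ⊔ N) p
        qKL = ℕP.m⊔n≤o⇒m≤o (K ⊔ L) (M ⊔ N) q ; qMN = ℕP.m⊔n≤o⇒n≤o (K ⊔ L) (M ⊔ N) q
    in subst (ℚ.∣ a m ℚ.* b m ℚ.- a n ℚ.* b n ∣ ℚ.≤_) total
      (*-close {a m} {b m} {a n} {b n} {A} {B} {e} {f}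
        (hA m (ℕP.m⊔n≤o⇒m≤o K L pKL)) (hB n (ℕP.m⊔n≤o⇒n≤o K L qKL))
        (hM m n (ℕP.m⊔n≤o⇒m≤o M N pMN) (ℕP.m⊔n≤o⇒m≤o M N qMN))
        (hN m n (ℕP.m⊔n≤o⇒n≤o M N pMN) (ℕP.m⊔n≤o⇒n≤o M N qMN)))

_*_ : ℝ → ℝ → ℝ
(x * y) .seq n = seq x n ℚ.* seq y n
(x * y) .cauchy = *-cauchy {seq x} {seq y} (cauchy x) (cauchy y) (bounded x) (bounded y)

_^_ : ℝ → ℕ → ℝ
x ^ zero  = fromℕ 1
x ^ suc n = x * x ^ n

record Positive (x : ℝ) : Set where
  constructor mkPositive
  field
    0<x : fromℕ 0 < x

inv-difference : ∀ {a b} → 0ℚ ℚ.< a → 0ℚ ℚ.< b → inv a ℚ.- inv b ≡ (inv a ℚ.* inv b) ℚ.* (b ℚ.- a)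
inv-difference {a} {b} 0<a 0<b = trans
  (cong₂ ℚ._-_ (sym (trans (cong (inv a ℚ.*_) (inv-* 0<b)) (ℚP.*-identityʳ (inv a))))
               (sym (trans (cong (inv b ℚ.*_) (inv-* 0<a)) (ℚP.*-identityʳ (inv b)))))
  (solve 4 (λ i j a b → i :* (j :* b) :- j :* (i :* a) := (i :* j) :* (b :- a)) refl (inv a) (inv b) a b)
  where open +-*-Solver

inv-close : ∀ {a b δ ε} → 0ℚ ℚ.< δ → δ ℚ.≤ a → δ ℚ.≤ b →
  ℚ.∣ b ℚ.- a ∣ ℚ.≤ (ε ℚ.* δ) ℚ.* δ → ℚ.∣ inv a ℚ.- inv b ∣ ℚ.≤ ε
inv-close {a} {b} {δ} {ε} 0<δ δ≤a δ≤b h = begin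
  ℚ.∣ inv a ℚ.- inv b ∣
    ≡⟨ cong ℚ.∣_∣ (inv-difference {a} {b} 0<a 0<b) ⟩
  ℚ.∣ (inv a ℚ.* inv b) ℚ.* (b ℚ.- a) ∣
    ≡⟨ ℚP.∣p*q∣≡∣p∣*∣q∣ (inv a ℚ.* inv b) (b ℚ.- a) ⟩
  ℚ.∣ inv a ℚ.* inv b ∣ ℚ.* ℚ.∣ b ℚ.- a ∣
    ≡⟨ cong (ℚ._* ℚ.∣ b ℚ.- a ∣) (ℚP.0≤p⇒∣p∣≡p 0≤ab) ⟩
  (inv a ℚ.* inv b) ℚ.* ℚ.∣ b ℚ.- a ∣
    ≤⟨ *-mono-≤ {inv a ℚ.* inv b} {inv δ ℚ.* inv δ} 0≤ab
         (*-mono-≤ {inv a} {inv δ} {inv b} {inv δ} (ℚP.<⇒≤ (inv-pos 0<a)) (inv-anti {δ} {a} 0<δ δ≤a)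
                                                   (ℚP.<⇒≤ (inv-pos 0<b)) (inv-anti {δ} {b} 0<δ δ≤b))
         (ℚP.0≤∣p∣ (b ℚ.- a)) h ⟩
  (inv δ ℚ.* inv δ) ℚ.* ((ε ℚ.* δ) ℚ.* δ)
    ≡⟨ solve 3 (λ i e d → (i :* i) :* ((e :* d) :* d) := e :* ((i :* d) :* (i :* d))) refl (inv δ) ε δ ⟩
  ε ℚ.* ((inv δ ℚ.* δ) ℚ.* (inv δ ℚ.* δ))
    ≡⟨ cong (λ z → ε ℚ.* (z ℚ.* z)) (inv-* 0<δ) ⟩
  ε ℚ.* 1ℚ
    ≡⟨ ℚP.*-identityʳ ε ⟩
  ε ∎
  where
  open ℚP.≤-Reasoning
  open +-*-Solver
  0<a = ℚP.<-≤-trans 0<δ δ≤a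
  0<b = ℚP.<-≤-trans 0<δ δ≤b
  0≤ab = 0≤* {inv a} {inv b} (ℚP.<⇒≤ (inv-pos 0<a)) (ℚP.<⇒≤ (inv-pos 0<b))

inv-cauchy : ∀ {a} → Cauchy a → (∃[ δ ] 0ℚ ℚ.< δ × ∃[ N ] ∀ n → N ℕ.≤ n → 0ℚ ℚ.+ δ ℚ.≤ a n) →
  Cauchy (inv ∘ a)
inv-cauchy {a} ca (δ , 0<δ , K , hK) ε 0<ε = from (ca _ (0<* (0<* 0<ε 0<δ) 0<δ))
  where
  lower : ∀ n → K ℕ.≤ n → δ ℚ.≤ a n
  lower n p = subst (ℚ._≤ a n) (ℚP.+-identityˡ δ) (hK n p)
  from : (∃[ N ] ∀ m n → N ℕ.≤ m → N ℕ.≤ n → ℚ.∣ a m ℚ.- a n ∣ ℚ.≤ (ε ℚ.* δ) ℚ.* δ) →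
         ∃[ N ] ∀ m n → N ℕ.≤ m → N ℕ.≤ n → ℚ.∣ inv (a m) ℚ.- inv (a n) ∣ ℚ.≤ ε
  from (N , h) = K ⊔ N , λ m n p q → inv-close {a m} {a n} {δ} {ε} 0<δ
    (lower m (ℕP.m⊔n≤o⇒m≤o K N p)) (lower n (ℕP.m⊔n≤o⇒m≤o K N q))
    (h n m (ℕP.m⊔n≤o⇒n≤o K N q) (ℕP.m⊔n≤o⇒n≤o K N p))

-- The evidence that x is positive is only used to show that the result is Cauchy.
1/_ : (x : ℝ) {{_ : Positive x}} → ℝ
(1/ x) .seq n = inv (seq x n)
(1/_ x {{x>0}}) .cauchy = inv-cauchy {seq x} (cauchy x) (Positive.0<x x>0)

_/_ : (x y : ℝ) {{_ : Positive y}} → ℝ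
x / y = x * (1/ y)

-- ⌊ √ n ⌋
isqrt : ℕ → ℕ
isqrt zero    = zero
isqrt (suc n) = if suc (isqrt n) ℕ.* suc (isqrt n) ℕ.≤ᵇ suc n then suc (isqrt n) else isqrt n

≤ᵇ-true : ∀ {m n} → m ℕ.≤ n → (m ℕ.≤ᵇ n) ≡ true
≤ᵇ-true {m} {n} p with m ℕ.≤ᵇ n | ℕP.≤⇒≤ᵇ p
... | true | _ = refl

≤ᵇ-false : ∀ {m n} → ¬ (m ℕ.≤ n) → (m ℕ.≤ᵇ n) ≡ false
≤ᵇ-false {m} {n} ¬p with m ℕ.≤ᵇ n in eq
... | false = refl
... | true  = ⊥-elim (¬p (ℕP.≤ᵇ⇒≤ m n (subst 𝔹.T (sym eq) _)))

isqrt-spec : ∀ n → isqrt n ℕ.* isqrt n ℕ.≤ n × n ℕ.< suc (isqrt n) ℕ.* suc (isqrt n)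
isqrt-spec zero = ℕ.z≤n , ℕ.s≤s ℕ.z≤n
isqrt-spec (suc n) with isqrt-spec n | suc (isqrt n) ℕ.* suc (isqrt n) ℕP.≤? suc n
... | lo , hi | yes p rewrite ≤ᵇ-true p = p , ℕP.≤-<-trans hi (ℕP.*-mono-< {suc r} {suc (suc r)} ℕP.≤-refl ℕP.≤-refl)
  where
  r = isqrt n
... | lo , hi | no ¬p rewrite ≤ᵇ-false ¬p = ℕP.m≤n⇒m≤1+n lo , ℕP.≰⇒> ¬p

-- √ (p/d) = √ (pd) / d, approximated from below with denominator (n + 1) d.
-- Negative arguments are sent to 0.
sqrtℚ : ℕ → ℚ → ℚ
sqrtℚ n (mkℚ (+ p) d-1 _)    = + isqrt (p ℕ.* suc d-1 ℕ.* (suc n ℕ.* suc n)) ℚ./ (suc n ℕ.* suc d-1)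
sqrtℚ n (mkℚ -[1+ _ ] _ _) = 0ℚ

0≤/ : ∀ p n → 0ℚ ℚ.≤ + p ℚ./ suc n
0≤/ p n = ℚP.nonNegative⁻¹ _ {{ℚP.normalize-nonNeg p (suc n)}}

sqrtℚ-nonNeg : ∀ n q → 0ℚ ℚ.≤ sqrtℚ n q
sqrtℚ-nonNeg n (mkℚ (+ p) d _)     = 0≤/ (isqrt (p ℕ.* suc d ℕ.* (suc n ℕ.* suc n))) (d ℕ.+ n ℕ.* suc d)
sqrtℚ-nonNeg n (mkℚ -[1+ _ ] _ _) = ℚP.≤-refl

sqrtℚ-scale : ∀ p d n → let w = u (d ℕ.+ n ℕ.* suc d) in
  ι (p ℕ.* suc d ℕ.* (suc n ℕ.* suc n)) ℚ.* (w ℚ.* w) ≡ ι p ℚ.* u d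
sqrtℚ-scale p d n = begin
  ι (p ℕ.* suc d ℕ.* (suc n ℕ.* suc n)) ℚ.* (w ℚ.* w)
    ≡⟨ cong (ℚ._* (w ℚ.* w)) (trans (ι-* (p ℕ.* suc d) (suc n ℕ.* suc n)) (cong₂ ℚ._*_ (ι-* p (suc d)) (ι-* (suc n) (suc n)))) ⟩
  ((ι p ℚ.* D) ℚ.* (m ℚ.* m)) ℚ.* (w ℚ.* w)
    ≡⟨ ℚP.*-identityʳ _ ⟨
  (((ι p ℚ.* D) ℚ.* (m ℚ.* m)) ℚ.* (w ℚ.* w)) ℚ.* 1ℚ
    ≡⟨ cong ((((ι p ℚ.* D) ℚ.* (m ℚ.* m)) ℚ.* (w ℚ.* w)) ℚ.*_) (ι*u≡1 d) ⟨
  (((ι p ℚ.* D) ℚ.* (m ℚ.* m)) ℚ.* (w ℚ.* w)) ℚ.* (D ℚ.* u d)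
    ≡⟨ solve 5 (λ p D m w v → (((p :* D) :* (m :* m)) :* (w :* w)) :* (D :* v) := (p :* v) :* (((m :* D) :* w) :* ((m :* D) :* w)))
         refl (ι p) D m w (u d) ⟩
  (ι p ℚ.* u d) ℚ.* (((m ℚ.* D) ℚ.* w) ℚ.* ((m ℚ.* D) ℚ.* w))
    ≡⟨ cong (λ z → (ι p ℚ.* u d) ℚ.* (z ℚ.* z)) (trans (cong (ℚ._* w) (sym (ι-* (suc n) (suc d)))) (ι*u≡1 (d ℕ.+ n ℕ.* suc d))) ⟩
  (ι p ℚ.* u d) ℚ.* 1ℚ
    ≡⟨ ℚP.*-identityʳ _ ⟩
  ι p ℚ.* u d ∎
  where
  open ≡-Reasoning
  open +-*-Solver
  w = u (d ℕ.+ n ℕ.* suc d)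
  D = ι (suc d)
  m = ι (suc n)

sqrtℚ-lower : ∀ n q → 0ℚ ℚ.< sqrtℚ n q → sqrtℚ n q ℚ.* sqrtℚ n q ℚ.≤ q
sqrtℚ-lower n q@(mkℚ (+ p) d c) _ = begin
  a ℚ.* a
    ≡⟨ cong₂ ℚ._*_ (/-≡ι*u k W-1) (/-≡ι*u k W-1) ⟩
  (ι k ℚ.* w) ℚ.* (ι k ℚ.* w)
    ≡⟨ solve 2 (λ k w → (k :* w) :* (k :* w) := (k :* k) :* (w :* w)) refl (ι k) w ⟩
  (ι k ℚ.* ι k) ℚ.* (w ℚ.* w)
    ≡⟨ cong (ℚ._* (w ℚ.* w)) (ι-* k k) ⟨
  ι (k ℕ.* k) ℚ.* (w ℚ.* w)
    ≤⟨ ℚP.*-monoʳ-≤-nonNeg (w ℚ.* w) {{ℚ.nonNegative (0≤* 0≤w 0≤w)}} (ι-mono (proj₁ (isqrt-spec X))) ⟩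
  ι X ℚ.* (w ℚ.* w)
    ≡⟨ sqrtℚ-scale p d n ⟩
  ι p ℚ.* u d
    ≡⟨ mkℚ≡ι*u p d {c} ⟨
  q ∎
  where
  open ℚP.≤-Reasoning
  open +-*-Solver
  X = p ℕ.* suc d ℕ.* (suc n ℕ.* suc n)
  k = isqrt X
  W-1 = d ℕ.+ n ℕ.* suc d
  w = u W-1
  a = sqrtℚ n q
  0≤w = ℚP.<⇒≤ (0<u W-1)
sqrtℚ-lower n (mkℚ -[1+ _ ] _ _) 0<0 = ⊥-elim (ℚP.<-irrefl refl 0<0)

sqrtℚ-upper : ∀ n q → q ℚ.≤ (sqrtℚ n q ℚ.+ u n) ℚ.* (sqrtℚ n q ℚ.+ u n)
sqrtℚ-upper n q@(mkℚ (+ p) d c) = begin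
  q
    ≡⟨ mkℚ≡ι*u p d {c} ⟩
  ι p ℚ.* u d
    ≡⟨ sqrtℚ-scale p d n ⟨
  ι X ℚ.* (w ℚ.* w)
    ≤⟨ ℚP.*-monoʳ-≤-nonNeg (w ℚ.* w) {{ℚ.nonNegative (0≤* 0≤w 0≤w)}} (ι-mono (ℕP.<⇒≤ (proj₂ (isqrt-spec X)))) ⟩
  ι (suc k ℕ.* suc k) ℚ.* (w ℚ.* w)
    ≡⟨ cong (ℚ._* (w ℚ.* w)) (trans (ι-* (suc k) (suc k)) (cong₂ ℚ._*_ (ι-+ 1 k) (ι-+ 1 k))) ⟩
  ((1ℚ ℚ.+ ι k) ℚ.* (1ℚ ℚ.+ ι k)) ℚ.* (w ℚ.* w)
    ≡⟨ solve 2 (λ k w → ((con 1ℚ :+ k) :* (con 1ℚ :+ k)) :* (w :* w) := (k :* w :+ w) :* (k :* w :+ w)) refl (ι k) w ⟩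
  (ι k ℚ.* w ℚ.+ w) ℚ.* (ι k ℚ.* w ℚ.+ w)
    ≡⟨ cong (λ z → (z ℚ.+ w) ℚ.* (z ℚ.+ w)) (/-≡ι*u k W-1) ⟨
  (a ℚ.+ w) ℚ.* (a ℚ.+ w)
    ≤⟨ *-mono-≤ (0≤+ 0≤a 0≤w) a+w≤a+u (0≤+ 0≤a 0≤w) a+w≤a+u ⟩
  (a ℚ.+ u n) ℚ.* (a ℚ.+ u n) ∎
  where
  open ℚP.≤-Reasoning
  open +-*-Solver
  X = p ℕ.* suc d ℕ.* (suc n ℕ.* suc n)
  k = isqrt X
  W-1 = d ℕ.+ n ℕ.* suc d
  w = u W-1
  a = sqrtℚ n q
  0≤w = ℚP.<⇒≤ (0<u W-1)
  0≤a = sqrtℚ-nonNeg n q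
  a+w≤a+u = ℚP.+-monoʳ-≤ a (u-anti {n} {W-1} (ℕP.≤-trans (ℕP.m≤m*n n (suc d)) (ℕP.m≤n+m (n ℕ.* suc d) d)))
sqrtℚ-upper n q@(mkℚ -[1+ _ ] _ _) = ℚP.≤-trans (ℚP.<⇒≤ (ℚP.negative⁻¹ q))
  (0≤* (0≤+ ℚP.≤-refl (ℚP.<⇒≤ (0<u n))) (0≤+ ℚP.≤-refl (ℚP.<⇒≤ (0<u n))))

<-absurd : ∀ {x y} z → x ℚ.≤ y → 0ℚ ℚ.< z → y ℚ.+ z ≡ x → ∀ {ℓ} {A : Set ℓ} → A
<-absurd {y = y} z x≤y 0<z refl = ⊥-elim (ℚP.<-irrefl refl
  (ℚP.<-≤-trans (subst (ℚ._< y ℚ.+ z) (ℚP.+-identityʳ y) (ℚP.+-monoʳ-< y 0<z)) x≤y))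

sqrt-close : ∀ {a b p q d ε} → 0ℚ ℚ.< ε → 0ℚ ℚ.≤ a → 0ℚ ℚ.≤ d → d ℚ.≤ ½ ℚ.* ε →
  p ℚ.≤ (a ℚ.+ d) ℚ.* (a ℚ.+ d) → (0ℚ ℚ.< b → b ℚ.* b ℚ.≤ q) →
  q ℚ.≤ p ℚ.+ (½ ℚ.* ε) ℚ.* (½ ℚ.* ε) → b ℚ.≤ a ℚ.+ ε
sqrt-close {a} {b} {p} {q} {d} {ε} 0<ε 0≤a 0≤d d≤½ε p≤ b²≤ q≤ with ℚP.≤-total b (a ℚ.+ ε)
... | inj₁ b≤a+ε = b≤a+ε
... | inj₂ a+ε≤b = <-absurd (½ ℚ.* (ε ℚ.* ε) ℚ.+ a ℚ.* ε)
  (begin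
    (a ℚ.+ ε) ℚ.* (a ℚ.+ ε)
      ≤⟨ *-mono-≤ 0≤a+ε a+ε≤b 0≤a+ε a+ε≤b ⟩
    b ℚ.* b
      ≤⟨ b²≤ (ℚP.<-≤-trans (ℚP.+-mono-≤-< 0≤a 0<ε) a+ε≤b) ⟩
    q
      ≤⟨ q≤ ⟩
    p ℚ.+ (½ ℚ.* ε) ℚ.* (½ ℚ.* ε)
      ≤⟨ ℚP.+-monoˡ-≤ _ (ℚP.≤-trans p≤ (*-mono-≤ (0≤+ 0≤a 0≤d) a+d≤ (0≤+ 0≤a 0≤d) a+d≤)) ⟩
    (a ℚ.+ ½ ℚ.* ε) ℚ.* (a ℚ.+ ½ ℚ.* ε) ℚ.+ (½ ℚ.* ε) ℚ.* (½ ℚ.* ε) ∎)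
  (ℚP.+-mono-<-≤ (½-pos (0<* 0<ε 0<ε)) (0≤* 0≤a (ℚP.<⇒≤ 0<ε)))
  (solve 2 (λ a e → ((a :+ con ½ :* e) :* (a :+ con ½ :* e) :+ (con ½ :* e) :* (con ½ :* e))
                      :+ (con ½ :* (e :* e) :+ a :* e) := (a :+ e) :* (a :+ e)) refl a ε)
  where
  open ℚP.≤-Reasoning
  open +-*-Solver
  0≤a+ε = 0≤+ 0≤a (ℚP.<⇒≤ 0<ε)
  a+d≤ = ℚP.+-monoʳ-≤ a d≤½ε

sqrt-big : ∀ {a q d η} → 0ℚ ℚ.< η → 0ℚ ℚ.≤ a → 0ℚ ℚ.≤ d → d ℚ.≤ ½ ℚ.* (½ ℚ.* η) →
  q ℚ.≤ (a ℚ.+ d) ℚ.* (a ℚ.+ d) → η ℚ.* η ℚ.≤ q → ½ ℚ.* η ℚ.≤ a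
sqrt-big {a} {q} {d} {η} 0<η 0≤a 0≤d d≤ q≤ η²≤q with ℚP.≤-total (½ ℚ.* η) a
... | inj₁ ½η≤a = ½η≤a
... | inj₂ a≤½η = <-absurd ((+ 7 ℚ./ 16) ℚ.* (η ℚ.* η))
  (begin
    η ℚ.* η
      ≤⟨ η²≤q ⟩
    q
      ≤⟨ q≤ ⟩
    (a ℚ.+ d) ℚ.* (a ℚ.+ d)
      ≤⟨ *-mono-≤ (0≤+ 0≤a 0≤d) a+d≤ (0≤+ 0≤a 0≤d) a+d≤ ⟩
    (½ ℚ.* η ℚ.+ ½ ℚ.* (½ ℚ.* η)) ℚ.* (½ ℚ.* η ℚ.+ ½ ℚ.* (½ ℚ.* η)) ∎)
  (0<* (ℚP.positive⁻¹ (+ 7 ℚ./ 16)) (0<* 0<η 0<η))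
  (solve 1 (λ e → (con ½ :* e :+ con ½ :* (con ½ :* e)) :* (con ½ :* e :+ con ½ :* (con ½ :* e))
                    :+ con (+ 7 ℚ./ 16) :* (e :* e)
                    := e :* e) refl η)
  where
  open ℚP.≤-Reasoning
  open +-*-Solver
  a+d≤ = ℚP.+-mono-≤ a≤½η d≤

√-cauchy : ∀ {a} → Cauchy a → Cauchy (λ n → sqrtℚ n (a n))
√-cauchy {a} ca ε 0<ε = from (ca _ (0<* (½-pos 0<ε) (½-pos 0<ε))) (archimedean _ (½-pos 0<ε))
  where
  from : (∃[ N ] ∀ m n → N ℕ.≤ m → N ℕ.≤ n → ℚ.∣ a m ℚ.- a n ∣ ℚ.≤ (½ ℚ.* ε) ℚ.* (½ ℚ.* ε)) →
         (∃[ N ] ∀ n → N ℕ.≤ n → u n ℚ.≤ ½ ℚ.* ε) →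
         ∃[ N ] ∀ m n → N ℕ.≤ m → N ℕ.≤ n → ℚ.∣ sqrtℚ m (a m) ℚ.- sqrtℚ n (a n) ∣ ℚ.≤ ε
  from (M , hM) (N , hN) = M ⊔ N , λ m n p q →
    let Mm = ℕP.m⊔n≤o⇒m≤o M N p ; Nm = ℕP.m⊔n≤o⇒n≤o M N p
        Mn = ℕP.m⊔n≤o⇒m≤o M N q ; Nn = ℕP.m⊔n≤o⇒n≤o M N q
    in ∣-∣-intro {sqrtℚ m (a m)} {sqrtℚ n (a n)} {ε} (close n m Nn (hM m n Mm Mn)) (close m n Nm (hM n m Mn Mm))
    where
    close : ∀ m n → N ℕ.≤ m → ℚ.∣ a n ℚ.- a m ∣ ℚ.≤ (½ ℚ.* ε) ℚ.* (½ ℚ.* ε) →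
            sqrtℚ n (a n) ℚ.≤ sqrtℚ m (a m) ℚ.+ ε
    close m n N≤m h = sqrt-close {sqrtℚ m (a m)} {sqrtℚ n (a n)} {a m} {a n} {u m} {ε}
      0<ε (sqrtℚ-nonNeg m (a m)) (ℚP.<⇒≤ (0<u m)) (hN m N≤m)
      (sqrtℚ-upper m (a m)) (sqrtℚ-lower n (a n)) (-≤⇒≤+ {a n} {a m} h)

√_ : ℝ → ℝ
(√ x) .seq n = sqrtℚ n (seq x n)
(√ x) .cauchy = √-cauchy {seq x} (cauchy x)

instance
  fromℕ-positive : ∀ {n} .{{_ : NonZero n}} → Positive (fromℕ n)
  fromℕ-positive {suc n} = mkPositive (1ℚ , ℚP.positive⁻¹ 1ℚ , 0 , λ _ _ →
    ℚP.≤-trans (ℚP.≤-reflexive (ℚP.+-identityˡ 1ℚ)) (ι-mono {1} {suc n} (ℕ.s≤s ℕ.z≤n)))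

  *-positive : ∀ {x y} {{_ : Positive x}} {{_ : Positive y}} → Positive (x * y)
  *-positive {x} {y} {{mkPositive (δ , 0<δ , M , hM)}} {{mkPositive (ε , 0<ε , N , hN)}} =
    mkPositive (δ ℚ.* ε , 0<* 0<δ 0<ε , M ⊔ N , λ n p →
      ℚP.≤-trans (ℚP.≤-reflexive (ℚP.+-identityˡ (δ ℚ.* ε)))
        (*-mono-≤ {δ} {seq x n} {ε} {seq y n} (ℚP.<⇒≤ 0<δ)
          (ℚP.≤-trans (ℚP.≤-reflexive (sym (ℚP.+-identityˡ δ))) (hM n (ℕP.m⊔n≤o⇒m≤o M N p)))
          (ℚP.<⇒≤ 0<ε)
          (ℚP.≤-trans (ℚP.≤-reflexive (sym (ℚP.+-identityˡ ε))) (hN n (ℕP.m⊔n≤o⇒n≤o M N p)))))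

  √-positive : ∀ {x} {{_ : Positive x}} → Positive (√ x)
  √-positive {x} {{mkPositive (δ , 0<δ , M , hM)}} = from (archimedean (½ ℚ.* (½ ℚ.* η)) (½-pos (½-pos 0<η)))
    where
    η = δ ℚ.⊓ 1ℚ
    0<η : 0ℚ ℚ.< η
    0<η with ℚP.⊓-sel δ 1ℚ
    ... | inj₁ eq = subst (0ℚ ℚ.<_) (sym eq) 0<δ
    ... | inj₂ eq = subst (0ℚ ℚ.<_) (sym eq) (ℚP.positive⁻¹ 1ℚ)
    η²≤δ : η ℚ.* η ℚ.≤ δ
    η²≤δ = ℚP.≤-trans (*-mono-≤ {η} {δ} {η} {1ℚ} (ℚP.<⇒≤ 0<η) (ℚP.p⊓q≤p δ 1ℚ) (ℚP.<⇒≤ 0<η) (ℚP.p⊓q≤q δ 1ℚ))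
      (ℚP.≤-reflexive (ℚP.*-identityʳ δ))
    from : (∃[ N ] ∀ n → N ℕ.≤ n → u n ℚ.≤ ½ ℚ.* (½ ℚ.* η)) → Positive (√ x)
    from (N , hN) = mkPositive (½ ℚ.* η , ½-pos 0<η , M ⊔ N , λ n p →
      sqrt-away (δ≤ n (ℕP.m⊔n≤o⇒m≤o M N p)) (hN n (ℕP.m⊔n≤o⇒n≤o M N p)))
      where
      δ≤ : ∀ n → M ℕ.≤ n → δ ℚ.≤ seq x n
      δ≤ n p = ℚP.≤-trans (ℚP.≤-reflexive (sym (ℚP.+-identityˡ δ))) (hM n p)
      sqrt-away : ∀ {n} → δ ℚ.≤ seq x n → u n ℚ.≤ ½ ℚ.* (½ ℚ.* η) →
                  0ℚ ℚ.+ ½ ℚ.* η ℚ.≤ sqrtℚ n (seq x n)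
      sqrt-away {n} h k = ℚP.≤-trans (ℚP.≤-reflexive (ℚP.+-identityˡ (½ ℚ.* η)))
        (sqrt-big {sqrtℚ n (seq x n)} {seq x n} {u n} {η} 0<η (sqrtℚ-nonNeg n (seq x n)) (ℚP.<⇒≤ (0<u n)) k
          (sqrtℚ-upper n (seq x n)) (ℚP.≤-trans η²≤δ h))

-- π = 4 (1 - 1/3 + 1/5 - 1/7 + ⋯)

sign : ℕ → ℚ
sign zero    = 1ℚ
sign (suc n) = ℚ.- sign n

leibnizTerm : ℕ → ℚ
leibnizTerm k = + 4 ℚ./ suc (2 ℕ.* k)

leibnizSum : ℕ → ℚ
leibnizSum zero    = 0ℚ
leibnizSum (suc n) = leibnizSum n ℚ.+ sign n ℚ.* leibnizTerm n

leibnizTail : ℕ → ℕ → ℚ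
leibnizTail n zero    = 0ℚ
leibnizTail n (suc m) = leibnizTerm n ℚ.- leibnizTail (suc n) m

leibnizSum-+ : ∀ n m → leibnizSum (m ℕ.+ n) ≡ leibnizSum n ℚ.+ sign n ℚ.* leibnizTail n m
leibnizSum-+ n zero    = solve 2 (λ s e → s := s :+ e :* con 0ℚ) refl (leibnizSum n) (sign n)
  where open +-*-Solver
leibnizSum-+ n (suc m) = begin
  leibnizSum (suc m ℕ.+ n)
    ≡⟨ cong leibnizSum (sym (ℕP.+-suc m n)) ⟩
  leibnizSum (m ℕ.+ suc n)
    ≡⟨ leibnizSum-+ (suc n) m ⟩
  (leibnizSum n ℚ.+ sign n ℚ.* leibnizTerm n) ℚ.+ ℚ.- sign n ℚ.* leibnizTail (suc n) m
    ≡⟨ solve 4 (λ s e t r → (s :+ e :* t) :+ (:- e) :* r := s :+ e :* (t :- r)) refl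
         (leibnizSum n) (sign n) (leibnizTerm n) (leibnizTail (suc n) m) ⟩
  leibnizSum n ℚ.+ sign n ℚ.* (leibnizTerm n ℚ.- leibnizTail (suc n) m) ∎
  where
  open ≡-Reasoning
  open +-*-Solver

leibnizTerm-anti : ∀ {m n} → m ℕ.≤ n → leibnizTerm n ℚ.≤ leibnizTerm m
leibnizTerm-anti {m} {n} m≤n = begin
  leibnizTerm n           ≡⟨ /-≡ι*u 4 (2 ℕ.* n) ⟩
  ι 4 ℚ.* u (2 ℕ.* n)     ≤⟨ ℚP.*-monoˡ-≤-nonNeg (ι 4) (u-anti (ℕP.*-monoʳ-≤ 2 m≤n)) ⟩
  ι 4 ℚ.* u (2 ℕ.* m)     ≡⟨ /-≡ι*u 4 (2 ℕ.* m) ⟨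
  leibnizTerm m           ∎
  where open ℚP.≤-Reasoning

leibnizTail-bounds : ∀ n m → 0ℚ ℚ.≤ leibnizTail n m × leibnizTail n m ℚ.≤ leibnizTerm n
leibnizTail-bounds n zero = ℚP.≤-refl , 0≤/ 4 (2 ℕ.* n)
leibnizTail-bounds n (suc m) with leibnizTail-bounds (suc n) m
... | lo , hi = 0≤- {leibnizTail (suc n) m} {leibnizTerm n} (ℚP.≤-trans hi (leibnizTerm-anti (ℕP.n≤1+n n)))
              , ≤-by (leibnizTail (suc n) m) lo
                  (solve 2 (λ t r → (t :- r) :+ r := t) refl (leibnizTerm n) (leibnizTail (suc n) m))
  where open +-*-Solver

∣sign∣ : ∀ n → ℚ.∣ sign n ∣ ≡ 1ℚ
∣sign∣ zero    = refl
∣sign∣ (suc n) = trans (ℚP.∣-p∣≡∣p∣ (sign n)) (∣sign∣ n)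

leibnizSum-close : ∀ N m n → N ℕ.≤ m → N ℕ.≤ n → ℚ.∣ leibnizSum m ℚ.- leibnizSum n ∣ ℚ.≤ leibnizTerm N
leibnizSum-close N m n N≤m N≤n = begin
  ℚ.∣ leibnizSum m ℚ.- leibnizSum n ∣
    ≡⟨ cong₂ (λ a b → ℚ.∣ a ℚ.- b ∣) (at m N≤m) (at n N≤n) ⟩
  ℚ.∣ (S ℚ.+ e ℚ.* T) ℚ.- (S ℚ.+ e ℚ.* T′) ∣
    ≡⟨ cong ℚ.∣_∣ (solve 4 (λ s e a b → (s :+ e :* a) :- (s :+ e :* b) := e :* (a :- b)) refl S e T T′) ⟩
  ℚ.∣ e ℚ.* (T ℚ.- T′) ∣
    ≡⟨ trans (ℚP.∣p*q∣≡∣p∣*∣q∣ e (T ℚ.- T′)) (cong (ℚ._* ℚ.∣ T ℚ.- T′ ∣) (∣sign∣ N)) ⟩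
  1ℚ ℚ.* ℚ.∣ T ℚ.- T′ ∣
    ≡⟨ ℚP.*-identityˡ ℚ.∣ T ℚ.- T′ ∣ ⟩
  ℚ.∣ T ℚ.- T′ ∣
    ≤⟨ ∣-∣-intro {T} {T′} {leibnizTerm N} (within (m ℕ.∸ N) (n ℕ.∸ N)) (within (n ℕ.∸ N) (m ℕ.∸ N)) ⟩
  leibnizTerm N ∎
  where
  open ℚP.≤-Reasoning
  open +-*-Solver
  S = leibnizSum N
  e = sign N
  T = leibnizTail N (m ℕ.∸ N)
  T′ = leibnizTail N (n ℕ.∸ N)
  at : ∀ k → N ℕ.≤ k → leibnizSum k ≡ leibnizSum N ℚ.+ sign N ℚ.* leibnizTail N (k ℕ.∸ N)
  at k N≤k = trans (cong leibnizSum (sym (ℕP.m∸n+n≡m N≤k))) (leibnizSum-+ N (k ℕ.∸ N))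
  within : ∀ i j → leibnizTail N i ℚ.≤ leibnizTail N j ℚ.+ leibnizTerm N
  within i j = ℚP.≤-trans (ℚP.≤-reflexive (sym (ℚP.+-identityˡ (leibnizTail N i))))
    (ℚP.+-mono-≤ {0ℚ} {leibnizTail N j} {leibnizTail N i} {leibnizTerm N}
      (proj₁ (leibnizTail-bounds N j)) (proj₂ (leibnizTail-bounds N i)))

leibniz-cauchy : Cauchy leibnizSum
leibniz-cauchy ε 0<ε = from (archimedean (u 3 ℚ.* ε) (0<* (0<u 3) 0<ε))
  where
  from : (∃[ N ] ∀ n → N ℕ.≤ n → u n ℚ.≤ u 3 ℚ.* ε) →
         ∃[ N ] ∀ m n → N ℕ.≤ m → N ℕ.≤ n → ℚ.∣ leibnizSum m ℚ.- leibnizSum n ∣ ℚ.≤ ε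
  from (N , hN) = N , λ m n p q → ℚP.≤-trans (leibnizSum-close N m n p q) (begin
    leibnizTerm N          ≡⟨ /-≡ι*u 4 (2 ℕ.* N) ⟩
    ι 4 ℚ.* u (2 ℕ.* N)    ≤⟨ ℚP.*-monoˡ-≤-nonNeg (ι 4) (hN (2 ℕ.* N) (ℕP.m≤n*m N 2)) ⟩
    ι 4 ℚ.* (u 3 ℚ.* ε)    ≡⟨ ℚP.*-assoc (ι 4) (u 3) ε ⟨
    (ι 4 ℚ.* u 3) ℚ.* ε    ≡⟨ ℚP.*-identityˡ ε ⟩
    ε                      ∎)
    where open ℚP.≤-Reasoning

π : ℝ
π .seq    = leibnizSum
π .cauchy = leibniz-cauchy

instance
  π-positive : Positive π
  π-positive = mkPositive (1ℚ , ℚP.positive⁻¹ 1ℚ , 2 , λ n 2≤n → begin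
    0ℚ ℚ.+ 1ℚ                                                 ≡⟨ ℚP.+-identityˡ 1ℚ ⟩
    1ℚ                                                        ≤⟨ ℚP.≤ᵇ⇒≤ {1ℚ} {leibnizSum 2} _ ⟩
    leibnizSum 2                                              ≤⟨ ≤-by {leibnizSum 2} (1ℚ ℚ.* leibnizTail 2 (n ℕ.∸ 2))
                                                                   (0≤* (ℚP.nonNegative⁻¹ 1ℚ) (proj₁ (leibnizTail-bounds 2 (n ℕ.∸ 2)))) refl ⟩
    leibnizSum 2 ℚ.+ sign 2 ℚ.* leibnizTail 2 (n ℕ.∸ 2)       ≡⟨ leibnizSum-+ 2 (n ℕ.∸ 2) ⟨
    leibnizSum (n ℕ.∸ 2 ℕ.+ 2)                                ≡⟨ cong leibnizSum (ℕP.m∸n+n≡m 2≤n) ⟩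
    leibnizSum n                                              ∎)
    where open ℚP.≤-Reasoning

count : ∀ {ℓ} {P : Pred ℕ ℓ} → Decidable P → ℕ → ℕ
count P? N = length (filter P? (upTo N))

-- The proportion of members among 0, …, n.
frequency : ∀ {ℓ} {P : Pred ℕ ℓ} → Decidable P → ℕ → ℚ
frequency P? n = + count P? (suc n) ℚ./ suc n

HasDensity : ∀ {ℓ} {P : Pred ℕ ℓ} → Decidable P → ℝ → Set
HasDensity P? x = ∀ ε → 0ℚ ℚ.< ε → ∃[ N ] ∀ n → N ℕ.≤ n → ∣ fromℚ (frequency P? n) - x ∣ ≤ fromℚ ε

indicator : Bool → ℕ
indicator b = if b then 1 else 0

count-suc : ∀ {ℓ} {P : Pred ℕ ℓ} (P? : Decidable P) N → count P? (suc N) ≡ count P? N ℕ.+ indicator (does (P? N))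
count-suc P? N = begin
  length (filter P? (upTo (suc N)))                      ≡⟨ cong (length ∘ filter P?) (ListP.upTo-∷ʳ N) ⟨
  length (filter P? (upTo N ++ N ∷ []))                  ≡⟨ cong length (ListP.filter-++ P? (upTo N) (N ∷ [])) ⟩
  length (filter P? (upTo N) ++ filter P? (N ∷ []))      ≡⟨ ListP.length-++ (filter P? (upTo N)) ⟩
  count P? N ℕ.+ length (filter P? (N ∷ []))             ≡⟨ cong (count P? N ℕ.+_) last ⟩
  count P? N ℕ.+ indicator (does (P? N))                 ∎
  where
  open ≡-Reasoning
  last : length (filter P? (N ∷ [])) ≡ indicator (does (P? N))
  last with does (P? N)
  ... | true  = refl
  ... | false = refl

Periodic : (ℕ → Bool) → Set
Periodic f = ∃[ M ] ∀ n → f (n ℕ.+ suc M) ≡ f n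

periodic-* : ∀ {f : ℕ → Bool} {M} → (∀ n → f (n ℕ.+ M) ≡ f n) → ∀ k n → f (n ℕ.+ k ℕ.* M) ≡ f n
periodic-* {f} {M} h zero    n = cong f (ℕP.+-identityʳ n)
periodic-* {f} {M} h (suc k) n = trans (cong f (sym (ℕP.+-assoc n M (k ℕ.* M))))
  (trans (periodic-* {f} h k (n ℕ.+ M)) (h n))

indicator≤1 : ∀ b → indicator b ℕ.≤ 1
indicator≤1 true  = ℕP.≤-refl
indicator≤1 false = ℕ.z≤n

count≤ : ∀ {ℓ} {P : Pred ℕ ℓ} (P? : Decidable P) N → count P? N ℕ.≤ N
count≤ P? zero    = ℕ.z≤n
count≤ P? (suc N) = begin
  count P? (suc N)                          ≡⟨ count-suc P? N ⟩
  count P? N ℕ.+ indicator (does (P? N))    ≤⟨ ℕP.+-mono-≤ (count≤ P? N) (indicator≤1 (does (P? N))) ⟩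
  N ℕ.+ 1                                   ≡⟨ ℕP.+-comm N 1 ⟩
  suc N                                     ∎
  where open ℕP.≤-Reasoning

module _ {ℓ} {P : Pred ℕ ℓ} (P? : Decidable P) {M-1} (periodic : ∀ n → does (P? (n ℕ.+ suc M-1)) ≡ does (P? n)) where

  private
    M = suc M-1
    D = count P? M

  count-+M : ∀ N → count P? (N ℕ.+ M) ≡ D ℕ.+ count P? N
  count-+M zero    = sym (ℕP.+-identityʳ D)
  count-+M (suc N) = begin
    count P? (suc (N ℕ.+ M))                                   ≡⟨ count-suc P? (N ℕ.+ M) ⟩
    count P? (N ℕ.+ M) ℕ.+ indicator (does (P? (N ℕ.+ M)))     ≡⟨ cong₂ ℕ._+_ (count-+M N) (cong indicator (periodic N)) ⟩
    (D ℕ.+ count P? N) ℕ.+ indicator (does (P? N))             ≡⟨ ℕP.+-assoc D (count P? N) _ ⟩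
    D ℕ.+ (count P? N ℕ.+ indicator (does (P? N)))             ≡⟨ cong (D ℕ.+_) (count-suc P? N) ⟨
    D ℕ.+ count P? (suc N)                                     ∎
    where open ≡-Reasoning

  count-+qM : ∀ q r → count P? (r ℕ.+ q ℕ.* M) ≡ q ℕ.* D ℕ.+ count P? r
  count-+qM zero    r = cong (count P?) (ℕP.+-identityʳ r)
  count-+qM (suc q) r = begin
    count P? (r ℕ.+ (M ℕ.+ q ℕ.* M))        ≡⟨ cong (count P?) (swap r M (q ℕ.* M)) ⟩
    count P? (r ℕ.+ q ℕ.* M ℕ.+ M)          ≡⟨ count-+M (r ℕ.+ q ℕ.* M) ⟩
    D ℕ.+ count P? (r ℕ.+ q ℕ.* M)          ≡⟨ cong (D ℕ.+_) (count-+qM q r) ⟩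
    D ℕ.+ (q ℕ.* D ℕ.+ count P? r)          ≡⟨ ℕP.+-assoc D (q ℕ.* D) (count P? r) ⟨
    D ℕ.+ q ℕ.* D ℕ.+ count P? r            ∎
    where
    open ≡-Reasoning
    swap : ∀ a b c → a ℕ.+ (b ℕ.+ c) ≡ a ℕ.+ c ℕ.+ b
    swap = ℕR.solve-∀

  count-bounds : ∀ N → count P? N ℕ.* M ℕ.≤ N ℕ.* D ℕ.+ M ℕ.* M × N ℕ.* D ℕ.≤ count P? N ℕ.* M ℕ.+ M ℕ.* M
  count-bounds N = subst
    (λ k → count P? k ℕ.* M ℕ.≤ k ℕ.* D ℕ.+ M ℕ.* M × k ℕ.* D ℕ.≤ count P? k ℕ.* M ℕ.+ M ℕ.* M)
    (sym (ℕD.m≡m%n+[m/n]*n N M)) (upper , lower)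
    where
    open ℕP.≤-Reasoning
    q = N ℕ./ M
    r = N ℕ.% M
    r≤M = ℕP.<⇒≤ (ℕD.m%n<n N M)
    up-eq : ∀ q D M r → q ℕ.* D ℕ.* M ℕ.+ M ℕ.* M ℕ.+ r ℕ.* D ≡ (r ℕ.+ q ℕ.* M) ℕ.* D ℕ.+ M ℕ.* M
    up-eq = ℕR.solve-∀
    low-eq : ∀ q D M r → (r ℕ.+ q ℕ.* M) ℕ.* D ≡ q ℕ.* D ℕ.* M ℕ.+ r ℕ.* D
    low-eq = ℕR.solve-∀
    upper : count P? (r ℕ.+ q ℕ.* M) ℕ.* M ℕ.≤ (r ℕ.+ q ℕ.* M) ℕ.* D ℕ.+ M ℕ.* M
    upper = begin
      count P? (r ℕ.+ q ℕ.* M) ℕ.* M              ≡⟨ cong (ℕ._* M) (count-+qM q r) ⟩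
      (q ℕ.* D ℕ.+ count P? r) ℕ.* M              ≡⟨ ℕP.*-distribʳ-+ M (q ℕ.* D) (count P? r) ⟩
      q ℕ.* D ℕ.* M ℕ.+ count P? r ℕ.* M          ≤⟨ ℕP.+-monoʳ-≤ (q ℕ.* D ℕ.* M) (ℕP.*-monoˡ-≤ M (ℕP.≤-trans (count≤ P? r) r≤M)) ⟩
      q ℕ.* D ℕ.* M ℕ.+ M ℕ.* M                   ≤⟨ ℕP.m≤m+n _ (r ℕ.* D) ⟩
      q ℕ.* D ℕ.* M ℕ.+ M ℕ.* M ℕ.+ r ℕ.* D       ≡⟨ up-eq q D M r ⟩
      (r ℕ.+ q ℕ.* M) ℕ.* D ℕ.+ M ℕ.* M           ∎
    lower : (r ℕ.+ q ℕ.* M) ℕ.* D ℕ.≤ count P? (r ℕ.+ q ℕ.* M) ℕ.* M ℕ.+ M ℕ.* M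
    lower = begin
      (r ℕ.+ q ℕ.* M) ℕ.* D                             ≡⟨ low-eq q D M r ⟩
      q ℕ.* D ℕ.* M ℕ.+ r ℕ.* D                         ≤⟨ ℕP.+-mono-≤ (ℕP.*-monoˡ-≤ M (ℕP.m≤m+n (q ℕ.* D) (count P? r))) (ℕP.*-mono-≤ r≤M (count≤ P? M)) ⟩
      (q ℕ.* D ℕ.+ count P? r) ℕ.* M ℕ.+ M ℕ.* M        ≡⟨ cong (λ z → z ℕ.* M ℕ.+ M ℕ.* M) (count-+qM q r) ⟨
      count P? (r ℕ.+ q ℕ.* M) ℕ.* M ℕ.+ M ℕ.* M        ∎

  frequency-close : ∀ n → ℚ.∣ frequency P? n ℚ.- + D ℚ./ M ∣ ℚ.≤ ι M ℚ.* u n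
  frequency-close n = subst₂ (λ a b → ℚ.∣ a ℚ.- b ∣ ℚ.≤ ι M ℚ.* u n)
    (sym (/-≡ι*u A n)) (sym (/-≡ι*u D M-1))
    (∣-∣-intro {ι A ℚ.* u n} {ι D ℚ.* u M-1} {ι M ℚ.* u n}
      (cross {A} {M} {N} {D} (proj₁ (count-bounds N)) (ι*u≡1 M-1) (ι*u≡1 n))
      (cross′ {A} {M} {N} {D} (proj₂ (count-bounds N)) (ι*u≡1 M-1) (ι*u≡1 n)))
    where
    N = suc n
    A = count P? N
    w = u n ℚ.* u M-1
    0≤w = 0≤* {u n} {u M-1} (ℚP.<⇒≤ (0<u n)) (ℚP.<⇒≤ (0<u M-1))
    open ℚP.≤-Reasoning
    open +-*-Solver
    scale : ∀ {x y} → x ℕ.≤ y → ι x ℚ.* w ℚ.≤ ι y ℚ.* w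
    scale x≤y = ℚP.*-monoʳ-≤-nonNeg w {{ℚ.nonNegative 0≤w}} (ι-mono x≤y)
    expand : ∀ a b m → ι (a ℕ.* b ℕ.+ m ℕ.* m) ≡ ι a ℚ.* ι b ℚ.+ ι m ℚ.* ι m
    expand a b m = trans (ι-+ (a ℕ.* b) (m ℕ.* m)) (cong₂ ℚ._+_ (ι-* a b) (ι-* m m))
    one : ∀ {z} y → z ≡ 1ℚ → y ℚ.* z ≡ y
    one y refl = ℚP.*-identityʳ y
    cross : ∀ {A M N D} → A ℕ.* M ℕ.≤ N ℕ.* D ℕ.+ M ℕ.* M → ι M ℚ.* u M-1 ≡ 1ℚ → ι N ℚ.* u n ≡ 1ℚ →
            ι A ℚ.* u n ℚ.≤ ι D ℚ.* u M-1 ℚ.+ ι M ℚ.* u n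
    cross {A} {M} {N} {D} h eM eN = begin
      ι A ℚ.* u n
        ≡⟨ one (ι A ℚ.* u n) eM ⟨
      (ι A ℚ.* u n) ℚ.* (ι M ℚ.* u M-1)
        ≡⟨ solve 4 (λ a v m x → (a :* v) :* (m :* x) := (a :* m) :* (v :* x)) refl (ι A) (u n) (ι M) (u M-1) ⟩
      (ι A ℚ.* ι M) ℚ.* w
        ≡⟨ cong (ℚ._* w) (ι-* A M) ⟨
      ι (A ℕ.* M) ℚ.* w
        ≤⟨ scale h ⟩
      ι (N ℕ.* D ℕ.+ M ℕ.* M) ℚ.* w
        ≡⟨ cong (ℚ._* w) (expand N D M) ⟩
      (ι N ℚ.* ι D ℚ.+ ι M ℚ.* ι M) ℚ.* (u n ℚ.* u M-1)
        ≡⟨ solve 5 (λ k d m v x → (k :* d :+ m :* m) :* (v :* x) := (d :* x) :* (k :* v) :+ (m :* v) :* (m :* x)) refl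
             (ι N) (ι D) (ι M) (u n) (u M-1) ⟩
      (ι D ℚ.* u M-1) ℚ.* (ι N ℚ.* u n) ℚ.+ (ι M ℚ.* u n) ℚ.* (ι M ℚ.* u M-1)
        ≡⟨ cong₂ ℚ._+_ (one (ι D ℚ.* u M-1) eN) (one (ι M ℚ.* u n) eM) ⟩
      ι D ℚ.* u M-1 ℚ.+ ι M ℚ.* u n ∎
    cross′ : ∀ {A M N D} → N ℕ.* D ℕ.≤ A ℕ.* M ℕ.+ M ℕ.* M → ι M ℚ.* u M-1 ≡ 1ℚ → ι N ℚ.* u n ≡ 1ℚ →
            ι D ℚ.* u M-1 ℚ.≤ ι A ℚ.* u n ℚ.+ ι M ℚ.* u n
    cross′ {A} {M} {N} {D} h eM eN = begin
      ι D ℚ.* u M-1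
        ≡⟨ one (ι D ℚ.* u M-1) eN ⟨
      (ι D ℚ.* u M-1) ℚ.* (ι N ℚ.* u n)
        ≡⟨ solve 4 (λ d x k v → (d :* x) :* (k :* v) := (k :* d) :* (v :* x)) refl (ι D) (u M-1) (ι N) (u n) ⟩
      (ι N ℚ.* ι D) ℚ.* w
        ≡⟨ cong (ℚ._* w) (ι-* N D) ⟨
      ι (N ℕ.* D) ℚ.* w
        ≤⟨ scale h ⟩
      ι (A ℕ.* M ℕ.+ M ℕ.* M) ℚ.* w
        ≡⟨ cong (ℚ._* w) (expand A M M) ⟩
      (ι A ℚ.* ι M ℚ.+ ι M ℚ.* ι M) ℚ.* (u n ℚ.* u M-1)
        ≡⟨ solve 4 (λ a m v x → (a :* m :+ m :* m) :* (v :* x) := (a :* v) :* (m :* x) :+ (m :* v) :* (m :* x)) refl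
             (ι A) (ι M) (u n) (u M-1) ⟩
      (ι A ℚ.* u n) ℚ.* (ι M ℚ.* u M-1) ℚ.+ (ι M ℚ.* u n) ℚ.* (ι M ℚ.* u M-1)
        ≡⟨ cong₂ ℚ._+_ (one (ι A ℚ.* u n) eM) (one (ι M ℚ.* u n) eM) ⟩
      ι A ℚ.* u n ℚ.+ ι M ℚ.* u n ∎

  frequency-cauchy : Cauchy (frequency P?)
  frequency-cauchy ε 0<ε = from (archimedean (u M-1 ℚ.* (½ ℚ.* ε)) (0<* (0<u M-1) (½-pos 0<ε)))
    where
    open ℚP.≤-Reasoning
    ρ = + D ℚ./ M
    from : (∃[ N ] ∀ n → N ℕ.≤ n → u n ℚ.≤ u M-1 ℚ.* (½ ℚ.* ε)) →
           ∃[ N ] ∀ m n → N ℕ.≤ m → N ℕ.≤ n → ℚ.∣ frequency P? m ℚ.- frequency P? n ∣ ℚ.≤ ε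
    from (N , hN) = N , λ m n p q → begin
      ℚ.∣ frequency P? m ℚ.- frequency P? n ∣
        ≤⟨ triangle (frequency P? m) ρ (frequency P? n) ⟩
      ℚ.∣ frequency P? m ℚ.- ρ ∣ ℚ.+ ℚ.∣ ρ ℚ.- frequency P? n ∣
        ≤⟨ ℚP.+-mono-≤ {ℚ.∣ frequency P? m ℚ.- ρ ∣} {½ ℚ.* ε} {ℚ.∣ ρ ℚ.- frequency P? n ∣} {½ ℚ.* ε}
             (near m p) (subst (ℚ._≤ ½ ℚ.* ε) (∣-∣-comm (frequency P? n) ρ) (near n q)) ⟩
      ½ ℚ.* ε ℚ.+ ½ ℚ.* ε
        ≡⟨ ½+½ ε ⟩
      ε ∎
      where
      near : ∀ n → N ℕ.≤ n → ℚ.∣ frequency P? n ℚ.- ρ ∣ ℚ.≤ ½ ℚ.* ε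
      near n p = begin
        ℚ.∣ frequency P? n ℚ.- ρ ∣             ≤⟨ frequency-close n ⟩
        ι M ℚ.* u n                            ≤⟨ ℚP.*-monoˡ-≤-nonNeg (ι M) {{ℚ.nonNegative (0≤ι M)}} (hN n p) ⟩
        ι M ℚ.* (u M-1 ℚ.* (½ ℚ.* ε))          ≡⟨ ℚP.*-assoc (ι M) (u M-1) (½ ℚ.* ε) ⟨
        (ι M ℚ.* u M-1) ℚ.* (½ ℚ.* ε)          ≡⟨ cong (ℚ._* (½ ℚ.* ε)) (ι*u≡1 M-1) ⟩
        1ℚ ℚ.* (½ ℚ.* ε)                       ≡⟨ ℚP.*-identityˡ (½ ℚ.* ε) ⟩
        ½ ℚ.* ε                                ∎

digitSum : Expansion 2 → ℕ
digitSum ds = sum (map Fin.toℕ ds)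

s : ℕ → ℕ
s n = digitSum (proj₁ (toDigits 2 n))

odd≢even : ∀ x y → suc (x ℕ.* 2) ≢ y ℕ.* 2
odd≢even (suc x) (suc y) eq = odd≢even x y (ℕP.suc-injective (ℕP.suc-injective eq))

-- Expansions of the same number may differ by leading zeros.
digitSum-unique : ∀ (ds es : Expansion 2) → fromDigits ds ≡ fromDigits es → digitSum ds ≡ digitSum es
digitSum-unique [] [] eq = refl
digitSum-unique [] (Fin.zero ∷ es) eq = digitSum-unique [] es (ℕP.*-cancelʳ-≡ 0 (fromDigits es) 2 eq)
digitSum-unique (Fin.zero ∷ ds) [] eq = digitSum-unique ds [] (ℕP.*-cancelʳ-≡ (fromDigits ds) 0 2 eq)
digitSum-unique (Fin.zero ∷ ds) (Fin.zero ∷ es) eq =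
  digitSum-unique ds es (ℕP.*-cancelʳ-≡ (fromDigits ds) (fromDigits es) 2 eq)
digitSum-unique (Fin.zero ∷ ds) (Fin.suc Fin.zero ∷ es) eq = ⊥-elim (odd≢even (fromDigits es) (fromDigits ds) (sym eq))
digitSum-unique (Fin.suc Fin.zero ∷ ds) (Fin.zero ∷ es) eq = ⊥-elim (odd≢even (fromDigits ds) (fromDigits es) eq)
digitSum-unique (Fin.suc Fin.zero ∷ ds) (Fin.suc Fin.zero ∷ es) eq =
  cong suc (digitSum-unique ds es (ℕP.*-cancelʳ-≡ (fromDigits ds) (fromDigits es) 2 (ℕP.suc-injective eq)))

s-digits : ∀ ds → s (fromDigits ds) ≡ digitSum ds
s-digits ds = digitSum-unique (proj₁ (toDigits 2 (fromDigits ds))) ds (proj₂ (toDigits 2 (fromDigits ds)))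

s-even : ∀ n → s (n ℕ.* 2) ≡ s n
s-even n = trans (cong (λ k → s (k ℕ.* 2)) (sym (proj₂ (toDigits 2 n)))) (s-digits (Fin.zero ∷ proj₁ (toDigits 2 n)))

s-odd : ∀ n → s (suc (n ℕ.* 2)) ≡ suc (s n)
s-odd n = trans (cong (λ k → s (suc (k ℕ.* 2))) (sym (proj₂ (toDigits 2 n)))) (s-digits (Fin.suc Fin.zero ∷ proj₁ (toDigits 2 n)))

data Halving : ℕ → Set where
  even : ∀ n → Halving (n ℕ.* 2)
  odd  : ∀ n → Halving (suc (n ℕ.* 2))

halve : ∀ n → Halving n
halve zero = even 0
halve (suc n) with halve n
... | even m = odd m
... | odd m  = even (suc m)

n<n*2 : ∀ n → suc n ℕ.< suc n ℕ.* 2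
n<n*2 n = ℕ.s≤s (ℕ.s≤s (ℕP.m≤m*n n 2))

s-suc : ∀ n → s (suc n) ℕ.≤ suc (s n)
s-suc = <-rec (λ n → s (suc n) ℕ.≤ suc (s n)) step
  where
  open ℕP.≤-Reasoning
  step : ∀ n → (∀ {m} → m ℕ.< n → s (suc m) ℕ.≤ suc (s m)) → s (suc n) ℕ.≤ suc (s n)
  step n rec with halve n
  ... | even m = ℕP.≤-reflexive (trans (s-odd m) (cong suc (sym (s-even m))))
  ... | odd m  = begin
    s (suc m ℕ.* 2)              ≡⟨ s-even (suc m) ⟩
    s (suc m)                    ≤⟨ rec (ℕ.s≤s (ℕP.m≤m*n m 2)) ⟩
    suc (s m)                    ≤⟨ ℕP.n≤1+n (suc (s m)) ⟩
    suc (suc (s m))              ≡⟨ cong suc (s-odd m) ⟨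
    suc (s (suc (m ℕ.* 2)))      ∎

-- For fixed a, b and t the condition s(n) + a ≤ s(n + t) + b is periodic in n.
compare : ℕ → ℕ → ℕ → ℕ → Bool
compare a b t n = (s n ℕ.+ a) ℕ.≤ᵇ (s (n ℕ.+ t) ℕ.+ b)

interleave : ∀ {f g h} → (∀ n → f (n ℕ.* 2) ≡ g n) → (∀ n → f (suc (n ℕ.* 2)) ≡ h n) →
  Periodic g → Periodic h → Periodic f
interleave {f} {g} {h} f≡g f≡h (M , hM) (N , hN) = suc (L-1 ℕ.* 2) , λ n → step n (halve n)
  where
  open ≡-Reasoning
  L-1 = N ℕ.+ M ℕ.* suc N
  L = suc M ℕ.* suc N
  hg : ∀ n → g (n ℕ.+ L) ≡ g n
  hg n = trans (cong (λ k → g (n ℕ.+ k)) (ℕP.*-comm (suc M) (suc N))) (periodic-* {g} hM (suc N) n)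
  hh : ∀ n → h (n ℕ.+ L) ≡ h n
  hh = periodic-* {h} hN (suc M)
  step : ∀ n → Halving n → f (n ℕ.+ L ℕ.* 2) ≡ f n
  step _ (even n) = begin
    f (n ℕ.* 2 ℕ.+ L ℕ.* 2)        ≡⟨ cong f (ℕP.*-distribʳ-+ 2 n L) ⟨
    f ((n ℕ.+ L) ℕ.* 2)            ≡⟨ f≡g (n ℕ.+ L) ⟩
    g (n ℕ.+ L)                    ≡⟨ hg n ⟩
    g n                            ≡⟨ f≡g n ⟨
    f (n ℕ.* 2)                    ∎
  step _ (odd n) = begin
    f (suc (n ℕ.* 2 ℕ.+ L ℕ.* 2))  ≡⟨ cong (f ∘ suc) (ℕP.*-distribʳ-+ 2 n L) ⟨
    f (suc ((n ℕ.+ L) ℕ.* 2))      ≡⟨ f≡h (n ℕ.+ L) ⟩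
    h (n ℕ.+ L)                    ≡⟨ hh n ⟩
    h n                            ≡⟨ f≡h n ⟨
    f (suc (n ℕ.* 2))              ∎

constant : ∀ {f} b → (∀ n → f n ≡ b) → Periodic f
constant b h = 0 , λ n → trans (h (n ℕ.+ 1)) (sym (h n))

≤ᵇ-shift : ∀ c a b → (c ℕ.+ a ℕ.≤ᵇ c ℕ.+ b) ≡ (a ℕ.≤ᵇ b)
≤ᵇ-shift c a b with a ℕP.≤? b
... | yes p = trans (≤ᵇ-true (ℕP.+-monoʳ-≤ c p)) (sym (≤ᵇ-true p))
... | no ¬p = trans (≤ᵇ-false (¬p ∘ ℕP.+-cancelˡ-≤ c a b)) (sym (≤ᵇ-false ¬p))

compare-even-even : ∀ a b t n → compare a b (t ℕ.* 2) (n ℕ.* 2) ≡ compare a b t n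
compare-even-even a b t n = cong₂ (λ x y → x ℕ.+ a ℕ.≤ᵇ y ℕ.+ b) (s-even n)
  (trans (cong s (sym (ℕP.*-distribʳ-+ 2 n t))) (s-even (n ℕ.+ t)))

compare-even-odd : ∀ a b t n → compare a b (t ℕ.* 2) (suc (n ℕ.* 2)) ≡ compare a b t n
compare-even-odd a b t n = trans (cong₂ (λ x y → x ℕ.+ a ℕ.≤ᵇ y ℕ.+ b) (s-odd n)
  (trans (cong (s ∘ suc) (sym (ℕP.*-distribʳ-+ 2 n t))) (s-odd (n ℕ.+ t))))
  (≤ᵇ-shift 1 (s n ℕ.+ a) (s (n ℕ.+ t) ℕ.+ b))

compare-odd-even : ∀ a b t n → compare a b (suc (t ℕ.* 2)) (n ℕ.* 2) ≡ compare a (suc b) t n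
compare-odd-even a b t n = cong₂ (λ x y → x ℕ.+ a ℕ.≤ᵇ y) (s-even n)
  (trans (cong (ℕ._+ b) (trans (cong s (shift n t)) (s-odd (n ℕ.+ t)))) (sym (ℕP.+-suc (s (n ℕ.+ t)) b)))
  where
  shift : ∀ n t → n ℕ.* 2 ℕ.+ suc (t ℕ.* 2) ≡ suc ((n ℕ.+ t) ℕ.* 2)
  shift = ℕR.solve-∀

compare-odd-odd : ∀ a b t n → compare a b (suc (t ℕ.* 2)) (suc (n ℕ.* 2)) ≡ compare (suc a) b (suc t) n
compare-odd-odd a b t n = cong₂ (λ x y → x ℕ.≤ᵇ y ℕ.+ b)
  (trans (cong (ℕ._+ a) (s-odd n)) (sym (ℕP.+-suc (s n) a)))
  (trans (cong s (shift n t)) (s-even (n ℕ.+ suc t)))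
  where
  shift : ∀ n t → suc (n ℕ.* 2) ℕ.+ suc (t ℕ.* 2) ≡ (n ℕ.+ suc t) ℕ.* 2
  shift = ℕR.solve-∀

periodic-0 : ∀ a b → Periodic (compare a b 0)
periodic-0 a b = constant (a ℕ.≤ᵇ b) λ n →
  trans (cong (λ k → s n ℕ.+ a ℕ.≤ᵇ s k ℕ.+ b) (ℕP.+-identityʳ n)) (≤ᵇ-shift (s n) a b)

periodic-1 : ∀ k a b → b ℕ.+ 2 ℕ.≤ a ℕ.+ k → Periodic (compare a b 1)
periodic-1 zero a b b+2≤a = constant false λ n → ≤ᵇ-false λ le → ℕP.<-irrefl refl (begin-strict
  s n ℕ.+ (b ℕ.+ 1)         <⟨ ℕP.+-monoʳ-< (s n) (ℕP.+-monoʳ-< b (ℕP.n<1+n 1)) ⟩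
  s n ℕ.+ (b ℕ.+ 2)         ≤⟨ ℕP.+-monoʳ-≤ (s n) (subst (b ℕ.+ 2 ℕ.≤_) (ℕP.+-identityʳ a) b+2≤a) ⟩
  s n ℕ.+ a                 ≤⟨ le ⟩
  s (n ℕ.+ 1) ℕ.+ b         ≡⟨ cong (λ k → s k ℕ.+ b) (ℕP.+-comm n 1) ⟩
  s (suc n) ℕ.+ b           ≤⟨ ℕP.+-monoˡ-≤ b (s-suc n) ⟩
  suc (s n) ℕ.+ b           ≡⟨ rearrange (s n) b ⟩
  s n ℕ.+ (b ℕ.+ 1)         ∎)
  where
  open ℕP.≤-Reasoning
  rearrange : ∀ x b → suc x ℕ.+ b ≡ x ℕ.+ (b ℕ.+ 1)
  rearrange = ℕR.solve-∀
periodic-1 (suc k) a b h = interleave (compare-odd-even a b 0) (compare-odd-odd a b 0)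
  (periodic-0 a (suc b)) (periodic-1 k (suc a) b (subst (b ℕ.+ 2 ℕ.≤_) (ℕP.+-suc a k) h))

compare-periodic : ∀ t a b → Periodic (compare a b t)
compare-periodic = <-rec (λ t → ∀ a b → Periodic (compare a b t)) step
  where
  step : ∀ t → (∀ {r} → r ℕ.< t → ∀ a b → Periodic (compare a b r)) → ∀ a b → Periodic (compare a b t)
  step t rec a b with halve t
  ... | even zero    = periodic-0 a b
  ... | even (suc r) = interleave (compare-even-even a b (suc r)) (compare-even-odd a b (suc r))
                         (rec (n<n*2 r) a b) (rec (n<n*2 r) a b)
  ... | odd zero     = periodic-1 (b ℕ.+ 2) a b (ℕP.m≤n+m (b ℕ.+ 2) a)
  ... | odd (suc r)  = interleave (compare-odd-even a b (suc r)) (compare-odd-odd a b (suc r))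
                         (rec (ℕP.<-trans (n<n*2 r) (ℕP.n<1+n _)) a (suc b)) (rec (ℕ.s≤s (n<n*2 r)) (suc a) b)

s≤s[_+]? : ∀ t → Decidable (λ n → s n ℕ.≤ s (n ℕ.+ t))
s≤s[ t +]? n = s n ℕP.≤? s (n ℕ.+ t)

s≤s-periodic : ∀ t → Periodic (does ∘ s≤s[ t +]?)
s≤s-periodic t = let M , h = compare-periodic t 0 0 in M , λ n → trans (sym (drop (n ℕ.+ suc M))) (trans (h n) (drop n))
  where
  drop : ∀ n → compare 0 0 t n ≡ (s n ℕ.≤ᵇ s (n ℕ.+ t))
  drop n = cong₂ ℕ._≤ᵇ_ (ℕP.+-identityʳ (s n)) (ℕP.+-identityʳ (s (n ℕ.+ t)))

-- The sequence of frequencies, being Cauchy, represents its own limit.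
c : ℕ → ℝ
c t .seq    = frequency s≤s[ t +]?
c t .cauchy = frequency-cauchy s≤s[ t +]? (proj₂ (s≤s-periodic t))

c-density : ∀ t → HasDensity s≤s[ t +]? (c t)
c-density t ε 0<ε = let N , h = cauchy (c t) ε 0<ε in N , λ n N≤n δ 0<δ → N , λ m N≤m →
  ℚP.≤-trans (h n m N≤n N≤m) (≤-by {ε} δ (ℚP.<⇒≤ 0<δ) refl)

-- 4 ^ j ≥ 1 and 3 divides 4 ^ j - 1, so neither operation truncates.
t : ℕ → ℕ
t j = (4 ℕ.^ j ℕ.∸ 1) ℕ./ 3

{-# OPTIONS --safe #-}
module Submission where

-- Let d = s(n + t_j) - s(n).  Removing the last binary digits of n gives a three-term
-- recurrence in j for the tails of the law of d.  Symmetrising them makes the recurrence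
-- a symmetric walk, whose value at the origin is the bias 2 c(t_j) - 1, and the kernel
-- method yields
--   N · Σ bias_j X^j + X/4 = M · D^(-1/2),   D = (1 - X) (1 - X/4) (1 + 3X/4 + X²/4),
-- with polynomials M and N.  As a recurrence for the bias this is a contraction towards
-- 3/4 of the coefficient a_j of D^(-1/2), with error O(j^(-3/2)).  Splitting off
-- (1 - X)^(-1/2), whose coefficients are b_j = (2j choose j) / 4^j, leaves a factor with
-- coefficients O(2^(-j)) and sum √(2/3), so a_j = √(2/3) b_j + O(j^(-3/2)); Wallis's
-- product gives b_j² = 1 / (π j) + O(j^(-2)), where the π of Leibniz's series enters
-- through the Fourier series of sgn ∘ cos.  Everything is estimated for squares, which
-- keeps the argument rational up to the last step.
-- For positivity, the linear recurrence of a_j keeps a_j / a_{j-1} between 17/20 and 9/8,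
-- which gives the inhomogeneous term of the recurrence for the bias a constant sign; a
-- minimum principle then excludes negative values.

open import Defs
open import Data.Nat.Base as ℕ using (ℕ; NonZero; zero; suc)
open import Data.Product.Base using (_×_; ∃-syntax; _,_; proj₁; proj₂)
open import Data.Rational.Base as ℚ using (ℚ; ½; 0ℚ; 1ℚ)
open import Algebra.Bundles using (CommutativeRing)
import Algebra.Solver.Ring
import Algebra.Solver.Ring.AlmostCommutativeRing as ACR
open import Data.Bool.Base using (Bool; true; false)
open import Data.Empty using (⊥-elim)
open import Data.Integer.Base using (+_)
open import Data.List.Base using (List; []; _∷_)
open import Data.Maybe.Base as Maybe using (Maybe)
import Data.Nat.DivMod as ℕD
import Data.Nat.Properties as ℕP
import Data.Nat.Tactic.RingSolver as ℕR
import Data.Rational.Properties as ℚP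
open import Data.Rational.Solver using (module +-*-Solver)
open import Data.Sum.Base using (inj₁; inj₂)
open import Function.Base using (_∘_)
open import Level using (0ℓ)
open import Relation.Binary.PropositionalEquality
import Relation.Binary.Reasoning.Setoid
open import Relation.Nullary using (Dec; does; yes; no)
open import Relation.Nullary.Decidable.Core using (dec⇒maybe)

-- Formal power series

-- The obstacle is N = 1 - 3X/2 + X²/4: its root 3 - √5 lies inside the unit disc, so running the
-- recurrence for the bias forwards amplifies errors like 1.31^j, although the bias itself is
-- bounded. Both the asymptotics and the positivity therefore read it as an equation for its middle
-- term. The two neighbours then have weights 2/3 and 1/6, of sum 5/6, and iteration from the a
-- priori bound |bias| ≤ 1 forgets its start exponentially fast. The factor 3/4 is M(1) / N(1), the
-- value at the dominant singularity X = 1, and the constant of the theorem is 1/2 · 3/4 · √(2/3) ·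
-- 1/√(π j) = √3 / (4 √(2 π j)).

tail : (ℕ → ℚ) → ℕ → ℚ
tail x n = x (suc n)

infixl 7 _∗_

_∗_ : (ℕ → ℚ) → (ℕ → ℚ) → ℕ → ℚ
(x ∗ y) zero    = x 0 ℚ.* y 0
(x ∗ y) (suc n) = x 0 ℚ.* y (suc n) ℚ.+ (tail x ∗ y) n

∗-cong : ∀ x x′ y y′ → (∀ n → x n ≡ x′ n) → (∀ n → y n ≡ y′ n) → ∀ n → (x ∗ y) n ≡ (x′ ∗ y′) n
∗-cong x x′ y y′ p q zero    = cong₂ ℚ._*_ (p 0) (q 0)
∗-cong x x′ y y′ p q (suc n) = cong₂ ℚ._+_ (cong₂ ℚ._*_ (p 0) (q (suc n)))
  (∗-cong (tail x) (tail x′) y y′ (λ n → p (suc n)) q n)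

∗-zeroˡ : ∀ y n → ((λ _ → 0ℚ) ∗ y) n ≡ 0ℚ
∗-zeroˡ y zero    = ℚP.*-zeroˡ (y 0)
∗-zeroˡ y (suc n) = cong₂ ℚ._+_ (ℚP.*-zeroˡ (y (suc n))) (∗-zeroˡ y n)

∗-distribʳ : ∀ y x x′ n → ((λ k → x k ℚ.+ x′ k) ∗ y) n ≡ (x ∗ y) n ℚ.+ (x′ ∗ y) n
∗-distribʳ y x x′ zero    = ℚP.*-distribʳ-+ (y 0) (x 0) (x′ 0)
∗-distribʳ y x x′ (suc n) = trans
  (cong ((x 0 ℚ.+ x′ 0) ℚ.* y (suc n) ℚ.+_) (∗-distribʳ y (tail x) (tail x′) n))
  (solve 5 (λ a b c p q → (a :+ b) :* c :+ (p :+ q) := a :* c :+ p :+ (b :* c :+ q)) refl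
    (x 0) (x′ 0) (y (suc n)) ((tail x ∗ y) n) ((tail x′ ∗ y) n))
  where open +-*-Solver

-- The definition peels terms off the left factor; peeling them off the right one is what
-- commutativity needs.
∗-suc : ∀ x y n → (x ∗ y) (suc n) ≡ (x ∗ tail y) n ℚ.+ x (suc n) ℚ.* y 0
∗-suc x y zero    = refl
∗-suc x y (suc n) = trans (cong (x 0 ℚ.* y (suc (suc n)) ℚ.+_) (∗-suc (tail x) y n))
  (sym (ℚP.+-assoc (x 0 ℚ.* y (suc (suc n))) ((tail x ∗ tail y) n) (x (suc (suc n)) ℚ.* y 0)))

∗-comm : ∀ x y n → (x ∗ y) n ≡ (y ∗ x) n
∗-comm x y zero    = ℚP.*-comm (x 0) (y 0)
∗-comm x y (suc n) = trans (cong₂ ℚ._+_ (ℚP.*-comm (x 0) (y (suc n))) (∗-comm (tail x) y n))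
  (trans (ℚP.+-comm (y (suc n) ℚ.* x 0) ((y ∗ tail x) n)) (sym (∗-suc y x n)))

scale-∗ : ∀ q x y n → ((λ k → q ℚ.* x k) ∗ y) n ≡ q ℚ.* (x ∗ y) n
scale-∗ q x y zero    = ℚP.*-assoc q (x 0) (y 0)
scale-∗ q x y (suc n) = trans (cong₂ ℚ._+_ (ℚP.*-assoc q (x 0) (y (suc n))) (scale-∗ q (tail x) y n))
  (sym (ℚP.*-distribˡ-+ q (x 0 ℚ.* y (suc n)) ((tail x ∗ y) n)))

∗-assoc : ∀ x y z n → ((x ∗ y) ∗ z) n ≡ (x ∗ (y ∗ z)) n
∗-assoc x y z zero    = ℚP.*-assoc (x 0) (y 0) (z 0)
∗-assoc x y z (suc n) = begin
  x 0 ℚ.* y 0 ℚ.* z (suc n) ℚ.+ (tail (x ∗ y) ∗ z) n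
    ≡⟨ cong (x 0 ℚ.* y 0 ℚ.* z (suc n) ℚ.+_) (∗-distribʳ z (λ k → x 0 ℚ.* y (suc k)) (tail x ∗ y) n) ⟩
  x 0 ℚ.* y 0 ℚ.* z (suc n) ℚ.+ (((λ k → x 0 ℚ.* y (suc k)) ∗ z) n ℚ.+ ((tail x ∗ y) ∗ z) n)
    ≡⟨ cong₂ (λ a b → x 0 ℚ.* y 0 ℚ.* z (suc n) ℚ.+ (a ℚ.+ b)) (scale-∗ (x 0) (tail y) z n) (∗-assoc (tail x) y z n) ⟩
  x 0 ℚ.* y 0 ℚ.* z (suc n) ℚ.+ (x 0 ℚ.* (tail y ∗ z) n ℚ.+ (tail x ∗ (y ∗ z)) n)
    ≡⟨ solve 5 (λ a b c p q → a :* b :* c :+ (a :* p :+ q) := a :* (b :* c :+ p) :+ q) refl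
         (x 0) (y 0) (z (suc n)) ((tail y ∗ z) n) ((tail x ∗ (y ∗ z)) n) ⟩
  x 0 ℚ.* (y 0 ℚ.* z (suc n) ℚ.+ (tail y ∗ z) n) ℚ.+ (tail x ∗ (y ∗ z)) n ∎
  where
  open ≡-Reasoning
  open +-*-Solver

infix  4 _≈_
infixl 6 _⊕_
infixl 7 _⊛_
infix  8 ⊝_

record Series : Set where
  no-eta-equality
  constructor series
  field coeff : ℕ → ℚ

open Series

record _≈_ (x y : Series) : Set where
  constructor pointwise
  field at : ∀ n → coeff x n ≡ coeff y n

open _≈_

_⊕_ : Series → Series → Series
(x ⊕ y) .coeff n = coeff x n ℚ.+ coeff y n

⊝_ : Series → Series
(⊝ x) .coeff n = ℚ.- coeff x n

_⊛_ : Series → Series → Series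
(x ⊛ y) .coeff = coeff x ∗ coeff y

const : ℚ → Series
const q .coeff zero    = q
const q .coeff (suc _) = 0ℚ

X : Series
X .coeff zero          = 0ℚ
X .coeff (suc zero)    = 1ℚ
X .coeff (suc (suc _)) = 0ℚ

const-⊛ : ∀ q x n → coeff (const q ⊛ x) n ≡ q ℚ.* coeff x n
const-⊛ q x zero    = refl
const-⊛ q x (suc n) = trans (cong (q ℚ.* coeff x (suc n) ℚ.+_) (∗-zeroˡ (coeff x) n)) (ℚP.+-identityʳ (q ℚ.* coeff x (suc n)))

seriesRing : CommutativeRing 0ℓ 0ℓ
seriesRing = record
  { Carrier = Series ; _≈_ = _≈_ ; _+_ = _⊕_ ; _*_ = _⊛_ ; -_ = ⊝_ ; 0# = const 0ℚ ; 1# = const 1ℚ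
  ; isCommutativeRing = record
    { isRing = record
      { +-isAbelianGroup = record
        { isGroup = record
          { isMonoid = record
            { isSemigroup = record
              { isMagma = record
                { isEquivalence = record
                  { refl  = pointwise λ _ → refl
                  ; sym   = λ p → pointwise λ n → sym (at p n)
                  ; trans = λ p q → pointwise λ n → trans (at p n) (at q n)
                  }
                ; ∙-cong = λ p q → pointwise λ n → cong₂ ℚ._+_ (at p n) (at q n)
                }
              ; assoc = λ x y z → pointwise λ n → ℚP.+-assoc (coeff x n) (coeff y n) (coeff z n)
              }
            ; identity = (λ x → pointwise λ n → trans (cong (ℚ._+ coeff x n) (const0 n)) (ℚP.+-identityˡ (coeff x n)))
                       , (λ x → pointwise λ n → trans (cong (coeff x n ℚ.+_) (const0 n)) (ℚP.+-identityʳ (coeff x n)))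
            }
          ; inverse = (λ x → pointwise λ n → trans (ℚP.+-inverseˡ (coeff x n)) (sym (const0 n)))
                    , (λ x → pointwise λ n → trans (ℚP.+-inverseʳ (coeff x n)) (sym (const0 n)))
          ; ⁻¹-cong = λ p → pointwise λ n → cong ℚ.-_ (at p n)
          }
        ; comm = λ x y → pointwise λ n → ℚP.+-comm (coeff x n) (coeff y n)
        }
      ; *-cong = λ {x} {x′} {y} {y′} p q → pointwise (∗-cong (coeff x) (coeff x′) (coeff y) (coeff y′) (at p) (at q))
      ; *-assoc = λ x y z → pointwise (∗-assoc (coeff x) (coeff y) (coeff z))
      ; *-identity = (λ x → pointwise (one x))
                   , (λ x → pointwise λ n → trans (∗-comm (coeff x) (coeff (const 1ℚ)) n) (one x n))
      ; distrib = (λ x y z → pointwise λ n → trans (∗-comm (coeff x) (coeff (y ⊕ z)) n)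
                    (trans (∗-distribʳ (coeff x) (coeff y) (coeff z) n)
                      (cong₂ ℚ._+_ (∗-comm (coeff y) (coeff x) n) (∗-comm (coeff z) (coeff x) n))))
                , (λ x y z → pointwise (∗-distribʳ (coeff x) (coeff y) (coeff z)))
      }
    ; *-comm = λ x y → pointwise (∗-comm (coeff x) (coeff y))
    }
  }
  where
  const0 : ∀ n → coeff (const 0ℚ) n ≡ 0ℚ
  const0 zero    = refl
  const0 (suc n) = refl
  one : ∀ x n → coeff (const 1ℚ ⊛ x) n ≡ coeff x n
  one x n = trans (const-⊛ 1ℚ x n) (ℚP.*-identityˡ (coeff x n))

module SeriesRing = CommutativeRing seriesRing

open SeriesRing using () renaming
  (refl to ≈-refl; sym to ≈-sym; trans to ≈-trans; +-cong to ⊕-cong; *-cong to ⊛-cong; -‿cong to ⊝-cong)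

constants : ℚ.+-*-rawRing ACR.-Raw-AlmostCommutative⟶ ACR.fromCommutativeRing seriesRing
constants = record
  { ⟦_⟧    = const
  ; +-homo = λ p q → pointwise λ { zero → refl ; (suc n) → refl }
  ; *-homo = λ p q → pointwise λ { zero → refl ; (suc n) → sym (trans (const-⊛ p (const q) (suc n)) (ℚP.*-zeroʳ p)) }
  ; -‿homo = λ p → pointwise λ { zero → refl ; (suc n) → refl }
  ; 0-homo = ≈-refl
  ; 1-homo = ≈-refl
  }

const-≟ : ∀ p q → Maybe (const p ≈ const q)
const-≟ p q = Maybe.map (λ { refl → ≈-refl }) (dec⇒maybe (p ℚP.≟ q))

module SeriesSolver = Algebra.Solver.Ring ℚ.+-*-rawRing (ACR.fromCommutativeRing seriesRing) constants const-≟

module ≈-Reasoning = Relation.Binary.Reasoning.Setoid SeriesRing.setoid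

X-⊛-zero : ∀ x → coeff (X ⊛ x) 0 ≡ 0ℚ
X-⊛-zero x = ℚP.*-zeroˡ (coeff x 0)

X-⊛-suc : ∀ x n → coeff (X ⊛ x) (suc n) ≡ coeff x n
X-⊛-suc x n = trans (cong₂ ℚ._+_ (ℚP.*-zeroˡ (coeff x (suc n)))
    (trans (∗-cong (tail (coeff X)) (coeff (const 1ℚ)) (coeff x) (coeff x) tail-X (λ _ → refl) n)
           (trans (const-⊛ 1ℚ x n) (ℚP.*-identityˡ (coeff x n)))))
  (ℚP.+-identityˡ (coeff x n))
  where
  tail-X : ∀ n → tail (coeff X) n ≡ coeff (const 1ℚ) n
  tail-X zero    = refl
  tail-X (suc n) = refl

X-cancel : ∀ {x y} → X ⊛ x ≈ X ⊛ y → x ≈ y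
X-cancel {x} {y} h = pointwise λ n → trans (sym (X-⊛-suc x n)) (trans (at h (suc n)) (X-⊛-suc y n))

ι-suc : ∀ n → ι (suc n) ≡ 1ℚ ℚ.+ ι n
ι-suc n = ι-+ 1 n

-- The Euler derivation X · d/dX.
ϑ : Series → Series
ϑ x .coeff n = ι n ℚ.* coeff x n

-- Leibniz's rule by induction on the index. Since ϑ does not commute with the shift, the tail of ϑ
-- x is y + ϑ y, where y is the tail of x; this correction is carried along.
ϑ-⊛ : ∀ x y → ϑ (x ⊛ y) ≈ ϑ x ⊛ y ⊕ x ⊛ ϑ y
ϑ-⊛ x y = pointwise (go (coeff x))
  where
  open +-*-Solver
  open ≡-Reasoning
  c′ = coeff y
  θ : (ℕ → ℚ) → ℕ → ℚ
  θ x n = ι n ℚ.* x n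
  tail-θ : ∀ x n → tail (θ x) n ≡ tail x n ℚ.+ θ (tail x) n
  tail-θ x n = trans (cong (ℚ._* x (suc n)) (ι-suc n))
    (solve 2 (λ k a → (con 1ℚ :+ k) :* a := a :+ k :* a) refl (ι n) (x (suc n)))
  go : ∀ x n → θ (x ∗ c′) n ≡ (θ x ∗ c′) n ℚ.+ (x ∗ θ c′) n
  go x zero    = solve 2 (λ a b → con 0ℚ :* (a :* b) := con 0ℚ :* a :* b :+ a :* (con 0ℚ :* b)) refl (x 0) (c′ 0)
  go x (suc n) = begin
    ι (suc n) ℚ.* (x 0 ℚ.* c′ (suc n) ℚ.+ T)
      ≡⟨ cong (ℚ._* (x 0 ℚ.* c′ (suc n) ℚ.+ T)) (ι-suc n) ⟩
    (1ℚ ℚ.+ ι n) ℚ.* (x 0 ℚ.* c′ (suc n) ℚ.+ T)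
      ≡⟨ solve 4 (λ k a b c → (con 1ℚ :+ k) :* (a :* b :+ c) := c :+ k :* c :+ a :* ((con 1ℚ :+ k) :* b)) refl
           (ι n) (x 0) (c′ (suc n)) T ⟩
    T ℚ.+ ι n ℚ.* T ℚ.+ x 0 ℚ.* ((1ℚ ℚ.+ ι n) ℚ.* c′ (suc n))
      ≡⟨ cong₂ (λ p q → T ℚ.+ p ℚ.+ x 0 ℚ.* (q ℚ.* c′ (suc n))) (go (tail x) n) (sym (ι-suc n)) ⟩
    T ℚ.+ ((θ (tail x) ∗ c′) n ℚ.+ U) ℚ.+ x 0 ℚ.* (ι (suc n) ℚ.* c′ (suc n))
      ≡⟨ solve 6 (λ c p q a k b → c :+ (p :+ q) :+ a :* (k :* b) := con 0ℚ :* a :* b :+ (c :+ p) :+ (a :* (k :* b) :+ q)) refl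
           T ((θ (tail x) ∗ c′) n) U (x 0) (ι (suc n)) (c′ (suc n)) ⟩
    0ℚ ℚ.* x 0 ℚ.* c′ (suc n) ℚ.+ (T ℚ.+ (θ (tail x) ∗ c′) n) ℚ.+ (x 0 ℚ.* (ι (suc n) ℚ.* c′ (suc n)) ℚ.+ U)
      ≡⟨ cong (λ p → 0ℚ ℚ.* x 0 ℚ.* c′ (suc n) ℚ.+ p ℚ.+ (x 0 ℚ.* (ι (suc n) ℚ.* c′ (suc n)) ℚ.+ U))
           (sym (trans (∗-cong (tail (θ x)) (λ k → tail x k ℚ.+ θ (tail x) k) c′ c′ (tail-θ x) (λ _ → refl) n)
                       (∗-distribʳ c′ (tail x) (θ (tail x)) n))) ⟩
    0ℚ ℚ.* x 0 ℚ.* c′ (suc n) ℚ.+ (tail (θ x) ∗ c′) n ℚ.+ (x 0 ℚ.* (ι (suc n) ℚ.* c′ (suc n)) ℚ.+ U) ∎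
    where
    T = (tail x ∗ c′) n
    U = (tail x ∗ θ c′) n

ϑ-⊕ : ∀ x y → ϑ (x ⊕ y) ≈ ϑ x ⊕ ϑ y
ϑ-⊕ x y = pointwise λ n → ℚP.*-distribˡ-+ (ι n) (coeff x n) (coeff y n)

ϑ-const : ∀ q → ϑ (const q) ≈ const 0ℚ
ϑ-const q = pointwise λ { zero → ℚP.*-zeroˡ q ; (suc n) → ℚP.*-zeroʳ (ι (suc n)) }

ϑ-X : ϑ X ≈ X
ϑ-X = pointwise λ { zero → refl ; (suc zero) → refl ; (suc (suc n)) → ℚP.*-zeroʳ (ι (suc (suc n))) }

ϑ-kernel : ∀ x → ϑ x ≈ const 0ℚ → x ≈ const (coeff x 0)
ϑ-kernel x h = pointwise λ { zero → refl ; (suc n) → vanish n }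
  where
  open ≡-Reasoning
  open +-*-Solver
  vanish : ∀ n → coeff x (suc n) ≡ 0ℚ
  vanish n = begin
    coeff x (suc n)                          ≡⟨ ℚP.*-identityˡ (coeff x (suc n)) ⟨
    1ℚ ℚ.* coeff x (suc n)                   ≡⟨ cong (ℚ._* coeff x (suc n)) (ι*u≡1 n) ⟨
    ι (suc n) ℚ.* u n ℚ.* coeff x (suc n)    ≡⟨ solve 3 (λ a b c → a :* b :* c := b :* (a :* c)) refl (ι (suc n)) (u n) (coeff x (suc n)) ⟩
    u n ℚ.* (ι (suc n) ℚ.* coeff x (suc n))  ≡⟨ cong (u n ℚ.*_) (at h (suc n)) ⟩
    u n ℚ.* 0ℚ                               ≡⟨ ℚP.*-zeroʳ (u n) ⟩
    0ℚ                                       ∎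

-- The logarithmic derivative characterises the inverse square root of P.
inverse-square : ∀ P y → coeff P 0 ≡ 1ℚ → coeff y 0 ≡ 1ℚ →
  P ⊛ ϑ y ⊕ P ⊛ ϑ y ⊕ y ⊛ ϑ P ≈ const 0ℚ → P ⊛ (y ⊛ y) ≈ const 1ℚ
inverse-square P y P0 y0 h = ≈-trans (ϑ-kernel (P ⊛ (y ⊛ y)) derivative)
  (pointwise λ n → cong (λ q → coeff (const q) n) (cong₂ (λ p q → p ℚ.* (q ℚ.* q)) P0 y0))
  where
  open ≈-Reasoning
  open SeriesSolver
  derivative : ϑ (P ⊛ (y ⊛ y)) ≈ const 0ℚ
  derivative = begin
    ϑ (P ⊛ (y ⊛ y))
      ≈⟨ ϑ-⊛ P (y ⊛ y) ⟩
    ϑ P ⊛ (y ⊛ y) ⊕ P ⊛ ϑ (y ⊛ y)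
      ≈⟨ ⊕-cong ≈-refl (⊛-cong ≈-refl (ϑ-⊛ y y)) ⟩
    ϑ P ⊛ (y ⊛ y) ⊕ P ⊛ (ϑ y ⊛ y ⊕ y ⊛ ϑ y)
      ≈⟨ solve 4 (λ P P′ y y′ → P′ :* (y :* y) :+ P :* (y′ :* y :+ y :* y′) := y :* (P :* y′ :+ P :* y′ :+ y :* P′)) ≈-refl
           P (ϑ P) y (ϑ y) ⟩
    y ⊛ (P ⊛ ϑ y ⊕ P ⊛ ϑ y ⊕ y ⊛ ϑ P)
      ≈⟨ ⊛-cong ≈-refl h ⟩
    y ⊛ const 0ℚ
      ≈⟨ SeriesRing.zeroʳ y ⟩
    const 0ℚ ∎

-- The generating function of a symmetric walk

¼ : ℚ
¼ = + 1 ℚ./ 4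

-- Polynomials, by their coefficients from the constant term on.
polynomial : List ℚ → Series
polynomial []       = const 0ℚ
polynomial (p ∷ ps) = const p ⊕ X ⊛ polynomial ps

-- A polynomial in X as a difference operator, with the terms of negative index dropped. It turns
-- identities between series into linear recurrences with explicit low-index cases.
act : List ℚ → (ℕ → ℚ) → ℕ → ℚ
act []       y n       = 0ℚ
act (p ∷ ps) y zero    = p ℚ.* y 0
act (p ∷ ps) y (suc n) = p ℚ.* y (suc n) ℚ.+ act ps y n

polynomial-⊛ : ∀ ps y n → coeff (polynomial ps ⊛ y) n ≡ act ps (coeff y) n
polynomial-⊛ []       y n = trans (const-⊛ 0ℚ y n) (ℚP.*-zeroˡ (coeff y n))
polynomial-⊛ (p ∷ ps) y n = trans (at (solve 4 (λ c x r y → (c :+ x :* r) :* y := c :* y :+ x :* (r :* y)) ≈-refl (const p) X (polynomial ps) y) n) (step n)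
  where
  open SeriesSolver
  step : ∀ n → coeff (const p ⊛ y ⊕ X ⊛ (polynomial ps ⊛ y)) n ≡ act (p ∷ ps) (coeff y) n
  step zero    = trans (cong (p ℚ.* coeff y 0 ℚ.+_) (X-⊛-zero (polynomial ps ⊛ y))) (ℚP.+-identityʳ (p ℚ.* coeff y 0))
  step (suc n) = cong₂ ℚ._+_ (const-⊛ p y (suc n)) (trans (X-⊛-suc (polynomial ps ⊛ y) n) (polynomial-⊛ ps y n))

weigh : ℕ → List ℚ → List ℚ
weigh k []       = []
weigh k (p ∷ ps) = ι k ℚ.* p ∷ weigh (suc k) ps

-- Because ϑ (X r) = X (r + ϑ r), the induction has to treat k + ϑ for every k; the theorem is the
-- case k = 0.
ϑ-polynomial : ∀ ps → ϑ (polynomial ps) ≈ polynomial (weigh 0 ps)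
ϑ-polynomial ps = ≈-trans (solve 2 (λ x y → y := con 0ℚ :* x :+ y) ≈-refl (polynomial ps) (ϑ (polynomial ps))) (go 0 ps)
  where
  open SeriesSolver
  go : ∀ k ps → const (ι k) ⊛ polynomial ps ⊕ ϑ (polynomial ps) ≈ polynomial (weigh k ps)
  go k [] = ≈-trans (⊕-cong ≈-refl (ϑ-const 0ℚ)) (solve 1 (λ k → k :* con 0ℚ :+ con 0ℚ := con 0ℚ) ≈-refl (const (ι k)))
  go k (p ∷ ps) = begin
    const (ι k) ⊛ (const p ⊕ X ⊛ polynomial ps) ⊕ ϑ (const p ⊕ X ⊛ polynomial ps)
      ≈⟨ ⊕-cong ≈-refl (≈-trans (ϑ-⊕ (const p) (X ⊛ polynomial ps)) (⊕-cong (ϑ-const p)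
           (≈-trans (ϑ-⊛ X (polynomial ps)) (⊕-cong (⊛-cong ϑ-X ≈-refl) ≈-refl)))) ⟩
    const (ι k) ⊛ (const p ⊕ X ⊛ polynomial ps) ⊕ (const 0ℚ ⊕ (X ⊛ polynomial ps ⊕ X ⊛ ϑ (polynomial ps)))
      ≈⟨ solve 5 (λ k p x r r′ → k :* (p :+ x :* r) :+ (con 0ℚ :+ (x :* r :+ x :* r′)) := k :* p :+ x :* ((con 1ℚ :+ k) :* r :+ r′))
           ≈-refl (const (ι k)) (const p) X (polynomial ps) (ϑ (polynomial ps)) ⟩
    const (ι k) ⊛ const p ⊕ X ⊛ ((const 1ℚ ⊕ const (ι k)) ⊛ polynomial ps ⊕ ϑ (polynomial ps))
      ≈⟨ ⊕-cong (pointwise λ n → trans (const-⊛ (ι k) (const p) n) (product n)) (⊛-cong ≈-refl (⊕-cong (⊛-cong (pointwise successor) ≈-refl) ≈-refl)) ⟩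
    const (ι k ℚ.* p) ⊕ X ⊛ (const (ι (suc k)) ⊛ polynomial ps ⊕ ϑ (polynomial ps))
      ≈⟨ ⊕-cong ≈-refl (⊛-cong ≈-refl (go (suc k) ps)) ⟩
    const (ι k ℚ.* p) ⊕ X ⊛ polynomial (weigh (suc k) ps) ∎
    where
    open ≈-Reasoning
    product : ∀ n → ι k ℚ.* coeff (const p) n ≡ coeff (const (ι k ℚ.* p)) n
    product zero    = refl
    product (suc n) = ℚP.*-zeroʳ (ι k)
    successor : ∀ n → coeff (const 1ℚ ⊕ const (ι k)) n ≡ coeff (const (ι (suc k))) n
    successor zero    = sym (ι-suc k)
    successor (suc n) = refl

-- (1 - q X)^(-1/2)
binomial : ℚ → Series
binomial q .coeff zero    = 1ℚ
binomial q .coeff (suc n) = q ℚ.* (ι n ℚ.+ ½) ℚ.* u n ℚ.* coeff (binomial q) n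

binomial-suc : ∀ q n → ι (suc n) ℚ.* coeff (binomial q) (suc n) ≡ q ℚ.* (ι n ℚ.+ ½) ℚ.* coeff (binomial q) n
binomial-suc q n = trans
  (solve 4 (λ m p v y → m :* (p :* v :* y) := (m :* v) :* (p :* y)) refl (ι (suc n)) (q ℚ.* (ι n ℚ.+ ½)) (u n) y)
  (trans (cong (ℚ._* (q ℚ.* (ι n ℚ.+ ½) ℚ.* y)) (ι*u≡1 n)) (ℚP.*-identityˡ (q ℚ.* (ι n ℚ.+ ½) ℚ.* y)))
  where
  open +-*-Solver
  y = coeff (binomial q) n

-- Brings the hypothesis of `inverse-square` into the form of a recurrence, by which a recursively
-- defined sequence is recognised as an inverse square root.
differential-equation : ∀ ps y → (∀ n → act ps (coeff (ϑ y)) n ℚ.+ act ps (coeff (ϑ y)) n ℚ.+ act (weigh 0 ps) (coeff y) n ≡ 0ℚ) →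
  polynomial ps ⊛ ϑ y ⊕ polynomial ps ⊛ ϑ y ⊕ y ⊛ ϑ (polynomial ps) ≈ const 0ℚ
differential-equation ps y h = pointwise λ n → trans
  (cong₂ ℚ._+_ (cong₂ ℚ._+_ (polynomial-⊛ ps (ϑ y) n) (polynomial-⊛ ps (ϑ y) n))
    (trans (at (⊛-cong (≈-refl {y}) (ϑ-polynomial ps)) n) (trans (∗-comm (coeff y) (coeff (polynomial (weigh 0 ps))) n) (polynomial-⊛ (weigh 0 ps) y n))))
  (trans (h n) (zeros n))
  where
  zeros : ∀ n → 0ℚ ≡ coeff (const 0ℚ) n
  zeros zero    = refl
  zeros (suc n) = refl

binomial-square : ∀ q → polynomial (1ℚ ∷ ℚ.- q ∷ []) ⊛ (binomial q ⊛ binomial q) ≈ const 1ℚ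
binomial-square q = inverse-square (polynomial ps) (binomial q) (solve 1 (λ q → con 1ℚ :+ con 0ℚ :* ((:- q) :+ con 0ℚ :* con 0ℚ) := con 1ℚ) refl q) refl
  (differential-equation ps (binomial q) coefficients)
  where
  open +-*-Solver
  ps = 1ℚ ∷ ℚ.- q ∷ []
  y = coeff (binomial q)
  coefficients : ∀ n → act ps (coeff (ϑ (binomial q))) n ℚ.+ act ps (coeff (ϑ (binomial q))) n ℚ.+ act (weigh 0 ps) y n ≡ 0ℚ
  coefficients zero       = solve 1 (λ q → con 1ℚ :* (con 0ℚ :* con 1ℚ) :+ con 1ℚ :* (con 0ℚ :* con 1ℚ) :+ con 0ℚ :* con 1ℚ :* con 1ℚ := con 0ℚ) refl q
  coefficients (suc zero) = trans
    (cong (λ w → 1ℚ ℚ.* w ℚ.+ ℚ.- q ℚ.* (0ℚ ℚ.* 1ℚ) ℚ.+ (1ℚ ℚ.* w ℚ.+ ℚ.- q ℚ.* (0ℚ ℚ.* 1ℚ)) ℚ.+ (0ℚ ℚ.* 1ℚ ℚ.* y 1 ℚ.+ 1ℚ ℚ.* ℚ.- q ℚ.* 1ℚ))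
      (binomial-suc q 0))
    (solve 2 (λ q y → let w = q :* (con 0ℚ :+ con ½) :* con 1ℚ in
      con 1ℚ :* w :+ (:- q) :* (con 0ℚ :* con 1ℚ) :+ (con 1ℚ :* w :+ (:- q) :* (con 0ℚ :* con 1ℚ))
        :+ (con 0ℚ :* con 1ℚ :* y :+ con 1ℚ :* (:- q) :* con 1ℚ) := con 0ℚ) refl q (y 1))
  coefficients (suc (suc n)) = trans
    (cong (λ w → 1ℚ ℚ.* w ℚ.+ (ℚ.- q ℚ.* (ι (suc n) ℚ.* y (suc n)) ℚ.+ 0ℚ) ℚ.+ (1ℚ ℚ.* w ℚ.+ (ℚ.- q ℚ.* (ι (suc n) ℚ.* y (suc n)) ℚ.+ 0ℚ))
                   ℚ.+ (0ℚ ℚ.* 1ℚ ℚ.* y (suc (suc n)) ℚ.+ (1ℚ ℚ.* ℚ.- q ℚ.* y (suc n) ℚ.+ 0ℚ)))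
      (binomial-suc q (suc n)))
    (solve 4 (λ q k y₁ y₂ → let w = q :* (k :+ con ½) :* y₁ in
      con 1ℚ :* w :+ ((:- q) :* (k :* y₁) :+ con 0ℚ) :+ (con 1ℚ :* w :+ ((:- q) :* (k :* y₁) :+ con 0ℚ))
        :+ (con 0ℚ :* con 1ℚ :* y₂ :+ (con 1ℚ :* (:- q) :* y₁ :+ con 0ℚ)) := con 0ℚ) refl q (ι (suc n)) (y (suc n)) (y (suc (suc n))))

-- (1 + 3/4 X + 1/4 X²)^(-1/2), whose coefficients are 2^(-n) P_n(-3/4) for the
-- Legendre polynomials P_n.
legendre : Series
legendre .coeff zero          = 1ℚ
legendre .coeff (suc zero)    = ℚ.- (+ 3 ℚ./ 8)
legendre .coeff (suc (suc n)) =
  ℚ.- (u (suc n) ℚ.* ((+ 3 ℚ./ 4) ℚ.* (ι n ℚ.+ (+ 3 ℚ./ 2)) ℚ.* coeff legendre (suc n) ℚ.+ ¼ ℚ.* (ι n ℚ.+ 1ℚ) ℚ.* coeff legendre n))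

legendre-suc : ∀ n → ι (suc (suc n)) ℚ.* coeff legendre (suc (suc n)) ≡
  ℚ.- ((+ 3 ℚ./ 4) ℚ.* (ι n ℚ.+ (+ 3 ℚ./ 2)) ℚ.* coeff legendre (suc n) ℚ.+ ¼ ℚ.* (ι n ℚ.+ 1ℚ) ℚ.* coeff legendre n)
legendre-suc n = trans
  (solve 3 (λ m v r → m :* (:- (v :* r)) := (m :* v) :* (:- r)) refl (ι (suc (suc n))) (u (suc n)) R)
  (trans (cong (ℚ._* ℚ.- R) (ι*u≡1 (suc n))) (ℚP.*-identityˡ (ℚ.- R)))
  where
  open +-*-Solver
  R = (+ 3 ℚ./ 4) ℚ.* (ι n ℚ.+ (+ 3 ℚ./ 2)) ℚ.* coeff legendre (suc n) ℚ.+ ¼ ℚ.* (ι n ℚ.+ 1ℚ) ℚ.* coeff legendre n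

legendre-square : polynomial (1ℚ ∷ + 3 ℚ./ 4 ∷ ¼ ∷ []) ⊛ (legendre ⊛ legendre) ≈ const 1ℚ
legendre-square = inverse-square (polynomial ps) legendre refl refl (differential-equation ps legendre coefficients)
  where
  open +-*-Solver
  ps = 1ℚ ∷ + 3 ℚ./ 4 ∷ ¼ ∷ []
  y = coeff legendre
  coefficients : ∀ n → act ps (coeff (ϑ legendre)) n ℚ.+ act ps (coeff (ϑ legendre)) n ℚ.+ act (weigh 0 ps) y n ≡ 0ℚ
  coefficients zero             = refl
  coefficients (suc zero)       = refl
  coefficients (suc (suc zero)) = refl
  coefficients (suc (suc (suc n))) = trans
    (cong₂ (λ w k → let r = (+ 3 ℚ./ 4) ℚ.* (k ℚ.* y₂) ℚ.+ (¼ ℚ.* (ι (suc n) ℚ.* y₁) ℚ.+ 0ℚ) in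
        1ℚ ℚ.* w ℚ.+ r ℚ.+ (1ℚ ℚ.* w ℚ.+ r) ℚ.+ (0ℚ ℚ.* y₃ ℚ.+ ((+ 3 ℚ./ 4) ℚ.* y₂ ℚ.+ (½ ℚ.* y₁ ℚ.+ 0ℚ))))
      (legendre-suc (suc n)) (ι-suc (suc n)))
    (solve 4 (λ k y₁ y₂ y₃ → let r = con (+ 3 ℚ./ 4) :* ((con 1ℚ :+ k) :* y₂) :+ (con ¼ :* (k :* y₁) :+ con 0ℚ)
                                 w = :- (con (+ 3 ℚ./ 4) :* (k :+ con (+ 3 ℚ./ 2)) :* y₂ :+ con ¼ :* (k :+ con 1ℚ) :* y₁) in
        con 1ℚ :* w :+ r :+ (con 1ℚ :* w :+ r) :+ (con 0ℚ :* y₃ :+ (con (+ 3 ℚ./ 4) :* y₂ :+ (con ½ :* y₁ :+ con 0ℚ))) := con 0ℚ)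
      refl (ι (suc n)) y₁ y₂ y₃)
    where
    y₁ = y (suc n)
    y₂ = y (suc (suc n))
    y₃ = y (suc (suc (suc n)))

-- A collects the terms of the walk that keep their position. One has B = A + X, and A - X = (1 - X)
-- (1 - X/4), so that D = (A - X) (A + X). N is the kernel A - X (z + 1/z) / 2 at z = 1/2, the ratio
-- of the source; M is what remains of the boundary condition after the source has been absorbed.
A B D M N : Series
A = polynomial (1ℚ ∷ ℚ.- ¼ ∷ ¼ ∷ [])
B = polynomial (1ℚ ∷ + 3 ℚ./ 4 ∷ ¼ ∷ [])
D = polynomial (1ℚ ∷ ℚ.- ½ ∷ ℚ.- (+ 7 ℚ./ 16) ∷ ℚ.- (+ 1 ℚ./ 8) ∷ + 1 ℚ./ 16 ∷ [])
M = polynomial (1ℚ ∷ ℚ.- 1ℚ ∷ ℚ.- (+ 5 ℚ./ 16) ∷ + 1 ℚ./ 8 ∷ [])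
N = polynomial (1ℚ ∷ ℚ.- (+ 3 ℚ./ 2) ∷ ¼ ∷ [])

-- D^(-1/2) is the generating function of the constant terms of the walk with
-- kernel A - X (z + 1/z) / 2, because D = A² - X².
smooth walk : Series
smooth = binomial ¼ ⊛ legendre
walk   = binomial 1ℚ ⊛ smooth

smooth-square : polynomial (1ℚ ∷ ℚ.- ¼ ∷ []) ⊛ B ⊛ (smooth ⊛ smooth) ≈ const 1ℚ
smooth-square = begin
  P₄ ⊛ B ⊛ (p ⊛ h ⊛ (p ⊛ h))        ≈⟨ solve 4 (λ P B p h → P :* B :* (p :* h :* (p :* h)) := P :* (p :* p) :* (B :* (h :* h))) ≈-refl P₄ B p h ⟩
  P₄ ⊛ (p ⊛ p) ⊛ (B ⊛ (h ⊛ h))      ≈⟨ ⊛-cong (binomial-square ¼) legendre-square ⟩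
  const 1ℚ ⊛ const 1ℚ               ≈⟨ SeriesRing.*-identityˡ (const 1ℚ) ⟩
  const 1ℚ                          ∎
  where
  open ≈-Reasoning
  open SeriesSolver
  P₄ = polynomial (1ℚ ∷ ℚ.- ¼ ∷ [])
  p  = binomial ¼
  h  = legendre

walk-square : D ⊛ (walk ⊛ walk) ≈ const 1ℚ
walk-square = begin
  D ⊛ (b ⊛ g ⊛ (b ⊛ g))
    ≈⟨ solve 3 (λ x b g →
         let P₁ = con 1ℚ :+ x :* (con (ℚ.- 1ℚ) :+ x :* con 0ℚ)
             P₄ = con 1ℚ :+ x :* (con (ℚ.- ¼) :+ x :* con 0ℚ)
             B = con 1ℚ :+ x :* (con (+ 3 ℚ./ 4) :+ x :* (con ¼ :+ x :* con 0ℚ))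
             D = con 1ℚ :+ x :* (con (ℚ.- ½) :+ x :* (con (ℚ.- (+ 7 ℚ./ 16)) :+ x :* (con (ℚ.- (+ 1 ℚ./ 8)) :+ x :* (con (+ 1 ℚ./ 16) :+ x :* con 0ℚ)))) in
         D :* (b :* g :* (b :* g)) := P₁ :* (b :* b) :* (P₄ :* B :* (g :* g))) ≈-refl X b g ⟩
  P₁ ⊛ (b ⊛ b) ⊛ (P₄ ⊛ B ⊛ (g ⊛ g))
    ≈⟨ ⊛-cong (binomial-square 1ℚ) smooth-square ⟩
  const 1ℚ ⊛ const 1ℚ
    ≈⟨ SeriesRing.*-identityˡ (const 1ℚ) ⟩
  const 1ℚ ∎
  where
  open ≈-Reasoning
  open SeriesSolver
  P₁ = polynomial (1ℚ ∷ ℚ.- 1ℚ ∷ [])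
  P₄ = polynomial (1ℚ ∷ ℚ.- ¼ ∷ [])
  b  = binomial 1ℚ
  g  = smooth

-- The root of X (1 + Λ²) = 2 A Λ without constant term.
root : Series
root .coeff n = coeff (A ⊕ ⊝ (D ⊛ walk)) (suc n)

X-root : X ⊛ root ≈ A ⊕ ⊝ (D ⊛ walk)
X-root = pointwise λ { zero → X-⊛-zero root ; (suc n) → X-⊛-suc root n }

root-0 : coeff root 0 ≡ 0ℚ
root-0 = refl

-- The quadratic formula: with √D = D f for f = `walk`, the square of A - √D is A² - 2 A √D + D, and
-- D = A² - X². The equation is proved after multiplication by X, where `X-root` applies.
root-equation : X ⊛ (const 1ℚ ⊕ root ⊛ root) ≈ A ⊛ root ⊕ A ⊛ root
root-equation = X-cancel (begin
  X ⊛ (X ⊛ (const 1ℚ ⊕ root ⊛ root))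
    ≈⟨ solve 2 (λ x l → x :* (x :* (con 1ℚ :+ l :* l)) := x :* x :+ (x :* l) :* (x :* l)) ≈-refl X root ⟩
  X ⊛ X ⊕ X ⊛ root ⊛ (X ⊛ root)
    ≈⟨ ⊕-cong ≈-refl (⊛-cong X-root X-root) ⟩
  X ⊛ X ⊕ (A ⊕ ⊝ (D ⊛ f)) ⊛ (A ⊕ ⊝ (D ⊛ f))
    ≈⟨ solve 4 (λ x a d f → x :* x :+ (a :- d :* f) :* (a :- d :* f) := x :* x :+ a :* a :- (a :* d :* f :+ a :* d :* f) :+ d :* (d :* (f :* f)))
         ≈-refl X A D f ⟩
  X ⊛ X ⊕ A ⊛ A ⊕ ⊝ (A ⊛ D ⊛ f ⊕ A ⊛ D ⊛ f) ⊕ D ⊛ (D ⊛ (f ⊛ f))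
    ≈⟨ ⊕-cong ≈-refl (⊛-cong ≈-refl walk-square) ⟩
  X ⊛ X ⊕ A ⊛ A ⊕ ⊝ (A ⊛ D ⊛ f ⊕ A ⊛ D ⊛ f) ⊕ D ⊛ const 1ℚ
    ≈⟨ solve 2 (λ x f →
         let A = con 1ℚ :+ x :* (con (ℚ.- ¼) :+ x :* (con ¼ :+ x :* con 0ℚ))
             D = con 1ℚ :+ x :* (con (ℚ.- ½) :+ x :* (con (ℚ.- (+ 7 ℚ./ 16)) :+ x :* (con (ℚ.- (+ 1 ℚ./ 8)) :+ x :* (con (+ 1 ℚ./ 16) :+ x :* con 0ℚ)))) in
         x :* x :+ A :* A :- (A :* D :* f :+ A :* D :* f) :+ D :* con 1ℚ := A :* (A :- D :* f) :+ A :* (A :- D :* f)) ≈-refl X f ⟩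
  A ⊛ (A ⊕ ⊝ (D ⊛ f)) ⊕ A ⊛ (A ⊕ ⊝ (D ⊛ f))
    ≈⟨ ⊕-cong (⊛-cong ≈-refl X-root) (⊛-cong ≈-refl X-root) ⟨
  A ⊛ (X ⊛ root) ⊕ A ⊛ (X ⊛ root)
    ≈⟨ solve 3 (λ a x l → a :* (x :* l) :+ a :* (x :* l) := x :* (a :* l :+ a :* l)) ≈-refl A X root ⟩
  X ⊛ (A ⊛ root ⊕ A ⊛ root) ∎)
  where
  open ≈-Reasoning
  open SeriesSolver
  f = walk

∗-vanish : ∀ x y n → (∀ k → k ℕ.≤ n → y k ≡ 0ℚ) → (x ∗ y) n ≡ 0ℚ
∗-vanish x y zero    h = trans (cong (x 0 ℚ.*_) (h 0 ℕ.z≤n)) (ℚP.*-zeroʳ (x 0))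
∗-vanish x y (suc n) h = cong₂ ℚ._+_ (trans (cong (x 0 ℚ.*_) (h (suc n) ℕP.≤-refl)) (ℚP.*-zeroʳ (x 0)))
  (∗-vanish (tail x) y n (λ k k≤n → h k (ℕP.m≤n⇒m≤1+n k≤n)))

-- Each use of the hypothesis raises the order of vanishing by one, provided that the induction
-- treats all m at once.
infinitely-divisible : ∀ x (E : ℕ → Series) → coeff x 0 ≡ 0ℚ → (∀ m → E m ≈ x ⊛ E (suc m)) → ∀ m → E m ≈ const 0ℚ
infinitely-divisible x E x0 h m = pointwise λ n → trans (vanish n n ℕP.≤-refl m) (zeros n)
  where
  zeros : ∀ n → 0ℚ ≡ coeff (const 0ℚ) n
  zeros zero    = refl
  zeros (suc n) = refl
  vanish : ∀ n k → k ℕ.≤ n → ∀ m → coeff (E m) k ≡ 0ℚ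
  vanish n zero    _         m = trans (at (h m) 0) (trans (cong (ℚ._* coeff (E (suc m)) 0) x0) (ℚP.*-zeroˡ (coeff (E (suc m)) 0)))
  vanish (suc n) (suc k) (ℕ.s≤s k≤n) m = trans (at (h m) (suc k)) (cong₂ ℚ._+_
    (trans (cong (ℚ._* coeff (E (suc m)) (suc k)) x0) (ℚP.*-zeroˡ (coeff (E (suc m)) (suc k))))
    (∗-vanish (tail (coeff x)) (coeff (E (suc m))) k (λ l l≤k → vanish n l (ℕP.≤-trans l≤k k≤n) (suc m))))

-- Z (suc m) - root ⊛ Z m is divisible by every power of the root, hence zero.
kernel-method : ∀ (Z : ℕ → Series) → (∀ m → A ⊛ Z (suc m) ⊕ A ⊛ Z (suc m) ≈ X ⊛ (Z (suc (suc m)) ⊕ Z m)) →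
  A ⊛ Z 0 ⊕ ⊝ (X ⊛ Z 1) ≈ M → Z 0 ≈ walk ⊛ M
kernel-method Z interior boundary = begin
  Z 0
    ≈⟨ solve 1 (λ z → z := con 1ℚ :* z) ≈-refl (Z 0) ⟩
  const 1ℚ ⊛ Z 0
    ≈⟨ ⊛-cong walk-square ≈-refl ⟨
  D ⊛ (f ⊛ f) ⊛ Z 0
    ≈⟨ solve 4 (λ a d f z → d :* (f :* f) :* z := f :* (a :* z :- (a :- d :* f) :* z)) ≈-refl A D f (Z 0) ⟩
  f ⊛ (A ⊛ Z 0 ⊕ ⊝ ((A ⊕ ⊝ (D ⊛ f)) ⊛ Z 0))
    ≈⟨ ⊛-cong ≈-refl (⊕-cong ≈-refl (⊝-cong (⊛-cong X-root ≈-refl))) ⟨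
  f ⊛ (A ⊛ Z 0 ⊕ ⊝ (X ⊛ root ⊛ Z 0))
    ≈⟨ solve 6 (λ a f x l z₀ z₁ → f :* (a :* z₀ :- x :* l :* z₀) := f :* (a :* z₀ :- x :* z₁ :+ x :* (z₁ :- l :* z₀))) ≈-refl A f X root (Z 0) (Z 1) ⟩
  f ⊛ (A ⊛ Z 0 ⊕ ⊝ (X ⊛ Z 1) ⊕ X ⊛ E 0)
    ≈⟨ ⊛-cong ≈-refl (⊕-cong boundary (⊛-cong ≈-refl (infinitely-divisible root E root-0 descent 0))) ⟩
  f ⊛ (M ⊕ X ⊛ const 0ℚ)
    ≈⟨ solve 3 (λ f m x → f :* (m :+ x :* con 0ℚ) := f :* m) ≈-refl f M X ⟩
  f ⊛ M ∎
  where
  open ≈-Reasoning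
  open SeriesSolver
  f = walk
  E : ℕ → Series
  E m = Z (suc m) ⊕ ⊝ (root ⊛ Z m)
  descent : ∀ m → E m ≈ root ⊛ E (suc m)
  descent m = X-cancel (begin
    X ⊛ (z₁ ⊕ ⊝ (l ⊛ z₀))
      ≈⟨ solve 4 (λ x l z₀ z₁ → x :* (z₁ :- l :* z₀) := x :* (con 1ℚ :+ l :* l) :* z₁ :- x :* l :* l :* z₁ :- l :* x :* z₀) ≈-refl X l z₀ z₁ ⟩
    X ⊛ (const 1ℚ ⊕ l ⊛ l) ⊛ z₁ ⊕ ⊝ (X ⊛ l ⊛ l ⊛ z₁) ⊕ ⊝ (l ⊛ X ⊛ z₀)
      ≈⟨ ⊕-cong (⊕-cong (⊛-cong root-equation ≈-refl) ≈-refl) ≈-refl ⟩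
    (A ⊛ l ⊕ A ⊛ l) ⊛ z₁ ⊕ ⊝ (X ⊛ l ⊛ l ⊛ z₁) ⊕ ⊝ (l ⊛ X ⊛ z₀)
      ≈⟨ solve 5 (λ a x l z₀ z₁ → (a :* l :+ a :* l) :* z₁ :- x :* l :* l :* z₁ :- l :* x :* z₀ := l :* (a :* z₁ :+ a :* z₁) :- x :* l :* l :* z₁ :- l :* x :* z₀)
           ≈-refl A X l z₀ z₁ ⟩
    l ⊛ (A ⊛ z₁ ⊕ A ⊛ z₁) ⊕ ⊝ (X ⊛ l ⊛ l ⊛ z₁) ⊕ ⊝ (l ⊛ X ⊛ z₀)
      ≈⟨ ⊕-cong (⊕-cong (⊛-cong ≈-refl (interior m)) ≈-refl) ≈-refl ⟩
    l ⊛ (X ⊛ (z₂ ⊕ z₀)) ⊕ ⊝ (X ⊛ l ⊛ l ⊛ z₁) ⊕ ⊝ (l ⊛ X ⊛ z₀)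
      ≈⟨ solve 5 (λ x l z₀ z₁ z₂ → l :* (x :* (z₂ :+ z₀)) :- x :* l :* l :* z₁ :- l :* x :* z₀ := x :* (l :* (z₂ :- l :* z₁))) ≈-refl X l z₀ z₁ z₂ ⟩
    X ⊛ (l ⊛ (z₂ ⊕ ⊝ (l ⊛ z₁))) ∎)
    where
    l  = root
    z₀ = Z m
    z₁ = Z (suc m)
    z₂ = Z (suc (suc m))

halves : ℕ → ℚ
halves zero    = 1ℚ
halves (suc n) = ½ ℚ.* halves n

-- The kernel method needs a homogeneous system. Multiplying by N makes room for a geometric
-- particular solution without dividing by N.
constant-term : ∀ (Y : ℕ → Series) →
  (∀ m → A ⊛ Y (suc m) ⊕ A ⊛ Y (suc m) ≈ X ⊛ (Y (suc (suc m)) ⊕ Y m) ⊕ ⊝ (X ⊛ const (¼ ℚ.* halves m))) →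
  A ⊛ Y 0 ⊕ ⊝ (X ⊛ Y 1) ≈ const 1ℚ ⊕ const ¼ ⊛ X →
  N ⊛ Y 0 ⊕ X ⊛ const ¼ ≈ walk ⊛ M
constant-term Y interior boundary = kernel-method Z interior′ boundary′
  where
  open ≈-Reasoning
  open SeriesSolver
  γ : ℕ → Series
  γ m = const (¼ ℚ.* halves m)
  -- N = A - (5/4) X makes the geometric summand absorb the source.
  Z : ℕ → Series
  Z m = N ⊛ Y m ⊕ X ⊛ γ m
  γ-suc : ∀ m → γ (suc m) ≈ const ½ ⊛ γ m
  γ-suc m = pointwise λ
    { zero    → +-*-Solver.solve 1 (λ h → +-*-Solver.con ¼ +-*-Solver.:* (+-*-Solver.con ½ +-*-Solver.:* h)
                  +-*-Solver.:= +-*-Solver.con ½ +-*-Solver.:* (+-*-Solver.con ¼ +-*-Solver.:* h)) refl (halves m)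
    ; (suc n) → sym (const-⊛ ½ (γ m) (suc n)) }
  interior′ : ∀ m → A ⊛ Z (suc m) ⊕ A ⊛ Z (suc m) ≈ X ⊛ (Z (suc (suc m)) ⊕ Z m)
  interior′ m = begin
    A ⊛ (N ⊛ y₁ ⊕ X ⊛ γ (suc m)) ⊕ A ⊛ (N ⊛ y₁ ⊕ X ⊛ γ (suc m))
      ≈⟨ ⊕-cong (⊛-cong ≈-refl (⊕-cong ≈-refl (⊛-cong ≈-refl (γ-suc m)))) (⊛-cong ≈-refl (⊕-cong ≈-refl (⊛-cong ≈-refl (γ-suc m)))) ⟩
    A ⊛ (N ⊛ y₁ ⊕ X ⊛ (const ½ ⊛ γ m)) ⊕ A ⊛ (N ⊛ y₁ ⊕ X ⊛ (const ½ ⊛ γ m))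
      ≈⟨ solve 5 (λ a n y x g → a :* (n :* y :+ x :* (con ½ :* g)) :+ a :* (n :* y :+ x :* (con ½ :* g)) := n :* (a :* y :+ a :* y) :+ a :* (x :* g))
           ≈-refl A N y₁ X (γ m) ⟩
    N ⊛ (A ⊛ y₁ ⊕ A ⊛ y₁) ⊕ A ⊛ (X ⊛ γ m)
      ≈⟨ ⊕-cong (⊛-cong ≈-refl (interior m)) ≈-refl ⟩
    N ⊛ (X ⊛ (y₂ ⊕ y₀) ⊕ ⊝ (X ⊛ γ m)) ⊕ A ⊛ (X ⊛ γ m)
      ≈⟨ solve 4 (λ x y₀ y₂ g →
           let A = con 1ℚ :+ x :* (con (ℚ.- ¼) :+ x :* (con ¼ :+ x :* con 0ℚ))
               N = con 1ℚ :+ x :* (con (ℚ.- (+ 3 ℚ./ 2)) :+ x :* (con ¼ :+ x :* con 0ℚ)) in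
           N :* (x :* (y₂ :+ y₀) :- x :* g) :+ A :* (x :* g) := x :* (N :* y₂ :+ x :* (con ½ :* (con ½ :* g)) :+ (N :* y₀ :+ x :* g)))
           ≈-refl X y₀ y₂ (γ m) ⟩
    X ⊛ (N ⊛ y₂ ⊕ X ⊛ (const ½ ⊛ (const ½ ⊛ γ m)) ⊕ (N ⊛ y₀ ⊕ X ⊛ γ m))
      ≈⟨ ⊛-cong ≈-refl (⊕-cong (⊕-cong ≈-refl (⊛-cong ≈-refl (≈-trans (γ-suc (suc m)) (⊛-cong ≈-refl (γ-suc m))))) ≈-refl) ⟨
    X ⊛ (N ⊛ y₂ ⊕ X ⊛ γ (suc (suc m)) ⊕ (N ⊛ y₀ ⊕ X ⊛ γ m)) ∎
    where
    y₀ = Y m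
    y₁ = Y (suc m)
    y₂ = Y (suc (suc m))
  boundary′ : A ⊛ Z 0 ⊕ ⊝ (X ⊛ Z 1) ≈ M
  boundary′ = begin
    A ⊛ (N ⊛ Y 0 ⊕ X ⊛ const ¼) ⊕ ⊝ (X ⊛ (N ⊛ Y 1 ⊕ X ⊛ const (+ 1 ℚ./ 8)))
      ≈⟨ solve 5 (λ a n x y₀ y₁ → a :* (n :* y₀ :+ x :* con ¼) :- x :* (n :* y₁ :+ x :* con (+ 1 ℚ./ 8))
           := n :* (a :* y₀ :- x :* y₁) :+ (a :* x :* con ¼ :- x :* x :* con (+ 1 ℚ./ 8))) ≈-refl A N X (Y 0) (Y 1) ⟩
    N ⊛ (A ⊛ Y 0 ⊕ ⊝ (X ⊛ Y 1)) ⊕ (A ⊛ X ⊛ const ¼ ⊕ ⊝ (X ⊛ X ⊛ const (+ 1 ℚ./ 8)))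
      ≈⟨ ⊕-cong (⊛-cong ≈-refl boundary) ≈-refl ⟩
    N ⊛ (const 1ℚ ⊕ const ¼ ⊛ X) ⊕ (A ⊛ X ⊛ const ¼ ⊕ ⊝ (X ⊛ X ⊛ const (+ 1 ℚ./ 8)))
      ≈⟨ solve 1 (λ x →
           let A = con 1ℚ :+ x :* (con (ℚ.- ¼) :+ x :* (con ¼ :+ x :* con 0ℚ))
               N = con 1ℚ :+ x :* (con (ℚ.- (+ 3 ℚ./ 2)) :+ x :* (con ¼ :+ x :* con 0ℚ))
               M = con 1ℚ :+ x :* (con (ℚ.- 1ℚ) :+ x :* (con (ℚ.- (+ 5 ℚ./ 16)) :+ x :* (con (+ 1 ℚ./ 8) :+ x :* con 0ℚ))) in
           N :* (con 1ℚ :+ con ¼ :* x) :+ (A :* x :* con ¼ :- x :* x :* con (+ 1 ℚ./ 8)) := M) ≈-refl X ⟩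
    M ∎

-- Densities of digit sum comparisons

tally : (ℕ → Bool) → ℕ → ℕ
tally f zero    = 0
tally f (suc n) = tally f n ℕ.+ indicator (f n)

count-tally : ∀ {ℓ} {P : ℕ → Set ℓ} (P? : ∀ n → Dec (P n)) n → count P? n ≡ tally (does ∘ P?) n
count-tally P? zero    = refl
count-tally P? (suc n) = trans (count-suc P? n) (cong (ℕ._+ indicator (does (P? n))) (count-tally P? n))

-- A bounded discrepancy is much stronger than the existence of a density; it passes through
-- interleaving and yields an error O(1/n) for the frequencies.
record Density (f : ℕ → Bool) (q : ℚ) : Set where
  constructor _,_
  field
    discrepancy : ℚ
    bound       : ∀ n → ℚ.∣ ι (tally f n) ℚ.- ι n ℚ.* q ∣ ℚ.≤ discrepancy

density-constant : ∀ {f} b → (∀ n → f n ≡ b) → Density f (ι (indicator b))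
density-constant {f} b h = 0ℚ , λ n → ℚP.≤-reflexive (cong ℚ.∣_∣ (begin
  ι (tally f n) ℚ.- ι n ℚ.* ι (indicator b)               ≡⟨ cong (λ k → ι k ℚ.- ι n ℚ.* ι (indicator b)) (total n) ⟩
  ι (n ℕ.* indicator b) ℚ.- ι n ℚ.* ι (indicator b)       ≡⟨ cong (ℚ._- ι n ℚ.* ι (indicator b)) (ι-* n (indicator b)) ⟩
  ι n ℚ.* ι (indicator b) ℚ.- ι n ℚ.* ι (indicator b)     ≡⟨ ℚP.+-inverseʳ (ι n ℚ.* ι (indicator b)) ⟩
  0ℚ                                                      ∎))
  where
  open ≡-Reasoning
  total : ∀ n → tally f n ≡ n ℕ.* indicator b
  total zero    = refl
  total (suc n) = trans (cong₂ ℕ._+_ (total n) (cong indicator (h n))) (ℕP.+-comm (n ℕ.* indicator b) (indicator b))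

tally-cong : ∀ {f g} → (∀ n → f n ≡ g n) → ∀ n → tally f n ≡ tally g n
tally-cong h zero    = refl
tally-cong h (suc n) = cong₂ ℕ._+_ (tally-cong h n) (cong indicator (h n))

tally-interleave : ∀ {f g h} → (∀ n → f (n ℕ.* 2) ≡ g n) → (∀ n → f (suc (n ℕ.* 2)) ≡ h n) →
  ∀ n → tally f (n ℕ.* 2) ≡ tally g n ℕ.+ tally h n
tally-interleave {f} {g} {h} f≡g f≡h zero    = refl
tally-interleave {f} {g} {h} f≡g f≡h (suc n) = begin
  tally f (n ℕ.* 2) ℕ.+ indicator (f (n ℕ.* 2)) ℕ.+ indicator (f (suc (n ℕ.* 2)))
    ≡⟨ cong₂ ℕ._+_ (cong₂ ℕ._+_ (tally-interleave {f} {g} {h} f≡g f≡h n) (cong indicator (f≡g n))) (cong indicator (f≡h n)) ⟩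
  tally g n ℕ.+ tally h n ℕ.+ indicator (g n) ℕ.+ indicator (h n)
    ≡⟨ swap (tally g n) (tally h n) (indicator (g n)) (indicator (h n)) ⟩
  tally g n ℕ.+ indicator (g n) ℕ.+ (tally h n ℕ.+ indicator (h n)) ∎
  where
  open ≡-Reasoning
  swap : ∀ a b c d → a ℕ.+ b ℕ.+ c ℕ.+ d ≡ a ℕ.+ c ℕ.+ (b ℕ.+ d)
  swap = ℕR.solve-∀

-- Up to an even index the discrepancies simply add. An odd index has one more term, whose deviation
-- from r is at most 1 + |r|.
density-interleave : ∀ {f g h p q} → (∀ n → f (n ℕ.* 2) ≡ g n) → (∀ n → f (suc (n ℕ.* 2)) ≡ h n) →
  Density g p → Density h q → Density f (½ ℚ.* p ℚ.+ ½ ℚ.* q)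
density-interleave {f} {g} {h} {p} {q} f≡g f≡h (K , hK) (L , hL) = K ℚ.+ L ℚ.+ (1ℚ ℚ.+ ℚ.∣ r ∣) , λ n → bound n (halve n)
  where
  open ℚP.≤-Reasoning
  open +-*-Solver
  r = ½ ℚ.* p ℚ.+ ½ ℚ.* q
  even-split : ∀ n → ι (tally f (n ℕ.* 2)) ℚ.- ι (n ℕ.* 2) ℚ.* r ≡ (ι (tally g n) ℚ.- ι n ℚ.* p) ℚ.+ (ι (tally h n) ℚ.- ι n ℚ.* q)
  even-split n = trans
    (cong₂ (λ a b → a ℚ.- b ℚ.* r) (trans (cong ι (tally-interleave {f} {g} {h} f≡g f≡h n)) (ι-+ (tally g n) (tally h n))) (ι-* n 2))
    (solve 5 (λ a b n p q → a :+ b :- n :* con (ι 2) :* (con ½ :* p :+ con ½ :* q) := (a :- n :* p) :+ (b :- n :* q)) refl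
      (ι (tally g n)) (ι (tally h n)) (ι n) p q)
  even-bound : ∀ n → ℚ.∣ ι (tally f (n ℕ.* 2)) ℚ.- ι (n ℕ.* 2) ℚ.* r ∣ ℚ.≤ K ℚ.+ L
  even-bound n = begin
    ℚ.∣ ι (tally f (n ℕ.* 2)) ℚ.- ι (n ℕ.* 2) ℚ.* r ∣
      ≡⟨ cong ℚ.∣_∣ (even-split n) ⟩
    ℚ.∣ (ι (tally g n) ℚ.- ι n ℚ.* p) ℚ.+ (ι (tally h n) ℚ.- ι n ℚ.* q) ∣
      ≤⟨ ℚP.∣p+q∣≤∣p∣+∣q∣ (ι (tally g n) ℚ.- ι n ℚ.* p) (ι (tally h n) ℚ.- ι n ℚ.* q) ⟩
    ℚ.∣ ι (tally g n) ℚ.- ι n ℚ.* p ∣ ℚ.+ ℚ.∣ ι (tally h n) ℚ.- ι n ℚ.* q ∣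
      ≤⟨ ℚP.+-mono-≤ {ℚ.∣ ι (tally g n) ℚ.- ι n ℚ.* p ∣} {K} {ℚ.∣ ι (tally h n) ℚ.- ι n ℚ.* q ∣} {L} (hK n) (hL n) ⟩
    K ℚ.+ L ∎
  0≤1+r : 0ℚ ℚ.≤ 1ℚ ℚ.+ ℚ.∣ r ∣
  0≤1+r = 0≤+ {1ℚ} {ℚ.∣ r ∣} (ℚP.nonNegative⁻¹ 1ℚ) (ℚP.0≤∣p∣ r)
  ∣indicator∣ : ∀ b → ℚ.∣ ι (indicator b) ∣ ℚ.≤ 1ℚ
  ∣indicator∣ true  = ℚP.≤-refl
  ∣indicator∣ false = ℚP.nonNegative⁻¹ 1ℚ
  bound : ∀ n → Halving n → ℚ.∣ ι (tally f n) ℚ.- ι n ℚ.* r ∣ ℚ.≤ K ℚ.+ L ℚ.+ (1ℚ ℚ.+ ℚ.∣ r ∣)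
  bound _ (even n) = ℚP.≤-trans (even-bound n) (≤-by {K ℚ.+ L} (1ℚ ℚ.+ ℚ.∣ r ∣) 0≤1+r refl)
  bound _ (odd n)  = begin
    ℚ.∣ ι (tally f (n ℕ.* 2) ℕ.+ i) ℚ.- ι (suc (n ℕ.* 2)) ℚ.* r ∣
      ≡⟨ cong₂ (λ a b → ℚ.∣ a ℚ.- b ℚ.* r ∣) (ι-+ (tally f (n ℕ.* 2)) i) (ι-suc (n ℕ.* 2)) ⟩
    ℚ.∣ (ι (tally f (n ℕ.* 2)) ℚ.+ ι i) ℚ.- (1ℚ ℚ.+ ι (n ℕ.* 2)) ℚ.* r ∣
      ≡⟨ cong ℚ.∣_∣ (solve 4 (λ a i m r → (a :+ i) :- (con 1ℚ :+ m) :* r := (a :- m :* r) :+ (i :- r)) refl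
           (ι (tally f (n ℕ.* 2))) (ι i) (ι (n ℕ.* 2)) r) ⟩
    ℚ.∣ e ℚ.+ (ι i ℚ.- r) ∣
      ≤⟨ ℚP.∣p+q∣≤∣p∣+∣q∣ e (ι i ℚ.- r) ⟩
    ℚ.∣ e ∣ ℚ.+ ℚ.∣ ι i ℚ.- r ∣
      ≤⟨ ℚP.+-mono-≤ {ℚ.∣ e ∣} {K ℚ.+ L} {ℚ.∣ ι i ℚ.- r ∣} {1ℚ ℚ.+ ℚ.∣ r ∣} (even-bound n) (ℚP.≤-trans
           (ℚP.∣p+q∣≤∣p∣+∣q∣ (ι i) (ℚ.- r))
           (ℚP.+-mono-≤ {ℚ.∣ ι i ∣} {1ℚ} {ℚ.∣ ℚ.- r ∣} {ℚ.∣ r ∣} (∣indicator∣ (f (n ℕ.* 2))) (ℚP.≤-reflexive (ℚP.∣-p∣≡∣p∣ r)))) ⟩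
    K ℚ.+ L ℚ.+ (1ℚ ℚ.+ ℚ.∣ r ∣) ∎
    where
    i = indicator (f (n ℕ.* 2))
    e = ι (tally f (n ℕ.* 2)) ℚ.- ι (n ℕ.* 2) ℚ.* r

-- step a b, tail₁ a b, T j a b and R j a b are the densities of compare a b
-- at 0, 1, t j and 2 (t j) + 1.
step : ℕ → ℕ → ℚ
step zero    b       = 1ℚ
step (suc a) zero    = 0ℚ
step (suc a) (suc b) = step a b

-- If n ends in exactly k ones, then s (n + 1) - s n = 1 - k, and this has density 2^(-k-1). The
-- first clause is the sum over k ≤ b + 1, that is, the difference is at least - b.
tail₁ : ℕ → ℕ → ℚ
tail₁ zero          b       = 1ℚ ℚ.- halves (suc (suc b))
tail₁ (suc zero)    zero    = ½
tail₁ (suc (suc a)) zero    = 0ℚ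
tail₁ (suc a)       (suc b) = tail₁ a b

T R : ℕ → ℕ → ℕ → ℚ
T zero    a b = step a b
T (suc j) a b = ½ ℚ.* T j a (suc b) ℚ.+ ½ ℚ.* R j (suc a) b
R zero    a b = tail₁ a b
R (suc j) a b = ½ ℚ.* T (suc j) a (suc b) ℚ.+ ½ ℚ.* R j (suc a) b

density-0 : ∀ a b → Density (compare a b 0) (step a b)
density-0 a b = subst (Density (compare a b 0)) (value a b) (density-constant (a ℕ.≤ᵇ b) λ n →
  trans (cong (λ k → s n ℕ.+ a ℕ.≤ᵇ s k ℕ.+ b) (ℕP.+-identityʳ n)) (≤ᵇ-shift (s n) a b))
  where
  value : ∀ a b → ι (indicator (a ℕ.≤ᵇ b)) ≡ step a b
  value zero    b       = refl
  value (suc a) zero    = refl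
  value (suc a) (suc b) = trans (cong (ι ∘ indicator) (≤ᵇ-shift 1 a b)) (value a b)

tail₁-suc : ∀ a b → tail₁ a b ≡ ½ ℚ.* step a (suc b) ℚ.+ ½ ℚ.* tail₁ (suc a) b
tail₁-suc zero          zero    = refl
tail₁-suc zero          (suc b) = solve 1 (λ h → con 1ℚ :- con ½ :* h := con ½ :* con 1ℚ :+ con ½ :* (con 1ℚ :- h)) refl (halves (suc (suc b)))
  where open +-*-Solver
tail₁-suc (suc zero)    zero    = refl
tail₁-suc (suc (suc a)) zero    = refl
tail₁-suc (suc zero)    (suc b) = tail₁-suc zero b
tail₁-suc (suc (suc a)) (suc b) = tail₁-suc (suc a) b

tail₁-large : ∀ a b → b ℕ.+ 2 ℕ.≤ a → tail₁ a b ≡ 0ℚ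
tail₁-large (suc (suc a)) zero    _           = refl
tail₁-large (suc zero)    zero    (ℕ.s≤s ())
tail₁-large (suc zero)    (suc b) (ℕ.s≤s le) = tail₁-large zero b le
tail₁-large (suc (suc a)) (suc b) (ℕ.s≤s le) = tail₁-large (suc a) b le
tail₁-large zero          b       le          = ⊥-elim (ℕP.<⇒≱ (ℕP.m≤n+m 1 b) (ℕP.≤-trans (ℕP.+-monoʳ-≤ b (ℕ.s≤s ℕ.z≤n)) (ℕP.≤-trans le ℕ.z≤n)))

-- Halving leads from 1 to 0 and again to 1, with the threshold a raised. The recursion ends once b
-- + 2 ≤ a, where the comparison always fails because s (n + 1) ≤ s n + 1; k counts the steps until
-- then.
density-1 : ∀ k a b → b ℕ.+ 2 ℕ.≤ a ℕ.+ k → Density (compare a b 1) (tail₁ a b)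
density-1 zero a b b+2≤a = subst (Density (compare a b 1)) (sym (tail₁-large a b b+2≤a′)) (density-constant false λ n → ≤ᵇ-false λ le → ℕP.<-irrefl refl (begin-strict
  s n ℕ.+ (b ℕ.+ 1)         <⟨ ℕP.+-monoʳ-< (s n) (ℕP.+-monoʳ-< b (ℕP.n<1+n 1)) ⟩
  s n ℕ.+ (b ℕ.+ 2)         ≤⟨ ℕP.+-monoʳ-≤ (s n) b+2≤a′ ⟩
  s n ℕ.+ a                 ≤⟨ le ⟩
  s (n ℕ.+ 1) ℕ.+ b         ≡⟨ cong (λ k → s k ℕ.+ b) (ℕP.+-comm n 1) ⟩
  s (suc n) ℕ.+ b           ≤⟨ ℕP.+-monoˡ-≤ b (s-suc n) ⟩
  suc (s n) ℕ.+ b           ≡⟨ rearrange (s n) b ⟩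
  s n ℕ.+ (b ℕ.+ 1)         ∎))
  where
  open ℕP.≤-Reasoning
  b+2≤a′ = subst (b ℕ.+ 2 ℕ.≤_) (ℕP.+-identityʳ a) b+2≤a
  rearrange : ∀ x b → suc x ℕ.+ b ≡ x ℕ.+ (b ℕ.+ 1)
  rearrange = ℕR.solve-∀
density-1 (suc k) a b h = subst (Density (compare a b 1)) (sym (tail₁-suc a b))
  (density-interleave {p = step a (suc b)} {q = tail₁ (suc a) b} (compare-odd-even a b 0) (compare-odd-odd a b 0)
    (density-0 a (suc b)) (density-1 k (suc a) b (subst (b ℕ.+ 2 ℕ.≤_) (ℕP.+-suc a k) h)))

density-double : ∀ {r} {q : ℕ → ℕ → ℚ} → (∀ a b → Density (compare a b r) (q a b)) → ∀ a b → Density (compare a b (r ℕ.* 2)) (q a b)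
density-double {r} {q} h a b = subst (Density (compare a b (r ℕ.* 2))) (½+½ (q a b))
  (density-interleave {p = q a b} {q = q a b} (compare-even-even a b r) (compare-even-odd a b r) (h a b) (h a b))

-- The form 4 r + 1, with two separate doublings, is the one on which the halving rules for
-- `compare` act directly.
repunit : ℕ → ℕ
repunit zero    = 0
repunit (suc j) = suc (repunit j ℕ.* 2 ℕ.* 2)

t≡repunit : ∀ j → t j ≡ repunit j
t≡repunit j = trans (cong (λ k → (k ℕ.∸ 1) ℕ./ 3) (power j)) (ℕD.m*n/n≡m (repunit j) 3)
  where
  expand : ∀ r → 4 ℕ.* suc (r ℕ.* 3) ≡ suc (suc (r ℕ.* 2 ℕ.* 2) ℕ.* 3)
  expand = ℕR.solve-∀
  power : ∀ j → 4 ℕ.^ j ≡ suc (repunit j ℕ.* 3)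
  power zero    = refl
  power (suc j) = trans (cong (4 ℕ.*_) (power j)) (expand (repunit j))

-- The two families are closed under halving: 4 t_j + 1 leads to 2 t_j and 2 t_j + 1, while 2
-- t_(j+1) + 1 leads to t_(j+1) and to t_(j+1) + 1 = 2 (2 t_j + 1).
density-T : ∀ j a b → Density (compare a b (repunit j)) (T j a b)
density-R : ∀ j a b → Density (compare a b (suc (repunit j ℕ.* 2))) (R j a b)
density-T zero    a b = density-0 a b
density-T (suc j) a b = density-interleave {p = T j a (suc b)} {q = R j (suc a) b} (compare-odd-even a b (repunit j ℕ.* 2)) (compare-odd-odd a b (repunit j ℕ.* 2))
  (density-double {repunit j} {T j} (density-T j) a (suc b)) (density-R j (suc a) b)
density-R zero    a b = density-1 (b ℕ.+ 2) a b (ℕP.m≤n+m (b ℕ.+ 2) a)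
density-R (suc j) a b = density-interleave {p = T (suc j) a (suc b)} {q = R j (suc a) b} (compare-odd-even a b (repunit (suc j))) (compare-odd-odd a b (repunit (suc j)))
  (density-T (suc j) a (suc b)) (density-double {suc (repunit j ℕ.* 2)} {R j} (density-R j) (suc a) b)

T-shift : ∀ j a b → T j (suc a) (suc b) ≡ T j a b
R-shift : ∀ j a b → R j (suc a) (suc b) ≡ R j a b
T-shift zero    a b = refl
T-shift (suc j) a b = cong₂ (λ x y → ½ ℚ.* x ℚ.+ ½ ℚ.* y) (T-shift j a (suc b)) (R-shift j (suc a) b)
R-shift zero    zero    b = refl
R-shift zero    (suc a) b = refl
R-shift (suc j) a b = cong₂ (λ x y → ½ ℚ.* x ℚ.+ ½ ℚ.* y) (T-shift (suc j) a (suc b)) (R-shift j (suc a) b)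

-- Eliminates R: both `T (suc (suc j)) a b` and `T (suc j) (suc a) b` contain the value of R at
-- `suc (suc a)` and b, so a combination of the two is free of it.
T-recurrence : ∀ j a b → T (suc (suc j)) a b ≡ ½ ℚ.* (T (suc j) a (suc b) ℚ.+ T (suc j) (suc a) b) ℚ.+ ¼ ℚ.* (T (suc j) a b ℚ.- T j a b)
T-recurrence j a b = begin
  ½ ℚ.* T (suc j) a (suc b) ℚ.+ ½ ℚ.* (½ ℚ.* T (suc j) (suc a) (suc b) ℚ.+ ½ ℚ.* r)
    ≡⟨ solve 4 (λ x y z r → con ½ :* x :+ con ½ :* (con ½ :* y :+ con ½ :* r)
         := con ½ :* (x :+ (con ½ :* z :+ con ½ :* r)) :+ con ¼ :* (y :- z)) refl
         (T (suc j) a (suc b)) (T (suc j) (suc a) (suc b)) (T j (suc a) (suc b)) r ⟩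
  ½ ℚ.* (T (suc j) a (suc b) ℚ.+ T (suc j) (suc a) b) ℚ.+ ¼ ℚ.* (T (suc j) (suc a) (suc b) ℚ.- T j (suc a) (suc b))
    ≡⟨ cong₂ (λ x y → ½ ℚ.* (T (suc j) a (suc b) ℚ.+ T (suc j) (suc a) b) ℚ.+ ¼ ℚ.* (x ℚ.- y)) (T-shift (suc j) a b) (T-shift j a b) ⟩
  ½ ℚ.* (T (suc j) a (suc b) ℚ.+ T (suc j) (suc a) b) ℚ.+ ¼ ℚ.* (T (suc j) a b ℚ.- T j a b) ∎
  where
  open ≡-Reasoning
  open +-*-Solver
  r = R j (suc (suc a)) b

-- The symmetrised tails: with d = s (n + t j) - s n,
-- excess j m is the density of d ≥ m minus that of d < - m.
excess : ℕ → ℕ → ℚ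
excess j m = T j m 0 ℚ.+ T j 0 m ℚ.- 1ℚ

excess-recurrence : ∀ j m → excess (suc (suc j)) (suc m) ≡
  ½ ℚ.* (excess (suc j) (suc (suc m)) ℚ.+ excess (suc j) m) ℚ.+ ¼ ℚ.* (excess (suc j) (suc m) ℚ.- excess j (suc m))
excess-recurrence j m = trans
  (cong₂ (λ x y → x ℚ.+ y ℚ.- 1ℚ)
    (trans (T-recurrence j (suc m) 0) (cong (λ x → ½ ℚ.* (x ℚ.+ T (suc j) (suc (suc m)) 0) ℚ.+ ¼ ℚ.* (T (suc j) (suc m) 0 ℚ.- T j (suc m) 0)) (T-shift (suc j) m 0)))
    (trans (T-recurrence j 0 (suc m)) (cong (λ x → ½ ℚ.* (T (suc j) 0 (suc (suc m)) ℚ.+ x) ℚ.+ ¼ ℚ.* (T (suc j) 0 (suc m) ℚ.- T j 0 (suc m))) (T-shift (suc j) 0 m))))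
  (solve 8 (λ x y z w x′ y′ z′ w′ →
     (con ½ :* (x :+ y) :+ con ¼ :* (z :- w)) :+ (con ½ :* (y′ :+ x′) :+ con ¼ :* (z′ :- w′)) :- con 1ℚ :=
     con ½ :* ((y :+ y′ :- con 1ℚ) :+ (x :+ x′ :- con 1ℚ)) :+ con ¼ :* ((z :+ z′ :- con 1ℚ) :- (w :+ w′ :- con 1ℚ))) refl
    (T (suc j) m 0) (T (suc j) (suc (suc m)) 0) (T (suc j) (suc m) 0) (T j (suc m) 0)
    (T (suc j) 0 m) (T (suc j) 0 (suc (suc m))) (T (suc j) 0 (suc m)) (T j 0 (suc m)))
  where open +-*-Solver

-- As a function of an integer threshold the excess is even, so the two neighbours of 0 coincide.
-- This reflection confines the walk to the half-line.
excess-recurrence-0 : ∀ j → excess (suc (suc j)) 0 ≡ excess (suc j) 1 ℚ.+ ¼ ℚ.* (excess (suc j) 0 ℚ.- excess j 0)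
excess-recurrence-0 j = trans (cong (λ x → x ℚ.+ x ℚ.- 1ℚ) (T-recurrence j 0 0))
  (solve 4 (λ x y z w → (con ½ :* (x :+ y) :+ con ¼ :* (z :- w)) :+ (con ½ :* (x :+ y) :+ con ¼ :* (z :- w)) :- con 1ℚ :=
     (y :+ x :- con 1ℚ) :+ con ¼ :* ((z :+ z :- con 1ℚ) :- (w :+ w :- con 1ℚ))) refl
    (T (suc j) 0 1) (T (suc j) 1 0) (T (suc j) 0 0) (T j 0 0))
  where open +-*-Solver

excess-series : ℕ → Series
excess-series m .coeff j = excess j m

excess-equation : N ⊛ excess-series 0 ⊕ X ⊛ const ¼ ≈ walk ⊛ M
excess-equation = constant-term Y interior boundary
  where
  open ≡-Reasoning
  open +-*-Solver
  Y = excess-series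
  as = 1ℚ ∷ ℚ.- ¼ ∷ ¼ ∷ []
  -- The recurrence holds only from index 2 on. At index 1 it fails by a geometric term, which stems
  -- from the law for t = 1.
  source : ∀ m → excess 1 (suc m) ℚ.+ excess 1 (suc m) ≡ excess 0 (suc (suc m)) ℚ.+ excess 0 m ℚ.- ¼ ℚ.* halves m
  source zero    = refl
  source (suc m) = solve 1 (λ h → let g = con ½ :* con 0ℚ :+ con ½ :* con 0ℚ :+ (con ½ :* con 1ℚ :+ con ½ :* (con 1ℚ :- con ½ :* (con ½ :* (con ½ :* h)))) :- con 1ℚ in
    g :+ g := con 0ℚ :+ con 1ℚ :- con 1ℚ :+ (con 0ℚ :+ con 1ℚ :- con 1ℚ) :- con ¼ :* (con ½ :* h)) refl (halves m)
  interior : ∀ m → A ⊛ Y (suc m) ⊕ A ⊛ Y (suc m) ≈ X ⊛ (Y (suc (suc m)) ⊕ Y m) ⊕ ⊝ (X ⊛ const (¼ ℚ.* halves m))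
  interior m = pointwise λ n → trans (cong₂ ℚ._+_ (polynomial-⊛ as (Y (suc m)) n) (polynomial-⊛ as (Y (suc m)) n)) (go n)
    where
    rhs : ∀ n → excess n (suc (suc m)) ℚ.+ excess n m ℚ.- coeff (const (¼ ℚ.* halves m)) n ≡ coeff (X ⊛ (Y (suc (suc m)) ⊕ Y m) ⊕ ⊝ (X ⊛ const (¼ ℚ.* halves m))) (suc n)
    rhs n = sym (cong₂ ℚ._-_ (X-⊛-suc (Y (suc (suc m)) ⊕ Y m) n) (X-⊛-suc (const (¼ ℚ.* halves m)) n))
    go : ∀ n → act as (coeff (Y (suc m))) n ℚ.+ act as (coeff (Y (suc m))) n ≡ coeff (X ⊛ (Y (suc (suc m)) ⊕ Y m) ⊕ ⊝ (X ⊛ const (¼ ℚ.* halves m))) n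
    go zero = sym (cong₂ ℚ._-_ (X-⊛-zero (Y (suc (suc m)) ⊕ Y m)) (X-⊛-zero (const (¼ ℚ.* halves m))))
    go (suc zero) = trans (solve 1 (λ x → let y = con 1ℚ :* x :+ con (ℚ.- ¼) :* con 0ℚ in y :+ y := x :+ x) refl (excess 1 (suc m)))
      (trans (source m) (rhs 0))
    go (suc (suc n)) = trans
      (cong (λ x → let y = 1ℚ ℚ.* x ℚ.+ (ℚ.- ¼ ℚ.* excess (suc n) (suc m) ℚ.+ last n) in y ℚ.+ y) (excess-recurrence n m))
      (trans (trans (cong (λ x → let y = 1ℚ ℚ.* (½ ℚ.* (p ℚ.+ q) ℚ.+ ¼ ℚ.* (y₁ ℚ.- y₀)) ℚ.+ (ℚ.- ¼ ℚ.* y₁ ℚ.+ x) in y ℚ.+ y) (last≡ n))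
        (solve 4 (λ p q y₁ y₀ → let y = con 1ℚ :* (con ½ :* (p :+ q) :+ con ¼ :* (y₁ :- y₀)) :+ (con (ℚ.- ¼) :* y₁ :+ con ¼ :* y₀) in y :+ y
          := p :+ q :- con 0ℚ) refl p q y₁ y₀)) (rhs (suc n)))
      where
      p = excess (suc n) (suc (suc m))
      q = excess (suc n) m
      y₁ = excess (suc n) (suc m)
      y₀ = excess n (suc m)
      last : ℕ → ℚ
      last n = act (¼ ∷ []) (coeff (Y (suc m))) n
      last≡ : ∀ n → last n ≡ ¼ ℚ.* excess n (suc m)
      last≡ zero    = refl
      last≡ (suc n) = ℚP.+-identityʳ (¼ ℚ.* excess (suc n) (suc m))
  boundary : A ⊛ Y 0 ⊕ ⊝ (X ⊛ Y 1) ≈ const 1ℚ ⊕ const ¼ ⊛ X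
  boundary = pointwise λ n → trans (cong (ℚ._- coeff (X ⊛ Y 1) n) (polynomial-⊛ as (Y 0) n)) (go n)
    where
    go : ∀ n → act as (coeff (Y 0)) n ℚ.- coeff (X ⊛ Y 1) n ≡ coeff (const 1ℚ ⊕ const ¼ ⊛ X) n
    go zero       = refl
    go (suc zero) = refl
    go (suc (suc n)) = trans
      (cong₂ (λ x z → 1ℚ ℚ.* x ℚ.+ (ℚ.- ¼ ℚ.* excess (suc n) 0 ℚ.+ act (¼ ∷ []) (coeff (Y 0)) n) ℚ.- z) (excess-recurrence-0 n) (X-⊛-suc (Y 1) (suc n)))
      (trans (cong (λ x → 1ℚ ℚ.* (q ℚ.+ ¼ ℚ.* (y₁ ℚ.- y₀)) ℚ.+ (ℚ.- ¼ ℚ.* y₁ ℚ.+ x) ℚ.- q) (last≡ n))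
        (trans (solve 3 (λ q y₁ y₀ → con 1ℚ :* (q :+ con ¼ :* (y₁ :- y₀)) :+ (con (ℚ.- ¼) :* y₁ :+ con ¼ :* y₀) :- q := con 0ℚ) refl q y₁ y₀)
          (sym (cong (0ℚ ℚ.+_) (const-⊛ ¼ X (suc (suc n)))))))
      where
      q = excess (suc n) 1
      y₁ = excess (suc n) 0
      y₀ = excess n 0
      last≡ : ∀ n → act (¼ ∷ []) (coeff (Y 0)) n ≡ ¼ ℚ.* excess n 0
      last≡ zero    = refl
      last≡ (suc n) = ℚP.+-identityʳ (¼ ℚ.* excess (suc n) 0)

-- 2 c (t j) - 1
bias : ℕ → ℚ
bias j = excess j 0

bias-density : ∀ j → T j 0 0 ≡ ½ ℚ.* (1ℚ ℚ.+ bias j)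
bias-density j = solve 1 (λ q → q := con ½ :* (con 1ℚ :+ (q :+ q :- con 1ℚ))) refl (T j 0 0)
  where open +-*-Solver

density-frequency : ∀ r q → Density (compare 0 0 r) q → ∃[ K ] ∀ n → ℚ.∣ seq (c r) n ℚ.- q ∣ ℚ.≤ K ℚ.* u n
density-frequency r q (K , hK) = K , λ n → subst (λ x → ℚ.∣ x ℚ.- q ∣ ℚ.≤ K ℚ.* u n) (sym (value n)) (close n (ι (tally (compare 0 0 r) (suc n))) (hK (suc n)))
  where
  open ℚP.≤-Reasoning
  open +-*-Solver
  drop : ∀ n → does (s≤s[ r +]? n) ≡ compare 0 0 r n
  drop n = sym (cong₂ ℕ._≤ᵇ_ (ℕP.+-identityʳ (s n)) (ℕP.+-identityʳ (s (n ℕ.+ r))))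
  value : ∀ n → seq (c r) n ≡ ι (tally (compare 0 0 r) (suc n)) ℚ.* u n
  value n = trans (/-≡ι*u (count s≤s[ r +]? (suc n)) n)
    (cong (λ k → ι k ℚ.* u n) (trans (count-tally s≤s[ r +]? (suc n)) (tally-cong drop (suc n))))
  close : ∀ n a → ℚ.∣ a ℚ.- ι (suc n) ℚ.* q ∣ ℚ.≤ K → ℚ.∣ a ℚ.* u n ℚ.- q ∣ ℚ.≤ K ℚ.* u n
  close n a h = begin
    ℚ.∣ a ℚ.* u n ℚ.- q ∣
      ≡⟨ cong ℚ.∣_∣ (solve 3 (λ a v q → a :* v :- q := a :* v :- con 1ℚ :* q) refl a (u n) q) ⟩
    ℚ.∣ a ℚ.* u n ℚ.- 1ℚ ℚ.* q ∣
      ≡⟨ cong (λ x → ℚ.∣ a ℚ.* u n ℚ.- x ℚ.* q ∣) (ι*u≡1 n) ⟨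
    ℚ.∣ a ℚ.* u n ℚ.- ι (suc n) ℚ.* u n ℚ.* q ∣
      ≡⟨ cong ℚ.∣_∣ (solve 4 (λ a v m q → a :* v :- m :* v :* q := (a :- m :* q) :* v) refl a (u n) (ι (suc n)) q) ⟩
    ℚ.∣ (a ℚ.- ι (suc n) ℚ.* q) ℚ.* u n ∣
      ≡⟨ trans (ℚP.∣p*q∣≡∣p∣*∣q∣ (a ℚ.- ι (suc n) ℚ.* q) (u n)) (cong (ℚ.∣ a ℚ.- ι (suc n) ℚ.* q ∣ ℚ.*_) (ℚP.0≤p⇒∣p∣≡p (ℚP.<⇒≤ (0<u n)))) ⟩
    ℚ.∣ a ℚ.- ι (suc n) ℚ.* q ∣ ℚ.* u n
      ≤⟨ ℚP.*-monoʳ-≤-nonNeg (u n) {{ℚ.nonNegative (ℚP.<⇒≤ (0<u n))}} h ⟩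
    K ℚ.* u n ∎

frequency-bias : ∀ j → ∃[ K ] ∀ n → ℚ.∣ seq (c (t j)) n ℚ.- ½ ℚ.* (1ℚ ℚ.+ bias j) ∣ ℚ.≤ K ℚ.* u n
frequency-bias j = density-frequency (t j) (½ ℚ.* (1ℚ ℚ.+ bias j))
  (subst₂ (λ r q → Density (compare 0 0 r) q) (sym (t≡repunit j)) (bias-density j) (density-T j 0 0))

-- Bounds for the coefficients

infix 4 _⊑_

record _⊑_ (x a : ℚ) : Set where
  constructor absolute
  field ∣∣≤ : ℚ.∣ x ∣ ℚ.≤ a

open _⊑_

⊑-weaken : ∀ {x a b} → x ⊑ a → a ℚ.≤ b → x ⊑ b
⊑-weaken (absolute h) a≤b = absolute (ℚP.≤-trans h a≤b)

⊑-+ : ∀ {x y a b} → x ⊑ a → y ⊑ b → x ℚ.+ y ⊑ a ℚ.+ b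
⊑-+ {x} {y} {a} {b} (absolute h) (absolute k) = absolute (ℚP.≤-trans (ℚP.∣p+q∣≤∣p∣+∣q∣ x y) (ℚP.+-mono-≤ {ℚ.∣ x ∣} {a} {ℚ.∣ y ∣} {b} h k))

⊑-* : ∀ {x y a b} → x ⊑ a → y ⊑ b → x ℚ.* y ⊑ a ℚ.* b
⊑-* {x} {y} {a} {b} (absolute h) (absolute k) = absolute (ℚP.≤-trans (ℚP.≤-reflexive (ℚP.∣p*q∣≡∣p∣*∣q∣ x y))
  (*-mono-≤ {ℚ.∣ x ∣} {a} {ℚ.∣ y ∣} {b} (ℚP.0≤∣p∣ x) h (ℚP.0≤∣p∣ y) k))

⊑-neg : ∀ {x a} → x ⊑ a → ℚ.- x ⊑ a
⊑-neg {x} {a} (absolute h) = absolute (subst (ℚ._≤ a) (sym (ℚP.∣-p∣≡∣p∣ x)) h)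

⊑-refl : ∀ {a} → 0ℚ ℚ.≤ a → a ⊑ a
⊑-refl h = absolute (ℚP.≤-reflexive (ℚP.0≤p⇒∣p∣≡p h))

⊑-intro : ∀ {x a} → 0ℚ ℚ.≤ x → x ℚ.≤ a → x ⊑ a
⊑-intro h k = ⊑-weaken (⊑-refl h) k

⊑-≤ : ∀ {x a} → x ⊑ a → x ℚ.≤ a
⊑-≤ {x} (absolute h) = ℚP.≤-trans (p≤∣p∣ x) h

⊑-lower : ∀ {x a} → x ⊑ a → ℚ.- a ℚ.≤ x
⊑-lower {x} {a} h = subst (ℚ.- a ℚ.≤_) (solve 1 (λ x → :- (:- x) := x) refl x) (ℚP.neg-antimono-≤ {ℚ.- x} {a} (⊑-≤ (⊑-neg h)))
  where open +-*-Solver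

square-⊑ : ∀ {x a} → 0ℚ ℚ.≤ a → x ℚ.* x ℚ.≤ a ℚ.* a → x ⊑ a
square-⊑ {x} {a} 0≤a h with ℚ.∣ x ∣ ℚP.≤? a
... | yes le = absolute le
... | no ¬le = <-absurd (gap ℚ.* (gap ℚ.+ (a ℚ.+ a))) h
    (0<* 0<gap (ℚP.+-mono-<-≤ {0ℚ} {gap} {0ℚ} {a ℚ.+ a} 0<gap (0≤+ 0≤a 0≤a)))
    (trans (solve 2 (λ a y → a :* a :+ (y :- a) :* (y :- a :+ (a :+ a)) := y :* y) refl a (ℚ.∣ x ∣)) (abs-square x))
  where
  open +-*-Solver
  gap = ℚ.∣ x ∣ ℚ.- a
  0<gap : 0ℚ ℚ.< gap
  0<gap = subst (ℚ._< gap) (ℚP.+-inverseʳ a) (ℚP.+-monoˡ-< (ℚ.- a) (ℚP.≰⇒> ¬le))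
  abs-square : ∀ x → ℚ.∣ x ∣ ℚ.* ℚ.∣ x ∣ ≡ x ℚ.* x
  abs-square x with ℚP.∣p∣≡p∨∣p∣≡-p x
  ... | inj₁ eq = cong₂ ℚ._*_ eq eq
  ... | inj₂ eq = trans (cong₂ ℚ._*_ eq eq) (solve 1 (λ x → (:- x) :* (:- x) := x :* x) refl x)

-- The bounds are asked for only up to n, so that the lemma also covers sequences that depend on n,
-- such as `Gₙ k ℚ.- Gₙ n`, which `G-tail` controls for k ≤ n.
majorant : ∀ {x x′ y y′ : ℕ → ℚ} n → (∀ k → k ℕ.≤ n → x k ⊑ x′ k) → (∀ k → k ℕ.≤ n → y k ⊑ y′ k) → (x ∗ y) n ⊑ (x′ ∗ y′) n
majorant zero    h k = ⊑-* (h 0 ℕ.z≤n) (k 0 ℕ.z≤n)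
majorant (suc n) h k = ⊑-+ (⊑-* (h 0 ℕ.z≤n) (k (suc n) ℕP.≤-refl))
  (majorant n (λ i i≤n → h (suc i) (ℕ.s≤s i≤n)) (λ i i≤n → k i (ℕP.m≤n⇒m≤1+n i≤n)))

cancel-ι : ∀ n {x y} → ι (suc n) ℚ.* x ℚ.≤ ι (suc n) ℚ.* y → x ℚ.≤ y
cancel-ι n {x} {y} h = ℚP.*-cancelˡ-≤-pos (ι (suc n)) {{ℚ.positive (0<ι n)}} h
  where
  0<ι : ∀ n → 0ℚ ℚ.< ι (suc n)
  0<ι n = ℚP.<-≤-trans (ℚP.positive⁻¹ 1ℚ) (ι-mono {1} {suc n} (ℕ.s≤s ℕ.z≤n))

0≤halves : ∀ n → 0ℚ ℚ.≤ halves n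
0≤halves zero    = ℚP.nonNegative⁻¹ 1ℚ
0≤halves (suc n) = 0≤* {½} {halves n} (ℚP.nonNegative⁻¹ ½) (0≤halves n)

halves-∗ : ∀ y n → (halves ∗ y) (suc n) ≡ y (suc n) ℚ.+ ½ ℚ.* (halves ∗ y) n
halves-∗ y n = cong₂ ℚ._+_ (ℚP.*-identityˡ (y (suc n))) (scale-∗ ½ halves y n)

-- Coefficients of (1 - X)^(-1/2) and (1 - X)^(1/2)

bₙ : ℕ → ℚ
bₙ = coeff (binomial 1ℚ)

b-suc : ∀ n → ι (suc n) ℚ.* bₙ (suc n) ≡ (ι n ℚ.+ ½) ℚ.* bₙ n
b-suc n = trans (binomial-suc 1ℚ n) (cong (ℚ._* bₙ n) (ℚP.*-identityˡ (ι n ℚ.+ ½)))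

0<ι+½ : ∀ n → 0ℚ ℚ.< ι n ℚ.+ ½
0<ι+½ n = ℚP.+-mono-≤-< {0ℚ} {ι n} {0ℚ} {½} (0≤ι n) (ℚP.positive⁻¹ ½)

0<b : ∀ n → 0ℚ ℚ.< bₙ n
0<b zero    = ℚP.positive⁻¹ 1ℚ
0<b (suc n) = 0<* {1ℚ ℚ.* (ι n ℚ.+ ½) ℚ.* u n} (0<* {1ℚ ℚ.* (ι n ℚ.+ ½)} (0<* {1ℚ} (ℚP.positive⁻¹ 1ℚ) (0<ι+½ n)) (0<u n)) (0<b n)

-- The absolute values of the coefficients of (1 - X) ⊛ binomial 1 = (1 - X)^(1/2).
dₙ : ℕ → ℚ
dₙ zero    = 1ℚ
dₙ (suc n) = ½ ℚ.* u n ℚ.* bₙ n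

0<d : ∀ n → 0ℚ ℚ.< dₙ n
0<d zero    = ℚP.positive⁻¹ 1ℚ
0<d (suc n) = 0<* {½ ℚ.* u n} (0<* {½} (ℚP.positive⁻¹ ½) (0<u n)) (0<b n)

0≤d : ∀ n → 0ℚ ℚ.≤ dₙ n
0≤d n = ℚP.<⇒≤ (0<d n)

d-difference : ∀ n → bₙ n ℚ.- bₙ (suc n) ≡ dₙ (suc n)
d-difference n = begin
  bₙ n ℚ.- 1ℚ ℚ.* (ι n ℚ.+ ½) ℚ.* u n ℚ.* bₙ n
    ≡⟨ solve 3 (λ b k v → b :- con 1ℚ :* (k :+ con ½) :* v :* b := con ½ :* v :* b :+ (con 1ℚ :- (con 1ℚ :+ k) :* v) :* b) refl (bₙ n) (ι n) (u n) ⟩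
  ½ ℚ.* u n ℚ.* bₙ n ℚ.+ (1ℚ ℚ.- (1ℚ ℚ.+ ι n) ℚ.* u n) ℚ.* bₙ n
    ≡⟨ cong (λ x → ½ ℚ.* u n ℚ.* bₙ n ℚ.+ (1ℚ ℚ.- x) ℚ.* bₙ n) (trans (cong (ℚ._* u n) (sym (ι-suc n))) (ι*u≡1 n)) ⟩
  ½ ℚ.* u n ℚ.* bₙ n ℚ.+ (1ℚ ℚ.- 1ℚ) ℚ.* bₙ n
    ≡⟨ solve 2 (λ x b → x :+ (con 1ℚ :- con 1ℚ) :* b := x) refl (½ ℚ.* u n ℚ.* bₙ n) (bₙ n) ⟩
  ½ ℚ.* u n ℚ.* bₙ n ∎
  where
  open ≡-Reasoning
  open +-*-Solver

d-suc : ∀ n → ι (suc (suc n)) ℚ.* dₙ (suc (suc n)) ≡ (ι n ℚ.+ ½) ℚ.* dₙ (suc n)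
d-suc n = begin
  ι (suc (suc n)) ℚ.* (½ ℚ.* u (suc n) ℚ.* bₙ (suc n))
    ≡⟨ solve 3 (λ m v y → m :* (con ½ :* v :* y) := (m :* v) :* (con ½ :* y)) refl (ι (suc (suc n))) (u (suc n)) (bₙ (suc n)) ⟩
  ι (suc (suc n)) ℚ.* u (suc n) ℚ.* (½ ℚ.* bₙ (suc n))
    ≡⟨ cong (ℚ._* (½ ℚ.* bₙ (suc n))) (ι*u≡1 (suc n)) ⟩
  1ℚ ℚ.* (½ ℚ.* (1ℚ ℚ.* (ι n ℚ.+ ½) ℚ.* u n ℚ.* bₙ n))
    ≡⟨ solve 3 (λ k v y → con 1ℚ :* (con ½ :* (con 1ℚ :* (k :+ con ½) :* v :* y)) := (k :+ con ½) :* (con ½ :* v :* y)) refl (ι n) (u n) (bₙ n) ⟩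
  (ι n ℚ.+ ½) ℚ.* (½ ℚ.* u n ℚ.* bₙ n) ∎
  where
  open ≡-Reasoning
  open +-*-Solver

d-antitone : ∀ n → dₙ (suc n) ℚ.≤ dₙ n
d-antitone zero    = ℚP.≤ᵇ⇒≤ _
d-antitone (suc n) = cancel-ι (suc n) (subst (ℚ._≤ ι (suc (suc n)) ℚ.* dₙ (suc n)) (sym (d-suc n))
  (ℚP.*-monoʳ-≤-nonNeg (dₙ (suc n)) {{ℚ.nonNegative (0≤d (suc n))}}
    (≤-by {ι n ℚ.+ ½} (+ 3 ℚ./ 2) (ℚP.nonNegative⁻¹ (+ 3 ℚ./ 2))
      (trans (solve 1 (λ k → k :+ con ½ :+ con (+ 3 ℚ./ 2) := con 1ℚ :+ (con 1ℚ :+ k)) refl (ι n)) (sym (trans (ι-suc (suc n)) (cong (1ℚ ℚ.+_) (ι-suc n))))))))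
  where open +-*-Solver

d≤4d : ∀ n → dₙ n ℚ.≤ ι 4 ℚ.* dₙ (suc n)
d≤4d zero    = ℚP.≤ᵇ⇒≤ _
d≤4d (suc n) = cancel-ι (suc n) (begin
  ι (suc (suc n)) ℚ.* dₙ (suc n)
    ≡⟨ cong (ℚ._* dₙ (suc n)) (trans (ι-suc (suc n)) (cong (1ℚ ℚ.+_) (ι-suc n))) ⟩
  (1ℚ ℚ.+ (1ℚ ℚ.+ ι n)) ℚ.* dₙ (suc n)
    ≤⟨ ≤-by (ι 3 ℚ.* ι n ℚ.* dₙ (suc n)) (0≤* {ι 3 ℚ.* ι n} (0≤* {ι 3} (0≤ι 3) (0≤ι n)) (0≤d (suc n)))
         (solve 2 (λ k y → (con 1ℚ :+ (con 1ℚ :+ k)) :* y :+ con (ι 3) :* k :* y := con (ι 4) :* ((k :+ con ½) :* y)) refl (ι n) (dₙ (suc n))) ⟩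
  ι 4 ℚ.* ((ι n ℚ.+ ½) ℚ.* dₙ (suc n))
    ≡⟨ cong (ι 4 ℚ.*_) (d-suc n) ⟨
  ι 4 ℚ.* (ι (suc (suc n)) ℚ.* dₙ (suc (suc n)))
    ≡⟨ solve 2 (λ m y → con (ι 4) :* (m :* y) := m :* (con (ι 4) :* y)) refl (ι (suc (suc n))) (dₙ (suc (suc n))) ⟩
  ι (suc (suc n)) ℚ.* (ι 4 ℚ.* dₙ (suc (suc n))) ∎)
  where
  open ℚP.≤-Reasoning
  open +-*-Solver

-- The ratio of d at m + 1 to d at m is (m - 1/2) / (m + 1) for m ≥ 1, which increases to 1; it
-- exceeds 3/5 from m = 3 on.
3d≤5d : ∀ n → ι 3 ℚ.* dₙ (3 ℕ.+ n) ℚ.≤ ι 5 ℚ.* dₙ (4 ℕ.+ n)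
3d≤5d n = cancel-ι (3 ℕ.+ n) (begin
  ι (4 ℕ.+ n) ℚ.* (ι 3 ℚ.* y)
    ≡⟨ cong (ℚ._* (ι 3 ℚ.* y)) (ι-+ 4 n) ⟩
  (ι 4 ℚ.+ ι n) ℚ.* (ι 3 ℚ.* y)
    ≤⟨ ≤-by ((ι 2 ℚ.* ι n ℚ.+ ½) ℚ.* y) (0≤* {ι 2 ℚ.* ι n ℚ.+ ½} (0≤+ (0≤* {ι 2} (0≤ι 2) (0≤ι n)) (ℚP.nonNegative⁻¹ ½)) (0≤d (3 ℕ.+ n)))
         (solve 2 (λ k y → (con (ι 4) :+ k) :* (con (ι 3) :* y) :+ (con (ι 2) :* k :+ con ½) :* y := con (ι 5) :* ((con (ι 2) :+ k :+ con ½) :* y)) refl (ι n) y) ⟩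
  ι 5 ℚ.* ((ι 2 ℚ.+ ι n ℚ.+ ½) ℚ.* y)
    ≡⟨ cong (λ m → ι 5 ℚ.* ((m ℚ.+ ½) ℚ.* y)) (ι-+ 2 n) ⟨
  ι 5 ℚ.* ((ι (2 ℕ.+ n) ℚ.+ ½) ℚ.* y)
    ≡⟨ cong (ι 5 ℚ.*_) (d-suc (2 ℕ.+ n)) ⟨
  ι 5 ℚ.* (ι (4 ℕ.+ n) ℚ.* dₙ (4 ℕ.+ n))
    ≡⟨ solve 2 (λ m y → con (ι 5) :* (m :* y) := m :* (con (ι 5) :* y)) refl (ι (4 ℕ.+ n)) (dₙ (4 ℕ.+ n)) ⟩
  ι (4 ℕ.+ n) ℚ.* (ι 5 ℚ.* dₙ (4 ℕ.+ n)) ∎)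
  where
  open ℚP.≤-Reasoning
  open +-*-Solver
  y = dₙ (3 ℕ.+ n)

-- At m = 8 the ratio (m - 1/2) / (m + 1) equals 5/6, the contraction factor that it has to outlast.
5d≤6d : ∀ n → ι 5 ℚ.* dₙ (8 ℕ.+ n) ℚ.≤ ι 6 ℚ.* dₙ (9 ℕ.+ n)
5d≤6d n = cancel-ι (8 ℕ.+ n) (begin
  ι (9 ℕ.+ n) ℚ.* (ι 5 ℚ.* y)
    ≡⟨ cong (ℚ._* (ι 5 ℚ.* y)) (ι-+ 9 n) ⟩
  (ι 9 ℚ.+ ι n) ℚ.* (ι 5 ℚ.* y)
    ≤⟨ ≤-by (ι n ℚ.* y) (0≤* (0≤ι n) (0≤d (8 ℕ.+ n)))
         (solve 2 (λ k y → (con (ι 9) :+ k) :* (con (ι 5) :* y) :+ k :* y := con (ι 6) :* ((con (ι 7) :+ k :+ con ½) :* y)) refl (ι n) y) ⟩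
  ι 6 ℚ.* ((ι 7 ℚ.+ ι n ℚ.+ ½) ℚ.* y)
    ≡⟨ cong (λ m → ι 6 ℚ.* ((m ℚ.+ ½) ℚ.* y)) (ι-+ 7 n) ⟨
  ι 6 ℚ.* ((ι (7 ℕ.+ n) ℚ.+ ½) ℚ.* y)
    ≡⟨ cong (ι 6 ℚ.*_) (d-suc (7 ℕ.+ n)) ⟨
  ι 6 ℚ.* (ι (9 ℕ.+ n) ℚ.* dₙ (9 ℕ.+ n))
    ≡⟨ solve 2 (λ m y → con (ι 6) :* (m :* y) := m :* (con (ι 6) :* y)) refl (ι (9 ℕ.+ n)) (dₙ (9 ℕ.+ n)) ⟩
  ι (9 ℕ.+ n) ℚ.* (ι 6 ℚ.* dₙ (9 ℕ.+ n)) ∎)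
  where
  open ℚP.≤-Reasoning
  open +-*-Solver
  y = dₙ (8 ℕ.+ n)

-- A geometric sequence of ratio 1/2 decays faster than d, whose ratios are at least 3/5 from index
-- 3 on. The constant 6 is the fixed point of C = 1 + 1/2 · 5/3 · C.
halves∗d : ∀ n → (halves ∗ dₙ) n ℚ.≤ ι 6 ℚ.* dₙ n
halves∗d 0 = ℚP.≤ᵇ⇒≤ _
halves∗d 1 = ℚP.≤ᵇ⇒≤ _
halves∗d 2 = ℚP.≤ᵇ⇒≤ _
halves∗d 3 = ℚP.≤ᵇ⇒≤ _
halves∗d (suc m@(suc (suc (suc n)))) = begin
  (halves ∗ dₙ) (4 ℕ.+ n)
    ≡⟨ halves-∗ dₙ (3 ℕ.+ n) ⟩
  dₙ (4 ℕ.+ n) ℚ.+ ½ ℚ.* (halves ∗ dₙ) (3 ℕ.+ n)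
    ≤⟨ ℚP.+-monoʳ-≤ (dₙ (4 ℕ.+ n)) (ℚP.*-monoˡ-≤-nonNeg ½ (halves∗d m)) ⟩
  dₙ (4 ℕ.+ n) ℚ.+ ½ ℚ.* (ι 6 ℚ.* dₙ (3 ℕ.+ n))
    ≡⟨ solve 2 (λ x y → x :+ con ½ :* (con (ι 6) :* y) := x :+ con (ι 3) :* y) refl (dₙ (4 ℕ.+ n)) (dₙ (3 ℕ.+ n)) ⟩
  dₙ (4 ℕ.+ n) ℚ.+ ι 3 ℚ.* dₙ (3 ℕ.+ n)
    ≤⟨ ℚP.+-monoʳ-≤ (dₙ (4 ℕ.+ n)) (3d≤5d n) ⟩
  dₙ (4 ℕ.+ n) ℚ.+ ι 5 ℚ.* dₙ (4 ℕ.+ n)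
    ≡⟨ solve 1 (λ x → x :+ con (ι 5) :* x := con (ι 6) :* x) refl (dₙ (4 ℕ.+ n)) ⟩
  ι 6 ℚ.* dₙ (4 ℕ.+ n) ∎
  where
  open ℚP.≤-Reasoning
  open +-*-Solver

-- Exponential decay of the coefficients of the smooth factor

quarters : ℕ → ℚ
quarters n = halves n ℚ.* halves n

0≤quarters : ∀ n → 0ℚ ℚ.≤ quarters n
0≤quarters n = 0≤* (0≤halves n) (0≤halves n)

halves∗quarters : ∀ n → (halves ∗ quarters) n ≡ ι 2 ℚ.* halves n ℚ.- quarters n
halves∗quarters zero    = refl
halves∗quarters (suc n) = trans (halves-∗ quarters n) (trans (cong (λ x → quarters (suc n) ℚ.+ ½ ℚ.* x) (halves∗quarters n))
  (solve 1 (λ h → con ½ :* h :* (con ½ :* h) :+ con ½ :* (con (ι 2) :* h :- h :* h) := con (ι 2) :* (con ½ :* h) :- con ½ :* h :* (con ½ :* h)) refl (halves n)))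
  where open +-*-Solver

binomial-¼ : ∀ n → 0ℚ ℚ.≤ coeff (binomial ¼) n × coeff (binomial ¼) n ℚ.≤ quarters n
binomial-¼ zero    = ℚP.nonNegative⁻¹ 1ℚ , ℚP.≤-refl
binomial-¼ (suc n) with binomial-¼ n
... | 0≤y , y≤q = 0≤* (0≤* (0≤* {¼} (ℚP.nonNegative⁻¹ ¼) 0≤k+½) 0≤u) 0≤y , (begin
  ¼ ℚ.* (ι n ℚ.+ ½) ℚ.* u n ℚ.* y
    ≤⟨ ≤-by (¼ ℚ.* ½ ℚ.* u n ℚ.* y) (0≤* (0≤* {¼ ℚ.* ½} (ℚP.nonNegative⁻¹ (¼ ℚ.* ½)) 0≤u) 0≤y)
         (solve 3 (λ k v y → con ¼ :* (k :+ con ½) :* v :* y :+ con ¼ :* con ½ :* v :* y := con ¼ :* ((con 1ℚ :+ k) :* v) :* y) refl (ι n) (u n) y) ⟩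
  ¼ ℚ.* ((1ℚ ℚ.+ ι n) ℚ.* u n) ℚ.* y
    ≡⟨ cong (λ x → ¼ ℚ.* x ℚ.* y) (trans (cong (ℚ._* u n) (sym (ι-suc n))) (ι*u≡1 n)) ⟩
  ¼ ℚ.* 1ℚ ℚ.* y
    ≤⟨ ℚP.*-monoˡ-≤-nonNeg (¼ ℚ.* 1ℚ) y≤q ⟩
  ¼ ℚ.* 1ℚ ℚ.* quarters n
    ≡⟨ solve 1 (λ h → con ¼ :* con 1ℚ :* (h :* h) := con ½ :* h :* (con ½ :* h)) refl (halves n) ⟩
  quarters (suc n) ∎)
  where
  open ℚP.≤-Reasoning
  open +-*-Solver
  y = coeff (binomial ¼) n
  0≤u = ℚP.<⇒≤ (0<u n)
  0≤k+½ = ℚP.<⇒≤ (0<ι+½ n)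

-- Up to scaling, (1 - t²) P_n² + (P_{n-1} - t P_n)² for the Legendre polynomials at
-- t = - 3/4; it does not increase with n, which yields |P_n| ≤ 1.
energy : ℕ → ℚ
energy n = y ℚ.* y ℚ.+ (+ 3 ℚ./ 4) ℚ.* (y ℚ.* x) ℚ.+ ¼ ℚ.* (x ℚ.* x)
  where
  x = coeff legendre n
  y = coeff legendre (suc n)

square≥0 : ∀ x → 0ℚ ℚ.≤ x ℚ.* x
square≥0 x with ℚP.≤-total 0ℚ x
... | inj₁ 0≤x = 0≤* 0≤x 0≤x
... | inj₂ x≤0 = subst (0ℚ ℚ.≤_) (solve 1 (λ x → (:- x) :* (:- x) := x :* x) refl x) (0≤* 0≤-x 0≤-x)
  where
  open +-*-Solver
  0≤-x : 0ℚ ℚ.≤ ℚ.- x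
  0≤-x = ℚP.neg-antimono-≤ x≤0

-- Completing the square gives (y + 3x/8)² + 7x²/64 for the energy. The recurrence turns the next
-- square into (k w)² with k = (n + 1) / (n + 2), and with k = 1 the claim would be an equality;
-- what is lost is (1 - k²) w².
energy-suc : ∀ n → energy (suc n) ℚ.≤ ¼ ℚ.* energy n
energy-suc n = ≤-by ((1ℚ ℚ.- k ℚ.* k) ℚ.* (w ℚ.* w)) (0≤* (0≤- k²≤1) (square≥0 w)) (begin
  z ℚ.* z ℚ.+ (+ 3 ℚ./ 4) ℚ.* (z ℚ.* y) ℚ.+ ¼ ℚ.* (y ℚ.* y) ℚ.+ (1ℚ ℚ.- k ℚ.* k) ℚ.* (w ℚ.* w)
    ≡⟨ solve 4 (λ y z k w → z :* z :+ con (+ 3 ℚ./ 4) :* (z :* y) :+ con ¼ :* (y :* y) :+ (con 1ℚ :- k :* k) :* (w :* w)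
         := (z :+ con (+ 3 ℚ./ 8) :* y) :* (z :+ con (+ 3 ℚ./ 8) :* y) :+ con (+ 7 ℚ./ 64) :* (y :* y) :+ (con 1ℚ :- k :* k) :* (w :* w)) refl y z k w ⟩
  (z ℚ.+ (+ 3 ℚ./ 8) ℚ.* y) ℚ.* (z ℚ.+ (+ 3 ℚ./ 8) ℚ.* y) ℚ.+ (+ 7 ℚ./ 64) ℚ.* (y ℚ.* y) ℚ.+ (1ℚ ℚ.- k ℚ.* k) ℚ.* (w ℚ.* w)
    ≡⟨ cong (λ e → e ℚ.* e ℚ.+ (+ 7 ℚ./ 64) ℚ.* (y ℚ.* y) ℚ.+ (1ℚ ℚ.- k ℚ.* k) ℚ.* (w ℚ.* w)) contraction ⟩
  (ℚ.- (k ℚ.* w)) ℚ.* (ℚ.- (k ℚ.* w)) ℚ.+ (+ 7 ℚ./ 64) ℚ.* (y ℚ.* y) ℚ.+ (1ℚ ℚ.- k ℚ.* k) ℚ.* (w ℚ.* w)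
    ≡⟨ solve 3 (λ x y k → let w = con ¼ :* x :+ con (+ 3 ℚ./ 8) :* y in
         (:- (k :* w)) :* (:- (k :* w)) :+ con (+ 7 ℚ./ 64) :* (y :* y) :+ (con 1ℚ :- k :* k) :* (w :* w)
         := con ¼ :* (y :* y :+ con (+ 3 ℚ./ 4) :* (y :* x) :+ con ¼ :* (x :* x))) refl x y k ⟩
  ¼ ℚ.* energy n ∎)
  where
  open ≡-Reasoning
  open +-*-Solver
  x = coeff legendre n
  y = coeff legendre (suc n)
  z = coeff legendre (suc (suc n))
  k = (1ℚ ℚ.+ ι n) ℚ.* u (suc n)
  w = ¼ ℚ.* x ℚ.+ (+ 3 ℚ./ 8) ℚ.* y
  one : (ι 2 ℚ.+ ι n) ℚ.* u (suc n) ≡ 1ℚ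
  one = trans (cong (ℚ._* u (suc n)) (sym (ι-+ 2 n))) (ι*u≡1 (suc n))
  contraction : z ℚ.+ (+ 3 ℚ./ 8) ℚ.* y ≡ ℚ.- (k ℚ.* w)
  contraction = trans (cong (λ e → z ℚ.+ (+ 3 ℚ./ 8) ℚ.* e) (trans (sym (ℚP.*-identityˡ y)) (cong (ℚ._* y) (sym one))))
    (solve 4 (λ n v x y → (:- (v :* (con (+ 3 ℚ./ 4) :* (n :+ con (+ 3 ℚ./ 2)) :* y :+ con ¼ :* (n :+ con 1ℚ) :* x)))
        :+ con (+ 3 ℚ./ 8) :* ((con (ι 2) :+ n) :* v :* y)
        := :- ((con 1ℚ :+ n) :* v :* (con ¼ :* x :+ con (+ 3 ℚ./ 8) :* y))) refl (ι n) (u (suc n)) x y)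
  k≤1 : k ℚ.≤ 1ℚ
  k≤1 = ≤-by (u (suc n)) (ℚP.<⇒≤ (0<u (suc n)))
    (trans (solve 2 (λ n v → (con 1ℚ :+ n) :* v :+ v := (con (ι 2) :+ n) :* v) refl (ι n) (u (suc n))) one)
  0≤k : 0ℚ ℚ.≤ k
  0≤k = 0≤* (0≤+ {1ℚ} (ℚP.nonNegative⁻¹ 1ℚ) (0≤ι n)) (ℚP.<⇒≤ (0<u (suc n)))
  k²≤1 : k ℚ.* k ℚ.≤ 1ℚ
  k²≤1 = *-mono-≤ {k} {1ℚ} {k} {1ℚ} 0≤k k≤1 0≤k k≤1

-- The energy is at least 7/64 times the square of the coefficient, and it starts at exactly 7/64,
-- so the constant cancels.
legendre-bound : ∀ n → coeff legendre n ⊑ halves n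
legendre-bound n = square-⊑ (0≤halves n) (ℚP.*-cancelˡ-≤-pos (+ 7 ℚ./ 64) (begin
  (+ 7 ℚ./ 64) ℚ.* (x ℚ.* x)
    ≤⟨ ≤-by ((y ℚ.+ (+ 3 ℚ./ 8) ℚ.* x) ℚ.* (y ℚ.+ (+ 3 ℚ./ 8) ℚ.* x)) (square≥0 (y ℚ.+ (+ 3 ℚ./ 8) ℚ.* x))
         (solve 2 (λ x y → con (+ 7 ℚ./ 64) :* (x :* x) :+ (y :+ con (+ 3 ℚ./ 8) :* x) :* (y :+ con (+ 3 ℚ./ 8) :* x)
           := y :* y :+ con (+ 3 ℚ./ 4) :* (y :* x) :+ con ¼ :* (x :* x)) refl x y) ⟩
  energy n
    ≤⟨ energy-bound n ⟩
  (+ 7 ℚ./ 64) ℚ.* quarters n ∎))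
  where
  open ℚP.≤-Reasoning
  open +-*-Solver
  x = coeff legendre n
  y = coeff legendre (suc n)
  energy-bound : ∀ n → energy n ℚ.≤ (+ 7 ℚ./ 64) ℚ.* quarters n
  energy-bound zero    = ℚP.≤ᵇ⇒≤ _
  energy-bound (suc n) = ℚP.≤-trans (energy-suc n) (ℚP.≤-trans (ℚP.*-monoˡ-≤-nonNeg ¼ (energy-bound n)) (ℚP.≤-reflexive
    (solve 1 (λ h → con ¼ :* (con (+ 7 ℚ./ 64) :* (h :* h)) := con (+ 7 ℚ./ 64) :* (con ½ :* h :* (con ½ :* h))) refl (halves n))))

gₙ : ℕ → ℚ
gₙ = coeff smooth

g-bound : ∀ n → gₙ n ⊑ ι 2 ℚ.* halves n
g-bound n = ⊑-weaken (majorant n (λ k _ → ⊑-intro (proj₁ (binomial-¼ k)) (proj₂ (binomial-¼ k))) (λ k _ → legendre-bound k)) (begin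
  (quarters ∗ halves) n                ≡⟨ ∗-comm quarters halves n ⟩
  (halves ∗ quarters) n                ≡⟨ halves∗quarters n ⟩
  ι 2 ℚ.* halves n ℚ.- quarters n      ≤⟨ ≤-by (quarters n) (0≤quarters n) (solve 2 (λ h q → con (ι 2) :* h :- q :+ q := con (ι 2) :* h) refl (halves n) (quarters n)) ⟩
  ι 2 ℚ.* halves n                     ∎)
  where
  open ℚP.≤-Reasoning
  open +-*-Solver

2halves∗d : ∀ n → ((λ k → ι 2 ℚ.* halves k) ∗ dₙ) n ℚ.≤ ι 12 ℚ.* dₙ n
2halves∗d n = begin
  ((λ k → ι 2 ℚ.* halves k) ∗ dₙ) n    ≡⟨ scale-∗ (ι 2) halves dₙ n ⟩
  ι 2 ℚ.* (halves ∗ dₙ) n              ≤⟨ ℚP.*-monoˡ-≤-nonNeg (ι 2) (halves∗d n) ⟩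
  ι 2 ℚ.* (ι 6 ℚ.* dₙ n)               ≡⟨ ℚP.*-assoc (ι 2) (ι 6) (dₙ n) ⟨
  ι 12 ℚ.* dₙ n                        ∎
  where open ℚP.≤-Reasoning

-- The walk compared with (1 - X)^(-1/2)

aₙ : ℕ → ℚ
aₙ = coeff walk

Δ : (ℕ → ℚ) → ℕ → ℚ
Δ x = act (1ℚ ∷ ℚ.- 1ℚ ∷ []) x

1-X : Series
1-X = polynomial (1ℚ ∷ ℚ.- 1ℚ ∷ [])

eₙ : ℕ → ℚ
eₙ = coeff (1-X ⊛ binomial 1ℚ)

e-bound : ∀ n → eₙ n ⊑ dₙ n
e-bound n = subst (_⊑ dₙ n) (sym (polynomial-⊛ (1ℚ ∷ ℚ.- 1ℚ ∷ []) (binomial 1ℚ) n)) (go n)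
  where
  open +-*-Solver
  value : ∀ x y → 1ℚ ℚ.* y ℚ.+ ℚ.- 1ℚ ℚ.* x ≡ ℚ.- (x ℚ.- y)
  value = solve 2 (λ x y → con 1ℚ :* y :+ con (ℚ.- 1ℚ) :* x := :- (x :- y)) refl
  go : ∀ n → Δ bₙ n ⊑ dₙ n
  go zero          = absolute (ℚP.≤ᵇ⇒≤ _)
  go (suc zero)    = absolute (ℚP.≤ᵇ⇒≤ _)
  go (suc (suc n)) = subst (_⊑ dₙ (suc (suc n))) (trans (cong ℚ.-_ (sym (d-difference (suc n))))
      (trans (sym (value (bₙ (suc n)) (bₙ (suc (suc n))))) (cong (1ℚ ℚ.* bₙ (suc (suc n)) ℚ.+_) (sym (ℚP.+-identityʳ (ℚ.- 1ℚ ℚ.* bₙ (suc n)))))))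
    (⊑-neg (⊑-refl (0≤d (suc (suc n)))))

Δa-bound : ∀ n → Δ aₙ n ⊑ ι 12 ℚ.* dₙ n
Δa-bound n = subst (_⊑ ι 12 ℚ.* dₙ n) (trans (at (SeriesRing.*-assoc 1-X (binomial 1ℚ) smooth) n) (polynomial-⊛ (1ℚ ∷ ℚ.- 1ℚ ∷ []) walk n))
  (⊑-weaken (majorant n (λ k _ → e-bound k) (λ k _ → g-bound k))
    (ℚP.≤-trans (ℚP.≤-reflexive (∗-comm dₙ (λ k → ι 2 ℚ.* halves k) n)) (2halves∗d n)))

ones : Series
ones .coeff n = 1ℚ

1-X⊛ones : 1-X ⊛ ones ≈ const 1ℚ
1-X⊛ones = pointwise λ n → trans (polynomial-⊛ (1ℚ ∷ ℚ.- 1ℚ ∷ []) ones n) (go n)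
  where
  go : ∀ n → Δ (λ _ → 1ℚ) n ≡ coeff (const 1ℚ) n
  go zero          = refl
  go (suc zero)    = refl
  go (suc (suc n)) = refl

Gₙ : ℕ → ℚ
Gₙ = coeff (ones ⊛ smooth)

G-suc : ∀ n → Gₙ (suc n) ≡ Gₙ n ℚ.+ gₙ (suc n)
G-suc n = solve 2 (λ x y → con 1ℚ :* x :+ y := y :+ x) refl (gₙ (suc n)) (Gₙ n)
  where open +-*-Solver

G-close : ∀ m k → Gₙ k ℚ.- Gₙ (m ℕ.+ k) ⊑ ι 2 ℚ.* halves k ℚ.- ι 2 ℚ.* halves (m ℕ.+ k)
G-close zero    k = absolute (ℚP.≤-reflexive (trans (cong ℚ.∣_∣ (ℚP.+-inverseʳ (Gₙ k))) (sym (ℚP.+-inverseʳ (ι 2 ℚ.* halves k)))))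
G-close (suc m) k = subst₂ _⊑_
  (trans (solve 3 (λ x y z → x :- y :+ (:- z) := x :- (y :+ z)) refl (Gₙ k) (Gₙ (m ℕ.+ k)) (gₙ (suc m ℕ.+ k))) (cong (λ y → Gₙ k ℚ.- y) (sym (G-suc (m ℕ.+ k)))))
  (solve 2 (λ x h → con (ι 2) :* x :- con (ι 2) :* h :+ con (ι 2) :* (con ½ :* h) := con (ι 2) :* x :- con (ι 2) :* (con ½ :* h)) refl (halves k) (halves (m ℕ.+ k)))
  (⊑-+ (G-close m k) (⊑-neg (g-bound (suc m ℕ.+ k))))
  where open +-*-Solver

G-tail : ∀ n k → k ℕ.≤ n → Gₙ k ℚ.- Gₙ n ⊑ ι 2 ℚ.* halves k
G-tail n k k≤n = ⊑-weaken (subst (λ m → Gₙ k ℚ.- Gₙ m ⊑ ι 2 ℚ.* halves k ℚ.- ι 2 ℚ.* halves m) (ℕP.m∸n+n≡m k≤n) (G-close (n ℕ.∸ k) k))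
  (≤-by (ι 2 ℚ.* halves n) (0≤* {ι 2} (0≤ι 2) (0≤halves n)) (solve 2 (λ x y → x :- y :+ y := x) refl (ι 2 ℚ.* halves k) (ι 2 ℚ.* halves n)))
  where open +-*-Solver

G-bound : ∀ n → Gₙ n ⊑ ι 4
G-bound n = subst (_⊑ ι 4) (solve 2 (λ x y → x :+ (:- (x :- y)) := y) refl (Gₙ 0) (Gₙ n))
  (⊑-weaken (⊑-+ (⊑-refl {Gₙ 0} (ℚP.nonNegative⁻¹ 1ℚ)) (⊑-neg (G-tail n 0 ℕ.z≤n))) (ℚP.≤ᵇ⇒≤ _))
  where open +-*-Solver

-- The device for passing to limits inside a convolution: y is replaced by its last value, and the
-- differences that remain are small where x is not.
freeze : ∀ x y n → (x ∗ y) n ℚ.- y n ℚ.* (x ∗ (λ _ → 1ℚ)) n ≡ ((λ k → y k ℚ.- y n) ∗ x) n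
freeze x y n = begin
  (x ∗ y) n ℚ.- y n ℚ.* (x ∗ (λ _ → 1ℚ)) n
    ≡⟨ cong₂ (λ p q → p ℚ.- y n ℚ.* q) (∗-comm x y n) (∗-comm x (λ _ → 1ℚ) n) ⟩
  (y ∗ x) n ℚ.- y n ℚ.* ((λ _ → 1ℚ) ∗ x) n
    ≡⟨ solve 3 (λ p y q → p :- y :* q := p :+ (:- y) :* q) refl ((y ∗ x) n) (y n) (((λ _ → 1ℚ) ∗ x) n) ⟩
  (y ∗ x) n ℚ.+ (ℚ.- y n) ℚ.* ((λ _ → 1ℚ) ∗ x) n
    ≡⟨ cong ((y ∗ x) n ℚ.+_) (scale-∗ (ℚ.- y n) (λ _ → 1ℚ) x n) ⟨
  (y ∗ x) n ℚ.+ ((λ _ → ℚ.- y n ℚ.* 1ℚ) ∗ x) n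
    ≡⟨ ∗-distribʳ x y (λ _ → ℚ.- y n ℚ.* 1ℚ) n ⟨
  ((λ k → y k ℚ.+ ℚ.- y n ℚ.* 1ℚ) ∗ x) n
    ≡⟨ ∗-cong (λ k → y k ℚ.+ ℚ.- y n ℚ.* 1ℚ) (λ k → y k ℚ.- y n) x x (λ k → cong (y k ℚ.+_) (ℚP.*-identityʳ (ℚ.- y n))) (λ _ → refl) n ⟩
  ((λ k → y k ℚ.- y n) ∗ x) n ∎
  where
  open ≡-Reasoning
  open +-*-Solver

-- Let e be the coefficients of (1 - X)^(1/2). Convolved with the partial sums of `smooth` they give
-- the walk, and convolved with ones they give b. Freezing the partial sums therefore compares a
-- with G b, and the error is a convolution of a geometric sequence with d.
a-asymptotic : ∀ n → aₙ n ℚ.- Gₙ n ℚ.* bₙ n ⊑ ι 12 ℚ.* dₙ n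
a-asymptotic n = subst (_⊑ ι 12 ℚ.* dₙ n)
  (trans (sym (freeze eₙ Gₙ n)) (cong₂ (λ x y → x ℚ.- Gₙ n ℚ.* y) (at whole n) (at total n)))
  (⊑-weaken (majorant n (λ k k≤n → G-tail n k k≤n) (λ k _ → e-bound k)) (2halves∗d n))
  where
  open ≈-Reasoning
  open SeriesSolver
  β = binomial 1ℚ
  total : 1-X ⊛ β ⊛ ones ≈ β
  total = begin
    1-X ⊛ β ⊛ ones    ≈⟨ solve 3 (λ x β s → x :* β :* s := β :* (x :* s)) ≈-refl 1-X β ones ⟩
    β ⊛ (1-X ⊛ ones)  ≈⟨ ⊛-cong ≈-refl 1-X⊛ones ⟩
    β ⊛ const 1ℚ   ≈⟨ SeriesRing.*-identityʳ β ⟩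
    β              ∎
  whole : 1-X ⊛ β ⊛ (ones ⊛ smooth) ≈ walk
  whole = begin
    1-X ⊛ β ⊛ (ones ⊛ smooth)    ≈⟨ SeriesRing.*-assoc (1-X ⊛ β) ones smooth ⟨
    1-X ⊛ β ⊛ ones ⊛ smooth      ≈⟨ ⊛-cong total ≈-refl ⟩
    β ⊛ smooth                ∎

halves∗halves : ∀ n → (halves ∗ halves) n ≡ ι (suc n) ℚ.* halves n
halves∗halves zero    = refl
halves∗halves (suc n) = trans (halves-∗ halves n) (trans (cong (λ x → halves (suc n) ℚ.+ ½ ℚ.* x) (halves∗halves n))
  (trans (solve 2 (λ h m → con ½ :* h :+ con ½ :* (m :* h) := (con 1ℚ :+ m) :* (con ½ :* h)) refl (halves n) (ι (suc n)))
    (cong (ℚ._* (½ ℚ.* halves n)) (sym (ι-suc (suc n))))))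
  where open +-*-Solver

-- The maximum of (n + 1)² / 2^n, attained at n = 2.
square*halves : ∀ n → ι (suc n) ℚ.* (ι (suc n) ℚ.* halves n) ℚ.≤ (+ 9 ℚ./ 4)
square*halves 0 = ℚP.≤ᵇ⇒≤ _
square*halves 1 = ℚP.≤ᵇ⇒≤ _
square*halves 2 = ℚP.≤ᵇ⇒≤ _
square*halves (suc (suc (suc n))) = ℚP.≤-trans (begin
  ι (4 ℕ.+ n) ℚ.* (ι (4 ℕ.+ n) ℚ.* (½ ℚ.* h))
    ≡⟨ cong (λ m → m ℚ.* (m ℚ.* (½ ℚ.* h))) (ι-+ 4 n) ⟩
  (ι 4 ℚ.+ ι n) ℚ.* ((ι 4 ℚ.+ ι n) ℚ.* (½ ℚ.* h))
    ≤⟨ ≤-by (½ ℚ.* (ι n ℚ.* ι n ℚ.+ ι 4 ℚ.* ι n ℚ.+ ι 2) ℚ.* h)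
         (0≤* (0≤* {½} (ℚP.nonNegative⁻¹ ½) (0≤+ (0≤+ (0≤* (0≤ι n) (0≤ι n)) (0≤* {ι 4} (0≤ι 4) (0≤ι n))) (0≤ι 2))) (0≤halves (2 ℕ.+ n)))
         (solve 2 (λ k h → (con (ι 4) :+ k) :* ((con (ι 4) :+ k) :* (con ½ :* h)) :+ con ½ :* (k :* k :+ con (ι 4) :* k :+ con (ι 2)) :* h
           := (con (ι 3) :+ k) :* ((con (ι 3) :+ k) :* h)) refl (ι n) h) ⟩
  (ι 3 ℚ.+ ι n) ℚ.* ((ι 3 ℚ.+ ι n) ℚ.* h)
    ≡⟨ cong (λ m → m ℚ.* (m ℚ.* h)) (ι-+ 3 n) ⟨
  ι (3 ℕ.+ n) ℚ.* (ι (3 ℕ.+ n) ℚ.* h) ∎) (square*halves (suc (suc n)))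
  where
  open ℚP.≤-Reasoning
  open +-*-Solver
  h = halves (2 ℕ.+ n)

halves∗halves-bound : ∀ n → (halves ∗ halves) n ℚ.≤ (+ 9 ℚ./ 4) ℚ.* u n
halves∗halves-bound n = cancel-ι n (begin
  ι (suc n) ℚ.* (halves ∗ halves) n           ≡⟨ cong (ι (suc n) ℚ.*_) (halves∗halves n) ⟩
  ι (suc n) ℚ.* (ι (suc n) ℚ.* halves n)      ≤⟨ square*halves n ⟩
  (+ 9 ℚ./ 4)                                 ≡⟨ ℚP.*-identityʳ (+ 9 ℚ./ 4) ⟨
  (+ 9 ℚ./ 4) ℚ.* 1ℚ                          ≡⟨ cong ((+ 9 ℚ./ 4) ℚ.*_) (ι*u≡1 n) ⟨
  (+ 9 ℚ./ 4) ℚ.* (ι (suc n) ℚ.* u n)         ≡⟨ solve 2 (λ m v → con (+ 9 ℚ./ 4) :* (m :* v) := m :* (con (+ 9 ℚ./ 4) :* v)) refl (ι (suc n)) (u n) ⟩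
  ι (suc n) ℚ.* ((+ 9 ℚ./ 4) ℚ.* u n)         ∎)
  where
  open ℚP.≤-Reasoning
  open +-*-Solver

2halves∗2halves : ∀ n → ((λ k → ι 2 ℚ.* halves k) ∗ (λ k → ι 2 ℚ.* halves k)) n ℚ.≤ ι 9 ℚ.* u n
2halves∗2halves n = begin
  ((λ k → ι 2 ℚ.* halves k) ∗ (λ k → ι 2 ℚ.* halves k)) n
    ≡⟨ trans (scale-∗ (ι 2) halves (λ k → ι 2 ℚ.* halves k) n) (cong (ι 2 ℚ.*_) (trans (∗-comm halves (λ k → ι 2 ℚ.* halves k) n) (scale-∗ (ι 2) halves halves n))) ⟩
  ι 2 ℚ.* (ι 2 ℚ.* (halves ∗ halves) n)
    ≤⟨ ℚP.*-monoˡ-≤-nonNeg (ι 2) (ℚP.*-monoˡ-≤-nonNeg (ι 2) (halves∗halves-bound n)) ⟩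
  ι 2 ℚ.* (ι 2 ℚ.* ((+ 9 ℚ./ 4) ℚ.* u n))
    ≡⟨ solve 1 (λ v → con (ι 2) :* (con (ι 2) :* (con (+ 9 ℚ./ 4) :* v)) := con (ι 9) :* v) refl (u n) ⟩
  ι 9 ℚ.* u n ∎
  where
  open ℚP.≤-Reasoning
  open +-*-Solver

⅔ : ℚ
⅔ = + 2 ℚ./ 3

u-shift : ∀ n → u n ℚ.≤ ι 3 ℚ.* u (2 ℕ.+ n)
u-shift n = cancel-ι n (cancel-ι (2 ℕ.+ n) (begin
  ι (3 ℕ.+ n) ℚ.* (ι (suc n) ℚ.* u n)
    ≡⟨ trans (cong (ι (3 ℕ.+ n) ℚ.*_) (ι*u≡1 n)) (trans (ℚP.*-identityʳ (ι (3 ℕ.+ n))) (ι-+ 3 n)) ⟩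
  ι 3 ℚ.+ ι n
    ≤⟨ ≤-by (ι 2 ℚ.* ι n) (0≤* {ι 2} (0≤ι 2) (0≤ι n)) (solve 1 (λ k → con (ι 3) :+ k :+ con (ι 2) :* k := con (ι 3) :* (con 1ℚ :+ k) :* con 1ℚ) refl (ι n)) ⟩
  ι 3 ℚ.* (1ℚ ℚ.+ ι n) ℚ.* 1ℚ
    ≡⟨ cong₂ (λ x y → ι 3 ℚ.* x ℚ.* y) (ι-suc n) (ι*u≡1 (2 ℕ.+ n)) ⟨
  ι 3 ℚ.* ι (suc n) ℚ.* (ι (3 ℕ.+ n) ℚ.* u (2 ℕ.+ n))
    ≡⟨ solve 3 (λ p q v → con (ι 3) :* p :* (q :* v) := q :* (p :* (con (ι 3) :* v))) refl (ι (suc n)) (ι (3 ℕ.+ n)) (u (2 ℕ.+ n)) ⟩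
  ι (3 ℕ.+ n) ℚ.* (ι (suc n) ℚ.* (ι 3 ℚ.* u (2 ℕ.+ n))) ∎))
  where
  open ℚP.≤-Reasoning
  open +-*-Solver

-- (1 - 2/3 (1 - X/4) B) / (1 - X)
quotient : List ℚ
quotient = + 1 ℚ./ 3 ∷ 0ℚ ∷ ℚ.- (+ 1 ℚ./ 24) ∷ []

-- Partial fractions at X = 1: the square of `smooth` is the reciprocal of (1 - X/4) B, whose value
-- at 1 is 3/2, so its quotient by 1 - X has the polar part (2/3) / (1 - X).
smooth-sums : smooth ⊛ (ones ⊛ smooth) ≈ polynomial quotient ⊛ (smooth ⊛ smooth) ⊕ const ⅔ ⊛ ones
smooth-sums = begin
  smooth ⊛ (ones ⊛ smooth)
    ≈⟨ solve 3 (λ x g s →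
         let P₁ = con 1ℚ :+ x :* (con (ℚ.- 1ℚ) :+ x :* con 0ℚ)
             P₄ = con 1ℚ :+ x :* (con (ℚ.- ¼) :+ x :* con 0ℚ)
             B = con 1ℚ :+ x :* (con (+ 3 ℚ./ 4) :+ x :* (con ¼ :+ x :* con 0ℚ))
             Q = con (+ 1 ℚ./ 3) :+ x :* (con 0ℚ :+ x :* (con (ℚ.- (+ 1 ℚ./ 24)) :+ x :* con 0ℚ)) in
         g :* (s :* g) := Q :* (g :* g) :* (P₁ :* s) :+ con ⅔ :* s :* (P₄ :* B :* (g :* g))) ≈-refl X smooth ones ⟩
  polynomial quotient ⊛ (smooth ⊛ smooth) ⊛ (1-X ⊛ ones) ⊕ const ⅔ ⊛ ones ⊛ (polynomial (1ℚ ∷ ℚ.- ¼ ∷ []) ⊛ B ⊛ (smooth ⊛ smooth))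
    ≈⟨ ⊕-cong (⊛-cong ≈-refl 1-X⊛ones) (⊛-cong ≈-refl smooth-square) ⟩
  polynomial quotient ⊛ (smooth ⊛ smooth) ⊛ const 1ℚ ⊕ const ⅔ ⊛ ones ⊛ const 1ℚ
    ≈⟨ ⊕-cong (SeriesRing.*-identityʳ (polynomial quotient ⊛ (smooth ⊛ smooth))) (SeriesRing.*-identityʳ (const ⅔ ⊛ ones)) ⟩
  polynomial quotient ⊛ (smooth ⊛ smooth) ⊕ const ⅔ ⊛ ones ∎
  where
  open ≈-Reasoning
  open SeriesSolver

-- The sum of smooth is the square root of 1 / ((1 - 1/4) (1 + 3/4 + 1/4)) = 2/3.
G²-asymptotic : ∀ n → Gₙ n ℚ.* Gₙ n ℚ.- ⅔ ⊑ ι 14 ℚ.* u n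
G²-asymptotic n = subst₂ _⊑_
  (trans (cong (ℚ._+ (Y n ℚ.- ⅔)) (cong ℚ.-_ (cong (λ x → Y n ℚ.- Gₙ n ℚ.* x) (∗-comm gₙ (λ _ → 1ℚ) n))))
    (solve 3 (λ y g r → (:- (y :- g :* g)) :+ (y :- r) := g :* g :- r) refl (Y n) (Gₙ n) ⅔))
  (solve 1 (λ v → con (ι 9) :* v :+ con (ι 5) :* v := con (ι 14) :* v) refl (u n))
  (⊑-+ (⊑-neg difference) (remainder n))
  where
  open +-*-Solver
  q = smooth ⊛ smooth
  Y : ℕ → ℚ
  Y = coeff (smooth ⊛ (ones ⊛ smooth))
  -- Freezing the last partial sum makes its square appear, so that the limit 2/3 is reached without
  -- a square root.
  difference : Y n ℚ.- Gₙ n ℚ.* (gₙ ∗ (λ _ → 1ℚ)) n ⊑ ι 9 ℚ.* u n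
  difference = subst (_⊑ ι 9 ℚ.* u n) (sym (freeze gₙ Gₙ n))
    (⊑-weaken (majorant n (λ k k≤n → G-tail n k k≤n) (λ k _ → g-bound k)) (2halves∗2halves n))
  q-bound : ∀ n → coeff q n ⊑ ι 9 ℚ.* u n
  q-bound n = ⊑-weaken (majorant n (λ k _ → g-bound k) (λ k _ → g-bound k)) (2halves∗2halves n)
  qs = quotient
  Y-value : ∀ n → Y n ℚ.- ⅔ ≡ act qs (coeff q) n
  Y-value n = trans (cong (ℚ._- ⅔) (trans (at smooth-sums n) (cong₂ ℚ._+_ (polynomial-⊛ qs q n) (trans (const-⊛ ⅔ ones n) (ℚP.*-identityʳ ⅔)))))
    (solve 2 (λ x r → x :+ r :- r := x) refl (act qs (coeff q) n) ⅔)
  act-bound : ∀ n → act qs (coeff q) n ⊑ ι 5 ℚ.* u n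
  act-bound 0 = absolute (ℚP.≤ᵇ⇒≤ _)
  act-bound 1 = absolute (ℚP.≤ᵇ⇒≤ _)
  act-bound (suc (suc n)) = ⊑-weaken (⊑-+ (⊑-* (absolute {+ 1 ℚ./ 3} {+ 1 ℚ./ 3} ℚP.≤-refl) (q-bound (suc (suc n))))
      (⊑-+ (⊑-* (absolute {0ℚ} {0ℚ} ℚP.≤-refl) (q-bound (suc n))) (last n))) (begin
    (+ 1 ℚ./ 3) ℚ.* (ι 9 ℚ.* w) ℚ.+ (0ℚ ℚ.* (ι 9 ℚ.* u (suc n)) ℚ.+ (+ 1 ℚ./ 24) ℚ.* (ι 9 ℚ.* u n))
      ≡⟨ solve 3 (λ p q r → con (+ 1 ℚ./ 3) :* (con (ι 9) :* p) :+ (con 0ℚ :* (con (ι 9) :* q) :+ con (+ 1 ℚ./ 24) :* (con (ι 9) :* r)) := con (ι 3) :* p :+ con (+ 9 ℚ./ 24) :* r)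
           refl w (u (suc n)) (u n) ⟩
    ι 3 ℚ.* w ℚ.+ (+ 9 ℚ./ 24) ℚ.* u n
      ≤⟨ ℚP.+-monoʳ-≤ (ι 3 ℚ.* w) (ℚP.*-monoˡ-≤-nonNeg (+ 9 ℚ./ 24) (u-shift n)) ⟩
    ι 3 ℚ.* w ℚ.+ (+ 9 ℚ./ 24) ℚ.* (ι 3 ℚ.* w)
      ≤⟨ ≤-by ((+ 7 ℚ./ 8) ℚ.* w) (0≤* {+ 7 ℚ./ 8} (ℚP.nonNegative⁻¹ (+ 7 ℚ./ 8)) (ℚP.<⇒≤ (0<u (suc (suc n)))))
           (solve 1 (λ p → con (ι 3) :* p :+ con (+ 9 ℚ./ 24) :* (con (ι 3) :* p) :+ con (+ 7 ℚ./ 8) :* p := con (ι 5) :* p) refl w) ⟩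
    ι 5 ℚ.* w ∎)
    where
    open ℚP.≤-Reasoning
    w = u (suc (suc n))
    last : ∀ n → act (ℚ.- (+ 1 ℚ./ 24) ∷ []) (coeff q) n ⊑ (+ 1 ℚ./ 24) ℚ.* (ι 9 ℚ.* u n)
    last zero    = ⊑-* (absolute {ℚ.- (+ 1 ℚ./ 24)} {+ 1 ℚ./ 24} ℚP.≤-refl) (q-bound 0)
    last (suc n) = subst (_⊑ (+ 1 ℚ./ 24) ℚ.* (ι 9 ℚ.* u (suc n))) (sym (ℚP.+-identityʳ (ℚ.- (+ 1 ℚ./ 24) ℚ.* coeff q (suc n))))
      (⊑-* (absolute {ℚ.- (+ 1 ℚ./ 24)} {+ 1 ℚ./ 24} ℚP.≤-refl) (q-bound (suc n)))
  remainder : ∀ n → Y n ℚ.- ⅔ ⊑ ι 5 ℚ.* u n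
  remainder n = subst (_⊑ ι 5 ℚ.* u n) (sym (Y-value n)) (act-bound n)

-- The bias up to a relative error O(1/j)

act-last : ∀ p y n → act (p ∷ []) y n ≡ p ℚ.* y n
act-last p y zero    = refl
act-last p y (suc n) = ℚP.+-identityʳ (p ℚ.* y (suc n))

bias-recurrence : ∀ n → bias (3 ℕ.+ n) ℚ.- (+ 3 ℚ./ 2) ℚ.* bias (2 ℕ.+ n) ℚ.+ ¼ ℚ.* bias (1 ℕ.+ n) ≡
  aₙ (3 ℕ.+ n) ℚ.- aₙ (2 ℕ.+ n) ℚ.- (+ 5 ℚ./ 16) ℚ.* aₙ (1 ℕ.+ n) ℚ.+ (+ 1 ℚ./ 8) ℚ.* aₙ n
bias-recurrence n = begin
  bias (3 ℕ.+ n) ℚ.- (+ 3 ℚ./ 2) ℚ.* bias (2 ℕ.+ n) ℚ.+ ¼ ℚ.* bias (1 ℕ.+ n)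
    ≡⟨ solve 3 (λ x y z → x :- con (+ 3 ℚ./ 2) :* y :+ con ¼ :* z := con 1ℚ :* x :+ (con (ℚ.- (+ 3 ℚ./ 2)) :* y :+ (con ¼ :* z :+ con 0ℚ)) :+ con 0ℚ) refl
         (bias (3 ℕ.+ n)) (bias (2 ℕ.+ n)) (bias (1 ℕ.+ n)) ⟩
  act (1ℚ ∷ ℚ.- (+ 3 ℚ./ 2) ∷ ¼ ∷ []) bias (3 ℕ.+ n) ℚ.+ 0ℚ
    ≡⟨ cong₂ ℚ._+_ (sym (polynomial-⊛ (1ℚ ∷ ℚ.- (+ 3 ℚ./ 2) ∷ ¼ ∷ []) (excess-series 0) (3 ℕ.+ n))) (sym (X-⊛-suc (const ¼) (2 ℕ.+ n))) ⟩
  coeff (N ⊛ excess-series 0 ⊕ X ⊛ const ¼) (3 ℕ.+ n)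
    ≡⟨ at excess-equation (3 ℕ.+ n) ⟩
  coeff (walk ⊛ M) (3 ℕ.+ n)
    ≡⟨ trans (∗-comm aₙ (coeff M) (3 ℕ.+ n)) (polynomial-⊛ (1ℚ ∷ ℚ.- 1ℚ ∷ ℚ.- (+ 5 ℚ./ 16) ∷ + 1 ℚ./ 8 ∷ []) walk (3 ℕ.+ n)) ⟩
  1ℚ ℚ.* aₙ (3 ℕ.+ n) ℚ.+ (ℚ.- 1ℚ ℚ.* aₙ (2 ℕ.+ n) ℚ.+ (ℚ.- (+ 5 ℚ./ 16) ℚ.* aₙ (1 ℕ.+ n) ℚ.+ act (+ 1 ℚ./ 8 ∷ []) aₙ n))
    ≡⟨ cong (λ w → 1ℚ ℚ.* aₙ (3 ℕ.+ n) ℚ.+ (ℚ.- 1ℚ ℚ.* aₙ (2 ℕ.+ n) ℚ.+ (ℚ.- (+ 5 ℚ./ 16) ℚ.* aₙ (1 ℕ.+ n) ℚ.+ w))) (act-last (+ 1 ℚ./ 8) aₙ n) ⟩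
  1ℚ ℚ.* aₙ (3 ℕ.+ n) ℚ.+ (ℚ.- 1ℚ ℚ.* aₙ (2 ℕ.+ n) ℚ.+ (ℚ.- (+ 5 ℚ./ 16) ℚ.* aₙ (1 ℕ.+ n) ℚ.+ (+ 1 ℚ./ 8) ℚ.* aₙ n))
    ≡⟨ solve 4 (λ x y z w → con 1ℚ :* x :+ (con (ℚ.- 1ℚ) :* y :+ (con (ℚ.- (+ 5 ℚ./ 16)) :* z :+ con (+ 1 ℚ./ 8) :* w))
         := x :- y :- con (+ 5 ℚ./ 16) :* z :+ con (+ 1 ℚ./ 8) :* w) refl (aₙ (3 ℕ.+ n)) (aₙ (2 ℕ.+ n)) (aₙ (1 ℕ.+ n)) (aₙ n) ⟩
  aₙ (3 ℕ.+ n) ℚ.- aₙ (2 ℕ.+ n) ℚ.- (+ 5 ℚ./ 16) ℚ.* aₙ (1 ℕ.+ n) ℚ.+ (+ 1 ℚ./ 8) ℚ.* aₙ n ∎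
  where
  open ≡-Reasoning
  open +-*-Solver

UnitInterval : ℚ → Set
UnitInterval x = 0ℚ ℚ.≤ x × x ℚ.≤ 1ℚ

midpoint : ∀ x y → UnitInterval x → UnitInterval y → UnitInterval (½ ℚ.* x ℚ.+ ½ ℚ.* y)
midpoint x y (0≤x , x≤1) (0≤y , y≤1) = 0≤+ (0≤* {½} (ℚP.nonNegative⁻¹ ½) 0≤x) (0≤* {½} (ℚP.nonNegative⁻¹ ½) 0≤y)
  , ℚP.+-mono-≤ {½ ℚ.* x} {½} {½ ℚ.* y} {½} (ℚP.*-monoˡ-≤-nonNeg ½ x≤1) (ℚP.*-monoˡ-≤-nonNeg ½ y≤1)

T-unit : ∀ j x y → UnitInterval (T j x y)
R-unit : ∀ j x y → UnitInterval (R j x y)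
T-unit zero zero    y       = ℚP.nonNegative⁻¹ 1ℚ , ℚP.≤-refl
T-unit zero (suc x) zero    = ℚP.≤-refl , ℚP.nonNegative⁻¹ 1ℚ
T-unit zero (suc x) (suc y) = T-unit zero x y
T-unit (suc j) x y = midpoint (T j x (suc y)) (R j (suc x) y) (T-unit j x (suc y)) (R-unit j (suc x) y)
R-unit zero zero          y       = 0≤- {halves (suc (suc y))} {1ℚ} (halves≤1 (suc (suc y))) ,
  ≤-by {1ℚ ℚ.- halves (suc (suc y))} (halves (suc (suc y))) (0≤halves (suc (suc y))) (solve 1 (λ h → con 1ℚ :- h :+ h := con 1ℚ) refl (halves (suc (suc y))))
  where
  open +-*-Solver
  halves≤1 : ∀ n → halves n ℚ.≤ 1ℚ
  halves≤1 zero    = ℚP.≤-refl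
  halves≤1 (suc n) = ℚP.≤-trans (ℚP.*-monoˡ-≤-nonNeg ½ (halves≤1 n)) (ℚP.≤ᵇ⇒≤ _)
R-unit zero (suc zero)    zero    = ℚP.≤ᵇ⇒≤ _ , ℚP.≤ᵇ⇒≤ _
R-unit zero (suc (suc x)) zero    = ℚP.≤-refl , ℚP.nonNegative⁻¹ 1ℚ
R-unit zero (suc zero)    (suc y) = R-unit zero zero y
R-unit zero (suc (suc x)) (suc y) = R-unit zero (suc x) y
R-unit (suc j) x y = midpoint (T (suc j) x (suc y)) (R j (suc x) y) (T-unit (suc j) x (suc y)) (R-unit j (suc x) y)

-- The a priori bound from which both iterations of the recurrence start.
bias-bound : ∀ j → bias j ⊑ 1ℚ
bias-bound j = absolute (∣∣-≤ {bias j} {1ℚ}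
  (≤-by (ι 2 ℚ.* (1ℚ ℚ.- τ)) (0≤* {ι 2} (0≤ι 2) (0≤- (proj₂ (T-unit j 0 0)))) (solve 1 (λ x → x :+ x :- con 1ℚ :+ con (ι 2) :* (con 1ℚ :- x) := con 1ℚ) refl τ))
  (≤-by (ι 2 ℚ.* τ) (0≤* {ι 2} (0≤ι 2) (proj₁ (T-unit j 0 0))) (solve 1 (λ x → (:- (x :+ x :- con 1ℚ)) :+ con (ι 2) :* x := con 1ℚ) refl τ)))
  where
  open +-*-Solver
  τ = T j 0 0

b-antitone : ∀ n → bₙ (suc n) ℚ.≤ bₙ n
b-antitone n = ≤-by (dₙ (suc n)) (0≤d (suc n)) (trans (cong (bₙ (suc n) ℚ.+_) (sym (d-difference n)))
  (solve 2 (λ x y → x :+ (y :- x) := y) refl (bₙ (suc n)) (bₙ n)))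
  where open +-*-Solver

b-bound : ∀ n → bₙ n ⊑ 1ℚ
b-bound n = ⊑-intro (ℚP.<⇒≤ (0<b n)) (b≤1 n)
  where
  b≤1 : ∀ n → bₙ n ℚ.≤ 1ℚ
  b≤1 zero    = ℚP.≤-refl
  b≤1 (suc n) = ℚP.≤-trans (b-antitone n) (b≤1 n)

a-bound : ∀ n → aₙ n ⊑ ι 4
a-bound n = ⊑-weaken (majorant n (λ k _ → b-bound k) (λ k _ → g-bound k)) (begin
  ((λ _ → 1ℚ) ∗ (λ k → ι 2 ℚ.* halves k)) n
    ≡⟨ trans (∗-comm (λ _ → 1ℚ) (λ k → ι 2 ℚ.* halves k) n) (trans (scale-∗ (ι 2) halves (λ _ → 1ℚ) n) (cong (ι 2 ℚ.*_) (geometric n))) ⟩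
  ι 2 ℚ.* (ι 2 ℚ.- halves n)
    ≤⟨ ≤-by (ι 2 ℚ.* halves n) (0≤* {ι 2} (0≤ι 2) (0≤halves n)) (solve 1 (λ h → con (ι 2) :* (con (ι 2) :- h) :+ con (ι 2) :* h := con (ι 4)) refl (halves n)) ⟩
  ι 4 ∎)
  where
  open ℚP.≤-Reasoning
  open +-*-Solver
  geometric : ∀ n → (halves ∗ (λ _ → 1ℚ)) n ≡ ι 2 ℚ.- halves n
  geometric zero    = refl
  geometric (suc n) = trans (halves-∗ (λ _ → 1ℚ) n) (trans (cong (λ x → 1ℚ ℚ.+ ½ ℚ.* x) (geometric n))
    (solve 1 (λ h → con 1ℚ :+ con ½ :* (con (ι 2) :- h) := con (ι 2) :- con ½ :* h) refl (halves n)))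

a-difference : ∀ n → aₙ (suc n) ℚ.- aₙ n ⊑ ι 12 ℚ.* dₙ (suc n)
a-difference n = subst (_⊑ ι 12 ℚ.* dₙ (suc n)) (trans (cong (1ℚ ℚ.* aₙ (suc n) ℚ.+_) (act-last (ℚ.- 1ℚ) aₙ n))
  (solve 2 (λ x y → con 1ℚ :* x :+ con (ℚ.- 1ℚ) :* y := x :- y) refl (aₙ (suc n)) (aₙ n))) (Δa-bound (suc n))
  where open +-*-Solver

¾ : ℚ
¾ = + 3 ℚ./ 4

-- Here 3/4 = M(1) / N(1) = (- 3/16) / (- 1/4), which makes M - 3N/4 divisible by 1 - X.
zₙ : ℕ → ℚ
zₙ n = bias n ℚ.- ¾ ℚ.* aₙ n

z-bound : ∀ n → zₙ n ⊑ ι 4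
z-bound n = ⊑-+ (bias-bound n) (⊑-neg (⊑-* (⊑-refl {¾} (ℚP.nonNegative⁻¹ ¾)) (a-bound n)))

-- The coefficient at 3 + n of (M - 3N/4) · `walk`, where M - 3N/4 = (1 - X) (1/4 + 3X/8 - X²/8).
-- The factor 1 - X leaves only differences of a, which have the order of d.
εₙ : ℕ → ℚ
εₙ n = ¼ ℚ.* (aₙ (3 ℕ.+ n) ℚ.- aₙ (2 ℕ.+ n)) ℚ.+ (+ 3 ℚ./ 8) ℚ.* (aₙ (2 ℕ.+ n) ℚ.- aₙ (1 ℕ.+ n)) ℚ.- (+ 1 ℚ./ 8) ℚ.* (aₙ (1 ℕ.+ n) ℚ.- aₙ n)

ε-bound : ∀ n → εₙ n ⊑ ι 14 ℚ.* dₙ (2 ℕ.+ n)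
ε-bound n = ⊑-weaken
  (⊑-+ (⊑-+ (⊑-* (⊑-refl {¼} (ℚP.nonNegative⁻¹ ¼)) (a-difference (2 ℕ.+ n))) (⊑-* (⊑-refl {+ 3 ℚ./ 8} (ℚP.nonNegative⁻¹ (+ 3 ℚ./ 8))) (a-difference (1 ℕ.+ n))))
       (⊑-neg (⊑-* (⊑-refl {+ 1 ℚ./ 8} (ℚP.nonNegative⁻¹ (+ 1 ℚ./ 8))) (a-difference n))))
  (≤-by (ι 3 ℚ.* (d₂ ℚ.- d₃) ℚ.+ (+ 3 ℚ./ 2) ℚ.* (ι 4 ℚ.* d₂ ℚ.- d₁) ℚ.+ ½ ℚ.* d₂)
    (0≤+ (0≤+ (0≤* {ι 3} (0≤ι 3) (0≤- (d-antitone (2 ℕ.+ n)))) (0≤* {+ 3 ℚ./ 2} (ℚP.nonNegative⁻¹ (+ 3 ℚ./ 2)) (0≤- (d≤4d (1 ℕ.+ n))))) (0≤* {½} (ℚP.nonNegative⁻¹ ½) (0≤d (2 ℕ.+ n))))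
    (solve 3 (λ d₁ d₂ d₃ → con ¼ :* (con (ι 12) :* d₃) :+ con (+ 3 ℚ./ 8) :* (con (ι 12) :* d₂) :+ con (+ 1 ℚ./ 8) :* (con (ι 12) :* d₁)
      :+ (con (ι 3) :* (d₂ :- d₃) :+ con (+ 3 ℚ./ 2) :* (con (ι 4) :* d₂ :- d₁) :+ con ½ :* d₂) := con (ι 14) :* d₂) refl d₁ d₂ d₃))
  where
  open +-*-Solver
  d₁ = dₙ (1 ℕ.+ n)
  d₂ = dₙ (2 ℕ.+ n)
  d₃ = dₙ (3 ℕ.+ n)

-- The recurrence is solved for its middle term, which makes it a contraction.
z-recurrence : ∀ n → zₙ (2 ℕ.+ n) ≡ ⅔ ℚ.* (zₙ (3 ℕ.+ n) ℚ.+ ¼ ℚ.* zₙ (1 ℕ.+ n) ℚ.+ ℚ.- εₙ n)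
z-recurrence n = begin
  g₂ ℚ.- ¾ ℚ.* a₂
    ≡⟨ solve 4 (λ g₁ g₂ g₃ a₂ → g₂ :- con ¾ :* a₂ := con ⅔ :* (g₃ :+ con ¼ :* g₁ :- (g₃ :- con (+ 3 ℚ./ 2) :* g₂ :+ con ¼ :* g₁) :- con (+ 9 ℚ./ 8) :* a₂)) refl
         g₁ g₂ g₃ a₂ ⟩
  ⅔ ℚ.* (g₃ ℚ.+ ¼ ℚ.* g₁ ℚ.- (g₃ ℚ.- (+ 3 ℚ./ 2) ℚ.* g₂ ℚ.+ ¼ ℚ.* g₁) ℚ.- (+ 9 ℚ./ 8) ℚ.* a₂)
    ≡⟨ cong (λ r → ⅔ ℚ.* (g₃ ℚ.+ ¼ ℚ.* g₁ ℚ.- r ℚ.- (+ 9 ℚ./ 8) ℚ.* a₂)) (bias-recurrence n) ⟩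
  ⅔ ℚ.* (g₃ ℚ.+ ¼ ℚ.* g₁ ℚ.- (a₃ ℚ.- a₂ ℚ.- (+ 5 ℚ./ 16) ℚ.* a₁ ℚ.+ (+ 1 ℚ./ 8) ℚ.* a₀) ℚ.- (+ 9 ℚ./ 8) ℚ.* a₂)
    ≡⟨ solve 6 (λ g₁ g₃ a₀ a₁ a₂ a₃ →
         con ⅔ :* (g₃ :+ con ¼ :* g₁ :- (a₃ :- a₂ :- con (+ 5 ℚ./ 16) :* a₁ :+ con (+ 1 ℚ./ 8) :* a₀) :- con (+ 9 ℚ./ 8) :* a₂) :=
         con ⅔ :* (g₃ :- con ¾ :* a₃ :+ con ¼ :* (g₁ :- con ¾ :* a₁) :+
           (:- (con ¼ :* (a₃ :- a₂) :+ con (+ 3 ℚ./ 8) :* (a₂ :- a₁) :- con (+ 1 ℚ./ 8) :* (a₁ :- a₀))))) refl g₁ g₃ a₀ a₁ a₂ a₃ ⟩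
  ⅔ ℚ.* (zₙ (3 ℕ.+ n) ℚ.+ ¼ ℚ.* zₙ (1 ℕ.+ n) ℚ.+ ℚ.- εₙ n) ∎
  where
  open ≡-Reasoning
  open +-*-Solver
  g₁ = bias (1 ℕ.+ n)
  g₂ = bias (2 ℕ.+ n)
  g₃ = bias (3 ℕ.+ n)
  a₀ = aₙ n
  a₁ = aₙ (1 ℕ.+ n)
  a₂ = aₙ (2 ℕ.+ n)
  a₃ = aₙ (3 ℕ.+ n)

⅚^ : ℕ → ℚ
⅚^ zero    = 1ℚ
⅚^ (suc n) = (+ 5 ℚ./ 6) ℚ.* ⅚^ n

-- Each of the i iterations moves the index by one in either direction, and i ≤ n keeps it at 3 or
-- above, where `3d≤5d` applies. The constant 168 is the fixed point of C = 2/3 · (C + 1/4 · 5/3 · C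
-- + 14); the start 4 comes from `z-bound` and decays by 2/3 · 5/4 = 5/6.
z-contraction : ∀ i n → i ℕ.≤ n → zₙ (3 ℕ.+ n) ⊑ ι 168 ℚ.* dₙ (3 ℕ.+ n) ℚ.+ ι 4 ℚ.* ⅚^ i
z-contraction zero    n       _           = ⊑-weaken (z-bound (3 ℕ.+ n)) (≤-by (ι 168 ℚ.* dₙ (3 ℕ.+ n)) (0≤* {ι 168} (0≤ι 168) (0≤d (3 ℕ.+ n)))
  (ℚP.+-comm (ι 4) (ι 168 ℚ.* dₙ (3 ℕ.+ n))))
z-contraction (suc i) (suc n) (ℕ.s≤s i≤n) = subst (_⊑ ι 168 ℚ.* d₄ ℚ.+ ι 4 ℚ.* ⅚^ (suc i)) (sym (z-recurrence (2 ℕ.+ n))) (⊑-weaken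
  (⊑-* (⊑-refl {⅔} (ℚP.nonNegative⁻¹ ⅔))
    (⊑-+ (⊑-+ (z-contraction i (suc (suc n)) (ℕP.m≤n⇒m≤1+n (ℕP.m≤n⇒m≤1+n i≤n))) (⊑-* (⊑-refl {¼} (ℚP.nonNegative⁻¹ ¼)) (z-contraction i n i≤n)))
         (⊑-neg (ε-bound (2 ℕ.+ n)))))
  (≤-by (ι 112 ℚ.* (d₄ ℚ.- d₅) ℚ.+ (+ 28 ℚ./ 3) ℚ.* (ι 5 ℚ.* d₄ ℚ.- ι 3 ℚ.* d₃))
    (0≤+ (0≤* {ι 112} (0≤ι 112) (0≤- (d-antitone (4 ℕ.+ n)))) (0≤* {+ 28 ℚ./ 3} (ℚP.nonNegative⁻¹ (+ 28 ℚ./ 3)) (0≤- (3d≤5d n))))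
    (solve 4 (λ d₃ d₄ d₅ p →
      con ⅔ :* (con (ι 168) :* d₅ :+ con (ι 4) :* p :+ con ¼ :* (con (ι 168) :* d₃ :+ con (ι 4) :* p) :+ con (ι 14) :* d₄)
        :+ (con (ι 112) :* (d₄ :- d₅) :+ con (+ 28 ℚ./ 3) :* (con (ι 5) :* d₄ :- con (ι 3) :* d₃))
      := con (ι 168) :* d₄ :+ con (ι 4) :* (con (+ 5 ℚ./ 6) :* p)) refl d₃ d₄ d₅ (⅚^ i))))
  where
  open +-*-Solver
  d₃ = dₙ (3 ℕ.+ n)
  d₄ = dₙ (4 ℕ.+ n)
  d₅ = dₙ (5 ℕ.+ n)

-- From `dₙ 8` on the ratios of d are at least 5/6, so the constant 32 has to be checked only at the
-- beginning.
⅚^≤d : ∀ n → ⅚^ n ℚ.≤ ι 32 ℚ.* dₙ (3 ℕ.+ n)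
⅚^≤d 0 = ℚP.≤ᵇ⇒≤ _
⅚^≤d 1 = ℚP.≤ᵇ⇒≤ _
⅚^≤d 2 = ℚP.≤ᵇ⇒≤ _
⅚^≤d 3 = ℚP.≤ᵇ⇒≤ _
⅚^≤d 4 = ℚP.≤ᵇ⇒≤ _
⅚^≤d 5 = ℚP.≤ᵇ⇒≤ _
⅚^≤d (suc m@(suc (suc (suc (suc (suc n)))))) = begin
  (+ 5 ℚ./ 6) ℚ.* ⅚^ m
    ≤⟨ ℚP.*-monoˡ-≤-nonNeg (+ 5 ℚ./ 6) (⅚^≤d m) ⟩
  (+ 5 ℚ./ 6) ℚ.* (ι 32 ℚ.* dₙ (8 ℕ.+ n))
    ≤⟨ ≤-by ((+ 32 ℚ./ 6) ℚ.* (ι 6 ℚ.* dₙ (9 ℕ.+ n) ℚ.- ι 5 ℚ.* dₙ (8 ℕ.+ n))) (0≤* {+ 32 ℚ./ 6} (ℚP.nonNegative⁻¹ (+ 32 ℚ./ 6)) (0≤- (5d≤6d n)))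
         (solve 2 (λ x y → con (+ 5 ℚ./ 6) :* (con (ι 32) :* x) :+ con (+ 32 ℚ./ 6) :* (con (ι 6) :* y :- con (ι 5) :* x) := con (ι 32) :* y) refl (dₙ (8 ℕ.+ n)) (dₙ (9 ℕ.+ n))) ⟩
  ι 32 ℚ.* dₙ (9 ℕ.+ n) ∎
  where
  open ℚP.≤-Reasoning
  open +-*-Solver

z-asymptotic : ∀ n → zₙ (3 ℕ.+ n) ⊑ ι 296 ℚ.* dₙ (3 ℕ.+ n)
z-asymptotic n = ⊑-weaken (z-contraction n n ℕP.≤-refl) (≤-by (ι 4 ℚ.* (ι 32 ℚ.* y ℚ.- ⅚^ n)) (0≤* {ι 4} (0≤ι 4) (0≤- (⅚^≤d n)))
  (solve 2 (λ y p → con (ι 168) :* y :+ con (ι 4) :* p :+ con (ι 4) :* (con (ι 32) :* y :- p) := con (ι 296) :* y) refl y (⅚^ n)))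
  where
  open +-*-Solver
  y = dₙ (3 ℕ.+ n)

d≤u*b : ∀ n → dₙ (suc n) ℚ.≤ u n ℚ.* bₙ (suc n)
d≤u*b n = cancel-ι n (≤-by (½ ℚ.* ι n ℚ.* (u n ℚ.* bₙ n)) (0≤* (0≤* {½} (ℚP.nonNegative⁻¹ ½) (0≤ι n)) (0≤* 0≤u (ℚP.<⇒≤ (0<b n)))) (begin
  ι (suc n) ℚ.* (½ ℚ.* u n ℚ.* bₙ n) ℚ.+ ½ ℚ.* ι n ℚ.* (u n ℚ.* bₙ n)
    ≡⟨ solve 4 (λ m v k y → m :* (con ½ :* v :* y) :+ con ½ :* k :* (v :* y) := (m :* v) :* (con ½ :* y) :+ con ½ :* k :* (v :* y)) refl (ι (suc n)) (u n) (ι n) (bₙ n) ⟩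
  ι (suc n) ℚ.* u n ℚ.* (½ ℚ.* bₙ n) ℚ.+ ½ ℚ.* ι n ℚ.* (u n ℚ.* bₙ n)
    ≡⟨ cong (λ w → w ℚ.* (½ ℚ.* bₙ n) ℚ.+ ½ ℚ.* ι n ℚ.* (u n ℚ.* bₙ n)) one ⟩
  (1ℚ ℚ.+ ι n) ℚ.* u n ℚ.* (½ ℚ.* bₙ n) ℚ.+ ½ ℚ.* ι n ℚ.* (u n ℚ.* bₙ n)
    ≡⟨ solve 3 (λ v k y → (con 1ℚ :+ k) :* v :* (con ½ :* y) :+ con ½ :* k :* (v :* y) := v :* ((k :+ con ½) :* y)) refl (u n) (ι n) (bₙ n) ⟩
  u n ℚ.* ((ι n ℚ.+ ½) ℚ.* bₙ n)
    ≡⟨ cong (u n ℚ.*_) (b-suc n) ⟨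
  u n ℚ.* (ι (suc n) ℚ.* bₙ (suc n))
    ≡⟨ solve 3 (λ v m y → v :* (m :* y) := m :* (v :* y)) refl (u n) (ι (suc n)) (bₙ (suc n)) ⟩
  ι (suc n) ℚ.* (u n ℚ.* bₙ (suc n)) ∎))
  where
  open ≡-Reasoning
  open +-*-Solver
  0≤u = ℚP.<⇒≤ (0<u n)
  one : ι (suc n) ℚ.* u n ≡ (1ℚ ℚ.+ ι n) ℚ.* u n
  one = cong (ℚ._* u n) (ι-suc n)

-- The bias is 3/4 G b + ζ with ζ of relative order 1/n, and G² is close to 2/3, whence 3/8 = 9/16 ·
-- 2/3. Comparing squares avoids √(2/3).
bias-asymptotic : ∀ n → bias (3 ℕ.+ n) ℚ.* bias (3 ℕ.+ n) ℚ.- (+ 3 ℚ./ 8) ℚ.* (bₙ (3 ℕ.+ n) ℚ.* bₙ (3 ℕ.+ n))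
  ⊑ ι 95000 ℚ.* (u (2 ℕ.+ n) ℚ.* (bₙ (3 ℕ.+ n) ℚ.* bₙ (3 ℕ.+ n)))
bias-asymptotic n = subst₂ _⊑_ square total
  (⊑-+ (⊑-+ (⊑-* (⊑-refl {+ 9 ℚ./ 16} (ℚP.nonNegative⁻¹ (+ 9 ℚ./ 16))) (⊑-* G²-bound (⊑-refl (0≤* 0≤β 0≤β))))
            (⊑-* (⊑-refl {+ 3 ℚ./ 2} (ℚP.nonNegative⁻¹ (+ 3 ℚ./ 2))) (⊑-* (G-bound m) (⊑-* (⊑-refl 0≤β) ζ-bound))))
       (⊑-weaken (⊑-* ζ-bound ζ-bound) ζ²≤))
  where
  open +-*-Solver
  m = 3 ℕ.+ n
  β = bₙ m
  γ = Gₙ m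
  v = u (2 ℕ.+ n)
  0≤β = ℚP.<⇒≤ (0<b m)
  0≤v = ℚP.<⇒≤ (0<u (2 ℕ.+ n))
  ζ = zₙ m ℚ.+ ¾ ℚ.* (aₙ m ℚ.- γ ℚ.* β)
  ζ-bound : ζ ⊑ ι 305 ℚ.* (v ℚ.* β)
  ζ-bound = ⊑-weaken (⊑-+ (z-asymptotic n) (⊑-* (⊑-refl {¾} (ℚP.nonNegative⁻¹ ¾)) (a-asymptotic m)))
    (≤-by (ι 305 ℚ.* (v ℚ.* β ℚ.- dₙ m)) (0≤* {ι 305} (0≤ι 305) (0≤- (d≤u*b (2 ℕ.+ n))))
      (solve 2 (λ y w → con (ι 296) :* y :+ con ¾ :* (con (ι 12) :* y) :+ con (ι 305) :* (w :- y) := con (ι 305) :* w) refl (dₙ m) (v ℚ.* β)))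
  G²-bound : γ ℚ.* γ ℚ.- ⅔ ⊑ ι 14 ℚ.* v
  G²-bound = ⊑-weaken (G²-asymptotic m) (ℚP.*-monoˡ-≤-nonNeg (ι 14) (u-anti (ℕP.n≤1+n (2 ℕ.+ n))))
  v≤1 : v ℚ.≤ 1ℚ
  v≤1 = u-anti {0} {2 ℕ.+ n} ℕ.z≤n
  -- The summand 1097/8 only rounds the total 63/8 + 1830 + 93025 up to 95000.
  ζ²≤ : ι 305 ℚ.* (v ℚ.* β) ℚ.* (ι 305 ℚ.* (v ℚ.* β)) ℚ.≤ ι 93025 ℚ.* (v ℚ.* (β ℚ.* β)) ℚ.+ (+ 1097 ℚ./ 8) ℚ.* (v ℚ.* (β ℚ.* β))
  ζ²≤ = ≤-by (ι 93025 ℚ.* ((v ℚ.* (1ℚ ℚ.- v)) ℚ.* (β ℚ.* β)) ℚ.+ (+ 1097 ℚ./ 8) ℚ.* (v ℚ.* (β ℚ.* β)))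
    (0≤+ (0≤* {ι 93025} (0≤ι 93025) (0≤* (0≤* 0≤v (0≤- v≤1)) (0≤* 0≤β 0≤β))) (0≤* {+ 1097 ℚ./ 8} (ℚP.nonNegative⁻¹ (+ 1097 ℚ./ 8)) (0≤* 0≤v (0≤* 0≤β 0≤β))))
    (solve 2 (λ v β → con (ι 305) :* (v :* β) :* (con (ι 305) :* (v :* β)) :+ (con (ι 93025) :* ((v :* (con 1ℚ :- v)) :* (β :* β)) :+ con (+ 1097 ℚ./ 8) :* (v :* (β :* β)))
      := con (ι 93025) :* (v :* (β :* β)) :+ con (+ 1097 ℚ./ 8) :* (v :* (β :* β))) refl v β)
  total : (+ 9 ℚ./ 16) ℚ.* (ι 14 ℚ.* v ℚ.* (β ℚ.* β)) ℚ.+ (+ 3 ℚ./ 2) ℚ.* (ι 4 ℚ.* (β ℚ.* (ι 305 ℚ.* (v ℚ.* β))))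
      ℚ.+ (ι 93025 ℚ.* (v ℚ.* (β ℚ.* β)) ℚ.+ (+ 1097 ℚ./ 8) ℚ.* (v ℚ.* (β ℚ.* β))) ≡ ι 95000 ℚ.* (v ℚ.* (β ℚ.* β))
  total = solve 2 (λ v β → con (+ 9 ℚ./ 16) :* (con (ι 14) :* v :* (β :* β)) :+ con (+ 3 ℚ./ 2) :* (con (ι 4) :* (β :* (con (ι 305) :* (v :* β))))
      :+ (con (ι 93025) :* (v :* (β :* β)) :+ con (+ 1097 ℚ./ 8) :* (v :* (β :* β))) := con (ι 95000) :* (v :* (β :* β))) refl v β
  square : (+ 9 ℚ./ 16) ℚ.* ((γ ℚ.* γ ℚ.- ⅔) ℚ.* (β ℚ.* β)) ℚ.+ (+ 3 ℚ./ 2) ℚ.* (γ ℚ.* (β ℚ.* ζ)) ℚ.+ ζ ℚ.* ζ ≡ bias m ℚ.* bias m ℚ.- (+ 3 ℚ./ 8) ℚ.* (β ℚ.* β)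
  square = solve 4 (λ γ β s y → let ζ = s :- con ¾ :* y :+ con ¾ :* (y :- γ :* β) in
    con (+ 9 ℚ./ 16) :* ((γ :* γ :- con ⅔) :* (β :* β)) :+ con (+ 3 ℚ./ 2) :* (γ :* (β :* ζ)) :+ ζ :* ζ := s :* s :- con (+ 3 ℚ./ 8) :* (β :* β)) refl γ β (bias m) (aₙ m)

-- Positivity

Ds : List ℚ
Ds = 1ℚ ∷ ℚ.- ½ ∷ ℚ.- (+ 7 ℚ./ 16) ∷ ℚ.- (+ 1 ℚ./ 8) ∷ + 1 ℚ./ 16 ∷ []

-- The derivative of D f² = 1 is f E = 0, where E is the claimed expression and f is `walk`. Since f
-- is invertible with inverse D f, multiplying E by 1 = D f² makes f E appear and replaces the
-- cancellation.
walk-equation : D ⊛ ϑ walk ⊕ D ⊛ ϑ walk ⊕ walk ⊛ ϑ D ≈ const 0ℚ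
walk-equation = begin
  E
    ≈⟨ SeriesRing.*-identityˡ E ⟨
  const 1ℚ ⊛ E
    ≈⟨ ⊛-cong walk-square ≈-refl ⟨
  D ⊛ (f ⊛ f) ⊛ E
    ≈⟨ solve 4 (λ d d′ f f′ → d :* (f :* f) :* (d :* f′ :+ d :* f′ :+ f :* d′) := d :* f :* (d′ :* (f :* f) :+ d :* (f′ :* f :+ f :* f′))) ≈-refl D (ϑ D) f (ϑ f) ⟩
  D ⊛ f ⊛ (ϑ D ⊛ (f ⊛ f) ⊕ D ⊛ (ϑ f ⊛ f ⊕ f ⊛ ϑ f))
    ≈⟨ ⊛-cong ≈-refl (≈-trans (ϑ-⊛ D (f ⊛ f)) (⊕-cong ≈-refl (⊛-cong ≈-refl (ϑ-⊛ f f)))) ⟨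
  D ⊛ f ⊛ ϑ (D ⊛ (f ⊛ f))
    ≈⟨ ⊛-cong ≈-refl (≈-trans (pointwise λ n → cong (ι n ℚ.*_) (at walk-square n)) (ϑ-const 1ℚ)) ⟩
  D ⊛ f ⊛ const 0ℚ
    ≈⟨ SeriesRing.zeroʳ (D ⊛ f) ⟩
  const 0ℚ ∎
  where
  open ≈-Reasoning
  open SeriesSolver
  f = walk
  E = D ⊛ ϑ f ⊕ D ⊛ ϑ f ⊕ f ⊛ ϑ D

walk-coefficients : ∀ n → act Ds (coeff (ϑ walk)) (suc n) ℚ.+ act Ds (coeff (ϑ walk)) (suc n) ℚ.+ act (weigh 0 Ds) aₙ (suc n) ≡ 0ℚ
walk-coefficients n = trans (sym (cong₂ ℚ._+_ (cong₂ ℚ._+_ (polynomial-⊛ Ds (ϑ walk) (suc n)) (polynomial-⊛ Ds (ϑ walk) (suc n)))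
    (trans (at (⊛-cong (≈-refl {walk}) (ϑ-polynomial Ds)) (suc n)) (trans (∗-comm aₙ (coeff (polynomial (weigh 0 Ds))) (suc n)) (polynomial-⊛ (weigh 0 Ds) walk (suc n))))))
  (at walk-equation (suc n))

a-recurrence : ∀ n → ι (4 ℕ.+ n) ℚ.* aₙ (4 ℕ.+ n) ≡
  ½ ℚ.* (ι n ℚ.+ (+ 7 ℚ./ 2)) ℚ.* aₙ (3 ℕ.+ n) ℚ.+ (+ 7 ℚ./ 16) ℚ.* (ι n ℚ.+ ι 3) ℚ.* aₙ (2 ℕ.+ n)
  ℚ.+ (+ 1 ℚ./ 8) ℚ.* (ι n ℚ.+ (+ 5 ℚ./ 2)) ℚ.* aₙ (1 ℕ.+ n) ℚ.- (+ 1 ℚ./ 16) ℚ.* (ι n ℚ.+ ι 2) ℚ.* aₙ n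
a-recurrence n = begin
  w
    ≡⟨ solve 6 (λ w k x₃ x₂ x₁ x₀ →
         let r = con ½ :* (k :+ con (+ 7 ℚ./ 2)) :* x₃ :+ con (+ 7 ℚ./ 16) :* (k :+ con (ι 3)) :* x₂
                   :+ con (+ 1 ℚ./ 8) :* (k :+ con (+ 5 ℚ./ 2)) :* x₁ :- con (+ 1 ℚ./ 16) :* (k :+ con (ι 2)) :* x₀
             y = con 1ℚ :* w :+ (con (ℚ.- ½) :* ((con (ι 3) :+ k) :* x₃) :+ (con (ℚ.- (+ 7 ℚ./ 16)) :* ((con (ι 2) :+ k) :* x₂)
                   :+ (con (ℚ.- (+ 1 ℚ./ 8)) :* ((con (ι 1) :+ k) :* x₁) :+ con (+ 1 ℚ./ 16) :* (k :* x₀))))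
             y′ = con (ℚ.- ½) :* x₃ :+ (con (ℚ.- (+ 7 ℚ./ 8)) :* x₂ :+ (con (ℚ.- (+ 3 ℚ./ 8)) :* x₁ :+ con ¼ :* x₀)) in
         w := r :+ con ½ :* (y :+ y :+ y′)) refl w (ι n) x₃ x₂ x₁ x₀ ⟩
  r ℚ.+ ½ ℚ.* (y ℚ.+ y ℚ.+ y′)
    ≡⟨ cong (λ e → r ℚ.+ ½ ℚ.* e) vanish ⟩
  r ℚ.+ ½ ℚ.* 0ℚ
    ≡⟨ trans (cong (r ℚ.+_) (ℚP.*-zeroʳ ½)) (ℚP.+-identityʳ r) ⟩
  r ∎
  where
  open ≡-Reasoning
  open +-*-Solver
  x₀ = aₙ n
  x₁ = aₙ (1 ℕ.+ n)
  x₂ = aₙ (2 ℕ.+ n)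
  x₃ = aₙ (3 ℕ.+ n)
  w = ι (4 ℕ.+ n) ℚ.* aₙ (4 ℕ.+ n)
  r = ½ ℚ.* (ι n ℚ.+ (+ 7 ℚ./ 2)) ℚ.* x₃ ℚ.+ (+ 7 ℚ./ 16) ℚ.* (ι n ℚ.+ ι 3) ℚ.* x₂
    ℚ.+ (+ 1 ℚ./ 8) ℚ.* (ι n ℚ.+ (+ 5 ℚ./ 2)) ℚ.* x₁ ℚ.- (+ 1 ℚ./ 16) ℚ.* (ι n ℚ.+ ι 2) ℚ.* x₀
  Y : ℚ → ℚ → ℚ → ℚ → ℚ
  Y k₃ k₂ k₁ l = 1ℚ ℚ.* w ℚ.+ (ℚ.- ½ ℚ.* (k₃ ℚ.* x₃) ℚ.+ (ℚ.- (+ 7 ℚ./ 16) ℚ.* (k₂ ℚ.* x₂) ℚ.+ (ℚ.- (+ 1 ℚ./ 8) ℚ.* (k₁ ℚ.* x₁) ℚ.+ l)))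
  y = Y (ι 3 ℚ.+ ι n) (ι 2 ℚ.+ ι n) (ι 1 ℚ.+ ι n) ((+ 1 ℚ./ 16) ℚ.* (ι n ℚ.* x₀))
  y′ = ℚ.- ½ ℚ.* x₃ ℚ.+ (ℚ.- (+ 7 ℚ./ 8) ℚ.* x₂ ℚ.+ (ℚ.- (+ 3 ℚ./ 8) ℚ.* x₁ ℚ.+ ¼ ℚ.* x₀))
  y≡ : act Ds (coeff (ϑ walk)) (4 ℕ.+ n) ≡ y
  y≡ = trans (cong (Y (ι (3 ℕ.+ n)) (ι (2 ℕ.+ n)) (ι (1 ℕ.+ n))) (act-last (+ 1 ℚ./ 16) (coeff (ϑ walk)) n))
    (trans (cong₂ (λ p q → Y p q (ι (1 ℕ.+ n)) ((+ 1 ℚ./ 16) ℚ.* (ι n ℚ.* x₀))) (ι-+ 3 n) (ι-+ 2 n))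
           (cong (λ p → Y (ι 3 ℚ.+ ι n) (ι 2 ℚ.+ ι n) p ((+ 1 ℚ./ 16) ℚ.* (ι n ℚ.* x₀))) (ι-+ 1 n)))
  y′≡ : act (weigh 0 Ds) aₙ (4 ℕ.+ n) ≡ y′
  y′≡ = trans (cong (λ l → 0ℚ ℚ.* aₙ (4 ℕ.+ n) ℚ.+ (ℚ.- ½ ℚ.* x₃ ℚ.+ (ℚ.- (+ 7 ℚ./ 8) ℚ.* x₂ ℚ.+ (ℚ.- (+ 3 ℚ./ 8) ℚ.* x₁ ℚ.+ l)))) (act-last ¼ aₙ n))
    (solve 2 (λ x r → con 0ℚ :* x :+ r := r) refl (aₙ (4 ℕ.+ n)) y′)
  vanish : y ℚ.+ y ℚ.+ y′ ≡ 0ℚ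
  vanish = trans (sym (cong₂ ℚ._+_ (cong₂ ℚ._+_ y≡ y≡) y′≡)) (walk-coefficients (3 ℕ.+ n))

-- The ratios tend to 1. The interval from 17/20 to 9/8 is wide enough to be preserved by the
-- recurrence of a, and narrow enough to fix the sign of `source`.
record Ratio (n : ℕ) : Set where
  constructor ratio
  field
    lower : 0ℚ ℚ.≤ ι 20 ℚ.* aₙ (suc n) ℚ.- ι 17 ℚ.* aₙ n
    upper : 0ℚ ℚ.≤ ι 9 ℚ.* aₙ n ℚ.- ι 8 ℚ.* aₙ (suc n)
    pos   : 0ℚ ℚ.< aₙ n

open Ratio

affine : ℚ → ℚ → ℕ → ℚ
affine p q m = p ℚ.+ q ℚ.* ι m

0≤affine : ∀ p q m → ℚ.NonNegative p → ℚ.NonNegative q → 0ℚ ℚ.≤ affine p q m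
0≤affine p q m 0≤p 0≤q = 0≤+ (ℚP.nonNegative⁻¹ p {{0≤p}}) (0≤* {q} (ℚP.nonNegative⁻¹ q {{0≤q}}) (0≤ι m))

-- The nonnegative coefficients below were found by eliminating the oldest terms first.
ratio-step : ∀ m → Ratio (6 ℕ.+ m) → Ratio (7 ℕ.+ m) → Ratio (8 ℕ.+ m) → Ratio (9 ℕ.+ m)
ratio-step m r₁ r₂ r₃ = ratio lower₄ upper₄ pos₃
  where
  open +-*-Solver
  x₀ = aₙ (6 ℕ.+ m)
  x₁ = aₙ (7 ℕ.+ m)
  x₂ = aₙ (8 ℕ.+ m)
  x₃ = aₙ (9 ℕ.+ m)
  x₄ = aₙ (10 ℕ.+ m)
  pos₃ : 0ℚ ℚ.< x₃
  pos₃ = ℚP.<-≤-trans {0ℚ} {(+ 17 ℚ./ 20) ℚ.* x₂} (0<* {+ 17 ℚ./ 20} (ℚP.positive⁻¹ (+ 17 ℚ./ 20)) (pos r₃))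
    (≤-by ((+ 1 ℚ./ 20) ℚ.* (ι 20 ℚ.* x₃ ℚ.- ι 17 ℚ.* x₂)) (0≤* {+ 1 ℚ./ 20} (ℚP.nonNegative⁻¹ (+ 1 ℚ./ 20)) (lower r₃))
      (solve 2 (λ x y → con (+ 17 ℚ./ 20) :* x :+ con (+ 1 ℚ./ 20) :* (con (ι 20) :* y :- con (ι 17) :* x) := y) refl x₂ x₃))
  0≤x₃ = ℚP.<⇒≤ pos₃
  recurrence : (ι 10 ℚ.+ ι m) ℚ.* x₄ ≡ ½ ℚ.* (ι 6 ℚ.+ ι m ℚ.+ (+ 7 ℚ./ 2)) ℚ.* x₃ ℚ.+ (+ 7 ℚ./ 16) ℚ.* (ι 6 ℚ.+ ι m ℚ.+ ι 3) ℚ.* x₂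
    ℚ.+ (+ 1 ℚ./ 8) ℚ.* (ι 6 ℚ.+ ι m ℚ.+ (+ 5 ℚ./ 2)) ℚ.* x₁ ℚ.- (+ 1 ℚ./ 16) ℚ.* (ι 6 ℚ.+ ι m ℚ.+ ι 2) ℚ.* x₀
  recurrence = trans (cong (ℚ._* x₄) (sym (ι-+ 10 m))) (trans (a-recurrence (6 ℕ.+ m))
    (cong (λ k → ½ ℚ.* (k ℚ.+ (+ 7 ℚ./ 2)) ℚ.* x₃ ℚ.+ (+ 7 ℚ./ 16) ℚ.* (k ℚ.+ ι 3) ℚ.* x₂
      ℚ.+ (+ 1 ℚ./ 8) ℚ.* (k ℚ.+ (+ 5 ℚ./ 2)) ℚ.* x₁ ℚ.- (+ 1 ℚ./ 16) ℚ.* (k ℚ.+ ι 2) ℚ.* x₀) (ι-+ 6 m)))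
  scaled : ∀ y → 0ℚ ℚ.≤ (ι 10 ℚ.+ ι m) ℚ.* y → 0ℚ ℚ.≤ y
  scaled y h = cancel-ι (9 ℕ.+ m) (ℚP.≤-trans (ℚP.≤-reflexive (ℚP.*-zeroʳ (ι (10 ℕ.+ m)))) (subst (λ k → 0ℚ ℚ.≤ k ℚ.* y) (sym (ι-+ 10 m)) h))
  U : ℚ → ℚ → ℚ
  U x y = ι 9 ℚ.* x ℚ.- ι 8 ℚ.* y
  L : ℚ → ℚ → ℚ
  L x y = ι 20 ℚ.* y ℚ.- ι 17 ℚ.* x
  upper₄ : 0ℚ ℚ.≤ U x₃ x₄
  upper₄ = scaled (U x₃ x₄) (subst (0ℚ ℚ.≤_)
    (trans (solve 5 (λ k x₀ x₁ x₂ x₃ →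
        (con (+ 4 ℚ./ 9) :+ con (+ 1 ℚ./ 18) :* k) :* (con (ι 9) :* x₀ :- con (ι 8) :* x₁)
        :+ (con (+ 89 ℚ./ 306) :+ con (+ 5 ℚ./ 153) :* k) :* (con (ι 20) :* x₂ :- con (ι 17) :* x₁)
        :+ (con (+ 11419 ℚ./ 5202) :+ con (+ 1271 ℚ./ 5202) :* k) :* (con (ι 20) :* x₃ :- con (ι 17) :* x₂)
        :+ (con (+ 21062 ℚ./ 2601) :+ con (+ 295 ℚ./ 2601) :* k) :* x₃
      := con (ι 9) :* ((con (ι 10) :+ k) :* x₃) :- con (ι 8) :*
        (con ½ :* (con (ι 6) :+ k :+ con (+ 7 ℚ./ 2)) :* x₃ :+ con (+ 7 ℚ./ 16) :* (con (ι 6) :+ k :+ con (ι 3)) :* x₂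
          :+ con (+ 1 ℚ./ 8) :* (con (ι 6) :+ k :+ con (+ 5 ℚ./ 2)) :* x₁ :- con (+ 1 ℚ./ 16) :* (con (ι 6) :+ k :+ con (ι 2)) :* x₀))
        refl (ι m) x₀ x₁ x₂ x₃)
      (trans (cong (λ w → ι 9 ℚ.* ((ι 10 ℚ.+ ι m) ℚ.* x₃) ℚ.- ι 8 ℚ.* w) (sym recurrence))
        (solve 3 (λ n x y → con (ι 9) :* (n :* x) :- con (ι 8) :* (n :* y) := n :* (con (ι 9) :* x :- con (ι 8) :* y)) refl (ι 10 ℚ.+ ι m) x₃ x₄)))
    (0≤+ (0≤+ (0≤+ (0≤* (0≤affine (+ 4 ℚ./ 9) (+ 1 ℚ./ 18) m _ _) (upper r₁)) (0≤* (0≤affine (+ 89 ℚ./ 306) (+ 5 ℚ./ 153) m _ _) (lower r₂)))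
      (0≤* (0≤affine (+ 11419 ℚ./ 5202) (+ 1271 ℚ./ 5202) m _ _) (lower r₃))) (0≤* (0≤affine (+ 21062 ℚ./ 2601) (+ 295 ℚ./ 2601) m _ _) 0≤x₃)))
  lower₄ : 0ℚ ℚ.≤ L x₃ x₄
  lower₄ = scaled (L x₃ x₄) (subst (0ℚ ℚ.≤_)
    (trans (solve 5 (λ k x₀ x₁ x₂ x₃ →
        (con (+ 10 ℚ./ 17) :+ con (+ 5 ℚ./ 68) :* k) :* (con (ι 20) :* x₁ :- con (ι 17) :* x₀)
        :+ (con (+ 215 ℚ./ 204) :+ con (+ 35 ℚ./ 306) :* k) :* (con (ι 9) :* x₁ :- con (ι 8) :* x₂)
        :+ (con (+ 17785 ℚ./ 1836) :+ con (+ 5915 ℚ./ 5508) :* k) :* (con (ι 9) :* x₂ :- con (ι 8) :* x₃)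
        :+ (con (+ 1145 ℚ./ 459) :+ con (+ 2191 ℚ./ 1377) :* k) :* x₃
      := con (ι 20) :*
        (con ½ :* (con (ι 6) :+ k :+ con (+ 7 ℚ./ 2)) :* x₃ :+ con (+ 7 ℚ./ 16) :* (con (ι 6) :+ k :+ con (ι 3)) :* x₂
          :+ con (+ 1 ℚ./ 8) :* (con (ι 6) :+ k :+ con (+ 5 ℚ./ 2)) :* x₁ :- con (+ 1 ℚ./ 16) :* (con (ι 6) :+ k :+ con (ι 2)) :* x₀)
        :- con (ι 17) :* ((con (ι 10) :+ k) :* x₃))
        refl (ι m) x₀ x₁ x₂ x₃)
      (trans (cong (λ w → ι 20 ℚ.* w ℚ.- ι 17 ℚ.* ((ι 10 ℚ.+ ι m) ℚ.* x₃)) (sym recurrence))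
        (solve 3 (λ n x y → con (ι 20) :* (n :* y) :- con (ι 17) :* (n :* x) := n :* (con (ι 20) :* y :- con (ι 17) :* x)) refl (ι 10 ℚ.+ ι m) x₃ x₄)))
    (0≤+ (0≤+ (0≤+ (0≤* (0≤affine (+ 10 ℚ./ 17) (+ 5 ℚ./ 68) m _ _) (lower r₁)) (0≤* (0≤affine (+ 215 ℚ./ 204) (+ 35 ℚ./ 306) m _ _) (upper r₂)))
      (0≤* (0≤affine (+ 17785 ℚ./ 1836) (+ 5915 ℚ./ 5508) m _ _) (upper r₃))) (0≤* (0≤affine (+ 1145 ℚ./ 459) (+ 2191 ℚ./ 1377) m _ _) 0≤x₃)))

ratios : ∀ m → Ratio (4 ℕ.+ m)
ratios 0 = ratio (ℚP.≤ᵇ⇒≤ _) (ℚP.≤ᵇ⇒≤ _) (ℚP.positive⁻¹ (aₙ 4))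
ratios 1 = ratio (ℚP.≤ᵇ⇒≤ _) (ℚP.≤ᵇ⇒≤ _) (ℚP.positive⁻¹ (aₙ 5))
ratios 2 = ratio (ℚP.≤ᵇ⇒≤ _) (ℚP.≤ᵇ⇒≤ _) (ℚP.positive⁻¹ (aₙ 6))
ratios 3 = ratio (ℚP.≤ᵇ⇒≤ _) (ℚP.≤ᵇ⇒≤ _) (ℚP.positive⁻¹ (aₙ 7))
ratios 4 = ratio (ℚP.≤ᵇ⇒≤ _) (ℚP.≤ᵇ⇒≤ _) (ℚP.positive⁻¹ (aₙ 8))
ratios (suc m₄@(suc m₃@(suc m₂@(suc (suc m))))) = ratio-step m (ratios m₂) (ratios m₃) (ratios m₄)

-- The negative of the coefficient of walk ⊛ M at 3 + n.
source : ℕ → ℚ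
source n = aₙ (2 ℕ.+ n) ℚ.+ (+ 5 ℚ./ 16) ℚ.* aₙ (1 ℕ.+ n) ℚ.- aₙ (3 ℕ.+ n) ℚ.- (+ 1 ℚ./ 8) ℚ.* aₙ n

-- An explicit combination of three ratio bounds with nonnegative weights, which leaves a strictly
-- positive multiple of one coefficient. The cases that would involve ratios below index 4 are
-- evaluated.
source-pos : ∀ n → 0ℚ ℚ.< source (suc n)
source-pos 0 = ℚP.positive⁻¹ (source 1)
source-pos 1 = ℚP.positive⁻¹ (source 2)
source-pos 2 = ℚP.positive⁻¹ (source 3)
source-pos (suc (suc (suc n))) = subst (0ℚ ℚ.<_)
  (solve 4 (λ x₁ x₂ x₃ x₄ → con (+ 27 ℚ./ 1088) :* x₂ :+ (con (+ 1 ℚ./ 8) :* (con (ι 9) :* x₃ :- con (ι 8) :* x₄)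
      :+ con (+ 1 ℚ./ 64) :* (con (ι 9) :* x₂ :- con (ι 8) :* x₃) :+ con (+ 1 ℚ./ 136) :* (con (ι 20) :* x₂ :- con (ι 17) :* x₁))
    := x₃ :+ con (+ 5 ℚ./ 16) :* x₂ :- x₄ :- con (+ 1 ℚ./ 8) :* x₁) refl x₁ x₂ x₃ x₄)
  (ℚP.+-mono-<-≤ {0ℚ} {(+ 27 ℚ./ 1088) ℚ.* x₂} {0ℚ} (0<* {+ 27 ℚ./ 1088} (ℚP.positive⁻¹ (+ 27 ℚ./ 1088)) (pos (ratios (suc n))))
    (0≤+ (0≤+ (0≤* {+ 1 ℚ./ 8} (ℚP.nonNegative⁻¹ (+ 1 ℚ./ 8)) (upper (ratios (suc (suc n))))) (0≤* {+ 1 ℚ./ 64} (ℚP.nonNegative⁻¹ (+ 1 ℚ./ 64)) (upper (ratios (suc n)))))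
      (0≤* {+ 1 ℚ./ 136} (ℚP.nonNegative⁻¹ (+ 1 ℚ./ 136)) (lower (ratios n)))))
  where
  open +-*-Solver
  x₁ = aₙ (4 ℕ.+ n)
  x₂ = aₙ (5 ℕ.+ n)
  x₃ = aₙ (6 ℕ.+ n)
  x₄ = aₙ (7 ℕ.+ n)

0≤source : ∀ n → 0ℚ ℚ.≤ source n
0≤source zero    = ℚP.≤ᵇ⇒≤ _
0≤source (suc n) = ℚP.<⇒≤ (source-pos n)

bias-middle : ∀ n → bias (2 ℕ.+ n) ≡ ⅔ ℚ.* (bias (3 ℕ.+ n) ℚ.+ ¼ ℚ.* bias (1 ℕ.+ n) ℚ.+ source n)
bias-middle n = begin
  g₂
    ≡⟨ solve 3 (λ g₁ g₂ g₃ → g₂ := con ⅔ :* (g₃ :+ con ¼ :* g₁ :- (g₃ :- con (+ 3 ℚ./ 2) :* g₂ :+ con ¼ :* g₁))) refl g₁ g₂ g₃ ⟩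
  ⅔ ℚ.* (g₃ ℚ.+ ¼ ℚ.* g₁ ℚ.- (g₃ ℚ.- (+ 3 ℚ./ 2) ℚ.* g₂ ℚ.+ ¼ ℚ.* g₁))
    ≡⟨ cong (λ r → ⅔ ℚ.* (g₃ ℚ.+ ¼ ℚ.* g₁ ℚ.- r)) (bias-recurrence n) ⟩
  ⅔ ℚ.* (g₃ ℚ.+ ¼ ℚ.* g₁ ℚ.- (aₙ (3 ℕ.+ n) ℚ.- aₙ (2 ℕ.+ n) ℚ.- (+ 5 ℚ./ 16) ℚ.* aₙ (1 ℕ.+ n) ℚ.+ (+ 1 ℚ./ 8) ℚ.* aₙ n))
    ≡⟨ solve 6 (λ g₁ g₃ a₀ a₁ a₂ a₃ → con ⅔ :* (g₃ :+ con ¼ :* g₁ :- (a₃ :- a₂ :- con (+ 5 ℚ./ 16) :* a₁ :+ con (+ 1 ℚ./ 8) :* a₀))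
         := con ⅔ :* (g₃ :+ con ¼ :* g₁ :+ (a₂ :+ con (+ 5 ℚ./ 16) :* a₁ :- a₃ :- con (+ 1 ℚ./ 8) :* a₀))) refl
         g₁ g₃ (aₙ n) (aₙ (1 ℕ.+ n)) (aₙ (2 ℕ.+ n)) (aₙ (3 ℕ.+ n)) ⟩
  ⅔ ℚ.* (g₃ ℚ.+ ¼ ℚ.* g₁ ℚ.+ source n) ∎
  where
  open ≡-Reasoning
  open +-*-Solver
  g₁ = bias (1 ℕ.+ n)
  g₂ = bias (2 ℕ.+ n)
  g₃ = bias (3 ℕ.+ n)

0≤⅚^ : ∀ n → 0ℚ ℚ.≤ ⅚^ n
0≤⅚^ zero    = ℚP.nonNegative⁻¹ 1ℚ
0≤⅚^ (suc n) = 0≤* {+ 5 ℚ./ 6} (ℚP.nonNegative⁻¹ (+ 5 ℚ./ 6)) (0≤⅚^ n)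

-- The minimum principle in finite form. The lower bound starts at - 1; since `source` is
-- nonnegative, each use of `bias-middle` shrinks it by 2/3 · (1 + 1/4) = 5/6.
bias-lower : ∀ i n → 0ℚ ℚ.≤ ⅚^ i ℚ.+ bias (suc n)
bias-lower zero    n       = subst (0ℚ ℚ.≤_) (ℚP.+-comm (bias (suc n)) 1ℚ) (subst (ℚ._≤ bias (suc n) ℚ.+ 1ℚ) (ℚP.+-inverseˡ 1ℚ)
  (ℚP.+-monoˡ-≤ 1ℚ (⊑-lower (bias-bound (suc n)))))
-- The boundary value `bias 1` is 1/2, so the iteration never reaches below index 1.
bias-lower (suc i) zero    = 0≤+ (0≤⅚^ (suc i)) (ℚP.nonNegative⁻¹ ½)
bias-lower (suc i) (suc n) = subst (0ℚ ℚ.≤_)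
  (trans (solve 4 (λ p g₁ g₃ r → con ⅔ :* ((p :+ g₃) :+ con ¼ :* (p :+ g₁) :+ r) := con (+ 5 ℚ./ 6) :* p :+ con ⅔ :* (g₃ :+ con ¼ :* g₁ :+ r)) refl
      (⅚^ i) (bias (1 ℕ.+ n)) (bias (3 ℕ.+ n)) (source n))
    (cong (⅚^ (suc i) ℚ.+_) (sym (bias-middle n))))
  (0≤* {⅔} (ℚP.nonNegative⁻¹ ⅔) (0≤+ (0≤+ (bias-lower i (suc (suc n))) (0≤* {¼} (ℚP.nonNegative⁻¹ ¼) (bias-lower i n))) (0≤source n)))
  where open +-*-Solver

⅚^≤u : ∀ n → ⅚^ n ℚ.≤ ι 32 ℚ.* u (2 ℕ.+ n)
⅚^≤u n = ℚP.≤-trans (⅚^≤d n) (ℚP.*-monoˡ-≤-nonNeg (ι 32) (ℚP.≤-trans (d≤u*b (2 ℕ.+ n))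
  (ℚP.≤-trans (ℚP.*-monoˡ-≤-nonNeg (u (2 ℕ.+ n)) {{ℚ.nonNegative (ℚP.<⇒≤ (0<u (2 ℕ.+ n)))}} (⊑-≤ (b-bound (3 ℕ.+ n))))
    (ℚP.≤-reflexive (ℚP.*-identityʳ (u (2 ℕ.+ n)))))))

-- A negative value would eventually exceed (5/6)^k in absolute value, against `bias-lower`.
0≤bias : ∀ n → 0ℚ ℚ.≤ bias (suc n)
0≤bias n with 0ℚ ℚP.≤? bias (suc n)
... | yes p = p
... | no ¬p = <-absurd {0ℚ} {⅚^ k ℚ.+ bias (suc n)} (½ ℚ.* x ℚ.+ (½ ℚ.* x ℚ.- ⅚^ k)) (bias-lower k n)
    (ℚP.+-mono-<-≤ {0ℚ} {½ ℚ.* x} {0ℚ} {½ ℚ.* x ℚ.- ⅚^ k} (½-pos 0<x) (0≤- small))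
    (solve 2 (λ p g → p :+ g :+ (con ½ :* (:- g) :+ (con ½ :* (:- g) :- p)) := con 0ℚ) refl (⅚^ k) (bias (suc n)))
  where
  open +-*-Solver
  x = ℚ.- bias (suc n)
  0<x : 0ℚ ℚ.< x
  0<x = ℚP.neg-antimono-< (ℚP.≰⇒> ¬p)
  limit = archimedean ((+ 1 ℚ./ 64) ℚ.* x) (0<* {+ 1 ℚ./ 64} (ℚP.positive⁻¹ (+ 1 ℚ./ 64)) 0<x)
  k = proj₁ limit
  small : ⅚^ k ℚ.≤ ½ ℚ.* x
  small = ℚP.≤-trans (⅚^≤u k) (ℚP.≤-trans (ℚP.*-monoˡ-≤-nonNeg (ι 32) (proj₂ limit (2 ℕ.+ k) (ℕP.m≤n+m k 2)))
    (ℚP.≤-reflexive (solve 1 (λ x → con (ι 32) :* (con (+ 1 ℚ./ 64) :* x) := con ½ :* x) refl x)))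

bias-pos : ∀ n → 0ℚ ℚ.< bias (suc n)
bias-pos 0 = ℚP.positive⁻¹ ½
-- `source 0` vanishes, so strictness at this index cannot come from the recurrence.
bias-pos 1 = ℚP.positive⁻¹ ¼
bias-pos (suc (suc n)) = subst (0ℚ ℚ.<_) (sym (bias-middle (suc n)))
  (0<* {⅔} (ℚP.positive⁻¹ ⅔) (ℚP.+-mono-≤-< {0ℚ} {bias (4 ℕ.+ n) ℚ.+ ¼ ℚ.* bias (2 ℕ.+ n)}
    (0≤+ (0≤bias (3 ℕ.+ n)) (0≤* {¼} (ℚP.nonNegative⁻¹ ¼) (0≤bias (1 ℕ.+ n)))) (source-pos n)))

-- The density exceeds one half

1+∣_∣-pos : ∀ q → 0ℚ ℚ.< 1ℚ ℚ.+ ℚ.∣ q ∣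
1+∣ q ∣-pos = ℚP.+-mono-<-≤ {0ℚ} {1ℚ} {0ℚ} {ℚ.∣ q ∣} (ℚP.positive⁻¹ 1ℚ) (ℚP.0≤∣p∣ q)

archimedean-* : ∀ K ε → 0ℚ ℚ.< ε → ∃[ N ] ∀ n → N ℕ.≤ n → K ℚ.* u n ℚ.≤ ε
archimedean-* K ε 0<ε = from (archimedean (inv C ℚ.* ε) (0<* (inv-pos 0<C) 0<ε))
  where
  open ℚP.≤-Reasoning
  C = 1ℚ ℚ.+ ℚ.∣ K ∣
  0<C = 1+∣ K ∣-pos
  K≤C : K ℚ.≤ C
  K≤C = ℚP.≤-trans (p≤∣p∣ K) (≤-by {ℚ.∣ K ∣} 1ℚ (ℚP.nonNegative⁻¹ 1ℚ) (ℚP.+-comm (ℚ.∣ K ∣) 1ℚ))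
  from : (∃[ N ] ∀ n → N ℕ.≤ n → u n ℚ.≤ inv C ℚ.* ε) → ∃[ N ] ∀ n → N ℕ.≤ n → K ℚ.* u n ℚ.≤ ε
  from (N , hN) = N , λ n N≤n → begin
    K ℚ.* u n               ≤⟨ ℚP.*-monoʳ-≤-nonNeg (u n) {{ℚ.nonNegative (ℚP.<⇒≤ (0<u n))}} K≤C ⟩
    C ℚ.* u n               ≤⟨ ℚP.*-monoˡ-≤-nonNeg C {{ℚ.nonNegative (ℚP.<⇒≤ 0<C)}} (hN n N≤n) ⟩
    C ℚ.* (inv C ℚ.* ε)     ≡⟨ inv-cancel ε 0<C ⟩
    ε                       ∎

cusick : ∀ j → 1 ℕ.≤ j → fromℚ ½ < c (t j)
cusick (suc j) _ = from (frequency-bias (suc j))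
  where
  open +-*-Solver
  β = bias (suc j)
  ¼β = ¼ ℚ.* β
  0<¼β = 0<* {¼} (ℚP.positive⁻¹ ¼) (bias-pos j)
  from : (∃[ K ] ∀ n → ℚ.∣ seq (c (t (suc j))) n ℚ.- ½ ℚ.* (1ℚ ℚ.+ β) ∣ ℚ.≤ K ℚ.* u n) → fromℚ ½ < c (t (suc j))
  from (K , hK) = combine (archimedean-* K ¼β 0<¼β)
    where
    combine : (∃[ N ] ∀ n → N ℕ.≤ n → K ℚ.* u n ℚ.≤ ¼β) → fromℚ ½ < c (t (suc j))
    -- The frequencies tend to 1/2 + β/2: a quarter of β is the gap to be shown, and another quarter
    -- pays for the distance to the limit.
    combine (N , hN) = ¼β , 0<¼β , N , λ n N≤n →
      bound (seq (c (t (suc j))) n) (-≤⇒≤+ {½ ℚ.* (1ℚ ℚ.+ β)} {seq (c (t (suc j))) n} {¼β}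
        (subst (ℚ._≤ ¼β) (∣-∣-comm (seq (c (t (suc j))) n) (½ ℚ.* (1ℚ ℚ.+ β))) (ℚP.≤-trans (hK n) (hN n N≤n))))
      where
      bound : ∀ x → ½ ℚ.* (1ℚ ℚ.+ β) ℚ.≤ x ℚ.+ ¼β → ½ ℚ.+ ¼β ℚ.≤ x
      bound x h = ≤-by (x ℚ.+ ¼β ℚ.- ½ ℚ.* (1ℚ ℚ.+ β)) (0≤- h)
        (solve 2 (λ x β → con ½ :+ con ¼ :* β :+ (x :+ con ¼ :* β :- con ½ :* (con 1ℚ :+ β)) := x) refl x β)

-- Wallis's product and Leibniz's series

ι-∸ : ∀ {m n} → n ℕ.≤ m → ι (m ℕ.∸ n) ≡ ι m ℚ.- ι n
ι-∸ {m} {n} n≤m = trans (solve 2 (λ x y → x := x :+ y :- y) refl (ι (m ℕ.∸ n)) (ι n))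
  (cong (ℚ._- ι n) (trans (sym (ι-+ (m ℕ.∸ n) n)) (cong ι (ℕP.m∸n+n≡m n≤m))))
  where open +-*-Solver

-- The quotient of binomial coefficients (2n+1 choose n-k) / (2n+1 choose n).
ρ : ℕ → ℕ → ℚ
ρ n zero    = 1ℚ
ρ n (suc k) = ι (n ℕ.∸ k) ℚ.* u (suc (n ℕ.+ k)) ℚ.* ρ n k

0≤ρ : ∀ n k → 0ℚ ℚ.≤ ρ n k
0≤ρ n zero    = ℚP.nonNegative⁻¹ 1ℚ
0≤ρ n (suc k) = 0≤* (0≤* (0≤ι (n ℕ.∸ k)) (ℚP.<⇒≤ (0<u (suc (n ℕ.+ k))))) (0≤ρ n k)

ρ-vanish : ∀ n i → ρ n (suc (i ℕ.+ n)) ≡ 0ℚ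
ρ-vanish n i = trans (cong (λ k → ι k ℚ.* u (suc (n ℕ.+ (i ℕ.+ n))) ℚ.* ρ n (i ℕ.+ n)) (ℕP.m≤n⇒m∸n≡0 (ℕP.m≤n+m n i)))
  (solve 2 (λ v r → con 0ℚ :* v :* r := con 0ℚ) refl (u (suc (n ℕ.+ (i ℕ.+ n)))) (ρ n (i ℕ.+ n)))
  where open +-*-Solver

-- The recursion with true subtraction. Where n - k is truncated, both values of ρ are zero, so the
-- identity holds for every k.
ρ-suc : ∀ n k → (ι n ℚ.+ ι 2 ℚ.+ ι k) ℚ.* ρ n (suc k) ≡ (ι n ℚ.- ι k) ℚ.* ρ n k
ρ-suc n k with k ℕP.≤? n
... | yes k≤n = begin
  (ι n ℚ.+ ι 2 ℚ.+ ι k) ℚ.* (ι (n ℕ.∸ k) ℚ.* v ℚ.* r)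
    ≡⟨ solve 5 (λ n k d v r → (n :+ con (ι 2) :+ k) :* (d :* v :* r) := ((con (ι 2) :+ (n :+ k)) :* v) :* (d :* r)) refl (ι n) (ι k) (ι (n ℕ.∸ k)) v r ⟩
  (ι 2 ℚ.+ (ι n ℚ.+ ι k)) ℚ.* v ℚ.* (ι (n ℕ.∸ k) ℚ.* r)
    ≡⟨ cong (λ m → m ℚ.* v ℚ.* (ι (n ℕ.∸ k) ℚ.* r)) (trans (cong (ι 2 ℚ.+_) (sym (ι-+ n k))) (sym (ι-+ 2 (n ℕ.+ k)))) ⟩
  ι (2 ℕ.+ (n ℕ.+ k)) ℚ.* v ℚ.* (ι (n ℕ.∸ k) ℚ.* r)
    ≡⟨ cong₂ (λ x y → x ℚ.* (y ℚ.* r)) (ι*u≡1 (suc (n ℕ.+ k))) (ι-∸ k≤n) ⟩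
  1ℚ ℚ.* ((ι n ℚ.- ι k) ℚ.* r)
    ≡⟨ ℚP.*-identityˡ ((ι n ℚ.- ι k) ℚ.* r) ⟩
  (ι n ℚ.- ι k) ℚ.* r ∎
  where
  open ≡-Reasoning
  open +-*-Solver
  v = u (suc (n ℕ.+ k))
  r = ρ n k
... | no k≰n = trans (zero-product (ι n ℚ.+ ι 2 ℚ.+ ι k) (ρ≡0 (suc k) (ℕP.m≤n⇒m≤1+n (ℕP.≰⇒> k≰n)))) (sym (zero-product (ι n ℚ.- ι k) (ρ≡0 k (ℕP.≰⇒> k≰n))))
  where
  zero-product : ∀ x {y} → y ≡ 0ℚ → x ℚ.* y ≡ 0ℚ
  zero-product x refl = ℚP.*-zeroʳ x
  ρ≡0 : ∀ k → n ℕ.< k → ρ n k ≡ 0ℚ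
  ρ≡0 (suc k) (ℕ.s≤s n≤k) = trans (cong (λ l → ρ n (suc l)) (sym (ℕP.m∸n+n≡m n≤k))) (ρ-vanish n (k ℕ.∸ n))

ρ-antitone : ∀ n k → ρ n (suc k) ℚ.≤ ρ n k
ρ-antitone n k = begin
  ι (n ℕ.∸ k) ℚ.* v ℚ.* ρ n k
    ≤⟨ ℚP.*-monoʳ-≤-nonNeg (ρ n k) {{ℚ.nonNegative (0≤ρ n k)}} (ℚP.*-monoʳ-≤-nonNeg v {{ℚ.nonNegative (ℚP.<⇒≤ (0<u (suc (n ℕ.+ k))))}}
         (ι-mono (ℕP.≤-trans (ℕP.m∸n≤m n k) (ℕP.≤-trans (ℕP.m≤m+n n k) (ℕP.m≤n+m (n ℕ.+ k) 2))))) ⟩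
  ι (2 ℕ.+ (n ℕ.+ k)) ℚ.* v ℚ.* ρ n k
    ≡⟨ trans (cong (ℚ._* ρ n k) (ι*u≡1 (suc (n ℕ.+ k)))) (ℚP.*-identityˡ (ρ n k)) ⟩
  ρ n k ∎
  where
  open ℚP.≤-Reasoning
  v = u (suc (n ℕ.+ k))

ρ≤1 : ∀ n k → ρ n k ℚ.≤ 1ℚ
ρ≤1 n zero    = ℚP.≤-refl
ρ≤1 n (suc k) = ℚP.≤-trans (ρ-antitone n k) (ρ≤1 n k)

-- The hypergeometric contiguity relation in n, obtained from the one in k by induction; the common
-- factor n + 2 + k is positive and may be cancelled.
ρ-shift : ∀ n k → (ι n ℚ.+ 1ℚ) ℚ.* (ι n ℚ.+ ι 2) ℚ.* ρ n k ≡ (ι n ℚ.+ 1ℚ ℚ.- ι k) ℚ.* (ι n ℚ.+ ι 2 ℚ.+ ι k) ℚ.* ρ (suc n) k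
ρ-shift n zero    = solve 1 (λ n → (n :+ con 1ℚ) :* (n :+ con (ι 2)) :* con 1ℚ := (n :+ con 1ℚ :- con 0ℚ) :* (n :+ con (ι 2) :+ con 0ℚ) :* con 1ℚ) refl (ι n)
  where open +-*-Solver
ρ-shift n (suc k) = ℚP.≤-antisym (cancel (ℚP.≤-reflexive scaled)) (cancel (ℚP.≤-reflexive (sym scaled)))
  where
  open ≡-Reasoning
  open +-*-Solver
  x = ι n
  y = ι k
  cancel : ∀ {p q} → (x ℚ.+ ι 2 ℚ.+ y) ℚ.* p ℚ.≤ (x ℚ.+ ι 2 ℚ.+ y) ℚ.* q → p ℚ.≤ q
  cancel {p} {q} h = cancel-ι (suc (n ℕ.+ k)) (subst (λ m → m ℚ.* p ℚ.≤ m ℚ.* q)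
    (trans (solve 2 (λ x y → x :+ con (ι 2) :+ y := con (ι 2) :+ (x :+ y)) refl x y) (trans (cong (ι 2 ℚ.+_) (sym (ι-+ n k))) (sym (ι-+ 2 (n ℕ.+ k))))) h)
  next : (x ℚ.+ ι 3 ℚ.+ y) ℚ.* ρ (suc n) (suc k) ≡ (x ℚ.+ 1ℚ ℚ.- y) ℚ.* ρ (suc n) k
  next = trans (cong (ℚ._* ρ (suc n) (suc k)) (solve 2 (λ x y → x :+ con (ι 3) :+ y := (con 1ℚ :+ x) :+ con (ι 2) :+ y) refl x y))
    (trans (cong (λ m → (m ℚ.+ ι 2 ℚ.+ y) ℚ.* ρ (suc n) (suc k)) (sym (ι-suc n)))
      (trans (ρ-suc (suc n) k) (trans (cong (λ m → (m ℚ.- y) ℚ.* ρ (suc n) k) (ι-suc n))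
        (cong (ℚ._* ρ (suc n) k) (solve 2 (λ x y → con 1ℚ :+ x :- y := x :+ con 1ℚ :- y) refl x y)))))
  scaled : (x ℚ.+ ι 2 ℚ.+ y) ℚ.* ((x ℚ.+ 1ℚ) ℚ.* (x ℚ.+ ι 2) ℚ.* ρ n (suc k))
         ≡ (x ℚ.+ ι 2 ℚ.+ y) ℚ.* ((x ℚ.+ 1ℚ ℚ.- ι (suc k)) ℚ.* (x ℚ.+ ι 2 ℚ.+ ι (suc k)) ℚ.* ρ (suc n) (suc k))
  scaled = begin
    (x ℚ.+ ι 2 ℚ.+ y) ℚ.* ((x ℚ.+ 1ℚ) ℚ.* (x ℚ.+ ι 2) ℚ.* ρ n (suc k))
      ≡⟨ solve 3 (λ x y r → (x :+ con (ι 2) :+ y) :* ((x :+ con 1ℚ) :* (x :+ con (ι 2)) :* r) := (x :+ con 1ℚ) :* (x :+ con (ι 2)) :* ((x :+ con (ι 2) :+ y) :* r)) refl x y (ρ n (suc k)) ⟩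
    (x ℚ.+ 1ℚ) ℚ.* (x ℚ.+ ι 2) ℚ.* ((x ℚ.+ ι 2 ℚ.+ y) ℚ.* ρ n (suc k))
      ≡⟨ cong ((x ℚ.+ 1ℚ) ℚ.* (x ℚ.+ ι 2) ℚ.*_) (ρ-suc n k) ⟩
    (x ℚ.+ 1ℚ) ℚ.* (x ℚ.+ ι 2) ℚ.* ((x ℚ.- y) ℚ.* ρ n k)
      ≡⟨ solve 3 (λ x y r → (x :+ con 1ℚ) :* (x :+ con (ι 2)) :* ((x :- y) :* r) := (x :- y) :* ((x :+ con 1ℚ) :* (x :+ con (ι 2)) :* r)) refl x y (ρ n k) ⟩
    (x ℚ.- y) ℚ.* ((x ℚ.+ 1ℚ) ℚ.* (x ℚ.+ ι 2) ℚ.* ρ n k)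
      ≡⟨ cong ((x ℚ.- y) ℚ.*_) (ρ-shift n k) ⟩
    (x ℚ.- y) ℚ.* ((x ℚ.+ 1ℚ ℚ.- y) ℚ.* (x ℚ.+ ι 2 ℚ.+ y) ℚ.* ρ (suc n) k)
      ≡⟨ solve 3 (λ x y r → (x :- y) :* ((x :+ con 1ℚ :- y) :* (x :+ con (ι 2) :+ y) :* r) := (x :- y) :* (x :+ con (ι 2) :+ y) :* ((x :+ con 1ℚ :- y) :* r)) refl x y (ρ (suc n) k) ⟩
    (x ℚ.- y) ℚ.* (x ℚ.+ ι 2 ℚ.+ y) ℚ.* ((x ℚ.+ 1ℚ ℚ.- y) ℚ.* ρ (suc n) k)
      ≡⟨ cong ((x ℚ.- y) ℚ.* (x ℚ.+ ι 2 ℚ.+ y) ℚ.*_) (sym next) ⟩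
    (x ℚ.- y) ℚ.* (x ℚ.+ ι 2 ℚ.+ y) ℚ.* ((x ℚ.+ ι 3 ℚ.+ y) ℚ.* ρ (suc n) (suc k))
      ≡⟨ solve 3 (λ x y r → (x :- y) :* (x :+ con (ι 2) :+ y) :* ((x :+ con (ι 3) :+ y) :* r)
           := (x :+ con (ι 2) :+ y) :* ((x :+ con 1ℚ :- (con 1ℚ :+ y)) :* (x :+ con (ι 2) :+ (con 1ℚ :+ y)) :* r)) refl x y (ρ (suc n) (suc k)) ⟩
    (x ℚ.+ ι 2 ℚ.+ y) ℚ.* ((x ℚ.+ 1ℚ ℚ.- (1ℚ ℚ.+ y)) ℚ.* (x ℚ.+ ι 2 ℚ.+ (1ℚ ℚ.+ y)) ℚ.* ρ (suc n) (suc k))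
      ≡⟨ cong (λ m → (x ℚ.+ ι 2 ℚ.+ y) ℚ.* ((x ℚ.+ 1ℚ ℚ.- m) ℚ.* (x ℚ.+ ι 2 ℚ.+ m) ℚ.* ρ (suc n) (suc k))) (sym (ι-suc k)) ⟩
    (x ℚ.+ ι 2 ℚ.+ y) ℚ.* ((x ℚ.+ 1ℚ ℚ.- ι (suc k)) ℚ.* (x ℚ.+ ι 2 ℚ.+ ι (suc k)) ℚ.* ρ (suc n) (suc k)) ∎

-- The n-th damped Leibniz sum is the mean value of cos^(2n+1) against the Fourier
-- series of sgn ∘ cos, rescaled; Zeilberger's method yields its recurrence in n.
damped : ℕ → ℕ → ℚ
damped n zero    = 0ℚ
damped n (suc k) = damped n k ℚ.+ sign k ℚ.* (ρ n k ℚ.* leibnizTerm k)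

leibnizTerm-value : ∀ k → (ι 2 ℚ.* ι k ℚ.+ 1ℚ) ℚ.* leibnizTerm k ≡ ι 4
leibnizTerm-value k = begin
  (ι 2 ℚ.* ι k ℚ.+ 1ℚ) ℚ.* leibnizTerm k
    ≡⟨ cong₂ ℚ._*_ (trans (ℚP.+-comm (ι 2 ℚ.* ι k) 1ℚ) (sym (trans (ι-suc (2 ℕ.* k)) (cong (1ℚ ℚ.+_) (ι-* 2 k))))) (/-≡ι*u 4 (2 ℕ.* k)) ⟩
  ι (suc (2 ℕ.* k)) ℚ.* (ι 4 ℚ.* u (2 ℕ.* k))
    ≡⟨ solve 2 (λ m v → m :* (con (ι 4) :* v) := con (ι 4) :* (m :* v)) refl (ι (suc (2 ℕ.* k))) (u (2 ℕ.* k)) ⟩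
  ι 4 ℚ.* (ι (suc (2 ℕ.* k)) ℚ.* u (2 ℕ.* k))
    ≡⟨ cong (ι 4 ℚ.*_) (ι*u≡1 (2 ℕ.* k)) ⟩
  ι 4 ℚ.* 1ℚ
    ≡⟨⟩
  ι 4 ∎
  where
  open ≡-Reasoning
  open +-*-Solver

-- The right-hand side is Zeilberger's certificate, so the sum telescopes. The leading factor n + 1
-- clears the denominator of the certificate.
damped-recurrence : ∀ n k →
  (ι n ℚ.+ 1ℚ) ℚ.* ((ι 2 ℚ.* ι n ℚ.+ ι 3) ℚ.* (ι 2 ℚ.* ι n ℚ.+ ι 3) ℚ.* damped (suc n) k
    ℚ.- ι 4 ℚ.* ((ι n ℚ.+ 1ℚ) ℚ.* (ι n ℚ.+ ι 2)) ℚ.* damped n k)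
  ≡ ℚ.- (ι 4 ℚ.* (sign k ℚ.* (ι k ℚ.* (ι n ℚ.+ ι 2 ℚ.+ ι k) ℚ.* ρ (suc n) k)))
damped-recurrence n zero    = solve 1 (λ x → (x :+ con 1ℚ) :* ((con (ι 2) :* x :+ con (ι 3)) :* (con (ι 2) :* x :+ con (ι 3)) :* con 0ℚ
    :- con (ι 4) :* ((x :+ con 1ℚ) :* (x :+ con (ι 2))) :* con 0ℚ) := :- (con (ι 4) :* (con 1ℚ :* (con 0ℚ :* (x :+ con (ι 2) :+ con 0ℚ) :* con 1ℚ)))) refl (ι n)
  where open +-*-Solver
damped-recurrence n (suc k) = begin
  (x ℚ.+ 1ℚ) ℚ.* ((ι 2 ℚ.* x ℚ.+ ι 3) ℚ.* (ι 2 ℚ.* x ℚ.+ ι 3) ℚ.* (D′ ℚ.+ σ ℚ.* (r′ ℚ.* τ)) ℚ.- ι 4 ℚ.* ((x ℚ.+ 1ℚ) ℚ.* (x ℚ.+ ι 2)) ℚ.* (D₀ ℚ.+ σ ℚ.* (r ℚ.* τ)))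
    ≡⟨ solve 7 (λ x D′ D₀ σ r′ r τ →
         (x :+ con 1ℚ) :* ((con (ι 2) :* x :+ con (ι 3)) :* (con (ι 2) :* x :+ con (ι 3)) :* (D′ :+ σ :* (r′ :* τ)) :- con (ι 4) :* ((x :+ con 1ℚ) :* (x :+ con (ι 2))) :* (D₀ :+ σ :* (r :* τ)))
         := (x :+ con 1ℚ) :* ((con (ι 2) :* x :+ con (ι 3)) :* (con (ι 2) :* x :+ con (ι 3)) :* D′ :- con (ι 4) :* ((x :+ con 1ℚ) :* (x :+ con (ι 2))) :* D₀)
           :+ (x :+ con 1ℚ) :* (σ :* τ) :* ((con (ι 2) :* x :+ con (ι 3)) :* (con (ι 2) :* x :+ con (ι 3)) :* r′ :- con (ι 4) :* ((x :+ con 1ℚ) :* (x :+ con (ι 2)) :* r)))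
         refl x D′ D₀ σ r′ r τ ⟩
  (x ℚ.+ 1ℚ) ℚ.* ((ι 2 ℚ.* x ℚ.+ ι 3) ℚ.* (ι 2 ℚ.* x ℚ.+ ι 3) ℚ.* D′ ℚ.- ι 4 ℚ.* ((x ℚ.+ 1ℚ) ℚ.* (x ℚ.+ ι 2)) ℚ.* D₀)
    ℚ.+ (x ℚ.+ 1ℚ) ℚ.* (σ ℚ.* τ) ℚ.* ((ι 2 ℚ.* x ℚ.+ ι 3) ℚ.* (ι 2 ℚ.* x ℚ.+ ι 3) ℚ.* r′ ℚ.- ι 4 ℚ.* ((x ℚ.+ 1ℚ) ℚ.* (x ℚ.+ ι 2) ℚ.* r))
    ≡⟨ cong₂ (λ p q → p ℚ.+ (x ℚ.+ 1ℚ) ℚ.* (σ ℚ.* τ) ℚ.* ((ι 2 ℚ.* x ℚ.+ ι 3) ℚ.* (ι 2 ℚ.* x ℚ.+ ι 3) ℚ.* r′ ℚ.- ι 4 ℚ.* q))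
         (damped-recurrence n k) (ρ-shift n k) ⟩
  ℚ.- (ι 4 ℚ.* (σ ℚ.* (y ℚ.* (x ℚ.+ ι 2 ℚ.+ y) ℚ.* r′)))
    ℚ.+ (x ℚ.+ 1ℚ) ℚ.* (σ ℚ.* τ) ℚ.* ((ι 2 ℚ.* x ℚ.+ ι 3) ℚ.* (ι 2 ℚ.* x ℚ.+ ι 3) ℚ.* r′ ℚ.- ι 4 ℚ.* ((x ℚ.+ 1ℚ ℚ.- y) ℚ.* (x ℚ.+ ι 2 ℚ.+ y) ℚ.* r′))
    ≡⟨ solve 5 (λ x y σ r′ τ →
         (:- (con (ι 4) :* (σ :* (y :* (x :+ con (ι 2) :+ y) :* r′))))
           :+ (x :+ con 1ℚ) :* (σ :* τ) :* ((con (ι 2) :* x :+ con (ι 3)) :* (con (ι 2) :* x :+ con (ι 3)) :* r′ :- con (ι 4) :* ((x :+ con 1ℚ :- y) :* (x :+ con (ι 2) :+ y) :* r′))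
         := (:- (con (ι 4) :* (σ :* (y :* (x :+ con (ι 2) :+ y) :* r′)))) :+ (x :+ con 1ℚ) :* σ :* (con (ι 2) :* y :+ con 1ℚ) :* r′ :* ((con (ι 2) :* y :+ con 1ℚ) :* τ))
         refl x y σ r′ τ ⟩
  ℚ.- (ι 4 ℚ.* (σ ℚ.* (y ℚ.* (x ℚ.+ ι 2 ℚ.+ y) ℚ.* r′))) ℚ.+ (x ℚ.+ 1ℚ) ℚ.* σ ℚ.* (ι 2 ℚ.* y ℚ.+ 1ℚ) ℚ.* r′ ℚ.* ((ι 2 ℚ.* y ℚ.+ 1ℚ) ℚ.* τ)
    ≡⟨ cong (λ w → ℚ.- (ι 4 ℚ.* (σ ℚ.* (y ℚ.* (x ℚ.+ ι 2 ℚ.+ y) ℚ.* r′))) ℚ.+ (x ℚ.+ 1ℚ) ℚ.* σ ℚ.* (ι 2 ℚ.* y ℚ.+ 1ℚ) ℚ.* r′ ℚ.* w) (leibnizTerm-value k) ⟩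
  ℚ.- (ι 4 ℚ.* (σ ℚ.* (y ℚ.* (x ℚ.+ ι 2 ℚ.+ y) ℚ.* r′))) ℚ.+ (x ℚ.+ 1ℚ) ℚ.* σ ℚ.* (ι 2 ℚ.* y ℚ.+ 1ℚ) ℚ.* r′ ℚ.* ι 4
    ≡⟨ solve 4 (λ x y σ r′ →
         (:- (con (ι 4) :* (σ :* (y :* (x :+ con (ι 2) :+ y) :* r′)))) :+ (x :+ con 1ℚ) :* σ :* (con (ι 2) :* y :+ con 1ℚ) :* r′ :* con (ι 4)
         := con (ι 4) :* σ :* (con 1ℚ :+ y) :* ((con 1ℚ :+ x :- y) :* r′)) refl x y σ r′ ⟩
  ι 4 ℚ.* σ ℚ.* (1ℚ ℚ.+ y) ℚ.* ((1ℚ ℚ.+ x ℚ.- y) ℚ.* r′)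
    ≡⟨ cong (ι 4 ℚ.* σ ℚ.* (1ℚ ℚ.+ y) ℚ.*_) (trans (cong (λ m → (m ℚ.- y) ℚ.* r′) (sym (ι-suc n))) (trans (sym (ρ-suc (suc n) k)) (cong (λ m → (m ℚ.+ ι 2 ℚ.+ y) ℚ.* r″) (ι-suc n)))) ⟩
  ι 4 ℚ.* σ ℚ.* (1ℚ ℚ.+ y) ℚ.* ((1ℚ ℚ.+ x ℚ.+ ι 2 ℚ.+ y) ℚ.* r″)
    ≡⟨ solve 4 (λ x y σ r → con (ι 4) :* σ :* (con 1ℚ :+ y) :* ((con 1ℚ :+ x :+ con (ι 2) :+ y) :* r)
         := :- (con (ι 4) :* ((:- σ) :* ((con 1ℚ :+ y) :* (x :+ con (ι 2) :+ (con 1ℚ :+ y)) :* r)))) refl x y σ r″ ⟩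
  ℚ.- (ι 4 ℚ.* (ℚ.- σ ℚ.* ((1ℚ ℚ.+ y) ℚ.* (x ℚ.+ ι 2 ℚ.+ (1ℚ ℚ.+ y)) ℚ.* r″)))
    ≡⟨ cong (λ m → ℚ.- (ι 4 ℚ.* (ℚ.- σ ℚ.* (m ℚ.* (x ℚ.+ ι 2 ℚ.+ m) ℚ.* r″)))) (ι-suc k) ⟨
  ℚ.- (ι 4 ℚ.* (ℚ.- σ ℚ.* (ι (suc k) ℚ.* (x ℚ.+ ι 2 ℚ.+ ι (suc k)) ℚ.* r″))) ∎
  where
  open ≡-Reasoning
  open +-*-Solver
  x = ι n
  y = ι k
  σ = sign k
  τ = leibnizTerm k
  r = ρ n k
  r′ = ρ (suc n) k
  r″ = ρ (suc n) (suc k)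
  D′ = damped (suc n) k
  D₀ = damped n k

wallis : ℕ → ℚ
wallis n = damped n (suc n)

-- Up to k = n + 2 both sums are complete, and the certificate there contains
-- `ρ (suc n) (suc (suc n))`, which is zero.
wallis-recurrence : ∀ n → (ι 2 ℚ.* ι n ℚ.+ ι 3) ℚ.* (ι 2 ℚ.* ι n ℚ.+ ι 3) ℚ.* wallis (suc n) ≡ ι 4 ℚ.* ((ι n ℚ.+ 1ℚ) ℚ.* (ι n ℚ.+ ι 2)) ℚ.* wallis n
wallis-recurrence n = begin
  P
    ≡⟨ solve 2 (λ p q → p := q :+ con 1ℚ :* (p :- q)) refl P Q ⟩
  Q ℚ.+ 1ℚ ℚ.* (P ℚ.- Q)
    ≡⟨ cong (λ w → Q ℚ.+ w ℚ.* (P ℚ.- Q)) (trans (sym (ι*u≡1 n)) (cong (ℚ._* u n) (trans (ι-suc n) (ℚP.+-comm 1ℚ x)))) ⟩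
  Q ℚ.+ (x ℚ.+ 1ℚ) ℚ.* u n ℚ.* (P ℚ.- Q)
    ≡⟨ solve 4 (λ q x v z → q :+ (x :+ con 1ℚ) :* v :* z := q :+ v :* ((x :+ con 1ℚ) :* z)) refl Q x (u n) (P ℚ.- Q) ⟩
  Q ℚ.+ u n ℚ.* ((x ℚ.+ 1ℚ) ℚ.* (P ℚ.- Q))
    ≡⟨ cong (λ w → Q ℚ.+ u n ℚ.* ((x ℚ.+ 1ℚ) ℚ.* (P ℚ.- ι 4 ℚ.* ((x ℚ.+ 1ℚ) ℚ.* (x ℚ.+ ι 2)) ℚ.* w))) (sym stable) ⟩
  Q ℚ.+ u n ℚ.* ((x ℚ.+ 1ℚ) ℚ.* (P ℚ.- ι 4 ℚ.* ((x ℚ.+ 1ℚ) ℚ.* (x ℚ.+ ι 2)) ℚ.* damped n (2 ℕ.+ n)))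
    ≡⟨ cong (λ w → Q ℚ.+ u n ℚ.* w) (trans (damped-recurrence n (2 ℕ.+ n))
         (cong (λ w → ℚ.- (ι 4 ℚ.* (sign (2 ℕ.+ n) ℚ.* (ι (2 ℕ.+ n) ℚ.* (x ℚ.+ ι 2 ℚ.+ ι (2 ℕ.+ n)) ℚ.* w)))) (ρ-vanish (suc n) 0))) ⟩
  Q ℚ.+ u n ℚ.* ℚ.- (ι 4 ℚ.* (sign (2 ℕ.+ n) ℚ.* (ι (2 ℕ.+ n) ℚ.* (x ℚ.+ ι 2 ℚ.+ ι (2 ℕ.+ n)) ℚ.* 0ℚ)))
    ≡⟨ solve 4 (λ q v s y → q :+ v :* (:- (con (ι 4) :* (s :* (y :* con 0ℚ)))) := q) refl Q (u n) (sign (2 ℕ.+ n)) (ι (2 ℕ.+ n) ℚ.* (x ℚ.+ ι 2 ℚ.+ ι (2 ℕ.+ n))) ⟩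
  Q ∎
  where
  open ≡-Reasoning
  open +-*-Solver
  x = ι n
  P = (ι 2 ℚ.* x ℚ.+ ι 3) ℚ.* (ι 2 ℚ.* x ℚ.+ ι 3) ℚ.* wallis (suc n)
  Q = ι 4 ℚ.* ((x ℚ.+ 1ℚ) ℚ.* (x ℚ.+ ι 2)) ℚ.* wallis n
  stable : damped n (2 ℕ.+ n) ≡ wallis n
  stable = trans (cong (λ w → wallis n ℚ.+ sign (suc n) ℚ.* (w ℚ.* leibnizTerm (suc n))) (ρ-vanish n 0))
    (solve 3 (λ w s t → w :+ s :* (con 0ℚ :* t) := w) refl (wallis n) (sign (suc n)) (leibnizTerm (suc n)))

b² : ℕ → ℚ
b² n = bₙ n ℚ.* bₙ n

0<b² : ∀ n → 0ℚ ℚ.< b² n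
0<b² n = 0<* (0<b n) (0<b n)

b²-suc : ∀ n → ι (suc n) ℚ.* (ι (suc n) ℚ.* b² (suc n)) ≡ (ι n ℚ.+ ½) ℚ.* (ι n ℚ.+ ½) ℚ.* b² n
b²-suc n = trans (solve 2 (λ m y → m :* (m :* (y :* y)) := (m :* y) :* (m :* y)) refl (ι (suc n)) (bₙ (suc n)))
  (trans (cong₂ ℚ._*_ (b-suc n) (b-suc n)) (solve 2 (λ h y → (h :* y) :* (h :* y) := h :* h :* (y :* y)) refl (ι n ℚ.+ ½) (bₙ n)))
  where open +-*-Solver

-- The recurrences of the complete sums and of b² have reciprocal factors up to a telescoping
-- quotient, which gives the closed form that links π with central binomial coefficients.
wallis-value : ∀ n → wallis n ℚ.* ((ι 2 ℚ.* ι n ℚ.+ 1ℚ) ℚ.* (ι 2 ℚ.* ι n ℚ.+ 1ℚ) ℚ.* b² n) ≡ ι 4 ℚ.* (ι n ℚ.+ 1ℚ)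
wallis-value zero    = refl
wallis-value (suc n) = begin
  W′ ℚ.* ((ι 2 ℚ.* ι (suc n) ℚ.+ 1ℚ) ℚ.* (ι 2 ℚ.* ι (suc n) ℚ.+ 1ℚ) ℚ.* b² (suc n))
    ≡⟨ cong (λ m → W′ ℚ.* ((ι 2 ℚ.* m ℚ.+ 1ℚ) ℚ.* (ι 2 ℚ.* m ℚ.+ 1ℚ) ℚ.* b² (suc n))) (ι-suc n) ⟩
  W′ ℚ.* ((ι 2 ℚ.* (1ℚ ℚ.+ x) ℚ.+ 1ℚ) ℚ.* (ι 2 ℚ.* (1ℚ ℚ.+ x) ℚ.+ 1ℚ) ℚ.* b² (suc n))
    ≡⟨ solve 3 (λ x w y → w :* ((con (ι 2) :* (con 1ℚ :+ x) :+ con 1ℚ) :* (con (ι 2) :* (con 1ℚ :+ x) :+ con 1ℚ) :* y)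
         := (con (ι 2) :* x :+ con (ι 3)) :* (con (ι 2) :* x :+ con (ι 3)) :* w :* y) refl x W′ (b² (suc n)) ⟩
  (ι 2 ℚ.* x ℚ.+ ι 3) ℚ.* (ι 2 ℚ.* x ℚ.+ ι 3) ℚ.* W′ ℚ.* b² (suc n)
    ≡⟨ cong (ℚ._* b² (suc n)) (wallis-recurrence n) ⟩
  ι 4 ℚ.* ((x ℚ.+ 1ℚ) ℚ.* (x ℚ.+ ι 2)) ℚ.* W ℚ.* b² (suc n)
    ≡⟨ unit (ι 4 ℚ.* ((x ℚ.+ 1ℚ) ℚ.* (x ℚ.+ ι 2)) ℚ.* W ℚ.* b² (suc n)) ⟩
  ι (suc n) ℚ.* v ℚ.* (ι 4 ℚ.* ((x ℚ.+ 1ℚ) ℚ.* (x ℚ.+ ι 2)) ℚ.* W ℚ.* b² (suc n))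
    ≡⟨ cong (λ m → m ℚ.* v ℚ.* (ι 4 ℚ.* ((x ℚ.+ 1ℚ) ℚ.* (x ℚ.+ ι 2)) ℚ.* W ℚ.* b² (suc n))) (ι-suc n) ⟩
  (1ℚ ℚ.+ x) ℚ.* v ℚ.* (ι 4 ℚ.* ((x ℚ.+ 1ℚ) ℚ.* (x ℚ.+ ι 2)) ℚ.* W ℚ.* b² (suc n))
    ≡⟨ solve 4 (λ x v w y → (con 1ℚ :+ x) :* v :* (con (ι 4) :* ((x :+ con 1ℚ) :* (x :+ con (ι 2))) :* w :* y)
         := con (ι 4) :* v :* (x :+ con (ι 2)) :* w :* ((con 1ℚ :+ x) :* ((con 1ℚ :+ x) :* y))) refl x v W (b² (suc n)) ⟩
  ι 4 ℚ.* v ℚ.* (x ℚ.+ ι 2) ℚ.* W ℚ.* ((1ℚ ℚ.+ x) ℚ.* ((1ℚ ℚ.+ x) ℚ.* b² (suc n)))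
    ≡⟨ cong (ι 4 ℚ.* v ℚ.* (x ℚ.+ ι 2) ℚ.* W ℚ.*_) (trans (cong (λ m → m ℚ.* (m ℚ.* b² (suc n))) (sym (ι-suc n))) (b²-suc n)) ⟩
  ι 4 ℚ.* v ℚ.* (x ℚ.+ ι 2) ℚ.* W ℚ.* ((x ℚ.+ ½) ℚ.* (x ℚ.+ ½) ℚ.* b² n)
    ≡⟨ solve 4 (λ x v w y → con (ι 4) :* v :* (x :+ con (ι 2)) :* w :* ((x :+ con ½) :* (x :+ con ½) :* y)
         := v :* (x :+ con (ι 2)) :* (w :* ((con (ι 2) :* x :+ con 1ℚ) :* (con (ι 2) :* x :+ con 1ℚ) :* y))) refl x v W (b² n) ⟩
  v ℚ.* (x ℚ.+ ι 2) ℚ.* (W ℚ.* ((ι 2 ℚ.* x ℚ.+ 1ℚ) ℚ.* (ι 2 ℚ.* x ℚ.+ 1ℚ) ℚ.* b² n))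
    ≡⟨ cong (v ℚ.* (x ℚ.+ ι 2) ℚ.*_) (wallis-value n) ⟩
  v ℚ.* (x ℚ.+ ι 2) ℚ.* (ι 4 ℚ.* (x ℚ.+ 1ℚ))
    ≡⟨ solve 2 (λ x v → v :* (x :+ con (ι 2)) :* (con (ι 4) :* (x :+ con 1ℚ)) := (con 1ℚ :+ x) :* v :* (con (ι 4) :* (con 1ℚ :+ x :+ con 1ℚ))) refl x v ⟩
  (1ℚ ℚ.+ x) ℚ.* v ℚ.* (ι 4 ℚ.* (1ℚ ℚ.+ x ℚ.+ 1ℚ))
    ≡⟨ cong (λ m → m ℚ.* v ℚ.* (ι 4 ℚ.* (m ℚ.+ 1ℚ))) (ι-suc n) ⟨
  ι (suc n) ℚ.* v ℚ.* (ι 4 ℚ.* (ι (suc n) ℚ.+ 1ℚ))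
    ≡⟨ unit (ι 4 ℚ.* (ι (suc n) ℚ.+ 1ℚ)) ⟨
  ι 4 ℚ.* (ι (suc n) ℚ.+ 1ℚ) ∎
  where
  open ≡-Reasoning
  open +-*-Solver
  x = ι n
  v = u n
  W = wallis n
  W′ = wallis (suc n)
  unit : ∀ y → y ≡ ι (suc n) ℚ.* v ℚ.* y
  unit y = trans (sym (ℚP.*-identityˡ y)) (cong (ℚ._* y) (sym (ι*u≡1 n)))

cancel-pos : ∀ p {x y} → 0ℚ ℚ.< p → p ℚ.* x ℚ.≤ p ℚ.* y → x ℚ.≤ y
cancel-pos p 0<p h = ℚP.*-cancelˡ-≤-pos p {{ℚ.positive 0<p}} h

0<2ι+1 : ∀ n → 0ℚ ℚ.< ι 2 ℚ.* ι n ℚ.+ 1ℚ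
0<2ι+1 n = ℚP.+-mono-≤-< {0ℚ} {ι 2 ℚ.* ι n} {0ℚ} {1ℚ} (0≤* {ι 2} (0≤ι 2) (0≤ι n)) (ℚP.positive⁻¹ 1ℚ)

0≤wallis : ∀ n → 0ℚ ℚ.≤ wallis n
0≤wallis n = cancel-pos p 0<p (subst₂ ℚ._≤_ (sym (ℚP.*-zeroʳ p)) (trans (sym (wallis-value n)) (ℚP.*-comm (wallis n) p))
  (0≤* {ι 4} (0≤ι 4) (0≤+ (0≤ι n) (ℚP.nonNegative⁻¹ 1ℚ))))
  where
  p = (ι 2 ℚ.* ι n ℚ.+ 1ℚ) ℚ.* (ι 2 ℚ.* ι n ℚ.+ 1ℚ) ℚ.* b² n
  0<p : 0ℚ ℚ.< p
  0<p = 0<* {(ι 2 ℚ.* ι n ℚ.+ 1ℚ) ℚ.* (ι 2 ℚ.* ι n ℚ.+ 1ℚ)} (0<* (0<2ι+1 n) (0<2ι+1 n)) (0<b² n)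

-- Both sequences converge to 2 / π.
upper-wallis lower-wallis : ℕ → ℚ
upper-wallis n = (ι 2 ℚ.* ι n ℚ.+ 1ℚ) ℚ.* b² n
lower-wallis n = ι 2 ℚ.* ι n ℚ.* b² n

upper-wallis-step : ∀ n → upper-wallis (suc n) ℚ.≤ upper-wallis n
upper-wallis-step n = cancel-ι n (cancel-ι n (≤-by (¼ ℚ.* (ι 2 ℚ.* x ℚ.+ 1ℚ) ℚ.* b² n)
  (0≤* (0≤* {¼} (ℚP.nonNegative⁻¹ ¼) (ℚP.<⇒≤ (0<2ι+1 n))) (ℚP.<⇒≤ (0<b² n))) (begin
  m ℚ.* (m ℚ.* ((ι 2 ℚ.* m ℚ.+ 1ℚ) ℚ.* b² (suc n))) ℚ.+ ¼ ℚ.* (ι 2 ℚ.* x ℚ.+ 1ℚ) ℚ.* b² n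
    ≡⟨ solve 3 (λ m y r → m :* (m :* ((con (ι 2) :* m :+ con 1ℚ) :* y)) :+ r := (con (ι 2) :* m :+ con 1ℚ) :* (m :* (m :* y)) :+ r) refl m (b² (suc n)) (¼ ℚ.* (ι 2 ℚ.* x ℚ.+ 1ℚ) ℚ.* b² n) ⟩
  (ι 2 ℚ.* m ℚ.+ 1ℚ) ℚ.* (m ℚ.* (m ℚ.* b² (suc n))) ℚ.+ ¼ ℚ.* (ι 2 ℚ.* x ℚ.+ 1ℚ) ℚ.* b² n
    ≡⟨ cong₂ (λ k w → (ι 2 ℚ.* k ℚ.+ 1ℚ) ℚ.* w ℚ.+ ¼ ℚ.* (ι 2 ℚ.* x ℚ.+ 1ℚ) ℚ.* b² n) (ι-suc n) (b²-suc n) ⟩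
  (ι 2 ℚ.* (1ℚ ℚ.+ x) ℚ.+ 1ℚ) ℚ.* ((x ℚ.+ ½) ℚ.* (x ℚ.+ ½) ℚ.* b² n) ℚ.+ ¼ ℚ.* (ι 2 ℚ.* x ℚ.+ 1ℚ) ℚ.* b² n
    ≡⟨ solve 2 (λ x y → (con (ι 2) :* (con 1ℚ :+ x) :+ con 1ℚ) :* ((x :+ con ½) :* (x :+ con ½) :* y) :+ con ¼ :* (con (ι 2) :* x :+ con 1ℚ) :* y
         := (con 1ℚ :+ x) :* ((con 1ℚ :+ x) :* ((con (ι 2) :* x :+ con 1ℚ) :* y))) refl x (b² n) ⟩
  (1ℚ ℚ.+ x) ℚ.* ((1ℚ ℚ.+ x) ℚ.* ((ι 2 ℚ.* x ℚ.+ 1ℚ) ℚ.* b² n))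
    ≡⟨ cong (λ k → k ℚ.* (k ℚ.* upper-wallis n)) (ι-suc n) ⟨
  m ℚ.* (m ℚ.* upper-wallis n) ∎)))
  where
  open ≡-Reasoning
  open +-*-Solver
  x = ι n
  m = ι (suc n)

lower-wallis-step : ∀ n → lower-wallis n ℚ.≤ lower-wallis (suc n)
lower-wallis-step n = cancel-ι n (cancel-ι n (≤-by (½ ℚ.* (1ℚ ℚ.+ x) ℚ.* b² n)
  (0≤* (0≤* {½} (ℚP.nonNegative⁻¹ ½) (0≤+ {1ℚ} (ℚP.nonNegative⁻¹ 1ℚ) (0≤ι n))) (ℚP.<⇒≤ (0<b² n))) (begin
  m ℚ.* (m ℚ.* (ι 2 ℚ.* x ℚ.* b² n)) ℚ.+ ½ ℚ.* (1ℚ ℚ.+ x) ℚ.* b² n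
    ≡⟨ cong (λ k → k ℚ.* (k ℚ.* (ι 2 ℚ.* x ℚ.* b² n)) ℚ.+ ½ ℚ.* (1ℚ ℚ.+ x) ℚ.* b² n) (ι-suc n) ⟩
  (1ℚ ℚ.+ x) ℚ.* ((1ℚ ℚ.+ x) ℚ.* (ι 2 ℚ.* x ℚ.* b² n)) ℚ.+ ½ ℚ.* (1ℚ ℚ.+ x) ℚ.* b² n
    ≡⟨ solve 2 (λ x y → (con 1ℚ :+ x) :* ((con 1ℚ :+ x) :* (con (ι 2) :* x :* y)) :+ con ½ :* (con 1ℚ :+ x) :* y
         := con (ι 2) :* (con 1ℚ :+ x) :* ((x :+ con ½) :* (x :+ con ½) :* y)) refl x (b² n) ⟩
  ι 2 ℚ.* (1ℚ ℚ.+ x) ℚ.* ((x ℚ.+ ½) ℚ.* (x ℚ.+ ½) ℚ.* b² n)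
    ≡⟨ cong₂ (λ k w → ι 2 ℚ.* k ℚ.* w) (sym (ι-suc n)) (sym (b²-suc n)) ⟩
  ι 2 ℚ.* m ℚ.* (m ℚ.* (m ℚ.* b² (suc n)))
    ≡⟨ solve 2 (λ m y → con (ι 2) :* m :* (m :* (m :* y)) := m :* (m :* (con (ι 2) :* m :* y))) refl m (b² (suc n)) ⟩
  m ℚ.* (m ℚ.* lower-wallis (suc n)) ∎)))
  where
  open ≡-Reasoning
  open +-*-Solver
  x = ι n
  m = ι (suc n)

upper-wallis-antitone : ∀ i n → upper-wallis (i ℕ.+ n) ℚ.≤ upper-wallis n
upper-wallis-antitone zero    n = ℚP.≤-refl
upper-wallis-antitone (suc i) n = ℚP.≤-trans (upper-wallis-step (i ℕ.+ n)) (upper-wallis-antitone i n)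

lower-wallis-monotone : ∀ i n → lower-wallis n ℚ.≤ lower-wallis (i ℕ.+ n)
lower-wallis-monotone zero    n = ℚP.≤-refl
lower-wallis-monotone (suc i) n = ℚP.≤-trans (lower-wallis-monotone i n) (lower-wallis-step (i ℕ.+ n))

-- By the closed form the product is 4 (n + 1) / (2n + 1).
wallis-upper : ∀ n → ι 2 ℚ.≤ wallis n ℚ.* upper-wallis n
wallis-upper n = cancel-pos p (0<2ι+1 n) (≤-by (ι 2) (0≤ι 2) (trans
  (solve 1 (λ x → (con (ι 2) :* x :+ con 1ℚ) :* con (ι 2) :+ con (ι 2) := con (ι 4) :* (x :+ con 1ℚ)) refl (ι n))
  (trans (sym (wallis-value n)) (solve 3 (λ w p y → w :* (p :* p :* y) := p :* (w :* (p :* y))) refl (wallis n) p (b² n)))))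
  where
  open +-*-Solver
  p = ι 2 ℚ.* ι n ℚ.+ 1ℚ

-- By the closed form the product is 8n (n + 1) / (2n + 1)², just below 2.
wallis-lower : ∀ n → wallis n ℚ.* lower-wallis n ℚ.≤ ι 2
wallis-lower n = cancel-pos (p ℚ.* p) (0<* (0<2ι+1 n) (0<2ι+1 n)) (≤-by (ι 2) (0≤ι 2) (begin
  p ℚ.* p ℚ.* (wallis n ℚ.* (ι 2 ℚ.* x ℚ.* b² n)) ℚ.+ ι 2
    ≡⟨ solve 4 (λ p w x y → p :* p :* (w :* (con (ι 2) :* x :* y)) :+ con (ι 2) := con (ι 2) :* x :* (w :* (p :* p :* y)) :+ con (ι 2)) refl p (wallis n) x (b² n) ⟩
  ι 2 ℚ.* x ℚ.* (wallis n ℚ.* (p ℚ.* p ℚ.* b² n)) ℚ.+ ι 2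
    ≡⟨ cong (λ w → ι 2 ℚ.* x ℚ.* w ℚ.+ ι 2) (wallis-value n) ⟩
  ι 2 ℚ.* x ℚ.* (ι 4 ℚ.* (x ℚ.+ 1ℚ)) ℚ.+ ι 2
    ≡⟨ solve 1 (λ x → let p = con (ι 2) :* x :+ con 1ℚ in con (ι 2) :* x :* (con (ι 4) :* (x :+ con 1ℚ)) :+ con (ι 2) := p :* p :* con (ι 2)) refl x ⟩
  p ℚ.* p ℚ.* ι 2 ∎))
  where
  open ≡-Reasoning
  open +-*-Solver
  x = ι n
  p = ι 2 ℚ.* x ℚ.+ 1ℚ

module _ (n j : ℕ) (j≤n : j ℕ.≤ n) where

  private
    W = wallis n
    0≤W = 0≤wallis n
    n≡ = ℕP.m∸n+n≡m j≤n

  -- Monotonicity separates the two indices, so that n can tend to infinity while j stays fixed.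
  2≤wallis*upper : ι 2 ℚ.≤ W ℚ.* upper-wallis j
  2≤wallis*upper = ℚP.≤-trans (wallis-upper n) (ℚP.*-monoˡ-≤-nonNeg W {{ℚ.nonNegative 0≤W}}
    (subst (λ k → upper-wallis k ℚ.≤ upper-wallis j) n≡ (upper-wallis-antitone (n ℕ.∸ j) j)))

  wallis*lower≤2 : W ℚ.* lower-wallis j ℚ.≤ ι 2
  wallis*lower≤2 = ℚP.≤-trans (ℚP.*-monoˡ-≤-nonNeg W {{ℚ.nonNegative 0≤W}}
    (subst (λ k → lower-wallis j ℚ.≤ lower-wallis k) n≡ (lower-wallis-monotone (n ℕ.∸ j) j))) (wallis-lower n)

2≤wallis : ∀ n → ι 2 ℚ.≤ wallis n
2≤wallis n = subst (ι 2 ℚ.≤_) (ℚP.*-identityʳ (wallis n)) (2≤wallis*upper n 0 ℕ.z≤n)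

j*b²≤½ : ∀ j → ι j ℚ.* b² j ℚ.≤ ½
j*b²≤½ j = ℚP.*-cancelˡ-≤-pos (ι 4) (begin
  ι 4 ℚ.* (ι j ℚ.* b² j)                 ≡⟨ solve 2 (λ l y → con (ι 4) :* (l :* y) := con (ι 2) :* (con (ι 2) :* l :* y)) refl (ι j) (b² j) ⟩
  ι 2 ℚ.* lower-wallis j                 ≤⟨ ℚP.*-monoʳ-≤-nonNeg (lower-wallis j) {{ℚ.nonNegative (0≤* (0≤* {ι 2} (0≤ι 2) (0≤ι j)) (ℚP.<⇒≤ (0<b² j)))}} (2≤wallis j) ⟩
  wallis j ℚ.* lower-wallis j            ≤⟨ wallis-lower j ⟩
  ι 2                                    ∎)
  where
  open ℚP.≤-Reasoning
  open +-*-Solver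

-- The lower and the upper sequence differ by the factor 1 + 1/(2L) at L = j + 1, which confines the
-- product to an interval of length O(1/L) around 1.
wallis-close : ∀ n j → suc j ℕ.≤ n → wallis n ℚ.* (ι (suc j) ℚ.* b² (suc j)) ℚ.- 1ℚ ⊑ u j
wallis-close n j j<n = absolute (∣∣-≤ {W ℚ.* (L ℚ.* β) ℚ.- 1ℚ} {v}
  (≤-by (½ ℚ.* (ι 2 ℚ.- W ℚ.* lower-wallis (suc j)) ℚ.+ v) (0≤+ (0≤* {½} (ℚP.nonNegative⁻¹ ½) (0≤- below)) 0≤v)
    (solve 4 (λ w l y v → w :* (l :* y) :- con 1ℚ :+ (con ½ :* (con (ι 2) :- w :* (con (ι 2) :* l :* y)) :+ v) := v) refl W L β v))
  (≤-by (½ ℚ.* (W ℚ.* upper-wallis (suc j) ℚ.- ι 2) ℚ.+ ¼ ℚ.* v ℚ.* (ι 2 ℚ.- W ℚ.* lower-wallis (suc j)) ℚ.+ ½ ℚ.* v)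
    (0≤+ (0≤+ (0≤* {½} (ℚP.nonNegative⁻¹ ½) (0≤- (2≤wallis*upper n (suc j) j<n))) (0≤* (0≤* {¼} (ℚP.nonNegative⁻¹ ¼) 0≤v) (0≤- below))) (0≤* {½} (ℚP.nonNegative⁻¹ ½) 0≤v))
    (trans (solve 4 (λ w l y v → (:- (w :* (l :* y) :- con 1ℚ)) :+ (con ½ :* (w :* ((con (ι 2) :* l :+ con 1ℚ) :* y) :- con (ι 2))
              :+ con ¼ :* v :* (con (ι 2) :- w :* (con (ι 2) :* l :* y)) :+ con ½ :* v) := v :+ con ½ :* w :* y :* (con 1ℚ :- l :* v)) refl W L β v)
      (trans (cong (λ k → v ℚ.+ ½ ℚ.* W ℚ.* β ℚ.* (1ℚ ℚ.- k)) (ι*u≡1 j)) (solve 2 (λ v y → v :+ y :* (con 1ℚ :- con 1ℚ) := v) refl v (½ ℚ.* W ℚ.* β))))))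
  where
  open +-*-Solver
  W = wallis n
  L = ι (suc j)
  β = b² (suc j)
  v = u j
  0≤v = ℚP.<⇒≤ (0<u j)
  below = wallis*lower≤2 n (suc j) j<n

-- For fixed k the damping disappears as n grows. One step of ρ costs at most (2k + 2) / (n + 1),
-- and these costs add up to k (k + 1) / (n + 1).
ρ-near : ∀ n k → 1ℚ ℚ.- ρ n k ⊑ ι k ℚ.* (ι k ℚ.+ 1ℚ) ℚ.* u n
ρ-near n k = ⊑-intro (0≤- (ρ≤1 n k)) (go k)
  where
  open +-*-Solver
  step-bound : ∀ k → ρ n k ℚ.- ρ n (suc k) ℚ.≤ (ι 2 ℚ.* ι k ℚ.+ ι 2) ℚ.* u n
  step-bound k = cancel-ι n (≤-by ((ι k ℚ.+ 1ℚ) ℚ.* (ρ n k ℚ.- ρ n (suc k)) ℚ.+ (ι 2 ℚ.* ι k ℚ.+ ι 2) ℚ.* (1ℚ ℚ.- ρ n k))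
    (0≤+ (0≤* (0≤+ (0≤ι k) (ℚP.nonNegative⁻¹ 1ℚ)) (0≤- (ρ-antitone n k))) (0≤* (0≤+ (0≤* {ι 2} (0≤ι 2) (0≤ι k)) (0≤ι 2)) (0≤- (ρ≤1 n k))))
    (begin
      ι (suc n) ℚ.* (r ℚ.- r′) ℚ.+ ((y ℚ.+ 1ℚ) ℚ.* (r ℚ.- r′) ℚ.+ (ι 2 ℚ.* y ℚ.+ ι 2) ℚ.* (1ℚ ℚ.- r))
        ≡⟨ cong (λ m → m ℚ.* (r ℚ.- r′) ℚ.+ ((y ℚ.+ 1ℚ) ℚ.* (r ℚ.- r′) ℚ.+ (ι 2 ℚ.* y ℚ.+ ι 2) ℚ.* (1ℚ ℚ.- r))) (ι-suc n) ⟩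
      (1ℚ ℚ.+ x) ℚ.* (r ℚ.- r′) ℚ.+ ((y ℚ.+ 1ℚ) ℚ.* (r ℚ.- r′) ℚ.+ (ι 2 ℚ.* y ℚ.+ ι 2) ℚ.* (1ℚ ℚ.- r))
        ≡⟨ solve 4 (λ x y r r′ → (con 1ℚ :+ x) :* (r :- r′) :+ ((y :+ con 1ℚ) :* (r :- r′) :+ (con (ι 2) :* y :+ con (ι 2)) :* (con 1ℚ :- r))
             := (con (ι 2) :* y :+ con (ι 2)) :+ ((x :- y) :* r :- (x :+ con (ι 2) :+ y) :* r′)) refl x y r r′ ⟩
      (ι 2 ℚ.* y ℚ.+ ι 2) ℚ.+ ((x ℚ.- y) ℚ.* r ℚ.- (x ℚ.+ ι 2 ℚ.+ y) ℚ.* r′)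
        ≡⟨ cong (λ w → (ι 2 ℚ.* y ℚ.+ ι 2) ℚ.+ ((x ℚ.- y) ℚ.* r ℚ.- w)) (ρ-suc n k) ⟩
      (ι 2 ℚ.* y ℚ.+ ι 2) ℚ.+ ((x ℚ.- y) ℚ.* r ℚ.- (x ℚ.- y) ℚ.* r)
        ≡⟨ solve 2 (λ q w → q :+ (w :- w) := con 1ℚ :* q) refl (ι 2 ℚ.* y ℚ.+ ι 2) ((x ℚ.- y) ℚ.* r) ⟩
      1ℚ ℚ.* (ι 2 ℚ.* y ℚ.+ ι 2)
        ≡⟨ cong (ℚ._* (ι 2 ℚ.* y ℚ.+ ι 2)) (ι*u≡1 n) ⟨
      ι (suc n) ℚ.* u n ℚ.* (ι 2 ℚ.* y ℚ.+ ι 2)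
        ≡⟨ solve 3 (λ m v q → m :* v :* q := m :* (q :* v)) refl (ι (suc n)) (u n) (ι 2 ℚ.* y ℚ.+ ι 2) ⟩
      ι (suc n) ℚ.* ((ι 2 ℚ.* y ℚ.+ ι 2) ℚ.* u n) ∎))
    where
    open ≡-Reasoning
    x = ι n
    y = ι k
    r = ρ n k
    r′ = ρ n (suc k)
  go : ∀ k → 1ℚ ℚ.- ρ n k ℚ.≤ ι k ℚ.* (ι k ℚ.+ 1ℚ) ℚ.* u n
  go zero    = ℚP.≤-reflexive (solve 1 (λ v → con 1ℚ :- con 1ℚ := con 0ℚ :* (con 0ℚ :+ con 1ℚ) :* v) refl (u n))
  go (suc k) = ≤-by ((ι k ℚ.* (ι k ℚ.+ 1ℚ) ℚ.* u n ℚ.- (1ℚ ℚ.- ρ n k)) ℚ.+ ((ι 2 ℚ.* ι k ℚ.+ ι 2) ℚ.* u n ℚ.- (ρ n k ℚ.- ρ n (suc k))))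
    (0≤+ (0≤- (go k)) (0≤- (step-bound k)))
    (trans (solve 4 (λ y v r r′ → con 1ℚ :- r′ :+ ((y :* (y :+ con 1ℚ) :* v :- (con 1ℚ :- r)) :+ ((con (ι 2) :* y :+ con (ι 2)) :* v :- (r :- r′)))
        := (con 1ℚ :+ y) :* (con 1ℚ :+ y :+ con 1ℚ) :* v) refl (ι k) (u n) (ρ n k) (ρ n (suc k)))
      (cong (λ m → m ℚ.* (m ℚ.+ 1ℚ) ℚ.* u n) (sym (ι-suc k))))

0≤leibnizTerm : ∀ k → 0ℚ ℚ.≤ leibnizTerm k
0≤leibnizTerm k = 0≤/ 4 (2 ℕ.* k)

damping : ℕ → ℚ
damping zero    = 0ℚ
damping (suc k) = damping k ℚ.+ ι k ℚ.* (ι k ℚ.+ 1ℚ) ℚ.* leibnizTerm k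

damped-near : ∀ n k → leibnizSum k ℚ.- damped n k ⊑ damping k ℚ.* u n
damped-near n zero    = absolute (ℚP.≤-reflexive (sym (ℚP.*-zeroˡ (u n))))
damped-near n (suc k) = subst₂ _⊑_
  (solve 5 (λ l d s r t → l :- d :+ s :* ((con 1ℚ :- r) :* t) := l :+ s :* t :- (d :+ s :* (r :* t))) refl (leibnizSum k) (damped n k) (sign k) (ρ n k) (leibnizTerm k))
  (solve 4 (λ q y t v → q :* v :+ con 1ℚ :* (y :* v :* t) := (q :+ y :* t) :* v) refl (damping k) (ι k ℚ.* (ι k ℚ.+ 1ℚ)) (leibnizTerm k) (u n))
  (⊑-+ (damped-near n k) (⊑-* {sign k} {a = 1ℚ} (absolute (ℚP.≤-reflexive (∣sign∣ k))) (⊑-* (ρ-near n k) (⊑-refl (0≤leibnizTerm k)))))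
  where open +-*-Solver

dampedTail : ℕ → ℕ → ℕ → ℚ
dampedTail n k zero    = 0ℚ
dampedTail n k (suc m) = ρ n k ℚ.* leibnizTerm k ℚ.- dampedTail n (suc k) m

dampedTail-bounds : ∀ n k m → 0ℚ ℚ.≤ dampedTail n k m × dampedTail n k m ℚ.≤ ρ n k ℚ.* leibnizTerm k
dampedTail-bounds n k zero    = ℚP.≤-refl , 0≤* (0≤ρ n k) (0≤leibnizTerm k)
dampedTail-bounds n k (suc m) with dampedTail-bounds n (suc k) m
... | lo , hi = 0≤- (ℚP.≤-trans hi (*-mono-≤ (0≤ρ n (suc k)) (ρ-antitone n k) (0≤leibnizTerm (suc k)) (leibnizTerm-anti (ℕP.n≤1+n k))))
              , ≤-by (dampedTail n (suc k) m) lo (solve 2 (λ t r → t :- r :+ r := t) refl (ρ n k ℚ.* leibnizTerm k) (dampedTail n (suc k) m))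
  where open +-*-Solver

damped-+ : ∀ n k m → damped n (m ℕ.+ k) ≡ damped n k ℚ.+ sign k ℚ.* dampedTail n k m
damped-+ n k zero    = solve 2 (λ d s → d := d :+ s :* con 0ℚ) refl (damped n k) (sign k)
  where open +-*-Solver
damped-+ n k (suc m) = trans (cong (damped n) (sym (ℕP.+-suc m k))) (trans (damped-+ n (suc k) m)
  (solve 4 (λ d s x r → d :+ s :* x :+ (:- s) :* r := d :+ s :* (x :- r)) refl (damped n k) (sign k) (ρ n k ℚ.* leibnizTerm k) (dampedTail n (suc k) m)))
  where open +-*-Solver

-- The damped series still alternates with decreasing terms, so its remainder is bounded by the
-- first omitted term, uniformly in n.
wallis-tail : ∀ n k → k ℕ.≤ n → damped n k ℚ.- wallis n ⊑ leibnizTerm k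
wallis-tail n k k≤n = subst (_⊑ leibnizTerm k)
  (trans (solve 3 (λ d s r → :- (s :* r) := d :- (d :+ s :* r)) refl (damped n k) (sign k) (dampedTail n k m))
    (cong (λ w → damped n k ℚ.- w) (trans (sym (damped-+ n k m)) (cong (damped n) (ℕP.m∸n+n≡m (ℕP.m≤n⇒m≤1+n k≤n))))))
  (⊑-neg (⊑-weaken (⊑-* {sign k} {a = 1ℚ} (absolute (ℚP.≤-reflexive (∣sign∣ k))) (⊑-intro (proj₁ (dampedTail-bounds n k m)) (proj₂ (dampedTail-bounds n k m)))) (begin
    1ℚ ℚ.* (ρ n k ℚ.* leibnizTerm k)    ≡⟨ ℚP.*-identityˡ (ρ n k ℚ.* leibnizTerm k) ⟩
    ρ n k ℚ.* leibnizTerm k             ≤⟨ ℚP.*-monoʳ-≤-nonNeg (leibnizTerm k) {{ℚ.nonNegative (0≤leibnizTerm k)}} (ρ≤1 n k) ⟩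
    1ℚ ℚ.* leibnizTerm k                ≡⟨ ℚP.*-identityˡ (leibnizTerm k) ⟩
    leibnizTerm k                       ∎)))
  where
  open ℚP.≤-Reasoning
  open +-*-Solver
  m = suc n ℕ.∸ k

-- A limit exchanged with a sum by cutting both at k: the tails are small by alternation, the heads
-- agree up to O(1/n) for fixed k.
leibniz-wallis : ∀ m n k → k ℕ.≤ m → k ℕ.≤ n → leibnizSum m ℚ.- wallis n ⊑ ι 2 ℚ.* leibnizTerm k ℚ.+ damping k ℚ.* u n
leibniz-wallis m n k k≤m k≤n = subst₂ _⊑_
  (solve 4 (λ a b c d → (a :- b) :+ (b :- c) :+ (c :- d) := a :- d) refl (leibnizSum m) (leibnizSum k) (damped n k) (wallis n))
  (solve 2 (λ t q → t :+ q :+ t := con (ι 2) :* t :+ q) refl (leibnizTerm k) (damping k ℚ.* u n))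
  (⊑-+ (⊑-+ (absolute (leibnizSum-close k m k k≤m ℕP.≤-refl)) (damped-near n k)) (wallis-tail n k k≤n))
  where open +-*-Solver

leibnizTerm≤ : ∀ k → leibnizTerm k ℚ.≤ ι 4 ℚ.* u k
leibnizTerm≤ k = ℚP.≤-trans (ℚP.≤-reflexive (/-≡ι*u 4 (2 ℕ.* k))) (ℚP.*-monoˡ-≤-nonNeg (ι 4) (u-anti (ℕP.m≤n*m k 2)))

-- The statement π j b_j² = 1 + O(1/j) on the level of the sequence that represents π; the auxiliary
-- index n of Wallis's sums has disappeared from it.
π-b² : ∀ j η → 0ℚ ℚ.< η → ∃[ m₀ ] ∀ m → m₀ ℕ.≤ m → leibnizSum m ℚ.* (ι (suc j) ℚ.* b² (suc j)) ℚ.- 1ℚ ⊑ u j ℚ.+ η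
π-b² j η 0<η = k , λ m k≤m → subst₂ _⊑_
  (solve 3 (λ p w y → (p :- w) :* y :+ (w :* y :- con 1ℚ) := p :* y :- con 1ℚ) refl (leibnizSum m) (wallis n) y)
  (ℚP.+-comm η (u j))
  (⊑-+ (⊑-weaken (⊑-* (leibniz-wallis m n k k≤m k≤n) (⊑-intro 0≤y (j*b²≤½ (suc j)))) small) (wallis-close n j j<n))
  where
  open +-*-Solver
  y = ι (suc j) ℚ.* b² (suc j)
  0≤y = 0≤* (0≤ι (suc j)) (ℚP.<⇒≤ (0<b² (suc j)))
  -- The cut k is fixed before n, because `damping k` grows with k and has to be beaten by n.
  k-limit = archimedean-* (ι 8) η 0<η
  k = proj₁ k-limit
  n-limit = archimedean-* (damping k) η 0<η
  n = proj₁ n-limit ℕ.⊔ (k ℕ.⊔ suc j)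
  k≤n : k ℕ.≤ n
  k≤n = ℕP.≤-trans (ℕP.m≤m⊔n k (suc j)) (ℕP.m≤n⊔m (proj₁ n-limit) (k ℕ.⊔ suc j))
  j<n : suc j ℕ.≤ n
  j<n = ℕP.≤-trans (ℕP.m≤n⊔m k (suc j)) (ℕP.m≤n⊔m (proj₁ n-limit) (k ℕ.⊔ suc j))
  small : (ι 2 ℚ.* leibnizTerm k ℚ.+ damping k ℚ.* u n) ℚ.* ½ ℚ.≤ η
  small = ≤-by ((ι 4 ℚ.* u k ℚ.- leibnizTerm k) ℚ.+ ½ ℚ.* (η ℚ.- ι 8 ℚ.* u k) ℚ.+ ½ ℚ.* (η ℚ.- damping k ℚ.* u n))
    (0≤+ (0≤+ (0≤- (leibnizTerm≤ k)) (0≤* {½} (ℚP.nonNegative⁻¹ ½) (0≤- (proj₂ k-limit k ℕP.≤-refl))))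
      (0≤* {½} (ℚP.nonNegative⁻¹ ½) (0≤- (proj₂ n-limit n (ℕP.m≤m⊔n (proj₁ n-limit) (k ℕ.⊔ suc j))))))
    (solve 4 (λ t v q η → (con (ι 2) :* t :+ q) :* con ½ :+ ((con (ι 4) :* v :- t) :+ con ½ :* (η :- con (ι 8) :* v) :+ con ½ :* (η :- q)) := η) refl
      (leibnizTerm k) (u k) (damping k ℚ.* u n) η)

-- The asymptotic formula

≤-from-squares : ∀ {x y} → 0ℚ ℚ.≤ y → x ℚ.* x ℚ.≤ y ℚ.* y → x ℚ.≤ y
≤-from-squares {x} {y} 0≤y h = ⊑-≤ (square-⊑ {x} {y} 0≤y h)

-- r is the square root of y up to the error w.
record Root (r y w : ℚ) : Set where
  constructor root-of
  field
    1≤r   : 1ℚ ℚ.≤ r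
    below : r ℚ.* r ℚ.≤ y
    above : y ℚ.≤ (r ℚ.+ w) ℚ.* (r ℚ.+ w)

  0≤r : 0ℚ ℚ.≤ r
  0≤r = ℚP.≤-trans (ℚP.nonNegative⁻¹ 1ℚ) 1≤r

-- As 9/4 = (3/2)² and the precision is at most 1/2, the approximate root is at least 3/2 - 1/2 = 1.
sqrtℚ-root : ∀ m y → u m ℚ.≤ ½ → (+ 9 ℚ./ 4) ℚ.≤ y → Root (sqrtℚ m y) y (u m)
sqrtℚ-root m y w≤½ 9/4≤y = root-of 1≤r (sqrtℚ-lower m y (ℚP.<-≤-trans (ℚP.positive⁻¹ 1ℚ) 1≤r)) (sqrtℚ-upper m y)
  where
  r = sqrtℚ m y
  lift : ∀ r w → w ℚ.≤ ½ → (+ 3 ℚ./ 2) ℚ.≤ r ℚ.+ w → 1ℚ ℚ.≤ r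
  lift r w h k = ≤-by ((½ ℚ.- w) ℚ.+ (r ℚ.+ w ℚ.- (+ 3 ℚ./ 2))) (0≤+ (0≤- h) (0≤- k))
    (solve 2 (λ r w → con 1ℚ :+ ((con ½ :- w) :+ (r :+ w :- con (+ 3 ℚ./ 2))) := r) refl r w)
    where open +-*-Solver
  1≤r : 1ℚ ℚ.≤ r
  1≤r = lift r (u m) w≤½ (≤-from-squares {+ 3 ℚ./ 2} (0≤+ (sqrtℚ-nonNeg m y) (ℚP.<⇒≤ (0<u m))) (ℚP.≤-trans 9/4≤y (sqrtℚ-upper m y)))

-- The defect is at most (r + w)² - r² = 2 r w + w², where r ≤ k and w² ≤ w.
root-defect : ∀ {r y w k} → Root r y w → 0ℚ ℚ.≤ w → w ℚ.≤ 1ℚ → 0ℚ ℚ.≤ k → y ℚ.≤ k ℚ.* k → y ℚ.- r ℚ.* r ⊑ (ι 2 ℚ.* k ℚ.+ 1ℚ) ℚ.* w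
root-defect {r} {y} {w} {k} R 0≤w w≤1 0≤k y≤k² = ⊑-intro (0≤- below)
  (≤-by (((r ℚ.+ w) ℚ.* (r ℚ.+ w) ℚ.- y) ℚ.+ ι 2 ℚ.* w ℚ.* (k ℚ.- r) ℚ.+ w ℚ.* (1ℚ ℚ.- w))
    (0≤+ (0≤+ (0≤- above) (0≤* (0≤* {ι 2} (0≤ι 2) 0≤w) (0≤- (≤-from-squares 0≤k (ℚP.≤-trans below y≤k²))))) (0≤* 0≤w (0≤- w≤1)))
    (solve 4 (λ r y w k → y :- r :* r :+ (((r :+ w) :* (r :+ w) :- y) :+ con (ι 2) :* w :* (k :- r) :+ w :* (con 1ℚ :- w)) := (con (ι 2) :* k :+ con 1ℚ) :* w) refl r y w k))
  where
  open Root R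
  open +-*-Solver

-- The quantities at one late index of the real sequences: P is the partial sum for π, L = j, v =
-- 1/j, β = b_j², η is a tolerance for the limit of P L β, and w is the precision of the square
-- roots.
record Scale (P L v β η w : ℚ) : Set where
  field
    1≤P   : 1ℚ ℚ.≤ P
    P≤4   : P ℚ.≤ ι 4
    3≤L   : ι 3 ℚ.≤ L
    L*v≡1 : L ℚ.* v ≡ 1ℚ
    0≤v   : 0ℚ ℚ.≤ v
    v≤1   : v ℚ.≤ 1ℚ
    0≤β   : 0ℚ ℚ.≤ β
    0≤η   : 0ℚ ℚ.≤ η
    η≤1   : η ℚ.≤ 1ℚ
    0≤w   : 0ℚ ℚ.≤ w
    w≤½   : w ℚ.≤ ½
    PLβ≈1 : P ℚ.* (L ℚ.* β) ℚ.- 1ℚ ⊑ v ℚ.+ η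

  0≤P : 0ℚ ℚ.≤ P
  0≤P = ℚP.≤-trans (ℚP.nonNegative⁻¹ 1ℚ) 1≤P

  0≤L : 0ℚ ℚ.≤ L
  0≤L = ℚP.≤-trans (0≤ι 3) 3≤L

  w≤1 : w ℚ.≤ 1ℚ
  w≤1 = ℚP.≤-trans w≤½ (ℚP.≤ᵇ⇒≤ _)

  6≤2PL : ι 6 ℚ.≤ ι 2 ℚ.* P ℚ.* L
  6≤2PL = *-mono-≤ {ι 2} {ι 2 ℚ.* P} {ι 3} {L} (0≤ι 2) (ℚP.*-monoˡ-≤-nonNeg (ι 2) 1≤P) (0≤ι 3) 3≤L

  2PL≤64L² : ι 2 ℚ.* P ℚ.* L ℚ.≤ (ι 8 ℚ.* L) ℚ.* (ι 8 ℚ.* L)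
  2PL≤64L² = ≤-by (ι 2 ℚ.* L ℚ.* (ι 4 ℚ.- P) ℚ.+ ι 8 ℚ.* L ℚ.* (ι 8 ℚ.* (L ℚ.- ι 3) ℚ.+ ι 23))
    (0≤+ (0≤* (0≤* {ι 2} (0≤ι 2) 0≤L) (0≤- P≤4)) (0≤* (0≤* {ι 8} (0≤ι 8) 0≤L) (0≤+ (0≤* {ι 8} (0≤ι 8) (0≤- 3≤L)) (0≤ι 23))))
    (solve 2 (λ p l → con (ι 2) :* p :* l :+ (con (ι 2) :* l :* (con (ι 4) :- p) :+ con (ι 8) :* l :* (con (ι 8) :* (l :- con (ι 3)) :+ con (ι 23)))
      := (con (ι 8) :* l) :* (con (ι 8) :* l)) refl P L)
    where open +-*-Solver

-- The part of the error that vanishes with η and w while L is fixed. Its coefficients are 64 L + 9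
-- = 4 (16 L + 1) + 5, from the defects of the roots of 2 P L and of 3.
error : ℚ → ℚ → ℚ → ℚ
error L η w = ι 3 ℚ.* η ℚ.+ (ι 64 ℚ.* L ℚ.+ ι 9) ℚ.* w

-- Since g² is about 3β/8, the quantity 8 P L g² is about 3 P L β, hence about 3. The constant is 8
-- · 95000 · 3 + 3: the relative error of g² is multiplied by P L β ≤ 1 + v + η ≤ 3, and 3 (P L β -
-- 1) contributes the rest.
squares-close : ∀ {g P L v β η w r σ} → Scale P L v β η w → Root r (ι 3) w → Root σ (ι 2 ℚ.* P ℚ.* L) w →
  g ⊑ 1ℚ → g ℚ.* g ℚ.- (+ 3 ℚ./ 8) ℚ.* β ⊑ ι 95000 ℚ.* (v ℚ.* β) →
  ι 4 ℚ.* (σ ℚ.* σ) ℚ.* (g ℚ.* g) ℚ.- r ℚ.* r ⊑ ι 2280003 ℚ.* v ℚ.+ error L η w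
squares-close {g} {P} {L} {v} {β} {η} {w} {r} {σ} S r≈ σ≈ g≤1 g²≈ = subst (_⊑ ι 2280003 ℚ.* v ℚ.+ error L η w)
  (solve 6 (λ g p l β r σ →
    con (ι 8) :* ((p :* l) :* (g :* g :- con (+ 3 ℚ./ 8) :* β)) :+ con (ι 3) :* (p :* (l :* β) :- con 1ℚ)
      :+ con (ι 4) :* (:- ((g :* g) :* (con (ι 2) :* p :* l :- σ :* σ))) :+ (con (ι 3) :- r :* r)
    := con (ι 4) :* (σ :* σ) :* (g :* g) :- r :* r) refl g P L β r σ)
  (⊑-weaken
    (⊑-+ (⊑-+ (⊑-+ (⊑-* (⊑-refl {ι 8} (0≤ι 8)) (⊑-* (⊑-refl (0≤* 0≤P 0≤L)) g²≈)) (⊑-* (⊑-refl {ι 3} (0≤ι 3)) PLβ≈1))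
            (⊑-* (⊑-refl {ι 4} (0≤ι 4)) (⊑-neg (⊑-* (⊑-* g≤1 g≤1) (root-defect {k = ι 8 ℚ.* L} σ≈ 0≤w w≤1 (0≤* {ι 8} (0≤ι 8) 0≤L) 2PL≤64L²)))))
         (root-defect {k = ι 2} r≈ 0≤w w≤1 (0≤ι 2) (ℚP.≤ᵇ⇒≤ _)))
    (≤-by (ι 760000 ℚ.* v ℚ.* ((v ℚ.+ η ℚ.- (P ℚ.* (L ℚ.* β) ℚ.- 1ℚ)) ℚ.+ (1ℚ ℚ.- v) ℚ.+ (1ℚ ℚ.- η)))
      (0≤* (0≤* {ι 760000} (0≤ι 760000) 0≤v) (0≤+ (0≤+ (0≤- (⊑-≤ PLβ≈1)) (0≤- v≤1)) (0≤- η≤1)))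
      (solve 6 (λ p l β v η w →
        con (ι 8) :* ((p :* l) :* (con (ι 95000) :* (v :* β))) :+ con (ι 3) :* (v :+ η)
          :+ con (ι 4) :* (con 1ℚ :* con 1ℚ :* ((con (ι 2) :* (con (ι 8) :* l) :+ con 1ℚ) :* w)) :+ (con (ι 2) :* con (ι 2) :+ con 1ℚ) :* w
          :+ con (ι 760000) :* v :* ((v :+ η :- (p :* (l :* β) :- con 1ℚ)) :+ (con 1ℚ :- v) :+ (con 1ℚ :- η))
        := con (ι 2280003) :* v :+ (con (ι 3) :* η :+ (con (ι 64) :* l :+ con (ι 9)) :* w)) refl P L β v η w)))
  where
  open Scale S
  open +-*-Solver

0≤error : ∀ {P L v β η w} → Scale P L v β η w → 0ℚ ℚ.≤ error L η w
0≤error S = 0≤+ (0≤* {ι 3} (0≤ι 3) 0≤η) (0≤* (0≤+ (0≤* {ι 64} (0≤ι 64) 0≤L) (0≤ι 9)) 0≤w)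
  where open Scale S

-- The difference of the roots is the difference of the squares over the sum of the roots.
roots-close : ∀ {g P L v β η w r σ q} → Scale P L v β η w → Root r (ι 3) w → Root σ (ι 2 ℚ.* P ℚ.* L) w → Root q L w →
  g ⊑ 1ℚ → 0ℚ ℚ.≤ g → g ℚ.* g ℚ.- (+ 3 ℚ./ 8) ℚ.* β ⊑ ι 95000 ℚ.* (v ℚ.* β) →
  ½ ℚ.* g ℚ.- r ℚ.* inv (ι 4 ℚ.* σ) ⊑ ι 2280003 ℚ.* inv (q ℚ.* (q ℚ.* (q ℚ.* 1ℚ))) ℚ.+ error L η w
roots-close {g} {P} {L} {v} {β} {η} {w} {r} {σ} {q} S r≈ σ≈ q≈ g≤1 0≤g g²≈ = absolute (cancel-pos q 0<q (begin
  q ℚ.* ℚ.∣ δ ∣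
    ≤⟨ ℚP.*-monoʳ-≤-nonNeg (ℚ.∣ δ ∣) {{ℚ.nonNegative (ℚP.0≤∣p∣ δ)}} q≤m ⟩
  m ℚ.* ℚ.∣ δ ∣
    ≡⟨ cong (ℚ._* ℚ.∣ δ ∣) (ℚP.0≤p⇒∣p∣≡p (ℚP.≤-trans (Root.0≤r q≈) q≤m)) ⟨
  ℚ.∣ m ∣ ℚ.* ℚ.∣ δ ∣
    ≡⟨ ℚP.∣p*q∣≡∣p∣*∣q∣ m δ ⟨
  ℚ.∣ m ℚ.* δ ∣
    ≡⟨ cong ℚ.∣_∣ factor ⟩
  ℚ.∣ ι 4 ℚ.* (σ ℚ.* σ) ℚ.* (g ℚ.* g) ℚ.- r ℚ.* r ∣
    ≤⟨ ∣∣≤ (squares-close S r≈ σ≈ g≤1 g²≈) ⟩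
  C ℚ.* v ℚ.+ err
    ≤⟨ ≤-by (C ℚ.* (q ℚ.* I ℚ.- v) ℚ.+ err ℚ.* (q ℚ.- 1ℚ)) (0≤+ (0≤* {C} (0≤ι 2280003) (0≤- v≤qI)) (0≤* (0≤error S) (0≤- (Root.1≤r q≈))))
         (solve 5 (λ c v e q i → c :* v :+ e :+ (c :* (q :* i :- v) :+ e :* (q :- con 1ℚ)) := q :* (c :* i :+ e)) refl C v err q I) ⟩
  q ℚ.* (C ℚ.* I ℚ.+ err) ∎))
  where
  open ℚP.≤-Reasoning
  open +-*-Solver
  open Scale S
  C = ι 2280003
  err = error L η w
  q³ = q ℚ.* (q ℚ.* (q ℚ.* 1ℚ))
  I = inv q³
  y = r ℚ.* inv (ι 4 ℚ.* σ)
  δ = ½ ℚ.* g ℚ.- y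
  0<q = ℚP.<-≤-trans (ℚP.positive⁻¹ 1ℚ) (Root.1≤r q≈)
  0<σ = ℚP.<-≤-trans (ℚP.positive⁻¹ 1ℚ) (Root.1≤r σ≈)
  0≤σ = ℚP.<⇒≤ 0<σ
  0<q³ : 0ℚ ℚ.< q³
  0<q³ = 0<* 0<q (0<* 0<q (0<* {q} {1ℚ} 0<q (ℚP.positive⁻¹ 1ℚ)))
  0≤I = ℚP.<⇒≤ (inv-pos 0<q³)
  -- 16 σ² times the sum of the roots g / 2 and y
  m = ι 8 ℚ.* (σ ℚ.* σ) ℚ.* g ℚ.+ ι 4 ℚ.* σ ℚ.* r
  y*4σ : y ℚ.* (ι 4 ℚ.* σ) ≡ r
  y*4σ = trans (ℚP.*-assoc r (inv (ι 4 ℚ.* σ)) (ι 4 ℚ.* σ)) (trans (cong (r ℚ.*_) (inv-* (0<* {ι 4} (ℚP.positive⁻¹ (ι 4)) 0<σ))) (ℚP.*-identityʳ r))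
  factor : m ℚ.* δ ≡ ι 4 ℚ.* (σ ℚ.* σ) ℚ.* (g ℚ.* g) ℚ.- r ℚ.* r
  factor = trans (solve 4 (λ g y σ r → (con (ι 8) :* (σ :* σ) :* g :+ con (ι 4) :* σ :* r) :* (con ½ :* g :- y)
      := con (ι 4) :* (σ :* σ) :* (g :* g) :+ con (ι 2) :* σ :* g :* (r :- y :* (con (ι 4) :* σ)) :- r :* (y :* (con (ι 4) :* σ))) refl g y σ r)
    (trans (cong (λ z → ι 4 ℚ.* (σ ℚ.* σ) ℚ.* (g ℚ.* g) ℚ.+ ι 2 ℚ.* σ ℚ.* g ℚ.* (r ℚ.- z) ℚ.- r ℚ.* z) y*4σ)
      (solve 3 (λ g σ r → con (ι 4) :* (σ :* σ) :* (g :* g) :+ con (ι 2) :* σ :* g :* (r :- r) :- r :* r := con (ι 4) :* (σ :* σ) :* (g :* g) :- r :* r) refl g σ r))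
  q≤σ+w : q ℚ.≤ σ ℚ.+ w
  q≤σ+w = ≤-from-squares (0≤+ 0≤σ 0≤w) (ℚP.≤-trans (Root.below q≈) (ℚP.≤-trans L≤2PL (Root.above σ≈)))
    where
    L≤2PL : L ℚ.≤ ι 2 ℚ.* P ℚ.* L
    L≤2PL = ≤-by ((ι 2 ℚ.* (P ℚ.- 1ℚ) ℚ.+ 1ℚ) ℚ.* L) (0≤* (0≤+ (0≤* {ι 2} (0≤ι 2) (0≤- 1≤P)) (ℚP.nonNegative⁻¹ 1ℚ)) 0≤L)
      (solve 2 (λ p l → l :+ (con (ι 2) :* (p :- con 1ℚ) :+ con 1ℚ) :* l := con (ι 2) :* p :* l) refl P L)
  -- The term 4 σ r alone suffices, since r ≥ 1 and σ is at least q - w; no lower bound for g beyond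
  -- nonnegativity enters.
  q≤m : q ℚ.≤ m
  q≤m = ≤-by ((σ ℚ.+ w ℚ.- q) ℚ.+ (1ℚ ℚ.- w) ℚ.+ (σ ℚ.- 1ℚ) ℚ.+ ι 4 ℚ.* σ ℚ.* (r ℚ.- 1ℚ) ℚ.+ ι 2 ℚ.* σ ℚ.+ ι 8 ℚ.* (σ ℚ.* σ) ℚ.* g)
    (0≤+ (0≤+ (0≤+ (0≤+ (0≤+ (0≤- q≤σ+w) (0≤- w≤1)) (0≤- (Root.1≤r σ≈))) (0≤* (0≤* {ι 4} (0≤ι 4) 0≤σ) (0≤- (Root.1≤r r≈)))) (0≤* {ι 2} (0≤ι 2) 0≤σ))
      (0≤* (0≤* {ι 8} (0≤ι 8) (0≤* 0≤σ 0≤σ)) 0≤g))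
    (solve 5 (λ q σ w r g → q :+ ((σ :+ w :- q) :+ (con 1ℚ :- w) :+ (σ :- con 1ℚ) :+ con (ι 4) :* σ :* (r :- con 1ℚ) :+ con (ι 2) :* σ :+ con (ι 8) :* (σ :* σ) :* g)
      := con (ι 8) :* (σ :* σ) :* g :+ con (ι 4) :* σ :* r) refl q σ w r g)
  -- This is 1/L ≤ 1/q²: the rational root q approximates √L from below, so replacing L^(-3/2) by
  -- q^(-3) only enlarges the bound.
  v≤qI : v ℚ.≤ q ℚ.* I
  v≤qI = begin
    v
      ≡⟨ ℚP.*-identityʳ v ⟨
    v ℚ.* 1ℚ
      ≡⟨ cong (v ℚ.*_) (inv-* 0<q³) ⟨
    v ℚ.* (I ℚ.* q³)
      ≡⟨ solve 3 (λ v i q → v :* (i :* (q :* (q :* (q :* con 1ℚ)))) := (q :* q) :* (v :* (q :* i))) refl v I q ⟩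
    (q ℚ.* q) ℚ.* (v ℚ.* (q ℚ.* I))
      ≤⟨ ℚP.*-monoʳ-≤-nonNeg (v ℚ.* (q ℚ.* I)) {{ℚ.nonNegative (0≤* 0≤v (0≤* (Root.0≤r q≈) 0≤I))}} (Root.below q≈) ⟩
    L ℚ.* (v ℚ.* (q ℚ.* I))
      ≡⟨ ℚP.*-assoc L v (q ℚ.* I) ⟨
    L ℚ.* v ℚ.* (q ℚ.* I)
      ≡⟨ trans (cong (ℚ._* (q ℚ.* I)) L*v≡1) (ℚP.*-identityˡ (q ℚ.* I)) ⟩
    q ℚ.* I ∎

1≤leibnizSum : ∀ m → 2 ℕ.≤ m → 1ℚ ℚ.≤ leibnizSum m
1≤leibnizSum m 2≤m = ℚP.≤-trans (ℚP.≤-reflexive (sym (ℚP.+-identityˡ 1ℚ))) (proj₂ (proj₂ (proj₂ (Positive.0<x π-positive))) m 2≤m)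

leibnizSum≤4 : ∀ m → leibnizSum m ℚ.≤ ι 4
leibnizSum≤4 m = ℚP.≤-trans (-≤⇒≤+ {leibnizSum m} {0ℚ} {ι 4} (leibnizSum-close 0 m 0 ℕ.z≤n ℕ.z≤n)) (ℚP.≤-reflexive (ℚP.+-identityˡ (ι 4)))

-- The range starts at j = 3, where the estimates for the bias begin and where j exceeds the
-- threshold 9/4 of `sqrtℚ-root`. At a late index of the real sequences everything but the main
-- error is below ε.
asymptotic : ∀ n → ∣ c (t (3 ℕ.+ n)) - (fromℚ ½ + √ fromℕ 3 / (fromℕ 4 * √ (fromℕ 2 * π * fromℕ (3 ℕ.+ n)))) ∣ ≤ fromℕ 2280003 / (√ fromℕ (3 ℕ.+ n)) ^ 3
asymptotic n ε 0<ε = from (frequency-bias j)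
  where
  open ℚP.≤-Reasoning
  open +-*-Solver
  j = 3 ℕ.+ n
  g = bias j
  L = ι j
  v = u (2 ℕ.+ n)
  η-limit = archimedean ((+ 1 ℚ./ 6) ℚ.* ε) (0<* {+ 1 ℚ./ 6} (ℚP.positive⁻¹ (+ 1 ℚ./ 6)) 0<ε)
  η = u (proj₁ η-limit)
  η≤ : η ℚ.≤ (+ 1 ℚ./ 6) ℚ.* ε
  η≤ = proj₂ η-limit (proj₁ η-limit) ℕP.≤-refl
  from : (∃[ K ] ∀ m → ℚ.∣ seq (c (t j)) m ℚ.- ½ ℚ.* (1ℚ ℚ.+ g) ∣ ℚ.≤ K ℚ.* u m) →
    ∃[ m₀ ] ∀ m → m₀ ℕ.≤ m → ℚ.∣ seq (c (t j)) m ℚ.- (½ ℚ.+ sqrtℚ m (ι 3) ℚ.* inv (ι 4 ℚ.* sqrtℚ m (ι 2 ℚ.* leibnizSum m ℚ.* L))) ∣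
      ℚ.≤ ι 2280003 ℚ.* inv (sqrtℚ m L ℚ.* (sqrtℚ m L ℚ.* (sqrtℚ m L ℚ.* 1ℚ))) ℚ.+ ε
  from (K , hK) = combine (π-b² (2 ℕ.+ n) η (0<u (proj₁ η-limit))) (archimedean-* (K ℚ.+ (ι 64 ℚ.* L ℚ.+ ι 9)) (½ ℚ.* ε) (½-pos 0<ε))
    where
    combine : (∃[ m₀ ] ∀ m → m₀ ℕ.≤ m → leibnizSum m ℚ.* (L ℚ.* b² j) ℚ.- 1ℚ ⊑ v ℚ.+ η) →
      (∃[ m₀ ] ∀ m → m₀ ℕ.≤ m → (K ℚ.+ (ι 64 ℚ.* L ℚ.+ ι 9)) ℚ.* u m ℚ.≤ ½ ℚ.* ε) →
      ∃[ m₀ ] ∀ m → m₀ ℕ.≤ m → ℚ.∣ seq (c (t j)) m ℚ.- (½ ℚ.+ sqrtℚ m (ι 3) ℚ.* inv (ι 4 ℚ.* sqrtℚ m (ι 2 ℚ.* leibnizSum m ℚ.* L))) ∣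
        ℚ.≤ ι 2280003 ℚ.* inv (sqrtℚ m L ℚ.* (sqrtℚ m L ℚ.* (sqrtℚ m L ℚ.* 1ℚ))) ℚ.+ ε
    combine (m₁ , h₁) (m₂ , h₂) = 2 ℕ.⊔ (m₁ ℕ.⊔ m₂) , λ m m₀≤m →
      let 2≤m  = ℕP.m⊔n≤o⇒m≤o 2 (m₁ ℕ.⊔ m₂) m₀≤m
          rest = ℕP.m⊔n≤o⇒n≤o 2 (m₁ ℕ.⊔ m₂) m₀≤m
      in conclude m (seq (c (t j)) m) (hK m) 2≤m (h₁ m (ℕP.m⊔n≤o⇒m≤o m₁ m₂ rest)) (h₂ m (ℕP.m⊔n≤o⇒n≤o m₁ m₂ rest))
      where
      conclude : ∀ m x → ℚ.∣ x ℚ.- ½ ℚ.* (1ℚ ℚ.+ g) ∣ ℚ.≤ K ℚ.* u m → 2 ℕ.≤ m → leibnizSum m ℚ.* (L ℚ.* b² j) ℚ.- 1ℚ ⊑ v ℚ.+ η →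
        (K ℚ.+ (ι 64 ℚ.* L ℚ.+ ι 9)) ℚ.* u m ℚ.≤ ½ ℚ.* ε →
        ℚ.∣ x ℚ.- (½ ℚ.+ sqrtℚ m (ι 3) ℚ.* inv (ι 4 ℚ.* sqrtℚ m (ι 2 ℚ.* leibnizSum m ℚ.* L))) ∣
          ℚ.≤ ι 2280003 ℚ.* inv (sqrtℚ m L ℚ.* (sqrtℚ m L ℚ.* (sqrtℚ m L ℚ.* 1ℚ))) ℚ.+ ε
      conclude m x x≈ 2≤m P≈ small = ∣∣≤ (⊑-weaken (subst (_⊑ K ℚ.* u m ℚ.+ (C*I ℚ.+ error L η (u m)))
          (solve 3 (λ x g y → (x :- con ½ :* (con 1ℚ :+ g)) :+ (con ½ :* g :- y) := x :- (con ½ :+ y)) refl x g y)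
          (⊑-+ (absolute {x ℚ.- ½ ℚ.* (1ℚ ℚ.+ g)} x≈) (roots-close scale (sqrtℚ-root m (ι 3) w≤½ (ℚP.≤ᵇ⇒≤ _))
            (sqrtℚ-root m (ι 2 ℚ.* leibnizSum m ℚ.* L) w≤½ (ℚP.≤-trans (ℚP.≤ᵇ⇒≤ {+ 9 ℚ./ 4} {ι 6} _) (Scale.6≤2PL scale)))
            (sqrtℚ-root m L w≤½ (ℚP.≤-trans (ℚP.≤ᵇ⇒≤ {+ 9 ℚ./ 4} {ι 3} _) 3≤L)) (bias-bound j) (0≤bias (2 ℕ.+ n)) (bias-asymptotic n))))
        -- One half of ε covers the frequency and the square roots, whose errors are multiples of
        -- `u m`; the other half covers 3η, hence the choice η ≤ ε/6.
        (≤-by ((½ ℚ.* ε ℚ.- (K ℚ.+ (ι 64 ℚ.* L ℚ.+ ι 9)) ℚ.* u m) ℚ.+ ι 3 ℚ.* ((+ 1 ℚ./ 6) ℚ.* ε ℚ.- η)) (0≤+ (0≤- small) (0≤* {ι 3} (0≤ι 3) (0≤- η≤)))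
          (solve 6 (λ k w i l η ε → k :* w :+ (i :+ (con (ι 3) :* η :+ (con (ι 64) :* l :+ con (ι 9)) :* w))
              :+ ((con ½ :* ε :- (k :+ (con (ι 64) :* l :+ con (ι 9))) :* w) :+ con (ι 3) :* (con (+ 1 ℚ./ 6) :* ε :- η)) := i :+ ε) refl K (u m) C*I L η ε)))
        where
        y = sqrtℚ m (ι 3) ℚ.* inv (ι 4 ℚ.* sqrtℚ m (ι 2 ℚ.* leibnizSum m ℚ.* L))
        C*I = ι 2280003 ℚ.* inv (sqrtℚ m L ℚ.* (sqrtℚ m L ℚ.* (sqrtℚ m L ℚ.* 1ℚ)))
        w≤½ : u m ℚ.≤ ½
        w≤½ = u-anti {1} {m} (ℕP.≤-trans (ℕP.n≤1+n 1) 2≤m)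
        3≤L = ι-mono {3} {j} (ℕP.m≤m+n 3 n)
        scale : Scale (leibnizSum m) L v (b² j) η (u m)
        scale = record
          { 1≤P = 1≤leibnizSum m 2≤m ; P≤4 = leibnizSum≤4 m ; 3≤L = 3≤L ; L*v≡1 = ι*u≡1 (2 ℕ.+ n)
          ; 0≤v = ℚP.<⇒≤ (0<u (2 ℕ.+ n)) ; v≤1 = u-anti {0} {2 ℕ.+ n} ℕ.z≤n ; 0≤β = ℚP.<⇒≤ (0<b² j)
          ; 0≤η = ℚP.<⇒≤ (0<u (proj₁ η-limit)) ; η≤1 = u-anti {0} {proj₁ η-limit} ℕ.z≤n
          ; 0≤w = ℚP.<⇒≤ (0<u m) ; w≤½ = w≤½ ; PLβ≈1 = P≈ }

theorem1p2 : (∃[ C ] ∃[ J ] ∀ j .{{_ : NonZero j}} → J ℕ.≤ j →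
    ∣ c (t j) - (fromℚ ½ + √ fromℕ 3 / (fromℕ 4 * √ (fromℕ 2 * π * fromℕ j))) ∣ ≤ C / (√ fromℕ j) ^ 3)
    × (∀ j → 1 ℕ.≤ j → fromℚ ½ < c (t j))
theorem1p2 = (fromℕ 2280003 , 3 , λ { (suc (suc (suc n))) _ → asymptotic n ; (suc zero) (ℕ.s≤s ()) ; (suc (suc zero)) (ℕ.s≤s (ℕ.s≤s ())) }) , cusick
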